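{- Let $(H,\Pi)$ be a connected signed graph that does not contain all three of a negative digon, a positive loop, and a negative loop. Then the decision problem $\textsc{s-Hom}(H,\Pi)$ is polynomial-time solvable if the s-core of $(H,\Pi)$ has at most two edges; it is NP-complete otherwise.
   Context: All graphs are finite and undirected; loops are allowed. A signed graph $(G,\Sigma)$ is a graph $G$ in which every edge (including loops) has a sign $+$ or $-$; $\Sigma\subseteq E(G)$ is the set of negative edges. Multiple edges of the same sign between the same two (possibly equal) vertices are not allowed, but two vertices may be joined by both a positive and a negative edge, and a vertex may carry both a positive and a negative loop; these count as two distinct edges. A negative digon is a pair of distinct vertices joined by both a positive and a negative edge. $(G,\Sigma)$ is connected if $G$ is. Switching at a vertex $v$ changes the sign of every non-loop edge incident with $v$ (loops keep their sign). Two signatures $\Sigma,\Sigma'$ of $G$ are switching equivalent, written $\Sigma\equiv\Sigma'$, if one is obtained from the other by a sequence of switchings. An ec-homomorphism of $(G,\Sigma)$ to $(H,\Pi)$ is a map $\varphi:V(G)\to V(H)$ such that for every edge $e$ between $x$ and $y$ in $(G,\Sigma)$ there is an edge of the same sign between $\varphi(x)$ and $\varphi(y)$ in $(H,\Pi)$. An s-homomorphism of $(G,\Sigma)$ to $(H,\Pi)$ is a map $\varphi:V(G)\to V(H)$ for which there are $\Sigma'\equiv\Sigma$ and $\Pi'\equiv\Pi$ such that $\varphi$ is an ec-homomorphism of $(G,\Sigma')$ to $(H,\Pi')$; one may always take $\Pi'=\Pi$. A signed graph is an s-core if every s-homomorphism of it to itself is an s-automorphism (a bijection on vertices which, together with its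 inverse, is an s-homomorphism). The s-core of $(H,\Pi)$ is a signed subgraph of $(H,\Pi)$ that is an s-core and to which $(H,\Pi)$ admits an s-homomorphism; it exists and is unique up to s-isomorphism and switching. For a fixed signed graph $(H,\Pi)$, $\textsc{s-Hom}(H,\Pi)$ is the decision problem: given a signed graph $(G,\Sigma)$, is there an s-homomorphism of $(G,\Sigma)$ to $(H,\Pi)$? -}

module Defs where

open import Data.Bool.Base using (Bool; true; false; T; not; _∧_; _∨_; if_then_else_)
open import Data.Bool.Properties using (∨-comm)
open import Data.Fin.Base using (Fin)
open import Data.Fin.Properties using (_≟_; _≤?_)
open import Data.List.Base
  using (List; []; _∷_; [_]; _++_; length; map; concatMap; replicate; filterᵇ;
         foldl; allFin; cartesianProduct)
open import Data.Maybe.Base using (Maybe; just; nothing)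
open import Data.Nat.Base using (ℕ; zero; suc; _+_; _*_; _^_; _≤_)
open import Data.Product.Base using (Σ-syntax; ∃-syntax; _×_; _,_)
open import Data.Sign.Base as Sign using (Sign; opposite)
open import Data.Vec.Base as Vec using (Vec)
open import Function.Base using (_∘_)
open import Function.Bundles using (_⇔_)
open import Function.Definitions using (Injective; Inverseᵇ)
open import Relation.Binary.Construct.Closure.ReflexiveTransitive using (Star)
open import Relation.Binary.PropositionalEquality
  using (_≡_; _≢_; refl; sym; trans; cong; cong₂)
open import Relation.Nullary.Decidable.Core using (⌊_⌋; yes; no)
open import Relation.Nullary.Negation.Core using (contradiction)

------------------------------------------------------------------------
-- Signed graphs

-- One symmetric relation per sign: parallel edges of the same sign are thereby
-- excluded, while a pair x, y (possibly x ≡ y) may carry an edge of each sign.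
-- Forgetting which of two oppositely signed parallel edges is which is
-- harmless, since all notions below only depend on these two relations.

record SignedGraph (n : ℕ) : Set where
  field
    edge      : Sign → Fin n → Fin n → Bool
    edge-sym  : ∀ s x y → edge s x y ≡ edge s y x

open SignedGraph public

private variable
  n m : ℕ

Edge : SignedGraph n → Sign → Fin n → Fin n → Set
Edge G s x y = T (edge G s x y)

-- An undirected edge is listed once, with its endpoints in increasing order.

edges : SignedGraph n → List (Sign × Fin n × Fin n)
edges {n} G = filterᵇ (λ (s , x , y) → ⌊ x ≤? y ⌋ ∧ edge G s x y)
  (cartesianProduct (Sign.+ ∷ Sign.- ∷ []) (cartesianProduct (allFin n) (allFin n)))

numEdges : SignedGraph n → ℕ
numEdges G = length (edges G)

Adjacent : SignedGraph n → Fin n → Fin n → Set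
Adjacent G x y = ∃[ s ] Edge G s x y

Connected : SignedGraph n → Set
Connected G = ∀ x y → Star (Adjacent G) x y

HasNegativeDigon : SignedGraph n → Set
HasNegativeDigon G = ∃[ x ] ∃[ y ] (x ≢ y × Edge G Sign.+ x y × Edge G Sign.- x y)

HasLoop : Sign → SignedGraph n → Set
HasLoop s G = ∃[ x ] Edge G s x x

------------------------------------------------------------------------
-- Switching

nonLoopAt : Fin n → Fin n → Fin n → Bool
nonLoopAt v x y = not ⌊ x ≟ y ⌋ ∧ (⌊ x ≟ v ⌋ ∨ ⌊ y ≟ v ⌋)

≟-flip : (x y : Fin n) → ⌊ x ≟ y ⌋ ≡ ⌊ y ≟ x ⌋
≟-flip x y with x ≟ y | y ≟ x
... | yes _   | yes _   = refl
... | no _    | no _    = refl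
... | yes x≡y | no y≢x  = contradiction (sym x≡y) y≢x
... | no x≢y  | yes y≡x = contradiction (sym y≡x) x≢y

nonLoopAt-sym : (v x y : Fin n) → nonLoopAt v x y ≡ nonLoopAt v y x
nonLoopAt-sym v x y =
  cong₂ _∧_ (cong not (≟-flip x y)) (∨-comm ⌊ x ≟ v ⌋ ⌊ y ≟ v ⌋)

-- An edge at x, y has sign s after switching iff the edge it comes from had
-- the opposite sign (when affected) or sign s (when not).

switch : SignedGraph n → Fin n → SignedGraph n
switch G v .edge s x y = edge G (if nonLoopAt v x y then opposite s else s) x y
switch G v .edge-sym s x y =
  trans (cong (λ b → edge G (if b then opposite s else s) x y) (nonLoopAt-sym v x y))
        (edge-sym G _ x y)

-- Equality of the resulting graph is taken pointwise, as there is no function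
-- extensionality.

infix 4 _≡ₛ_

_≡ₛ_ : SignedGraph n → SignedGraph n → Set
_≡ₛ_ {n} G G′ = Σ[ vs ∈ List (Fin n) ]
  (∀ s x y → edge (foldl switch G vs) s x y ≡ edge G′ s x y)

------------------------------------------------------------------------
-- Homomorphisms and cores

IsECHom : SignedGraph n → SignedGraph m → (Fin n → Fin m) → Set
IsECHom G H φ = ∀ s x y → Edge G s x y → Edge H s (φ x) (φ y)

IsSHom : SignedGraph n → SignedGraph m → (Fin n → Fin m) → Set
IsSHom G H φ = ∃[ G′ ] ∃[ H′ ] (G ≡ₛ G′ × H ≡ₛ H′ × IsECHom G′ H′ φ)

SHom : SignedGraph n → SignedGraph m → Set
SHom G H = ∃[ φ ] IsSHom G H φ

IsSAut : (G : SignedGraph n) → (Fin n → Fin n) → Set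
IsSAut G φ = IsSHom G G φ × ∃[ ψ ] (Inverseᵇ _≡_ _≡_ φ ψ × IsSHom G G ψ)

IsSCore : SignedGraph n → Set
IsSCore G = ∀ φ → IsSHom G G φ → IsSAut G φ

-- An injective sign-preserving map identifies C with a signed subgraph of H
-- (not necessarily induced); no two edges of C can be identified because an
-- edge is determined by its ends and its sign.

IsSubgraph : SignedGraph m → SignedGraph n → Set
IsSubgraph C H = ∃[ ι ] (Injective _≡_ _≡_ ι × IsECHom C H ι)

_IsSCoreOf_ : SignedGraph m → SignedGraph n → Set
C IsSCoreOf H = IsSubgraph C H × IsSCore C × SHom H C

------------------------------------------------------------------------
-- Deterministic multi-tape Turing machines

Word : Set
Word = List Bool

Language : Set₁
Language = Word → Set

-- The tape alphabet: a blank, the two input symbols, and g further symbols.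

data Symbol (g : ℕ) : Set where
  blank : Symbol g
  bit   : Bool → Symbol g
  mark  : Fin g → Symbol g

data Move : Set where
  goLeft goRight stay : Move

-- Tapes are infinite in both directions: beyond the two lists every cell is
-- blank. Both lists start with the cell nearest to the head.

record Tape (g : ℕ) : Set where
  constructor tape
  field
    left  : List (Symbol g)
    head  : Symbol g
    right : List (Symbol g)

open Tape public

blankTape : ∀ {g} → Tape g
blankTape = tape [] blank []

write : ∀ {g} → Symbol g → Tape g → Tape g
write a (tape l _ r) = tape l a r

move : ∀ {g} → Move → Tape g → Tape g
move stay    t                  = t
move goLeft  (tape []      a r) = tape [] blank (a ∷ r)
move goLeft  (tape (b ∷ l) a r) = tape l b (a ∷ r)
move goRight (tape l a [])      = tape (a ∷ l) blank []
move goRight (tape l a (b ∷ r)) = tape (a ∷ l) b r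

-- The machine has one input/output tape (the first) and `work` further tapes;
-- it halts when δ yields nothing.

record TM : Set where
  field
    work    : ℕ
    marks   : ℕ
    states  : ℕ
    start   : Fin states
    δ       : Fin states → Vec (Symbol marks) (suc work) →
              Maybe (Fin states × Vec (Symbol marks × Move) (suc work))

module _ (M : TM) where
  open TM M

  record Config : Set where
    constructor config
    field
      state : Fin states
      tapes : Vec (Tape marks) (suc work)

  open Config public

  step : Config → Maybe Config
  step (config q ts) with δ q (Vec.map head ts)
  ... | nothing         = nothing
  ... | just (q′ , acts) =
    just (config q′ (Vec.zipWith (λ (a , d) t → move d (write a t)) acts ts))

  data HaltsIn : ℕ → Config → Config → Set where
    halted : ∀ {c} → step c ≡ nothing → HaltsIn zero c c
    next   : ∀ {c c′ c″ t} → step c ≡ just c′ → HaltsIn t c′ c″ → HaltsIn (suc t) c c″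

  inputTape : Word → Tape marks
  inputTape []      = blankTape
  inputTape (b ∷ w) = tape [] (bit b) (map bit w)

  initial : Word → Config
  initial w = config start (inputTape w Vec.∷ Vec.replicate work blankTape)

  bitPrefix : List (Symbol marks) → Word
  bitPrefix (bit b ∷ as) = b ∷ bitPrefix as
  bitPrefix _            = []

  -- The output is the maximal block of bits on the first tape that starts at
  -- the head and extends to the right.

  output : Config → Word
  output c = bitPrefix (head t ∷ right t)
    where t = Vec.head (tapes c)

------------------------------------------------------------------------
-- Complexity classes

-- Every polynomial over ℕ is bounded by one of this shape.

polyBound : ℕ → ℕ → ℕ → ℕ
polyBound c k n = c * n ^ k + c

PolyTime : (Word → Word) → Set
PolyTime f = Σ[ M ∈ TM ] ∃[ c ] ∃[ k ] (∀ w → ∃[ t ] ∃[ d ]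
  (t ≤ polyBound c k (length w) × HaltsIn M t (initial M w) d × output M d ≡ f w))

InP : Language → Set
InP L = Σ[ f ∈ (Word → Bool) ] (PolyTime ([_] ∘ f) × (∀ w → L w ⇔ T (f w)))

-- Every bit of the first word is doubled; the block 01 ends it.

pair : Word → Word → Word
pair w u = concatMap (λ b → b ∷ b ∷ []) w ++ false ∷ true ∷ u

InNP : Language → Set₁
InNP L = Σ[ V ∈ Language ] (InP V × ∃[ c ] ∃[ k ] (∀ w →
  L w ⇔ (∃[ u ] (length u ≤ polyBound c k (length w) × V (pair w u)))))

infix 4 _≤ₚ_

_≤ₚ_ : Language → Language → Set
L ≤ₚ L′ = ∃[ f ] (PolyTime f × (∀ w → L w ⇔ L′ (f w)))

NPComplete : Language → Set₁
NPComplete L = InNP L × (∀ L′ → InNP L′ → L′ ≤ₚ L)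

------------------------------------------------------------------------
-- The decision problem

-- The number of vertices in unary, then the adjacency matrices of the positive
-- and of the negative edges, row by row.

encode : SignedGraph n → Word
encode {n} G = replicate n true ++ false ∷ matrix Sign.+ ++ matrix Sign.-
  where
  matrix : Sign → Word
  matrix s = map (λ (x , y) → edge G s x y) (cartesianProduct (allFin n) (allFin n))

-- Words that do not encode a signed graph are no-instances.

s-Hom : SignedGraph m → Language
s-Hom H w = ∃[ n ] Σ[ G ∈ SignedGraph n ] (w ≡ encode G × SHom G H)

module Submission where

-- An s-homomorphism to H is an ec-homomorphism to the signed double cover of H,
-- whose vertices are pairs of a vertex and a sign. Consider on this cover the
-- positive edges, the negative edges and the walks of a negative and a positive
-- edge. If all three graphs are bipartite or contain a loop, then connectedness
-- and the excluded triple force the s-core of H to be one of a few graphs with at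
-- most two edges; whether G maps to it only depends on the existence of signs of
-- the vertices of G with prescribed products along the edges, and this is
-- decided by closing the set of signed walks of G. Otherwise one of the graphs is
-- loopless and not bipartite, a property that the core inherits and that needs at
-- least three edges. By the theorem of Hell and Nešetřil, in the form that one
-- can choose, compatibly with identifying and permuting variables, an argument
-- place of every operation that preserves such a graph, a map of a suitable graph
-- to the cover selects a tile in every cell of a grid; the tilings are the
-- tableaux of a Turing machine. Running times are bounded once and for all by
-- compiling a small language of register programs to Turing machines.

open import Defs
open import Data.Bool.Base using (Bool; true; false; T; not; _∧_; _∨_; if_then_else_; _xor_)
import Data.Bool.Properties as Boolₚ
open import Data.Empty using (⊥; ⊥-elim)
open import Data.Fin.Base as Fin
  using (Fin; zero; suc; toℕ; fromℕ<; _↑ˡ_; _↑ʳ_; splitAt; combine; remQuot; funToFin; finToFun; punchIn; punchOut)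
import Data.Fin.Properties as Finₚ
open import Data.List.Base as List
  using (List; []; _∷_; [_]; _++_; length; map; replicate; foldl; allFin; cartesianProduct; filterᵇ)
import Data.List.Properties as Listₚ
open import Data.List.Membership.Propositional using (_∈_)
import Data.List.Membership.Propositional.Properties as ∈ₚ
import Data.List.Relation.Unary.Any as Any
open import Data.Maybe.Base as Maybe using (Maybe; just; nothing)
open import Data.Nat.Base
  using (ℕ; zero; suc; pred; _+_; _*_; _^_; _∸_; _⊔_; _≤_; _<_; _≡ᵇ_; z≤n; s≤s)
import Data.Nat.Properties as ℕₚ
open import Data.Nat.Solver using (module +-*-Solver)
open +-*-Solver using (solve; _:+_; _:*_; _:=_) renaming (con to :con)
open import Data.Product.Base using (Σ-syntax; ∃-syntax; _×_; _,_; proj₁; proj₂; map₁; map₂; uncurry)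
open import Data.Sign.Base as Sign using (Sign; opposite)
import Data.Sign.Properties as Signₚ
open import Data.Sum.Base using (_⊎_; inj₁; inj₂; [_,_]′)
open import Data.Unit.Base using (⊤; tt)
open import Data.Vec.Base as Vec using (Vec; []; _∷_; lookup; _[_]≔_)
import Data.Vec.Properties as Vecₚ
open import Function.Base using (_∘_; id; const; case_of_)
open import Function.Bundles using (_⇔_; mk⇔; Equivalence)
open import Relation.Binary.Construct.Closure.ReflexiveTransitive using (Star; ε; _◅_)
open import Relation.Binary.PropositionalEquality
  using (_≡_; _≢_; _≗_; refl; sym; trans; cong; cong₂; subst; subst₂)
open import Relation.Nullary.Decidable
  using (Dec; yes; no; ⌊_⌋; map′; _×-dec_; _⊎-dec_; ¬?; T?; _→-dec_; decidable-stable; dec-true; dec-false; toWitness; fromWitness)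
open import Relation.Nullary.Negation using (¬_; contradiction)

-- Hardness needs no chain of gadgets. On a copy of a power of the cover, a map to the cover is an
-- operation that preserves both signs, and copies that share vertices give operations obtained from
-- each other by identifying variables. The choice of places makes a clause choose one of its
-- allowed pairs, and its two cells the entries of that pair. Compositions of operations never
-- occur, so the choice need not respect them; this freedom lets it pass between a graph, its
-- retracts, its induced subgraphs and the graphs definable from it, which is how it is found.
--
-- Each of the three graphs may supply the choice, but not if it has a loop. A loop of the first two
-- is a loop of H. A loop of the third is a negative digon or two loops at one vertex, and in the
-- latter case every signed graph maps to H. The excluded triple would put loops into all three
-- graphs and yet need not provide such a vertex.
--
-- The tableaux are aligned at the heads because there are several of them: the step to be taken is
-- then known in every column, and a move only shifts half-tapes by one cell.

-- Tapes as functions on the natural numbers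

Sym : Set
Sym = Symbol 0

-- A tape whose leftmost written cell has index 0: its contents and the head position.
ATape : Set
ATape = (ℕ → Sym) × ℕ

scan : ATape → Sym
scan (f , p) = f p

cellAt : ∀ {g} → List (Symbol g) → ℕ → Symbol g
cellAt []       _       = blank
cellAt (a ∷ as) zero    = a
cellAt (a ∷ as) (suc k) = cellAt as k

behind : (ℕ → Sym) → ℕ → ℕ → Sym
behind f zero    k       = blank
behind f (suc p) zero    = f p
behind f (suc p) (suc k) = behind f p k

record _≈ₜ_ (t : Tape 0) (a : ATape) : Set where
  constructor represents
  field
    here  : head t ≡ scan a
    ahead : ∀ k → cellAt (right t) k ≡ proj₁ a (k + suc (proj₂ a))
    back  : ∀ k → cellAt (left t) k ≡ behind (proj₁ a) (proj₂ a) k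

-- There is no way to the left from cell 0. The programs below respect this, which lets a head
-- position be a natural number although tapes are infinite in both directions.
data Moved : Move → ℕ → ℕ → Set where
  stays  : ∀ {p} → Moved stay p p
  rights : ∀ {p} → Moved goRight p (suc p)
  lefts  : ∀ {p} → Moved goLeft (suc p) p

-- A relation, not a function: contents are functions and are compared pointwise, so any function
-- with the right values is accepted as the new contents.
record Acted (a : Sym) (m : Move) (x y : ATape) : Set where
  constructor acted
  field
    written : proj₁ y (proj₂ x) ≡ a
    kept    : ∀ q → q ≢ proj₂ x → proj₁ y q ≡ proj₁ x q
    moved   : Moved m (proj₂ x) (proj₂ y)

behind-cong : ∀ {f g} p k → (∀ q → q < p → f q ≡ g q) → behind f p k ≡ behind g p k
behind-cong zero    k       e = refl
behind-cong (suc p) zero    e = e p ℕₚ.≤-refl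
behind-cong (suc p) (suc k) e = behind-cong p k (λ q q<p → e q (ℕₚ.m≤n⇒m≤1+n q<p))

private
  ahead≢ : ∀ k p → k + suc p ≢ p
  ahead≢ k p e = ℕₚ.m≢1+n+m p (trans (sym e) (ℕₚ.+-suc k p))

act-≈ₜ : ∀ {a m t x y} → t ≈ₜ x → Acted a m x y → move m (write a t) ≈ₜ y
act-≈ₜ {a} {t = tape l h r} {f , p} {g , _} (represents here ahead back) (acted w kept stays) =
  represents (sym w) (λ k → trans (ahead k) (sym (kept _ (ahead≢ k p))))
    (λ k → trans (back k) (behind-cong p k (λ q q<p → sym (kept q (ℕₚ.<⇒≢ q<p)))))
act-≈ₜ {a} {t = tape l h []} {f , p} {g , _} (represents here ahead back) (acted w kept rights) =
  represents (trans (ahead 0) (sym (kept _ (ahead≢ 0 p))))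
    (λ k → trans (ahead (suc k)) (trans (sym (kept _ (ahead≢ (suc k) p))) (cong g (sym (ℕₚ.+-suc k (suc p))))))
    λ { zero → sym w ; (suc k) → trans (back k) (behind-cong p k (λ q q<p → sym (kept q (ℕₚ.<⇒≢ q<p)))) }
act-≈ₜ {a} {t = tape l h (b ∷ r)} {f , p} {g , _} (represents here ahead back) (acted w kept rights) =
  represents (trans (ahead 0) (sym (kept _ (ahead≢ 0 p))))
    (λ k → trans (ahead (suc k)) (trans (sym (kept _ (ahead≢ (suc k) p))) (cong g (sym (ℕₚ.+-suc k (suc p))))))
    λ { zero → sym w ; (suc k) → trans (back k) (behind-cong p k (λ q q<p → sym (kept q (ℕₚ.<⇒≢ q<p)))) }
act-≈ₜ {a} {t = tape [] h r} {f , suc p} {g , _} (represents here ahead back) (acted w kept lefts) =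
  represents (trans (back 0) (sym (kept p (ℕₚ.<⇒≢ ℕₚ.≤-refl))))
    (λ { zero → sym w ; (suc k) → trans (ahead k) (trans (sym (kept _ (ahead≢ k (suc p)))) (cong g (ℕₚ.+-suc k (suc p)))) })
    (λ k → trans (back (suc k)) (behind-cong p k (λ q q<p → sym (kept q (ℕₚ.<⇒≢ (ℕₚ.m≤n⇒m≤1+n q<p))))))
act-≈ₜ {a} {t = tape (b ∷ l) h r} {f , suc p} {g , _} (represents here ahead back) (acted w kept lefts) =
  represents (trans (back 0) (sym (kept p (ℕₚ.<⇒≢ ℕₚ.≤-refl))))
    (λ { zero → sym w ; (suc k) → trans (ahead k) (trans (sym (kept _ (ahead≢ k (suc p)))) (cong g (ℕₚ.+-suc k (suc p)))) })
    (λ k → trans (back (suc k)) (behind-cong p k (λ q q<p → sym (kept q (ℕₚ.<⇒≢ (ℕₚ.m≤n⇒m≤1+n q<p))))))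

-- Structured programs and their machines

-- Structured programs on W tapes. Every program answers a Boolean, which its
-- context may branch on; every machine step touches a single tape.

data Prog (W : ℕ) : Set where
  act   : Fin W → (Sym → Sym × Move) → Prog W
  test  : Fin W → (Sym → Bool) → Prog W
  ite   : Prog W → Prog W → Prog W → Prog W
  while : Prog W → Prog W → Prog W

Store : ℕ → Set
Store W = Fin W → ATape

record OneTape {W} (i : Fin W) (a : Sym) (m : Move) (v v′ : Store W) : Set where
  constructor oneTape
  field
    on  : Acted a m (v i) (v′ i)
    off : ∀ j → j ≢ i → v′ j ≡ v j

data Exec {W} : Prog W → Store W → ℕ → Bool → Store W → Set where
  act⇓ : ∀ {i f v v′} → OneTape i (proj₁ (f (scan (v i)))) (proj₂ (f (scan (v i)))) v v′ →
         Exec (act i f) v 1 true v′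
  test⇓ : ∀ {i p v v′} → v′ ≗ v → Exec (test i p) v 1 (p (scan (v i))) v′
  then⇓ : ∀ {p q r v v′ v″ t u b} → Exec p v t true v′ → Exec q v′ u b v″ → Exec (ite p q r) v (t + u) b v″
  else⇓ : ∀ {p q r v v′ v″ t u b} → Exec p v t false v′ → Exec r v′ u b v″ → Exec (ite p q r) v (t + u) b v″
  stop⇓ : ∀ {p q v v′ t} → Exec p v t false v′ → Exec (while p q) v t false v′
  loop⇓ : ∀ {p q v₀ v₁ v₂ v₃ t u w b c} → Exec p v₀ t true v₁ → Exec q v₁ u b v₂ →
          Exec (while p q) v₂ w c v₃ → Exec (while p q) v₀ (t + (u + w)) c v₃

module _ {W : ℕ} where

  size : Prog W → ℕ
  size (act _ _)   = 1
  size (test _ _)  = 1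
  size (ite p q r) = size p + (size q + size r)
  size (while p q) = size p + size q

  begin : (p : Prog W) → Fin (size p)
  begin (act _ _)   = zero
  begin (test _ _)  = zero
  begin (ite p q r) = begin p ↑ˡ _
  begin (while p q) = begin p ↑ˡ _

  Instr : ℕ → Set
  Instr n = Fin W × (Sym → (Sym × Move) × (Fin n ⊎ Bool))

  -- Embeds the code of a part into the whole: jumps are renumbered by `f`, and `g` turns an answer
  -- into a jump or into an answer of the whole. Control passes on within the last step of a part,
  -- so that branching and looping cost no steps of their own.
  redirect : ∀ {m n} → (Fin m → Fin n) → (Bool → Fin n ⊎ Bool) → Instr m → Instr n
  redirect f g (i , h) = i , λ a → proj₁ (h a) , [ inj₁ ∘ f , g ]′ (proj₂ (h a))

  module _ (q r : Prog W) (m : ℕ) where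
    branch : Bool → Fin (m + (size q + size r))
    branch true  = m ↑ʳ (begin q ↑ˡ size r)
    branch false = m ↑ʳ (size q ↑ʳ begin r)

  again : (q : Prog W) (m : ℕ) → Bool → Fin (m + size q) ⊎ Bool
  again q m true  = inj₁ (m ↑ʳ begin q)
  again q m false = inj₂ false

  code : (p : Prog W) → Fin (size p) → Instr (size p)
  code (act i f)  _ = i , λ a → f a , inj₂ true
  code (test i p) _ = i , λ a → (a , stay) , inj₂ (p a)
  code (ite p q r) s =
    [ (λ s → redirect (_↑ˡ _) (inj₁ ∘ branch q r (size p)) (code p s))
    , (λ s → [ (λ s → redirect (λ s → size p ↑ʳ (s ↑ˡ _)) inj₂ (code q s))
             , (λ s → redirect (λ s → size p ↑ʳ (size q ↑ʳ s)) inj₂ (code r s)) ]′ (splitAt (size q) s)) ]′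
    (splitAt (size p) s)
  code (while p q) s =
    [ (λ s → redirect (_↑ˡ _) (again q (size p)) (code p s))
    , (λ s → redirect (size p ↑ʳ_) (λ _ → inj₁ (begin p ↑ˡ _)) (code q s)) ]′ (splitAt (size p) s)

  data Run {n} (c : Fin n → Instr n) : Fin n → Store W → ℕ → Fin n ⊎ Bool → Store W → Set where
    nil  : ∀ {s v} → Run c s v 0 (inj₁ s) v
    last : ∀ {s v v′ a m b} → proj₂ (c s) (scan (v (proj₁ (c s)))) ≡ ((a , m) , inj₂ b) →
           OneTape (proj₁ (c s)) a m v v′ → Run c s v 1 (inj₂ b) v′
    more : ∀ {s s′ v v′ v″ a m t e} → proj₂ (c s) (scan (v (proj₁ (c s)))) ≡ ((a , m) , inj₁ s′) →
           OneTape (proj₁ (c s)) a m v v′ → Run c s′ v′ t e v″ → Run c s v (suc t) e v″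

  run-++ : ∀ {n} {c : Fin n → Instr n} {s s′ v v′ v″ t u e} →
           Run c s v t (inj₁ s′) v′ → Run c s′ v′ u e v″ → Run c s v (t + u) e v″
  run-++ nil           ys = ys
  run-++ (more eq o xs) ys = more eq o (run-++ xs ys)

  redirected : ∀ {m n f g} {v : Store W} {i : Instr m} {j : Instr n} {x e} → j ≡ redirect f g i →
               proj₂ i (scan (v (proj₁ i))) ≡ (x , e) →
               proj₂ j (scan (v (proj₁ j))) ≡ (x , [ inj₁ ∘ f , g ]′ e)
  redirected {f = f} {g} refl eq = cong (λ (x , e) → x , [ inj₁ ∘ f , g ]′ e) eq

  embed : ∀ {m n} {c : Fin m → Instr m} {d : Fin n → Instr n} {f g} →
          (∀ s → d (f s) ≡ redirect f g (c s)) →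
          ∀ {s v t b v′} → Run c s v t (inj₂ b) v′ → Run d (f s) v t (g b) v′
  embed {c = c} {d = d} {f} {g} h {s} (last {v = v} {a = a} {m} {b} eq o) with g b in ge
  ... | inj₁ s′ = more (trans (redirected {f = f} {g} {v} {c s} (h s) eq) (cong ((a , m) ,_) ge))
                       (subst (λ z → OneTape (proj₁ z) a m _ _) (sym (h s)) o) nil
  ... | inj₂ _  = last (trans (redirected {f = f} {g} {v} {c s} (h s) eq) (cong ((a , m) ,_) ge))
                       (subst (λ z → OneTape (proj₁ z) a m _ _) (sym (h s)) o)
  embed {c = c} {f = f} {g} h {s} (more {v = v} {a = a} {m} eq o xs) =
    more (redirected {f = f} {g} {v} {c s} (h s) eq) (subst (λ z → OneTape (proj₁ z) a m _ _) (sym (h s)) o) (embed {f = f} {g} h xs)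

  module _ (p q r : Prog W) where
    code-if : ∀ s → code (ite p q r) (s ↑ˡ _) ≡ redirect (_↑ˡ _) (inj₁ ∘ branch q r (size p)) (code p s)
    code-if s rewrite Finₚ.splitAt-↑ˡ (size p) s (size q + size r) = refl

    code-then : ∀ s → code (ite p q r) (size p ↑ʳ (s ↑ˡ _)) ≡ redirect (λ s → size p ↑ʳ (s ↑ˡ _)) inj₂ (code q s)
    code-then s rewrite Finₚ.splitAt-↑ʳ (size p) (size q + size r) (s ↑ˡ size r)
                      | Finₚ.splitAt-↑ˡ (size q) s (size r) = refl

    code-else : ∀ s → code (ite p q r) (size p ↑ʳ (size q ↑ʳ s)) ≡ redirect (λ s → size p ↑ʳ (size q ↑ʳ s)) inj₂ (code r s)
    code-else s rewrite Finₚ.splitAt-↑ʳ (size p) (size q + size r) (size q ↑ʳ s)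
                      | Finₚ.splitAt-↑ʳ (size q) (size r) s = refl

  module _ (p q : Prog W) where
    code-cond : ∀ s → code (while p q) (s ↑ˡ _) ≡ redirect (_↑ˡ _) (again q (size p)) (code p s)
    code-cond s rewrite Finₚ.splitAt-↑ˡ (size p) s (size q) = refl

    code-body : ∀ s → code (while p q) (size p ↑ʳ s) ≡ redirect (size p ↑ʳ_) (λ _ → inj₁ (begin p ↑ˡ _)) (code q s)
    code-body s rewrite Finₚ.splitAt-↑ʳ (size p) (size q) s = refl

  exec-run : ∀ {p v t b v′} → Exec p v t b v′ → Run (code p) (begin p) v t (inj₂ b) v′
  exec-run (act⇓ o) = last refl o
  exec-run (test⇓ {i} {v = v} e) =
    last refl (oneTape (subst (Acted _ stay (v i)) (sym (e i)) (acted refl (λ _ _ → refl) stays)) (λ j _ → e j))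
  exec-run (then⇓ {p} {q} {r} x y) =
    run-++ (embed {f = _↑ˡ _} {g = inj₁ ∘ branch q r (size p)} (code-if p q r) (exec-run x))
           (embed {f = λ s → size p ↑ʳ (s ↑ˡ _)} {g = inj₂} (code-then p q r) (exec-run y))
  exec-run (else⇓ {p} {q} {r} x y) =
    run-++ (embed {f = _↑ˡ _} {g = inj₁ ∘ branch q r (size p)} (code-if p q r) (exec-run x))
           (embed {f = λ s → size p ↑ʳ (size q ↑ʳ s)} {g = inj₂} (code-else p q r) (exec-run y))
  exec-run (stop⇓ {p} {q} x) = embed {f = _↑ˡ _} {g = again q (size p)} (code-cond p q) (exec-run x)
  exec-run (loop⇓ {p} {q} x y z) =
    run-++ (embed {f = _↑ˡ _} {g = again q (size p)} (code-cond p q) (exec-run x))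
      (run-++ (embed {f = size p ↑ʳ_} {g = λ _ → inj₁ (begin p ↑ˡ _)} (code-body p q) (exec-run y)) (exec-run z))

module _ {w : ℕ} (p : Prog (suc w)) where

  -- State `zero` halts. The answer of the program is lost there, so its result has to be on the
  -- first tape.
  machine : TM
  machine .TM.work   = w
  machine .TM.marks  = 0
  machine .TM.states = suc (size p)
  machine .TM.start  = suc (begin p)
  machine .TM.δ zero    hs = nothing
  machine .TM.δ (suc s) hs =
    just ( [ suc , const zero ]′ (proj₂ (proj₂ (code p s) (lookup hs (proj₁ (code p s)))))
         , Vec.map (_, stay) hs [ proj₁ (code p s) ]≔ proj₁ (proj₂ (code p s) (lookup hs (proj₁ (code p s)))))

  Matches : Vec (Tape 0) (suc w) → Store (suc w) → Set
  Matches ts v = ∀ i → lookup ts i ≈ₜ v i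

  private
    effect : Sym × Move → Tape 0 → Tape 0
    effect (a , d) t = move d (write a t)

    effects : ∀ {i a m v v′} (ts : Vec (Tape 0) (suc w)) → Matches ts v → OneTape i a m v v′ →
              Matches (Vec.zipWith effect (Vec.map (_, stay) (Vec.map head ts) [ i ]≔ (a , m)) ts) v′
    effects {i} {a} {m} ts M (oneTape on off) j
      rewrite Vecₚ.lookup-zipWith effect j (Vec.map (_, stay) (Vec.map head ts) [ i ]≔ (a , m)) ts
      with j Finₚ.≟ i
    ... | yes refl rewrite Vecₚ.lookup∘update j (Vec.map (_, stay) (Vec.map head ts)) (a , m) = act-≈ₜ (M j) on
    ... | no j≢i rewrite Vecₚ.lookup∘update′ j≢i (Vec.map (_, stay) (Vec.map head ts)) (a , m)
                       | Vecₚ.lookup-map j (_, Move.stay) (Vec.map head ts)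
                       | Vecₚ.lookup-map j head ts | off j j≢i = M j

    symbol : ∀ {ts v} → Matches ts v → ∀ i → lookup (Vec.map head ts) i ≡ scan (v i)
    symbol {ts} M i = trans (Vecₚ.lookup-map i head ts) (_≈ₜ_.here (M i))

  one-step : ∀ {s ts v v′ a m e} → Matches ts v →
             proj₂ (code p s) (scan (v (proj₁ (code p s)))) ≡ ((a , m) , e) → OneTape (proj₁ (code p s)) a m v v′ →
             ∃[ ts′ ] (step machine (config (suc s) ts) ≡ just (config ([ suc , const zero ]′ e) ts′) × Matches ts′ v′)
  one-step {s} {ts} {a = a} {m} {e} M eq o =
    Vec.zipWith effect (Vec.map (_, stay) (Vec.map head ts) [ proj₁ (code p s) ]≔ (a , m)) ts ,
    cong (λ x → just (config ([ suc , const zero ]′ (proj₂ x))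
                        (Vec.zipWith effect (Vec.map (_, stay) (Vec.map head ts) [ proj₁ (code p s) ]≔ proj₁ x) ts)))
      (trans (cong (proj₂ (code p s)) (symbol {ts} M (proj₁ (code p s)))) eq) ,
    effects ts M o

  machine-halts : ∀ {s ts v t b v′} → Matches ts v → Run (code p) s v t (inj₂ b) v′ →
                  ∃[ ts′ ] (HaltsIn machine t (config (suc s) ts) (config zero ts′) × Matches ts′ v′)
  machine-halts M (last eq o) with one-step M eq o
  ... | ts′ , e , M′ = ts′ , next e (halted refl) , M′
  machine-halts M (more eq o xs) with one-step M eq o
  ... | ts′ , e , M′ with machine-halts M′ xs
  ... | ts″ , h , M″ = ts″ , next e h , M″

exec-cong : ∀ {W} {p : Prog W} {v w v′ w′ t b} → w ≗ v → w′ ≗ v′ → Exec p v t b v′ → Exec p w t b w′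
exec-cong {v = v} {w} {v′} {w′} e e′ (act⇓ {i} {f} (oneTape on off)) =
  act⇓ (oneTape (subst (λ x → Acted (proj₁ (f (scan x))) (proj₂ (f (scan x))) x (w′ i)) (sym (e i))
                  (subst (Acted (proj₁ (f (scan (v i)))) (proj₂ (f (scan (v i)))) (v i)) (sym (e′ i)) on))
                (λ j j≢i → trans (e′ j) (trans (off j j≢i) (sym (e j)))))
exec-cong {v = v} {w} e e′ (test⇓ {i} {p} e″) =
  subst (λ x → Exec (test i p) w 1 (p (scan x)) _) (e i) (test⇓ (λ j → trans (e′ j) (trans (e″ j) (sym (e j)))))
exec-cong e e′ (then⇓ x y) = then⇓ (exec-cong e (λ _ → refl) x) (exec-cong (λ _ → refl) e′ y)
exec-cong e e′ (else⇓ x y) = else⇓ (exec-cong e (λ _ → refl) x) (exec-cong (λ _ → refl) e′ y)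
exec-cong e e′ (stop⇓ x)   = stop⇓ (exec-cong e e′ x)
exec-cong e e′ (loop⇓ x y z) =
  loop⇓ (exec-cong e (λ _ → refl) x) (exec-cong (λ _ → refl) (λ _ → refl) y) (exec-cong (λ _ → refl) e′ z)

Ans : ∀ {W} → Prog W → Store W → ℕ → Bool → Store W → Set
Ans p v t b v′ = ∃[ u ] (u ≤ t × Exec p v u b v′)

infixr 5 _⨾_
-- Sequencing as a branch with equal sides. The code of `q` is duplicated, which costs states but no
-- steps.
_⨾_ : ∀ {W} → Prog W → Prog W → Prog W
p ⨾ q = ite p q q

module _ {W} {p : Prog W} where
  ans-cong : ∀ {v w v′ w′ t b} → w ≗ v → w′ ≗ v′ → Ans p v t b v′ → Ans p w t b w′
  ans-cong e e′ (u , l , x) = u , l , exec-cong e e′ x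

  ans-≤ : ∀ {v v′ t u b} → t ≤ u → Ans p v t b v′ → Ans p v u b v′
  ans-≤ le (s , l , x) = s , ℕₚ.≤-trans l le , x

module _ {W} {p q : Prog W} where
  infixr 5 _▹_
  _▹_ : ∀ {v v′ v″ t u b c} → Ans p v t b v′ → Ans q v′ u c v″ → Ans (p ⨾ q) v (t + u) c v″
  _▹_ {b = true}  (s , l , x) (s′ , l′ , y) = s + s′ , ℕₚ.+-mono-≤ l l′ , then⇓ x y
  _▹_ {b = false} (s , l , x) (s′ , l′ , y) = s + s′ , ℕₚ.+-mono-≤ l l′ , else⇓ x y

  ans-stop : ∀ {v v′ t} → Ans p v t false v′ → Ans (while p q) v t false v′
  ans-stop (s , l , x) = s , l , stop⇓ x

  ans-loop : ∀ {v₀ v₁ v₂ v₃ t u w b c} → Ans p v₀ t true v₁ → Ans q v₁ u b v₂ → Ans (while p q) v₂ w c v₃ →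
             Ans (while p q) v₀ (t + u + w) c v₃
  ans-loop (a , l , x) (b , m , y) (c , n , z) =
    a + (b + c) , ℕₚ.≤-trans (ℕₚ.≤-reflexive (sym (ℕₚ.+-assoc a b c))) (ℕₚ.+-mono-≤ (ℕₚ.+-mono-≤ l m) n) , loop⇓ x y z

ans-then : ∀ {W} {p q r : Prog W} {v v′ v″ t u b} → Ans p v t true v′ → Ans q v′ u b v″ → Ans (ite p q r) v (t + u) b v″
ans-then (s , l , x) (s′ , l′ , y) = s + s′ , ℕₚ.+-mono-≤ l l′ , then⇓ x y

ans-else : ∀ {W} {p q r : Prog W} {v v′ v″ t u b} → Ans p v t false v′ → Ans r v′ u b v″ → Ans (ite p q r) v (t + u) b v″
ans-else (s , l , x) (s′ , l′ , y) = s + s′ , ℕₚ.+-mono-≤ l l′ , else⇓ x y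

-- The number `k * p + c`, defined by the recursion in which the cost of a loop of `p` rounds adds
-- up.
lin : ℕ → ℕ → ℕ → ℕ
lin k c zero    = c
lin k c (suc p) = k + lin k c p

lin-mono : ∀ k c {p q} → p ≤ q → lin k c p ≤ lin k c q
lin-mono k c {q = zero}  z≤n     = ℕₚ.≤-refl
lin-mono k c {q = suc q} z≤n     = ℕₚ.≤-trans (lin-mono k c {zero} {q} z≤n) (ℕₚ.m≤n+m _ k)
lin-mono k c             (s≤s l) = ℕₚ.+-monoʳ-≤ k (lin-mono k c l)

-- Unary arithmetic and random access on tapes

-- Number tapes hold a block of ones that starts at cell 1; the head rests on the
-- blank behind it. The blank at cell 0 stops the leftward sweeps.

unary : ℕ → ℕ → Sym
unary r       zero          = blank
unary zero    (suc k)       = blank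
unary (suc r) (suc zero)    = bit true
unary (suc r) (suc (suc k)) = unary r (suc k)

unary-one : ∀ {r p} → p < r → unary r (suc p) ≡ bit true
unary-one {suc r} {zero}  _       = refl
unary-one {suc r} {suc p} (s≤s l) = unary-one l

unary-end : ∀ r → unary r (suc r) ≡ blank
unary-end zero    = refl
unary-end (suc r) = unary-end r

unary-suc : ∀ r q → q ≢ suc r → unary (suc r) q ≡ unary r q
unary-suc r       zero          _ = refl
unary-suc zero    (suc zero)    n = contradiction refl n
unary-suc zero    (suc (suc q)) _ = refl
unary-suc (suc r) (suc zero)    _ = refl
unary-suc (suc r) (suc (suc q)) n = unary-suc r (suc q) (n ∘ cong suc)

cells : (ℕ → Sym) → ℕ → Sym
cells g zero    = blank
cells g (suc k) = g k

num : ℕ → ATape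
num r = unary r , suc r

ram : (ℕ → Sym) → ATape
ram g = cells g , 1

outTape : Word → ATape
outTape o = cells (cellAt (map bit o)) , suc (length o)

isOne isBit : Sym → Bool
isOne (bit true) = true
isOne _          = false
isBit (bit _)    = true
isBit _          = false

rewindCost eqCost readCost markCost zeroCost : ℕ → ℕ
rewindCost B = 1 + lin 2 1 B
eqCost B   = 1 + (1 + (lin 4 2 B + (1 + (1 + (rewindCost B + (rewindCost B + 1))))))
readCost B = (1 + lin 3 1 B) + (1 + ((1 + lin 3 1 B) + 1))
markCost B = (1 + lin 3 1 B) + (1 + (1 + lin 3 1 B))
zeroCost B = 1 + (lin 2 1 B + 1)

module _ {W : ℕ} where

  opaque
    -- The store as an operation on two tapes sees it. For `m` equal to `i` the value `x` prevails,
    -- which serves operations on a single tape.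
    two : Fin W → ATape → Fin W → ATape → Store W → Store W
    two i x m y v j = if ⌊ j Finₚ.≟ i ⌋ then x else if ⌊ j Finₚ.≟ m ⌋ then y else v j

  module _ {i m : Fin W} {v : Store W} where
   opaque
    unfolding two
    two-fst : ∀ {x y} → two i x m y v i ≡ x
    two-fst with i Finₚ.≟ i
    ... | yes _ = refl
    ... | no n  = contradiction refl n

    two-snd : ∀ {x y} → m ≢ i → two i x m y v m ≡ y
    two-snd m≢i with m Finₚ.≟ i | m Finₚ.≟ m
    ... | yes e | _     = contradiction e m≢i
    ... | no _  | yes _ = refl
    ... | no _  | no n  = contradiction refl n

    two-uniq : ∀ {v′ : Store W} {x y} → v′ i ≡ x → v′ m ≡ y → (∀ j → j ≢ i → j ≢ m → v′ j ≡ v j) → v′ ≗ two i x m y v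
    two-uniq ex ey off j with j Finₚ.≟ i | j Finₚ.≟ m
    ... | yes refl | _        = ex
    ... | no _     | yes refl = ey
    ... | no j≢i   | no j≢m   = off j j≢i j≢m

    two-uniq₁ : ∀ {v′ : Store W} {x y} → v′ i ≡ x → (∀ j → j ≢ i → v′ j ≡ v j) → v′ ≗ two i x i y v
    two-uniq₁ ex off j with j Finₚ.≟ i
    ... | yes refl = ex
    ... | no j≢i   = off j j≢i

    two-id : ∀ {x y} → v i ≡ x → v m ≡ y → two i x m y v ≗ v
    two-id ex ey j with j Finₚ.≟ i | j Finₚ.≟ m
    ... | yes refl | _        = sym ex
    ... | no _     | yes refl = sym ey
    ... | no _     | no _     = refl

    two-off₁ : ∀ {x x′ y} j → j ≢ i → two i x m y v j ≡ two i x′ m y v j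
    two-off₁ j j≢i with j Finₚ.≟ i
    ... | yes e = contradiction e j≢i
    ... | no _  = refl

    two-off₂ : ∀ {x y y′} j → j ≢ m → two i x m y v j ≡ two i x m y′ v j
    two-off₂ j j≢m with j Finₚ.≟ i | j Finₚ.≟ m
    ... | yes _ | _     = refl
    ... | no _  | yes e = contradiction e j≢m
    ... | no _  | no _  = refl

  do! : ∀ {i f} {v v′ : Store W} {x y} → v i ≡ x → v′ i ≡ y → Acted (proj₁ (f (scan x))) (proj₂ (f (scan x))) x y →
        (∀ j → j ≢ i → v′ j ≡ v j) → Ans (act i f) v 1 true v′
  do! refl refl on off = 1 , ℕₚ.≤-refl , act⇓ (oneTape on off)

  check : ∀ {i p} {v : Store W} {x} → v i ≡ x → Ans (test i p) v 1 (p (scan x)) v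
  check refl = 1 , ℕₚ.≤-refl , test⇓ (λ _ → refl)

  check≡ : ∀ {i p} {v : Store W} {x b} → v i ≡ x → p (scan x) ≡ b → Ans (test i p) v 1 b v
  check≡ e refl = check e

  goL goR : Fin W → Prog W
  goL i = act i (_, goLeft)
  goR i = act i (_, goRight)

  answer : Fin W → Bool → Prog W
  answer i b = test i (const b)

  rewind : Fin W → Prog W
  rewind i = goR i ⨾ while (test i isOne) (goR i)

  -- Both heads run left in step until one of them meets the blank in cell 0. Starting from cells
  -- `a` and `b` they stop at `a ∸ b` and `b ∸ a`, which are both 0 exactly for equal numbers.
  eqP : Fin W → Fin W → Prog W
  eqP i j = goL i ⨾ goL j ⨾ while (ite (test i isOne) (test j isOne) (answer i false)) (goL i ⨾ goL j) ⨾
            ite (test i isOne) (fin false) (ite (test j isOne) (fin false) (fin true))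
    where
    fin : Bool → Prog W
    fin b = rewind i ⨾ rewind j ⨾ answer i b

  -- Random access: the ones on tape `i` count the moves of the head of tape `m`, away from cell 1
  -- and back again.
  walk unwalk : Fin W → Fin W → Prog W
  walk i m   = goL i ⨾ while (test i isOne) (goL i ⨾ goR m)
  unwalk i m = goR i ⨾ while (test i isOne) (goR i ⨾ goL m)

  readP : Fin W → Fin W → (Sym → Bool) → Prog W
  -- The symbol read is remembered by the branch taken, since the answer can only be given after the
  -- heads are back.
  readP i m p = walk i m ⨾ ite (test m p) (unwalk i m ⨾ answer i true) (unwalk i m ⨾ answer i false)

  markP : Fin W → Fin W → Prog W
  markP i m = walk i m ⨾ act m (λ _ → bit true , stay) ⨾ unwalk i m

  incP zeroP : Fin W → Prog W
  incP i  = act i (λ _ → bit true , goRight)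
  zeroP i = goL i ⨾ while (test i isOne) (act i (λ _ → blank , goLeft)) ⨾ goR i

  emitP : Fin W → Bool → Prog W
  emitP i b = act i (λ _ → bit b , goRight)

  one! : ∀ {i f} {v v′ : Store W} {a m x y} → Acted a m x y → (∀ s → f s ≡ (a , m)) → v i ≡ x → v′ i ≡ y →
         (∀ j → j ≢ i → v′ j ≡ v j) → Ans (act i f) v 1 true v′
  one! {f = f} {x = x} {y} on ef ex ey off =
    do! ex ey (subst (λ z → Acted (proj₁ z) (proj₂ z) x y) (sym (ef (scan x))) on) off

  incP-ok : ∀ {i} {v v′ : Store W} {r} → v i ≡ num r → v′ i ≡ num (suc r) → (∀ j → j ≢ i → v′ j ≡ v j) → Ans (incP i) v 1 true v′
  incP-ok {r = r} = one! (acted (unary-one {suc r} ℕₚ.≤-refl) (unary-suc r) rights) (λ _ → refl)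

  emitP-ok : ∀ {i b} {v v′ : Store W} {o} → v i ≡ outTape o → v′ i ≡ outTape (o ++ [ b ]) → (∀ j → j ≢ i → v′ j ≡ v j) →
             Ans (emitP i b) v 1 true v′
  emitP-ok {b = b} {o = o} = one! (acted (snoc-last o) (snoc-kept o)
      (subst (Moved goRight (suc (length o)))
         (sym (cong suc (trans (Listₚ.length-++ o) (ℕₚ.+-comm (length o) 1)))) rights)) (λ _ → refl)
    where
    snoc-last : ∀ o → cellAt (map bit (o ++ [ b ])) (length o) ≡ bit b
    snoc-last []      = refl
    snoc-last (_ ∷ o) = snoc-last o
    snoc-kept : ∀ o q → q ≢ suc (length o) → cells (cellAt (map bit (o ++ [ b ]))) q ≡ cells (cellAt (map bit o)) q
    snoc-kept o       zero          _ = refl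
    snoc-kept []      (suc zero)    n = contradiction refl n
    snoc-kept []      (suc (suc q)) _ = refl
    snoc-kept (_ ∷ o) (suc zero)    _ = refl
    snoc-kept (_ ∷ o) (suc (suc q)) n = snoc-kept o (suc q) (n ∘ cong suc)

  at-unary : ∀ {a p} → p < a → isOne (unary a (suc p)) ≡ true
  at-unary l rewrite unary-one l = refl

  at-end : ∀ a → isOne (unary a (suc a)) ≡ false
  at-end a rewrite unary-end a = refl

  module _ {i m : Fin W} (m≢i : m ≢ i) {v : Store W} where
    private
      i≢m : i ≢ m
      i≢m = m≢i ∘ sym

    L₁ : ∀ {f p y} → Ans (goL i) (two i (f , suc p) m y v) 1 true (two i (f , p) m y v)
    L₁ = do! two-fst two-fst (acted refl (λ _ _ → refl) lefts) two-off₁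

    R₁ : ∀ {f p y} → Ans (goR i) (two i (f , p) m y v) 1 true (two i (f , suc p) m y v)
    R₁ = do! two-fst two-fst (acted refl (λ _ _ → refl) rights) two-off₁

    L₂ : ∀ {x f p} → Ans (goL m) (two i x m (f , suc p) v) 1 true (two i x m (f , p) v)
    L₂ = do! (two-snd m≢i) (two-snd m≢i) (acted refl (λ _ _ → refl) lefts) two-off₂

    R₂ : ∀ {x f p} → Ans (goR m) (two i x m (f , p) v) 1 true (two i x m (f , suc p) v)
    R₂ = do! (two-snd m≢i) (two-snd m≢i) (acted refl (λ _ _ → refl) rights) two-off₂

    rewind₁ : ∀ {a y} p k → p + k ≡ a →
              Ans (rewind i) (two i (unary a , p) m y v) (1 + lin 2 1 k) false (two i (num a) m y v)
    rewind₁ {a} {y} p k e = R₁ ▹ go p k e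
      where
      go : ∀ p k → p + k ≡ a → Ans (while (test i isOne) (goR i)) (two i (unary a , suc p) m y v) (lin 2 1 k) false (two i (num a) m y v)
      go p zero    refl rewrite ℕₚ.+-identityʳ p = ans-stop (check≡ two-fst (at-end p))
      go p (suc k) refl = ans-loop (check≡ two-fst (at-unary (ℕₚ.m<m+n p (s≤s z≤n)))) R₁ (go (suc p) k (sym (ℕₚ.+-suc p k)))

    rewind₂ : ∀ {a x} p k → p + k ≡ a →
              Ans (rewind m) (two i x m (unary a , p) v) (1 + lin 2 1 k) false (two i x m (num a) v)
    rewind₂ {a} {x} p k e = R₂ ▹ go p k e
      where
      go : ∀ p k → p + k ≡ a → Ans (while (test m isOne) (goR m)) (two i x m (unary a , suc p) v) (lin 2 1 k) false (two i x m (num a) v)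
      go p zero    refl rewrite ℕₚ.+-identityʳ p = ans-stop (check≡ (two-snd m≢i) (at-end p))
      go p (suc k) refl = ans-loop (check≡ (two-snd m≢i) (at-unary (ℕₚ.m<m+n p (s≤s z≤n)))) R₂ (go (suc p) k (sym (ℕₚ.+-suc p k)))

    sweep : ∀ {a b} p q → p ≤ a → q ≤ b →
            Ans (while (ite (test i isOne) (test m isOne) (answer i false)) (goL i ⨾ goL m))
              (two i (unary a , p) m (unary b , q) v) (lin 4 2 p) false (two i (unary a , p ∸ q) m (unary b , q ∸ p) v)
    sweep zero    zero    p≤a q≤b = ans-stop (ans-else (check two-fst) (check two-fst))
    sweep zero    (suc q) p≤a q≤b = ans-stop (ans-else (check two-fst) (check two-fst))
    sweep (suc p) zero    p≤a q≤b =
      ans-≤ (ℕₚ.m≤n⇒m≤o+n 4 (lin-mono 4 2 {0} {p} z≤n))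
        (ans-stop (ans-then (check≡ two-fst (at-unary p≤a)) (check (two-snd m≢i))))
    sweep (suc p) (suc q) p≤a q≤b =
      ans-loop (ans-then (check≡ two-fst (at-unary p≤a)) (check≡ (two-snd m≢i) (at-unary q≤b))) (L₁ ▹ L₂)
        (sweep p q (ℕₚ.<⇒≤ p≤a) (ℕₚ.<⇒≤ q≤b))

    walk-ok : ∀ {a g} → Ans (walk i m) (two i (num a) m (g , 1) v) (1 + lin 3 1 a) false (two i (unary a , 0) m (g , suc a) v)
    walk-ok {a} {g} = L₁ ▹ at (ℕₚ.+-comm a 1) (go a 1 ℕₚ.≤-refl)
      where
      at : ∀ {p w t b f z z′} → z ≡ z′ → Ans p w t b (two i (f , 0) m (g , z) v) → Ans p w t b (two i (f , 0) m (g , z′) v)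
      at refl x = x
      go : ∀ p q → p ≤ a → Ans (while (test i isOne) (goL i ⨾ goR m)) (two i (unary a , p) m (g , q) v) (lin 3 1 p) false
                             (two i (unary a , 0) m (g , p + q) v)
      go zero    q l = ans-stop (check two-fst)
      go (suc p) q l = ans-loop (check≡ two-fst (at-unary l)) (L₁ ▹ R₂)
        (at (ℕₚ.+-suc p q) (go p (suc q) (ℕₚ.<⇒≤ l)))

    unwalk-ok : ∀ {a g} → Ans (unwalk i m) (two i (unary a , 0) m (g , suc a) v) (1 + lin 3 1 a) false (two i (num a) m (g , 1) v)
    unwalk-ok {a} {g} = R₁ ▹ go 0 a refl
      where
      go : ∀ p k → p + k ≡ a → Ans (while (test i isOne) (goR i ⨾ goL m)) (two i (unary a , suc p) m (g , suc k) v) (lin 3 1 k) false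
                                 (two i (num a) m (g , 1) v)
      go p zero    refl rewrite ℕₚ.+-identityʳ p = ans-stop (check≡ two-fst (at-end p))
      go p (suc k) refl = ans-loop (check≡ two-fst (at-unary (ℕₚ.m<m+n p (s≤s z≤n)))) (R₁ ▹ L₂) (go (suc p) k (sym (ℕₚ.+-suc p k)))

  readP-ok : ∀ {i m v a g B p} → m ≢ i → v i ≡ num a → v m ≡ ram g → a ≤ B → Ans (readP i m p) v (readCost B) (p (g a)) v
  readP-ok {i} {m} {v} {a} {g} {B} {p} m≢i ei em a≤B =
    ans-cong (sym ∘ two-id ei em) (sym ∘ two-id ei em)
      (ans-≤ (ℕₚ.+-mono-≤ l (ℕₚ.+-monoʳ-≤ 1 (ℕₚ.+-monoˡ-≤ 1 l))) (walk-ok m≢i {v} ▹ body (p (g a)) refl))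
    where
    l = ℕₚ.+-monoʳ-≤ 1 (lin-mono 3 1 a≤B)
    body : ∀ b → p (g a) ≡ b → Ans (ite (test m p) (unwalk i m ⨾ answer i true) (unwalk i m ⨾ answer i false))
             (two i (unary a , 0) m (cells g , suc a) v) (1 + ((1 + lin 3 1 a) + 1)) b (two i (num a) m (ram g) v)
    body true  e = ans-then (check≡ (two-snd m≢i) e) (unwalk-ok m≢i {v} ▹ check two-fst)
    body false e = ans-else (check≡ (two-snd m≢i) e) (unwalk-ok m≢i {v} ▹ check two-fst)

  markP-ok : ∀ {i m v v′ a g g′ B} → m ≢ i → v i ≡ num a → v m ≡ ram g → a ≤ B → v′ m ≡ ram g′ → (∀ j → j ≢ m → v′ j ≡ v j) →
             g′ a ≡ bit true → (∀ k → k ≢ a → g′ k ≡ g k) → ∃[ b ] Ans (markP i m) v (markCost B) b v′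
  markP-ok {i} {m} {v} {v′} {a} {g} {g′} m≢i ei em a≤B em′ off w kept = false ,
    ans-cong (sym ∘ two-id ei em) final
      (ans-≤ (ℕₚ.+-mono-≤ l (ℕₚ.+-monoʳ-≤ 1 l))
        (walk-ok m≢i {v} ▹ one! {y = cells g′ , suc a} (acted w kept′ stays) (λ _ → refl) (two-snd m≢i) (two-snd m≢i) two-off₂
          ▹ unwalk-ok m≢i {v}))
    where
    l = ℕₚ.+-monoʳ-≤ 1 (lin-mono 3 1 a≤B)
    kept′ : ∀ q → q ≢ suc a → cells g′ q ≡ cells g q
    kept′ zero    _ = refl
    kept′ (suc q) n = kept q (n ∘ cong suc)
    final : v′ ≗ two i (num a) m (ram g′) v
    final = two-uniq (trans (off i (m≢i ∘ sym)) ei) em′ (λ j _ → off j)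

  eqP-ok : ∀ {i j v a b B} → j ≢ i → v i ≡ num a → v j ≡ num b → a ≤ B → b ≤ B → Ans (eqP i j) v (eqCost B) (a ≡ᵇ b) v
  eqP-ok {i} {j} {v} {a} {b} {B} j≢i ei ej a≤B b≤B =
    ans-cong (sym ∘ two-id ei ej) (sym ∘ two-id ei ej)
      (L₁ j≢i {v} ▹ L₂ j≢i {v} ▹
        ans-≤ (lin-mono 4 2 a≤B) (sweep j≢i {v} a b ℕₚ.≤-refl ℕₚ.≤-refl) ▹
        tail a b refl refl)
    where
    fin : ∀ c {p q k l} → p + k ≡ a → q + l ≡ b → Ans (rewind i ⨾ rewind j ⨾ answer i c) (two i (unary a , p) j (unary b , q) v)
            (rewindCost B + (rewindCost B + 1)) c (two i (num a) j (num b) v)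
    fin c {p} {q} {k} {l} e f =
      ans-≤ (ℕₚ.+-monoʳ-≤ 1 (lin-mono 2 1 (ℕₚ.≤-trans (ℕₚ.m≤n+m k p) (subst (_≤ B) (sym e) a≤B)))) (rewind₁ j≢i {v} p k e) ▹
      ans-≤ (ℕₚ.+-monoʳ-≤ 1 (lin-mono 2 1 (ℕₚ.≤-trans (ℕₚ.m≤n+m l q) (subst (_≤ B) (sym f) b≤B)))) (rewind₂ j≢i {v} q l f) ▹
      check two-fst
    less : ∀ p q → q ∸ p ≡ 0 → (p ∸ q ≡ 0 → (p ≡ᵇ q) ≡ true)
    less zero    zero    _ _ = refl
    less (suc p) (suc q) e f = less p q e f
    differ : ∀ p q k → p ∸ q ≡ suc k → (p ≡ᵇ q) ≡ false
    differ (suc p) zero    k e = refl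
    differ (suc p) (suc q) k e = differ p q k e
    differ′ : ∀ p q k → q ∸ p ≡ suc k → (p ≡ᵇ q) ≡ false
    differ′ zero    (suc q) k e = refl
    differ′ (suc p) (suc q) k e = differ′ p q k e
    rest : ∀ p q → p ∸ q + (p ∸ (p ∸ q)) ≡ p
    rest p q = ℕₚ.m+[n∸m]≡n (ℕₚ.m∸n≤m p q)
    tail : ∀ p q → p ≡ a → q ≡ b →
      Ans (ite (test i isOne) (rewind i ⨾ rewind j ⨾ answer i false)
            (ite (test j isOne) (rewind i ⨾ rewind j ⨾ answer i false) (rewind i ⨾ rewind j ⨾ answer i true)))
        (two i (unary a , p ∸ q) j (unary b , q ∸ p) v) (1 + (1 + (rewindCost B + (rewindCost B + 1)))) (a ≡ᵇ b) (two i (num a) j (num b) v)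
    tail p q refl refl with p ∸ q in e | q ∸ p in f
    ... | suc k | l rewrite differ p q k e =
      ans-≤ (ℕₚ.n≤1+n _) (ans-then (check≡ two-fst (at-unary (subst (_≤ p) e (ℕₚ.m∸n≤m p q))))
        (fin false (trans (cong (_+ (p ∸ (p ∸ q))) (sym e)) (rest p q)) (trans (cong (_+ (q ∸ (q ∸ p))) (sym f)) (rest q p))))
    ... | zero  | suc l rewrite differ′ p q l f =
      ans-else (check two-fst) (ans-then (check≡ (two-snd j≢i) (at-unary (subst (_≤ q) f (ℕₚ.m∸n≤m q p)))) (fin false refl (trans (cong (_+ (q ∸ (q ∸ p))) (sym f)) (rest q p))))
    ... | zero  | zero rewrite less p q f e = ans-else (check two-fst) (ans-else (check (two-snd j≢i)) (fin true refl refl))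

  zeroP-ok : ∀ {i} {v v′ : Store W} {r B} → v i ≡ num r → v′ i ≡ num 0 → (∀ j → j ≢ i → v′ j ≡ v j) → r ≤ B → Ans (zeroP i) v (zeroCost B) true v′
  zeroP-ok {i} {v} {v′} {r} e e′ off r≤B =
    ans-cong {v = Z (num r)} {v′ = Z (num 0)} start (two-uniq₁ {m = i} e′ off)
      (do! two-fst two-fst (acted refl (λ _ _ → refl) lefts) two-off₁ ▹ ans-≤ (lin-mono 2 1 r≤B) (go r) ▹
       do! two-fst two-fst (acted refl (λ _ _ → refl) rights) two-off₁)
    where
    Z : ATape → Store W
    Z x = two i x i (num 0) v
    go : ∀ p → Ans (while (test i isOne) (act i (λ _ → blank , goLeft))) (Z (unary p , p)) (lin 2 1 p) false
                   (Z (unary 0 , 0))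
    go zero    = ans-stop (check two-fst)
    go (suc p) = ans-loop (check≡ two-fst (at-unary (ℕₚ.≤-refl {suc p})))
                   (do! two-fst two-fst (acted (unary-end p) (λ q n → sym (unary-suc p q n)) lefts) two-off₁) (go p)
    start : v ≗ Z (num r)
    start = two-uniq₁ {m = i} e (λ _ _ → refl)

-- A register language and its polynomial bounds

-- Register programs: number registers, the input and a write-once bit array, both
-- with random access, an output word, and loops that run once per input symbol.

data Cmd (r : ℕ) : Set where
  skip : Cmd r
  _▸_  : Cmd r → Cmd r → Cmd r
  inc zer mark : Fin r → Cmd r
  emit : Bool → Cmd r
  ifeq : Fin r → Fin r → Cmd r → Cmd r → Cmd r
  ifin : Fin r → Bool → Cmd r → Cmd r → Cmd r
  ifmk : Fin r → Cmd r → Cmd r → Cmd r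
  loop : Cmd r → Cmd r

infixr 5 _▸_

record State (r : ℕ) : Set where
  constructor mkState
  field
    regs  : Vec ℕ r
    marked : ℕ → Bool
    out   : Word

open State public

iter : {A : Set} → ℕ → (A → A) → A → A
iter zero    f x = x
iter (suc n) f x = iter n f (f x)

isSym : Bool → Sym → Bool
isSym true  (bit b) = b
isSym false (bit b) = not b
isSym _     _       = false

hit : Word → ℕ → Bool → Bool
hit w k b = isSym b (cellAt (map bit w) k)

run : ∀ {r} → Word → Cmd r → State r → State r
run w skip           σ = σ
run w (c ▸ d)        σ = run w d (run w c σ)
run w (inc j)        (mkState ρ μ o) = mkState (Vec.updateAt ρ j suc) μ o
run w (zer j)        (mkState ρ μ o) = mkState (Vec.updateAt ρ j (const 0)) μ o
run w (mark j)       (mkState ρ μ o) = mkState ρ (λ k → (k ≡ᵇ lookup ρ j) ∨ μ k) o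
run w (emit b)       (mkState ρ μ o) = mkState ρ μ (o ++ [ b ])
run w (ifeq i j c d) σ = if lookup (regs σ) i ≡ᵇ lookup (regs σ) j then run w c σ else run w d σ
run w (ifin i b c d) σ = if hit w (lookup (regs σ) i) b then run w c σ else run w d σ
run w (ifmk i c d)   σ = if marked σ (lookup (regs σ) i) then run w c σ else run w d σ
run w (loop c)       σ = iter (length w) (run w c) σ

level : ∀ {r} → Cmd r → ℕ
level (c ▸ d)        = level c ⊔ level d
level (ifeq _ _ c d) = level c ⊔ level d
level (ifin _ _ c d) = level c ⊔ level d
level (ifmk _ c d)   = level c ⊔ level d
level (loop c)       = suc (level c)
level _              = 0

-- Counts every increment and every output symbol, adding up both branches of a test. It bounds the
-- increase of all numbers in a run without following the run.
growth : ∀ {r} → ℕ → Cmd r → ℕ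
growth n skip           = 0
growth n (c ▸ d)        = growth n c + growth n d
growth n (inc j)        = 1
growth n (zer j)        = 0
growth n (mark j)       = 0
growth n (emit b)       = 1
growth n (ifeq i j c d) = growth n c + growth n d
growth n (ifin i b c d) = growth n c + growth n d
growth n (ifmk i c d)   = growth n c + growth n d
growth n (loop c)       = n * growth n c

-- Bounds the steps of the compiled command on an input of length `n` as long as no number exceeds
-- `B`. Again both branches of a test are charged.
cost : ∀ {r} → ℕ → ℕ → Cmd r → ℕ
cost n B skip           = 1
cost n B (c ▸ d)        = cost n B c + cost n B d
cost n B (inc j)        = 1
cost n B (zer j)        = zeroCost B
cost n B (mark j)       = markCost B
cost n B (emit b)       = 1
cost n B (ifeq i j c d) = eqCost B + (cost n B c + cost n B d)
cost n B (ifin i b c d) = readCost B + (cost n B c + cost n B d)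
cost n B (ifmk i c d)   = readCost B + (cost n B c + cost n B d)
cost n B (loop c)       = lin (readCost B + (cost n B c + 1)) (readCost B) n + zeroCost B

-- With the positive base `suc n` these bounds are monotone in `k` also at 0, so sums and products
-- need no case distinction.
Poly : (ℕ → ℕ) → Set
Poly g = ∃[ c ] ∃[ k ] (∀ n → g n ≤ c * suc n ^ k)

poly-≤ : ∀ {f g} → (∀ n → f n ≤ g n) → Poly g → Poly f
poly-≤ le (c , k , h) = c , k , λ n → ℕₚ.≤-trans (le n) (h n)

poly-const : ∀ c → Poly (const c)
poly-const c = c , 0 , λ n → ℕₚ.≤-reflexive (sym (ℕₚ.*-identityʳ c))

poly-id : Poly id
poly-id = 1 , 1 , λ n → ℕₚ.≤-trans (ℕₚ.n≤1+n n) (ℕₚ.≤-reflexive (sym (trans (ℕₚ.+-identityʳ _) (ℕₚ.*-identityʳ (suc n)))))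

poly-+ : ∀ {f g} → Poly f → Poly g → Poly (λ n → f n + g n)
poly-+ (c , k , h) (d , l , i) = c + d , k + l , λ n →
  ℕₚ.≤-trans (ℕₚ.+-mono-≤ (ℕₚ.≤-trans (h n) (ℕₚ.*-monoʳ-≤ c (ℕₚ.^-monoʳ-≤ (suc n) (ℕₚ.m≤m+n k l))))
                           (ℕₚ.≤-trans (i n) (ℕₚ.*-monoʳ-≤ d (ℕₚ.^-monoʳ-≤ (suc n) (ℕₚ.m≤n+m l k)))))
              (ℕₚ.≤-reflexive (sym (ℕₚ.*-distribʳ-+ (suc n ^ (k + l)) c d)))

poly-* : ∀ {f g} → Poly f → Poly g → Poly (λ n → f n * g n)
poly-* (c , k , h) (d , l , i) = c * d , k + l , λ n →
  ℕₚ.≤-trans (ℕₚ.*-mono-≤ (h n) (i n))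
    (ℕₚ.≤-reflexive (trans (ℕₚ.[m*n]*[o*p]≡[m*o]*[n*p] c (suc n ^ k) d (suc n ^ l))
                           (cong (c * d *_) (sym (ℕₚ.^-distribˡ-+-* (suc n) k l)))))

poly-lin : ∀ {k c p} → Poly k → Poly c → Poly p → Poly (λ n → lin (k n) (c n) (p n))
poly-lin {k} {c} {p} K C P = poly-≤ (λ n → ℕₚ.≤-reflexive (closed (k n) (c n) (p n))) (poly-+ (poly-* P K) C)
  where
  closed : ∀ k c p → lin k c p ≡ p * k + c
  closed k c zero    = refl
  closed k c (suc p) = trans (cong (k +_) (closed k c p)) (sym (ℕₚ.+-assoc k (p * k) c))

-- For positive `n` the base changes by `suc n ≤ 2 * n`, whence the factor `2 ^ k`; the constant
-- term of `polyBound` takes care of 0.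
poly-polyBound : ∀ {g} → Poly g → ∃[ c ] ∃[ k ] (∀ n → g n ≤ polyBound c k n)
poly-polyBound (c , k , h) = c * 2 ^ k , k , λ n → ℕₚ.≤-trans (h n) (bound n)
  where
  pow : ∀ m k → (2 * m) ^ k ≡ 2 ^ k * m ^ k
  pow m zero    = refl
  pow m (suc k) = trans (cong (2 * m *_) (pow m k)) (ℕₚ.[m*n]*[o*p]≡[m*o]*[n*p] 2 m (2 ^ k) (m ^ k))
  one^ : ∀ k → 1 ^ k ≤ 2 ^ k
  one^ k = ℕₚ.^-monoˡ-≤ k {1} {2} (s≤s z≤n)
  bound : ∀ n → c * suc n ^ k ≤ polyBound (c * 2 ^ k) k n
  bound zero    = ℕₚ.m≤n⇒m≤o+n (c * 2 ^ k * 0 ^ k) (ℕₚ.*-monoʳ-≤ c (one^ k))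
  bound (suc m) = ℕₚ.m≤n⇒m≤n+o (c * 2 ^ k)
    (ℕₚ.≤-trans (ℕₚ.*-monoʳ-≤ c (ℕₚ.≤-trans (ℕₚ.^-monoˡ-≤ k (le m)) (ℕₚ.≤-reflexive (pow (suc m) k))))
                (ℕₚ.≤-reflexive (sym (ℕₚ.*-assoc c (2 ^ k) (suc m ^ k)))))
    where
    le : ∀ m → suc (suc m) ≤ 2 * suc m
    le m = s≤s (ℕₚ.≤-trans (ℕₚ.m≤n+m (suc m) m) (ℕₚ.+-monoʳ-≤ m (ℕₚ.≤-reflexive (sym (ℕₚ.+-identityʳ (suc m))))))

module _ {r : ℕ} where

  poly-growth : (c : Cmd r) → Poly (λ n → growth n c)
  poly-growth skip           = poly-const 0
  poly-growth (c ▸ d)        = poly-+ (poly-growth c) (poly-growth d)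
  poly-growth (inc j)        = poly-const 1
  poly-growth (zer j)        = poly-const 0
  poly-growth (mark j)       = poly-const 0
  poly-growth (emit b)       = poly-const 1
  poly-growth (ifeq i j c d) = poly-+ (poly-growth c) (poly-growth d)
  poly-growth (ifin i b c d) = poly-+ (poly-growth c) (poly-growth d)
  poly-growth (ifmk i c d)   = poly-+ (poly-growth c) (poly-growth d)
  poly-growth (loop c)       = poly-* poly-id (poly-growth c)

  module _ {B : ℕ → ℕ} (PB : Poly B) where
    private
      PL : ∀ k c → Poly (λ n → lin k c (B n))
      PL k c = poly-lin (poly-const k) (poly-const c) PB
      suc′ : ∀ {g} → Poly g → Poly (λ n → 1 + g n)
      suc′ = poly-+ (poly-const 1)

    poly-zeroCost : Poly (λ n → zeroCost (B n))
    poly-zeroCost = suc′ (poly-+ (PL 2 1) (poly-const 1))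

    poly-readCost : Poly (λ n → readCost (B n))
    poly-readCost = poly-+ (suc′ (PL 3 1)) (suc′ (poly-+ (suc′ (PL 3 1)) (poly-const 1)))

    poly-markCost : Poly (λ n → markCost (B n))
    poly-markCost = poly-+ (suc′ (PL 3 1)) (suc′ (suc′ (PL 3 1)))

    poly-eqCost : Poly (λ n → eqCost (B n))
    poly-eqCost = suc′ (suc′ (poly-+ (PL 4 2) (suc′ (suc′
      (poly-+ (suc′ (PL 2 1)) (poly-+ (suc′ (PL 2 1)) (poly-const 1)))))))

    poly-cost : (c : Cmd r) → Poly (λ n → cost n (B n) c)
    poly-cost skip           = poly-const 1
    poly-cost (c ▸ d)        = poly-+ (poly-cost c) (poly-cost d)
    poly-cost (inc j)        = poly-const 1
    poly-cost (zer j)        = poly-zeroCost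
    poly-cost (mark j)       = poly-markCost
    poly-cost (emit b)       = poly-const 1
    poly-cost (ifeq i j c d) = poly-+ poly-eqCost (poly-+ (poly-cost c) (poly-cost d))
    poly-cost (ifin i b c d) = poly-+ poly-readCost (poly-+ (poly-cost c) (poly-cost d))
    poly-cost (ifmk i c d)   = poly-+ poly-readCost (poly-+ (poly-cost c) (poly-cost d))
    poly-cost (loop c)       =
      poly-+ (poly-lin (poly-+ poly-readCost (poly-+ (poly-cost c) (poly-const 1))) poly-readCost poly-id) poly-zeroCost

record Within {r} (σ : State r) (R : ℕ) : Set where
  constructor _,_
  field
    regs-≤ : ∀ j → lookup (regs σ) j ≤ R
    out-≤  : length (out σ) ≤ R

module _ {r : ℕ} where

  within-≤ : ∀ {σ : State r} {R S} → R ≤ S → Within σ R → Within σ S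
  within-≤ l (p , q) = (λ j → ℕₚ.≤-trans (p j) l) , ℕₚ.≤-trans q l

  updateAt-≤ : ∀ {n} (ρ : Vec ℕ n) {R S} j f → (∀ k → lookup ρ k ≤ R) → R ≤ S → f (lookup ρ j) ≤ S →
               ∀ k → lookup (Vec.updateAt ρ j f) k ≤ S
  updateAt-≤ ρ j f h l fj k with k Finₚ.≟ j
  ... | yes refl = ℕₚ.≤-trans (ℕₚ.≤-reflexive (Vecₚ.lookup∘updateAt j ρ)) fj
  ... | no k≢j   = ℕₚ.≤-trans (ℕₚ.≤-reflexive (Vecₚ.lookup∘updateAt′ k j k≢j ρ)) (ℕₚ.≤-trans (h k) l)

  within-run : ∀ w (c : Cmd r) {σ R} → Within σ R → Within (run w c σ) (R + growth (length w) c)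
  within-iter : ∀ w (c : Cmd r) m {σ R} → Within σ R → Within (iter m (run w c) σ) (R + m * growth (length w) c)
  within-if : ∀ w (c d : Cmd r) b {σ R} → Within σ R →
              Within (if b then run w c σ else run w d σ) (R + (growth (length w) c + growth (length w) d))

  within-run w skip    {R = R} h = within-≤ (ℕₚ.m≤m+n R 0) h
  within-run w (c ▸ d) {R = R} h = within-≤ (ℕₚ.≤-reflexive (ℕₚ.+-assoc R _ _)) (within-run w d (within-run w c h))
  within-run w (inc j) {σ} {R} (p , q) =
    updateAt-≤ (regs σ) j suc p (ℕₚ.m≤m+n R 1) (ℕₚ.≤-trans (s≤s (p j)) (ℕₚ.≤-reflexive (ℕₚ.+-comm 1 R))) , ℕₚ.m≤n⇒m≤n+o 1 q
  within-run w (zer j) {σ} {R} (p , q) = updateAt-≤ (regs σ) j (const 0) p (ℕₚ.m≤m+n R 0) z≤n , ℕₚ.m≤n⇒m≤n+o 0 q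
  within-run w (mark j) {R = R} (p , q) = (λ k → ℕₚ.m≤n⇒m≤n+o 0 (p k)) , ℕₚ.m≤n⇒m≤n+o 0 q
  within-run w (emit b) {σ} {R} (p , q) =
    (λ j → ℕₚ.m≤n⇒m≤n+o 1 (p j)) , ℕₚ.≤-trans (ℕₚ.≤-reflexive (Listₚ.length-++ (out σ))) (ℕₚ.+-monoˡ-≤ 1 q)
  within-run w (ifeq i j c d) h = within-if w c d _ h
  within-run w (ifin i b c d) h = within-if w c d _ h
  within-run w (ifmk i c d)   h = within-if w c d _ h
  within-run w (loop c)       h = within-iter w c (length w) h

  within-iter w c zero    {R = R} h = within-≤ (ℕₚ.m≤m+n R 0) h
  within-iter w c (suc m) {R = R} h = within-≤ (ℕₚ.≤-reflexive (ℕₚ.+-assoc R _ _)) (within-iter w c m (within-run w c h))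

  within-if w c d true  {R = R} h = within-≤ (ℕₚ.+-monoʳ-≤ R (ℕₚ.m≤m+n _ _)) (within-run w c h)
  within-if w c d false {R = R} h = within-≤ (ℕₚ.+-monoʳ-≤ R (ℕₚ.m≤n+m _ _)) (within-run w d h)

-- Compiling register programs

isBit-input : ∀ (w : Word) i → i < length w → isBit (cellAt (map bit w) i) ≡ true
isBit-input (x ∷ w) zero    _       = refl
isBit-input (x ∷ w) (suc i) (s≤s l) = isBit-input w i l

isBit-end : ∀ (w : Word) → isBit (cellAt (map bit w) (length w)) ≡ false
isBit-end []      = refl
isBit-end (_ ∷ w) = isBit-end w

module Compile {r : ℕ} (D : ℕ) where

  Tapes : ℕ
  Tapes = 3 + (r + D)

  reg : Fin r → Fin Tapes
  reg j = suc (suc (suc (j ↑ˡ D)))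

  ctr : Fin D → Fin Tapes
  ctr k = suc (suc (suc (r ↑ʳ k)))

  inputᵗ marksᵗ : Fin Tapes
  inputᵗ = suc zero
  marksᵗ = suc (suc zero)

  -- A loop with body `c` owns the counter number `level c`; the loops inside `c` use smaller
  -- numbers, so nested loops never share a counter. A comparison of a register with itself is
  -- settled here, because `eqP` works on two different tapes.
  compile : (c : Cmd r) → level c ≤ D → Prog Tapes
  compile skip           _  = answer zero true
  compile (c ▸ d)        le = compile c (ℕₚ.≤-trans (ℕₚ.m≤m⊔n _ _) le) ⨾ compile d (ℕₚ.≤-trans (ℕₚ.m≤n⊔m (level c) _) le)
  compile (inc j)        _  = incP (reg j)
  compile (zer j)        _  = zeroP (reg j)
  compile (mark j)       _  = markP (reg j) marksᵗ
  compile (emit b)       _  = emitP zero b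
  compile (ifeq i j c d) le = ite (if ⌊ i Finₚ.≟ j ⌋ then answer zero true else eqP (reg i) (reg j))
    (compile c (ℕₚ.≤-trans (ℕₚ.m≤m⊔n _ _) le)) (compile d (ℕₚ.≤-trans (ℕₚ.m≤n⊔m (level c) _) le))
  compile (ifin i b c d) le = ite (readP (reg i) inputᵗ (isSym b))
    (compile c (ℕₚ.≤-trans (ℕₚ.m≤m⊔n _ _) le)) (compile d (ℕₚ.≤-trans (ℕₚ.m≤n⊔m (level c) _) le))
  compile (ifmk i c d)   le = ite (readP (reg i) marksᵗ isBit)
    (compile c (ℕₚ.≤-trans (ℕₚ.m≤m⊔n _ _) le)) (compile d (ℕₚ.≤-trans (ℕₚ.m≤n⊔m (level c) _) le))
  compile (loop c)       le = while (readP (ctr (fromℕ< le)) inputᵗ isBit) (compile c (ℕₚ.<⇒≤ le) ⨾ incP (ctr (fromℕ< le)))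
                              ⨾ zeroP (ctr (fromℕ< le))

  module _ (w : Word) where
    private
      n : ℕ
      n = length w

    markCells : (ℕ → Bool) → ℕ → Sym
    markCells μ k = if μ k then bit true else blank

    asm : State r → (Fin D → ℕ) → Store Tapes
    asm σ κ zero                = outTape (out σ)
    asm σ κ (suc zero)          = ram (cellAt (map bit w))
    asm σ κ (suc (suc zero))    = ram (markCells (marked σ))
    asm σ κ (suc (suc (suc k))) = num ([ lookup (regs σ) , κ ]′ (splitAt r k))

    asm-reg : ∀ σ κ j → asm σ κ (reg j) ≡ num (lookup (regs σ) j)
    asm-reg σ κ j = cong (num ∘ [ lookup (regs σ) , κ ]′) (Finₚ.splitAt-↑ˡ r j D)

    asm-ctr : ∀ σ κ k → asm σ κ (ctr k) ≡ num (κ k)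
    asm-ctr σ κ k = cong (num ∘ [ lookup (regs σ) , κ ]′) (Finₚ.splitAt-↑ʳ r D k)

    asm-regs-off : ∀ {ρ μ o κ} j f i → i ≢ reg j → asm (mkState (Vec.updateAt ρ j f) μ o) κ i ≡ asm (mkState ρ μ o) κ i
    asm-regs-off j f zero             _ = refl
    asm-regs-off j f (suc zero)       _ = refl
    asm-regs-off j f (suc (suc zero)) _ = refl
    asm-regs-off {ρ} j f (suc (suc (suc k))) n with splitAt r k in eq
    ... | inj₂ _  = refl
    ... | inj₁ j′ = cong num (Vecₚ.lookup∘updateAt′ j′ j
                      (λ e → n (cong (λ z → suc (suc (suc z))) (trans (sym (Finₚ.splitAt⁻¹-↑ˡ eq)) (cong (_↑ˡ D) e)))) ρ)

    asm-ctrs-off : ∀ {σ κ κ′} k → (∀ l → l ≢ k → κ′ l ≡ κ l) → ∀ i → i ≢ ctr k → asm σ κ′ i ≡ asm σ κ i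
    asm-ctrs-off k h zero             _ = refl
    asm-ctrs-off k h (suc zero)       _ = refl
    asm-ctrs-off k h (suc (suc zero)) _ = refl
    asm-ctrs-off k h (suc (suc (suc l))) n with splitAt r l in eq
    ... | inj₁ _  = refl
    ... | inj₂ k′ = cong num (h k′ (λ e → n (cong (λ z → suc (suc (suc z))) (trans (sym (Finₚ.splitAt⁻¹-↑ʳ eq)) (cong (r ↑ʳ_) e)))))

    asm-out-off : ∀ {ρ μ o o′ κ} i → i ≢ zero → asm (mkState ρ μ o′) κ i ≡ asm (mkState ρ μ o) κ i
    asm-out-off zero n    = contradiction refl n
    asm-out-off (suc zero) _ = refl
    asm-out-off (suc (suc zero)) _ = refl
    asm-out-off (suc (suc (suc _))) _ = refl

    asm-marked-off : ∀ {ρ μ μ′ o κ} i → i ≢ marksᵗ → asm (mkState ρ μ′ o) κ i ≡ asm (mkState ρ μ o) κ i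
    asm-marked-off zero _    = refl
    asm-marked-off (suc zero) _ = refl
    asm-marked-off (suc (suc zero)) n = contradiction refl n
    asm-marked-off (suc (suc (suc _))) _ = refl

    asm-cong : ∀ {σ κ κ′} → κ ≗ κ′ → asm σ κ ≗ asm σ κ′
    asm-cong e zero             = refl
    asm-cong e (suc zero)       = refl
    asm-cong e (suc (suc zero)) = refl
    asm-cong e (suc (suc (suc l))) with splitAt r l
    ... | inj₁ _ = refl
    ... | inj₂ k = cong num (e k)

    put : Fin D → ℕ → (Fin D → ℕ) → Fin D → ℕ
    put k i κ l = if ⌊ l Finₚ.≟ k ⌋ then i else κ l

    put-same : ∀ k i κ → put k i κ k ≡ i
    put-same k i κ with k Finₚ.≟ k
    ... | yes _ = refl
    ... | no n  = contradiction refl n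

    put-off : ∀ k i κ l → l ≢ k → put k i κ l ≡ κ l
    put-off k i κ l n with l Finₚ.≟ k
    ... | yes e = contradiction e n
    ... | no _  = refl

    -- The invariant of nested loops: the counters that belong to loops inside `c` are zero before
    -- and after, whereas those of the surrounding loops have any value and keep it.
    compile-ok : ∀ c (le : level c ≤ D) σ κ B R → (∀ k → toℕ k < level c → κ k ≡ 0) → Within σ R →
                 R + growth n c ≤ B → n ≤ B → ∃[ b ] Ans (compile c le) (asm σ κ) (cost n B c) b (asm (run w c σ) κ)
    branch-ok : ∀ {p T} c d (lc : level c ≤ D) (ld : level d ≤ D) b σ κ B R → (∀ k → toℕ k < level c ⊔ level d → κ k ≡ 0) → Within σ R →
                R + (growth n c + growth n d) ≤ B → n ≤ B → Ans p (asm σ κ) T b (asm σ κ) →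
                ∃[ a ] Ans (ite p (compile c lc) (compile d ld)) (asm σ κ) (T + (cost n B c + cost n B d)) a
                         (asm (if b then run w c σ else run w d σ) κ)

    compile-ok skip le σ κ B R Z h RB nB = _ , check refl
    compile-ok (c ▸ d) le σ κ B R Z h RB nB =
      _ , proj₂ (compile-ok c _ σ κ B R (λ k l → Z k (ℕₚ.≤-trans l (ℕₚ.m≤m⊔n _ _))) h
                  (ℕₚ.≤-trans (ℕₚ.+-monoʳ-≤ R (ℕₚ.m≤m+n _ _)) RB) nB) ▹
          proj₂ (compile-ok d _ (run w c σ) κ B (R + growth n c) (λ k l → Z k (ℕₚ.≤-trans l (ℕₚ.m≤n⊔m (level c) _))) (within-run w c h)
                  (ℕₚ.≤-trans (ℕₚ.≤-reflexive (ℕₚ.+-assoc R _ _)) RB) nB)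
    compile-ok (inc j) le σ κ B R Z h RB nB = _ ,
      incP-ok (asm-reg σ κ j) (trans (asm-reg (run w (inc j) σ) κ j) (cong num (Vecₚ.lookup∘updateAt j (regs σ)))) (asm-regs-off j suc)
    compile-ok (zer j) le σ κ B R Z h RB nB = _ ,
      zeroP-ok (asm-reg σ κ j) (trans (asm-reg (run w (zer j) σ) κ j) (cong num (Vecₚ.lookup∘updateAt j (regs σ)))) (asm-regs-off j (const 0))
        (ℕₚ.≤-trans (Within.regs-≤ h j) (ℕₚ.≤-trans (ℕₚ.m≤m+n R 0) RB))
    compile-ok (mark j) le σ κ B R Z h RB nB =
      markP-ok (λ ()) (asm-reg σ κ j) refl (ℕₚ.≤-trans (Within.regs-≤ h j) (ℕₚ.≤-trans (ℕₚ.m≤m+n R 0) RB)) refl asm-marked-off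
        (new (lookup (regs σ) j)) (λ k n → old k (lookup (regs σ) j) n)
      where
      new : ∀ a → (if (a ≡ᵇ a) ∨ marked σ a then bit true else blank) ≡ bit true
      new a rewrite dec-true (T? (a ≡ᵇ a)) (ℕₚ.≡⇒≡ᵇ a a refl) = refl
      old : ∀ k a → k ≢ a → (if (k ≡ᵇ a) ∨ marked σ k then bit true else blank) ≡ markCells (marked σ) k
      old k a n rewrite dec-false (T? (k ≡ᵇ a)) (n ∘ ℕₚ.≡ᵇ⇒≡ k a) = refl
    compile-ok (emit b) le σ κ B R Z h RB nB = _ , emitP-ok {b = b} {o = out σ} refl refl asm-out-off
    compile-ok (ifeq i j c d) le σ κ B R Z h RB nB =
      branch-ok c d _ _ _ σ κ B R Z h RB nB (lemma (i Finₚ.≟ j))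
      where
      b : ∀ k → lookup (regs σ) k ≤ B
      b k = ℕₚ.≤-trans (Within.regs-≤ h k) (ℕₚ.≤-trans (ℕₚ.m≤m+n R _) RB)
      lemma : ∀ (d : Dec (i ≡ j)) → Ans (if ⌊ d ⌋ then answer zero true else eqP (reg i) (reg j)) (asm σ κ) (eqCost B)
                (lookup (regs σ) i ≡ᵇ lookup (regs σ) j) (asm σ κ)
      lemma (yes refl) rewrite dec-true (T? (lookup (regs σ) i ≡ᵇ lookup (regs σ) i)) (ℕₚ.≡⇒≡ᵇ _ _ (refl {x = lookup (regs σ) i})) =
        ans-≤ (s≤s z≤n) (check refl)
      lemma (no i≢j) = eqP-ok (λ e → i≢j (sym (Finₚ.↑ˡ-injective D j i (Finₚ.suc-injective (Finₚ.suc-injective (Finₚ.suc-injective e))))))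
                         (asm-reg σ κ i) (asm-reg σ κ j) (b i) (b j)
    compile-ok (ifin i b c d) le σ κ B R Z h RB nB =
      branch-ok c d _ _ _ σ κ B R Z h RB nB
        (readP-ok {p = isSym b} (λ ()) (asm-reg σ κ i) refl (ℕₚ.≤-trans (Within.regs-≤ h i) (ℕₚ.≤-trans (ℕₚ.m≤m+n R _) RB)))
    compile-ok (ifmk i c d) le σ κ B R Z h RB nB =
      branch-ok c d _ _ _ σ κ B R Z h RB nB
        (subst (λ b → Ans (readP (reg i) marksᵗ isBit) (asm σ κ) (readCost B) b (asm σ κ)) (bitness (marked σ (lookup (regs σ) i)))
          (readP-ok {p = isBit} (λ ()) (asm-reg σ κ i) refl (ℕₚ.≤-trans (Within.regs-≤ h i) (ℕₚ.≤-trans (ℕₚ.m≤m+n R _) RB))))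
      where
      bitness : ∀ b → isBit (if b then bit true else blank) ≡ b
      bitness true  = refl
      bitness false = refl
    compile-ok (loop c) le σ κ B R Z h RB nB = true ,
      ans-cong (asm-cong κ≗) (λ _ → refl)
        (proj₂ (go n 0 refl σ R h RB) ▹
         zeroP-ok (trans (asm-ctr (run w (loop c) σ) (put k n κ) k) (cong num (put-same k n κ)))
           (trans (asm-ctr (run w (loop c) σ) κ k) (cong num (Z k (ℕₚ.≤-reflexive (cong suc (Finₚ.toℕ-fromℕ< le))))))
           (asm-ctrs-off k (λ l l≢k → sym (put-off k n κ l l≢k))) nB)
      where
      k = fromℕ< le
      κ≗ : κ ≗ put k 0 κ
      κ≗ l with l Finₚ.≟ k
      ... | yes refl = Z k (ℕₚ.≤-reflexive (cong suc (Finₚ.toℕ-fromℕ< le)))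
      ... | no _     = refl
      below : ∀ i l → toℕ l < level c → put k i κ l ≡ 0
      below i l l<c = trans (put-off k i κ l (λ e → ℕₚ.<⇒≢ l<c (trans (cong toℕ e) (Finₚ.toℕ-fromℕ< le)))) (Z l (ℕₚ.m≤n⇒m≤1+n l<c))
      go : ∀ m i → i + m ≡ n → ∀ σ R → Within σ R → R + m * growth n c ≤ B →
           ∃[ b ] Ans (while (readP (ctr k) inputᵗ isBit) (compile c (ℕₚ.<⇒≤ le) ⨾ incP (ctr k))) (asm σ (put k i κ))
             (lin (readCost B + (cost n B c + 1)) (readCost B) m) b (asm (iter m (run w c) σ) (put k n κ))
      go zero i e σ R h RB with trans (sym (ℕₚ.+-identityʳ i)) e
      ... | refl = _ , ans-stop (subst (λ b → Ans (readP (ctr k) inputᵗ isBit) (asm σ (put k n κ)) _ b (asm σ (put k n κ)))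
                          (isBit-end w) (readP-ok {p = isBit} (λ ()) (trans (asm-ctr σ (put k n κ) k) (cong num (put-same k n κ))) refl nB))
      go (suc m) i e σ R h RB with go m (suc i) (trans (sym (ℕₚ.+-suc i m)) e) (run w c σ) (R + growth n c) (within-run w c h)
                                     (ℕₚ.≤-trans (ℕₚ.≤-reflexive (ℕₚ.+-assoc R _ _)) RB)
                                  | compile-ok c (ℕₚ.<⇒≤ le) σ (put k i κ) B R (below i) h
                                     (ℕₚ.≤-trans (ℕₚ.+-monoʳ-≤ R (ℕₚ.m≤m+n _ _)) RB) nB
      ... | b , rest | b′ , body = b , ans-loop
        (subst (λ b → Ans (readP (ctr k) inputᵗ isBit) (asm σ (put k i κ)) _ b (asm σ (put k i κ))) (isBit-input w i i<n)
          (readP-ok {p = isBit} (λ ()) (trans (asm-ctr σ (put k i κ) k) (cong num (put-same k i κ))) refl (ℕₚ.≤-trans (ℕₚ.<⇒≤ i<n) nB)))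
        (body ▹ incP-ok (trans (asm-ctr (run w c σ) (put k i κ) k) (cong num (put-same k i κ))) (trans (asm-ctr (run w c σ) (put k (suc i) κ) k) (cong num (put-same k (suc i) κ)))
                  (asm-ctrs-off k (λ l l≢k → trans (put-off k (suc i) κ l l≢k) (sym (put-off k i κ l l≢k)))))
        rest
        where
        i<n : i < n
        i<n = subst (i <_) e (ℕₚ.m<m+n i (s≤s z≤n))

    branch-ok {T = T} c d lc ld true σ κ B R Z h RB nB p = _ ,
      ans-≤ (ℕₚ.+-monoʳ-≤ T (ℕₚ.m≤m+n _ _))
        (ans-then p (proj₂ (compile-ok c lc σ κ B R (λ k l → Z k (ℕₚ.≤-trans l (ℕₚ.m≤m⊔n _ _))) h
          (ℕₚ.≤-trans (ℕₚ.+-monoʳ-≤ R (ℕₚ.m≤m+n _ _)) RB) nB)))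
    branch-ok {T = T} c d lc ld false σ κ B R Z h RB nB p = _ ,
      ans-≤ (ℕₚ.+-monoʳ-≤ T (ℕₚ.m≤n+m _ (cost n B c)))
        (ans-else p (proj₂ (compile-ok d ld σ κ B R (λ k l → Z k (ℕₚ.≤-trans l (ℕₚ.m≤n⊔m (level c) _))) h
          (ℕₚ.≤-trans (ℕₚ.+-monoʳ-≤ R (ℕₚ.m≤n+m _ _)) RB) nB)))

start : ∀ {r} → State r
start = mkState (Vec.replicate _ 0) (const false) []

-- The first tape while it is being erased: once `m` symbols have been copied, `m` further blanks
-- precede the rest of the input.
delay : ℕ → (ℕ → Sym) → ℕ → Sym
delay zero    f         = cells f
delay (suc m) f zero    = blank
delay (suc m) f (suc q) = delay m f q

delay-here : ∀ m (f : ℕ → Sym) → delay m f (suc m) ≡ f 0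
delay-here zero    f = refl
delay-here (suc m) f = delay-here m f

delay-next : ∀ m (f : ℕ → Sym) → delay (suc m) (λ k → f (suc k)) (suc m) ≡ blank
delay-next zero    f = refl
delay-next (suc m) f = delay-next m f

delay-kept : ∀ m (f : ℕ → Sym) q → q ≢ suc m → delay (suc m) (λ k → f (suc k)) q ≡ delay m f q
delay-kept zero    f zero          _ = refl
delay-kept zero    f (suc zero)    n = contradiction refl n
delay-kept zero    f (suc (suc q)) _ = refl
delay-kept (suc m) f zero          _ = refl
delay-kept (suc m) f (suc q)       n = delay-kept m f q (n ∘ cong suc)

delay-blank : ∀ m q → delay m (cellAt []) q ≡ blank
delay-blank zero    zero    = refl
delay-blank zero    (suc q) = refl
delay-blank (suc m) zero    = refl
delay-blank (suc m) (suc q) = delay-blank m q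

module _ {r : ℕ} (c : Cmd r) where
  open Compile {r} (level c)

  -- The first tape is the input at the start and the output at the end. So the input is moved to a
  -- tape of its own, and at the end the head goes back to the first output symbol, where reading
  -- begins.
  copy back prologue epilogue whole : Prog Tapes
  copy     = while (test zero isBit)
               (ite (test zero isOne) (emitP inputᵗ true) (emitP inputᵗ false) ⨾ act zero (λ _ → blank , goRight))
  back     = goL inputᵗ ⨾ while (test inputᵗ isBit) (goL inputᵗ ⨾ goL zero) ⨾ goR inputᵗ ⨾ act zero (_, stay)
  prologue = copy ⨾ back
  epilogue = goL zero ⨾ while (test zero isBit) (goL zero) ⨾ goR zero
  whole    = prologue ⨾ compile c ℕₚ.≤-refl ⨾ epilogue

  module _ (w : Word) where
    private
      n G : ℕ
      n = length w
      G = growth n c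

      κ₀ : Fin (level c) → ℕ
      κ₀ = const 0

    before : Store Tapes
    before zero          = ram (cellAt (map bit w))
    before (suc zero)    = outTape []
    before (suc (suc j)) = asm w start κ₀ (suc (suc j))

    blank-≈ₜ : ∀ {f} → (∀ k → f k ≡ blank) → blankTape ≈ₜ (f , 1)
    blank-≈ₜ {f} e = represents (sym (e 1)) (λ k → sym (e _)) λ { zero → sym (e 0) ; (suc k) → refl }

    registers-zero : ∀ (z : Fin r ⊎ Fin (level c)) → [ lookup (Vec.replicate r 0) , κ₀ ]′ z ≡ 0
    registers-zero (inj₁ i) = Vecₚ.lookup-replicate i 0
    registers-zero (inj₂ _) = refl

    before-ok : Matches whole (inputTape (machine whole) w Vec.∷ Vec.replicate _ blankTape) before
    before-ok zero = go w
      where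
      go : ∀ w → inputTape (machine whole) w ≈ₜ ram (cellAt (map bit w))
      go []      = blank-≈ₜ λ { zero → refl ; (suc _) → refl }
      go (b ∷ w) = represents refl (λ k → cong (cells (cellAt (map bit (b ∷ w)))) (trans (cong suc (ℕₚ.+-comm 1 k)) (sym (ℕₚ.+-suc k 1))))
                     λ { zero → refl ; (suc _) → refl }
    before-ok (suc zero) = blank-≈ₜ λ { zero → refl ; (suc _) → refl }
    before-ok (suc (suc zero)) = blank-≈ₜ λ { zero → refl ; (suc _) → refl }
    before-ok (suc (suc (suc j))) rewrite Vecₚ.lookup-replicate j (blankTape {0}) | registers-zero (splitAt r j) =
      blank-≈ₜ λ { zero → refl ; (suc _) → refl }

    during : ATape → ATape → Store Tapes
    during x y = two zero x inputᵗ y before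

    copy-ok : ∀ u pre m → Ans copy (during (delay m (cellAt (map bit u)) , suc m) (outTape pre)) (lin 4 1 (length u)) false
                            (during (delay (length u + m) (cellAt []) , suc (length u + m)) (outTape (pre ++ u)))
    copy-ok [] pre m rewrite Listₚ.++-identityʳ pre =
      ans-stop (check≡ {p = isBit} two-fst (cong isBit (delay-here m (cellAt []))))
    copy-ok (b ∷ u) pre m =
      ans-loop (check≡ two-fst (cong isBit (delay-here m (cellAt (map bit (b ∷ u))))))
        (emitting b (delay-here m (cellAt (map bit (b ∷ u)))) ▹
          one! (acted (delay-next m (cellAt (map bit (b ∷ u)))) (delay-kept m (cellAt (map bit (b ∷ u)))) rights) (λ _ → refl) two-fst two-fst two-off₁)
        (subst₂ (λ k o → Ans copy (during (delay (suc m) (cellAt (map bit u)) , suc (suc m)) (outTape (pre ++ [ b ]))) (lin 4 1 (length u)) false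
                           (during (delay k (cellAt []) , suc k) (outTape o)))
          (ℕₚ.+-suc (length u) m) (Listₚ.++-assoc pre [ b ] u) (copy-ok u (pre ++ [ b ]) (suc m)))
      where
      emitting : ∀ b {f p} → f p ≡ bit b → Ans (ite (test zero isOne) (emitP inputᵗ true) (emitP inputᵗ false))
                   (during (f , p) (outTape pre)) 2 true (during (f , p) (outTape (pre ++ [ b ])))
      emitting true  e = ans-then (check≡ two-fst (cong isOne e)) (emitP-ok {o = pre} (two-snd λ ()) (two-snd λ ()) two-off₂)
      emitting false e = ans-else (check≡ two-fst (cong isOne e)) (emitP-ok {o = pre} (two-snd λ ()) (two-snd λ ()) two-off₂)

    back-ok : Ans back (during (delay n (cellAt []) , suc n) (outTape w)) (1 + (lin 3 1 n + (1 + 1))) true (asm w start κ₀)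
    back-ok = ans-cong (λ _ → refl) after
      (L₂ (λ ()) ▹ go n ℕₚ.≤-refl ▹ R₂ (λ ()) ▹
       do! {v′ = during (outTape []) (ram (cellAt (map bit w)))} two-fst two-fst (acted (sym (delay-blank n 1)) (λ { zero _ → sym (delay-blank n 0) ; (suc q) _ → sym (delay-blank n (suc q)) }) stays) two-off₁)
      where
      go : ∀ k → k ≤ n → Ans (while (test inputᵗ isBit) (goL inputᵗ ⨾ goL zero)) (during (delay n (cellAt []) , suc k) (cells (cellAt (map bit w)) , k))
             (lin 3 1 k) false (during (delay n (cellAt []) , 1) (cells (cellAt (map bit w)) , 0))
      go zero    l = ans-stop (check (two-snd λ ()))
      go (suc k) l = ans-loop (check≡ (two-snd λ ()) (isBit-input w k l)) (L₂ (λ ()) ▹ L₁ (λ ())) (go k (ℕₚ.<⇒≤ l))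
      after : asm w start κ₀ ≗ during (outTape []) (ram (cellAt (map bit w)))
      after = two-uniq refl refl λ { zero n _ → contradiction refl n ; (suc zero) _ n → contradiction refl n ; (suc (suc _)) _ _ → refl }

    prologue-ok : Ans prologue before (lin 4 1 n + (1 + (lin 3 1 n + (1 + 1)))) true (asm w start κ₀)
    prologue-ok = ans-cong (λ j → sym (two-id refl refl j)) (λ _ → refl)
      (subst (λ k → Ans copy (during (ram (cellAt (map bit w))) (outTape [])) (lin 4 1 n) false (during (delay k (cellAt []) , suc k) (outTape w)))
        (ℕₚ.+-identityʳ n) (copy-ok w [] 0) ▹ back-ok)

    epilogue-ok : ∀ {v} o → v zero ≡ outTape o → Ans epilogue v (1 + (lin 2 1 (length o) + 1)) true (two zero (ram (cellAt (map bit o))) inputᵗ (v inputᵗ) v)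
    epilogue-ok {v} o e = ans-cong (λ j → sym (two-id e refl j)) (λ _ → refl) (L₁ (λ ()) ▹ go (length o) ℕₚ.≤-refl ▹ R₁ (λ ()))
      where
      go : ∀ k → k ≤ length o → Ans (while (test zero isBit) (goL zero)) (two zero (cells (cellAt (map bit o)) , k) inputᵗ (v inputᵗ) v)
             (lin 2 1 k) false (two zero (cells (cellAt (map bit o)) , 0) inputᵗ (v inputᵗ) v)
      go zero    l = ans-stop (check two-fst)
      go (suc k) l = ans-loop (check≡ two-fst (isBit-input o k l)) (L₁ (λ ())) (go k (ℕₚ.<⇒≤ l))

    totalCost : ℕ
    totalCost = (lin 4 1 n + (1 + (lin 3 1 n + (1 + 1)))) + (cost n (n + G) c + (1 + (lin 2 1 G + 1)))

    whole-ok : ∃[ v ] (v zero ≡ ram (cellAt (map bit (out (run w c start)))) × Ans whole before totalCost true v)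
    whole-ok = _ , two-fst , (prologue-ok ▹ proj₂ (compile-ok w c ℕₚ.≤-refl start κ₀ (n + G) 0 (λ _ _ → refl) W₀ (ℕₚ.m≤n+m G n) (ℕₚ.m≤m+n n G)) ▹
      ans-≤ (ℕₚ.+-monoʳ-≤ 1 (ℕₚ.+-monoˡ-≤ 1 (lin-mono 2 1 (Within.out-≤ (within-run w c W₀)))))
        (epilogue-ok (out (run w c start)) refl))
      where
      W₀ : Within {r} start 0
      W₀ = (λ j → ℕₚ.≤-reflexive (Vecₚ.lookup-replicate j 0)) , z≤n

    read-output : ∀ (o : Word) (t : Tape 0) → t ≈ₜ ram (cellAt (map bit o)) → bitPrefix (machine whole) (head t ∷ right t) ≡ o
    read-output o t (represents here ahead _) = go (head t ∷ right t) o
      λ { zero → here ; (suc k) → trans (ahead k) (cong (cells (cellAt (map bit o))) (trans (ℕₚ.+-suc k 1) (cong suc (ℕₚ.+-comm k 1)))) }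
      where
      go : ∀ xs o → (∀ k → cellAt xs k ≡ cellAt (map bit o) k) → bitPrefix (machine whole) xs ≡ o
      go []           []      e = refl
      go []           (b ∷ o) e = contradiction (e 0) λ ()
      go (blank ∷ xs) []      e = refl
      go (bit _ ∷ xs) []      e = contradiction (e 0) λ ()
      go (blank ∷ xs) (b ∷ o) e = contradiction (e 0) λ ()
      go (bit a ∷ xs) (b ∷ o) e with e 0
      ... | refl = cong (b ∷_) (go xs o (e ∘ suc))

  poly-totalCost : Poly (λ n → (lin 4 1 n + (1 + (lin 3 1 n + (1 + 1)))) + (cost n (n + growth n c) c + (1 + (lin 2 1 (growth n c) + 1))))
  poly-totalCost =
    poly-+ (poly-+ (PL 4 1 poly-id) (poly-+ (poly-const 1) (poly-+ (PL 3 1 poly-id) (poly-const 2))))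
      (poly-+ (poly-cost (poly-+ poly-id (poly-growth c)) c) (poly-+ (poly-const 1) (poly-+ (PL 2 1 (poly-growth c)) (poly-const 1))))
    where
    PL : ∀ k d {p} → Poly p → Poly (λ n → lin k d (p n))
    PL k d = poly-lin (poly-const k) (poly-const d)

  halting : ∀ w → ∃[ t ] ∃[ d ] (t ≤ totalCost w × HaltsIn (machine whole) t (initial (machine whole) w) d ×
                                 output (machine whole) d ≡ out (run w c start))
  halting w with whole-ok w
  ... | v , e , t , t≤ , ex with machine-halts whole {begin whole} {v = before w} (before-ok w) (exec-run ex)
  ... | a ∷ ts , halts , M = t , config zero (a ∷ ts) , t≤ , halts , read-output w (out (run w c start)) a (subst (a ≈ₜ_) e (M zero))

  -- Only the result of a program remains to be verified hereafter. Loops run once per input symbol,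
  -- so numbers and running times are polynomial by the shape of the program alone.
  program-polyTime : ∀ {f} → (∀ w → out (run w c start) ≡ f w) → PolyTime f
  program-polyTime correct =
    machine whole , proj₁ bounded , proj₁ (proj₂ bounded) , λ w →
      proj₁ (halting w) , proj₁ (proj₂ (halting w)) ,
      ℕₚ.≤-trans (proj₁ (proj₂ (proj₂ (halting w)))) (proj₂ (proj₂ bounded) (length w)) ,
      proj₁ (proj₂ (proj₂ (proj₂ (halting w)))) , trans (proj₂ (proj₂ (proj₂ (proj₂ (halting w))))) (correct w)
    where
    bounded = poly-polyBound poly-totalCost

-- Finite predicates

opaque
  ∃ᵇ : ∀ {n} → (Fin n → Bool) → Bool
  ∃ᵇ P = ⌊ Finₚ.any? (λ x → T? (P x)) ⌋

  ∃ᵇ-in : ∀ {n} {P : Fin n → Bool} x → T (P x) → T (∃ᵇ P)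
  ∃ᵇ-in {P = P} x p = fromWitness {a? = Finₚ.any? (λ x → T? (P x))} (x , p)

  ∃ᵇ-out : ∀ {n} {P : Fin n → Bool} → T (∃ᵇ P) → ∃[ x ] T (P x)
  ∃ᵇ-out {P = P} = toWitness {a? = Finₚ.any? (λ x → T? (P x))}

∧-in : ∀ {a b} → T a → T b → T (a ∧ b)
∧-in {true} {true} _ _ = tt

∧-out : ∀ {a b} → T (a ∧ b) → T a × T b
∧-out {true} {true} _ = tt , tt

count : ∀ {n} → (Fin n → Bool) → ℕ
count {zero}  P = 0
count {suc n} P = (if P zero then 1 else 0) + count (P ∘ suc)

private
  bit-≤ : ∀ a b → (T a → T b) → (if a then 1 else 0) ≤ (if b then 1 else 0)
  bit-≤ false b     h = z≤n
  bit-≤ true  true  h = s≤s z≤n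
  bit-≤ true  false h = ⊥-elim (h tt)

count-≤ : ∀ {n} {P Q : Fin n → Bool} → (∀ x → T (P x) → T (Q x)) → count P ≤ count Q
count-≤ {zero}  h = z≤n
count-≤ {suc n} {P} {Q} h = ℕₚ.+-mono-≤ (bit-≤ (P zero) (Q zero) (h zero)) (count-≤ (h ∘ suc))

count-< : ∀ {n} {P Q : Fin n → Bool} x → (∀ x → T (P x) → T (Q x)) → T (Q x) → ¬ T (P x) → count P < count Q
count-< {P = P} {Q} zero h q ¬p with P zero | Q zero
... | true  | _    = ⊥-elim (¬p tt)
... | false | true = s≤s (count-≤ (h ∘ suc))
count-< {P = P} {Q} (suc x) h q ¬p =
  ℕₚ.+-mono-≤-< (bit-≤ (P zero) (Q zero) (h zero)) (count-< x (h ∘ suc) q ¬p)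

least : ∀ {n} → (Fin n → Bool) → Maybe (Fin n)
least {zero}  P = nothing
least {suc n} P = if P zero then just zero else Maybe.map suc (least (P ∘ suc))

least-cong : ∀ {n} {P Q : Fin n → Bool} → P ≗ Q → least P ≡ least Q
least-cong {zero}  e = refl
least-cong {suc n} {P} {Q} e rewrite e zero | least-cong {P = P ∘ suc} {Q ∘ suc} (e ∘ suc) = refl

least-just : ∀ {n} {P : Fin n → Bool} x → T (P x) → ∃[ y ] (least P ≡ just y × T (P y))
least-just {suc n} {P} x p with P zero in eq
... | true = zero , refl , subst T (sym eq) tt
least-just {suc n} {P} zero    p | false = ⊥-elim (subst T eq p)
least-just {suc n} {P} (suc x) p | false with least-just {P = P ∘ suc} x p
... | y , e , q rewrite e = suc y , refl , q

funToFin-cong : ∀ {m n} {f g : Fin m → Fin n} → f ≗ g → funToFin f ≡ funToFin g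
funToFin-cong {zero}  e = refl
funToFin-cong {suc m} e = cong₂ combine (e zero) (funToFin-cong (e ∘ suc))

-- Otherwise `e` has a section. It is injective and misses `x` or `y`, as it picks only one preimage
-- of their common value; this contradicts the pigeonhole principle.
misses : ∀ {n} (e : Fin n → Fin n) {x y} → x ≢ y → e x ≡ e y → ∃[ z ] (∀ u → e u ≢ z)
misses {suc n} e {x} {y} x≢y exy with Finₚ.all? (λ z → Finₚ.any? (λ u → e u Finₚ.≟ z))
... | no ¬onto with Finₚ.¬∀⟶∃¬ _ _ (λ z → Finₚ.any? (λ u → e u Finₚ.≟ z)) ¬onto
...   | z , ¬hit = z , λ u eu → ¬hit (u , eu)
misses {suc n} e {x} {y} x≢y exy | yes onto = contradiction (missed (s (e x) Finₚ.≟ x)) λ ()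
  where
  s : Fin (suc n) → Fin (suc n)
  s z = proj₁ (onto z)
  s-inj : ∀ {a b} → s a ≡ s b → a ≡ b
  s-inj {a} {b} eq = trans (sym (proj₂ (onto a))) (trans (cong e eq) (proj₂ (onto b)))
  absurd : ∀ p → (∀ z → p ≢ s z) → ⊥
  absurd p off with Finₚ.pigeonhole (ℕₚ.n<1+n n) (λ z → punchOut (off z))
  ... | i , j , i<j , eq = ℕₚ.<⇒≢ i<j (cong toℕ (s-inj (Finₚ.punchOut-injective (off i) (off j) eq)))
  missed : Dec (s (e x) ≡ x) → ⊥
  missed (yes p) = absurd y λ z yz → x≢y (trans (sym p) (trans (cong s (trans exy (trans (cong e yz) (proj₂ (onto z))))) (sym yz)))
  missed (no ¬p) = absurd x λ z xz → ¬p (trans (cong s (trans (cong e xz) (proj₂ (onto z)))) (sym xz))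

-- The theorem of Hell and Nešetřil

-- Operations, and the choice of one argument place per operation that commutes
-- with identifying and permuting variables.

Op : ℕ → ℕ → Set
Op n k = (Fin k → Fin n) → Fin n

-- A minion homomorphism from `C` to the projections. With the identity for `π` it says that the
-- place depends only on the values of `f`, not on the proof of `C f`.
Selects : ∀ {n} → (∀ {k} → Op n k → Set) → Set
Selects {n} C =
  Σ[ ξ ∈ (∀ {k} (f : Op n k) → C f → Fin k) ]
    (∀ {k l} (f : Op n k) (g : Op n l) cf cg (π : Fin k → Fin l) → (∀ xs → g xs ≡ f (xs ∘ π)) → ξ g cg ≡ π (ξ f cf))

selects-map : ∀ {n} {C D : ∀ {k} → Op n k → Set} (F : ∀ {k} → Op n k → Op n k) →
              (∀ {k} (f : Op n k) → C f → D (F f)) →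
              (∀ {k l} (f : Op n k) (g : Op n l) (π : Fin k → Fin l) → C f → (∀ xs → g xs ≡ f (xs ∘ π)) → ∀ xs → F g xs ≡ F f (xs ∘ π)) →
              Selects D → Selects C
selects-map F h m (ξ , ok) =
  (λ f cf → ξ (F f) (h f cf)) , λ f g cf cg π e → ok (F f) (F g) (h f cf) (h g cg) π (m f g π cf e)

selects-⊆ : ∀ {n} {C D : ∀ {k} → Op n k → Set} → (∀ {k} (f : Op n k) → C f → D f) → Selects D → Selects C
selects-⊆ h = selects-map id h (λ f g π _ e → e)

Graph : ℕ → Set
Graph n = Fin n → Fin n → Bool

record Simple {n} (E : Graph n) : Set where
  field
    symm  : ∀ {x y} → T (E x y) → T (E y x)
    irrefl : ∀ {x} → ¬ T (E x x)

record Preserves {n} (E : Graph n) {k} (f : Op n k) : Set where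
  field
    ext  : ∀ {xs ys} → xs ≗ ys → f xs ≡ f ys
    pres : ∀ {xs ys} → (∀ i → T (E (xs i) (ys i))) → T (E (f xs) (f ys))

Triangle : ∀ {n} → Graph n → Set
Triangle E = ∃[ x ] ∃[ y ] ∃[ z ] (T (E x y) × T (E y z) × T (E x z))

-- The vertex set stays `Fin n` throughout: a graph is made smaller by isolating vertices, and the
-- support measures this.
support : ∀ {n} → Graph n → Fin n → Bool
support E x = ∃ᵇ (E x)

nonedges : ∀ {n} → Graph n → ℕ
nonedges {n} E = count {n * n} (λ i → not (uncurry E (remQuot n i)))

nonedges-< : ∀ {n} {E E′ : Graph n} → (∀ {x y} → T (E x y) → T (E′ x y)) → ∀ {x y} → T (E′ x y) → ¬ T (E x y) →
             nonedges E′ < nonedges E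
nonedges-< {n} {E} {E′} ⊆ {x} {y} e′ ¬e = count-< (combine x y) (λ i → sub (E _ _) (E′ _ _) ⊆) (at (not ∘ uncurry E) (neg (E x y) ¬e))
  (λ p → neg′ (E′ x y) e′ (subst (T ∘ not ∘ uncurry E′) (Finₚ.remQuot-combine {n} x y) p))
  where
  at : (P : Fin n × Fin n → Bool) → T (P (x , y)) → T (P (remQuot n (combine x y)))
  at P = subst (T ∘ P) (sym (Finₚ.remQuot-combine {n} x y))
  sub : ∀ a b → (T a → T b) → T (not b) → T (not a)
  sub false _     h _ = tt
  sub true  false h _ = ⊥-elim (h tt)
  neg : ∀ a → ¬ T a → T (not a)
  neg true  h = ⊥-elim (h tt)
  neg false h = tt
  neg′ : ∀ a → T a → T (not a) → ⊥
  neg′ true _ ()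

-- Homomorphisms from powers of the triangle into a graph without diamonds

Point : ℕ → Set
Point N = Fin N → Fin 3

avoid : ∀ (a b : Fin 3) → ∃[ c ] (c ≢ a × c ≢ b)
avoid = toWitness {a? = Finₚ.all? λ a → Finₚ.all? λ b → Finₚ.any? λ c → ¬? (c Finₚ.≟ a) ×-dec ¬? (c Finₚ.≟ b)} tt

-- Supplies, coordinate by coordinate, the auxiliary points of `merge`. For `a ≡ b` the colours `u`
-- and `w` are the other two, which forces `t ≡ a`; for `a ≢ b` there is room for every `t`.
between : ∀ (a b t : Fin 3) → (a ≢ b) ⊎ (t ≡ a) → ∃[ u ] ∃[ w ] (u ≢ a × w ≢ b × u ≢ w × t ≢ u × t ≢ w)
between = toWitness {a? = Finₚ.all? λ a → Finₚ.all? λ b → Finₚ.all? λ t → (¬? (a Finₚ.≟ b) ⊎-dec (t Finₚ.≟ a)) →-dec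
  Finₚ.any? λ u → Finₚ.any? λ w → ¬? (u Finₚ.≟ a) ×-dec ¬? (w Finₚ.≟ b) ×-dec ¬? (u Finₚ.≟ w) ×-dec ¬? (t Finₚ.≟ u) ×-dec ¬? (t Finₚ.≟ w)} tt

_⟨_≔_⟩ : ∀ {N} → Point N → Fin N → Fin 3 → Point N
(x ⟨ j ≔ v ⟩) i = if ⌊ i Finₚ.≟ j ⌋ then v else x i

module _ {N : ℕ} (x : Point N) (j : Fin N) where
  set-same : ∀ {v} → (x ⟨ j ≔ v ⟩) j ≡ v
  set-same with j Finₚ.≟ j
  ... | yes _ = refl
  ... | no n  = contradiction refl n

  set-off : ∀ {v} i → i ≢ j → (x ⟨ j ≔ v ⟩) i ≡ x i
  set-off i n with i Finₚ.≟ j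
  ... | yes e = contradiction e n
  ... | no _  = refl

  set-id : ∀ {v} → v ≡ x j → x ⟨ j ≔ v ⟩ ≗ x
  set-id e i with i Finₚ.≟ j
  ... | yes refl = e
  ... | no _     = refl

set-sep : ∀ {N} (x y : Point N) j {u v} → (∀ i → i ≢ j → x i ≢ y i) → u ≢ v → ∀ i → (x ⟨ j ≔ u ⟩) i ≢ (y ⟨ j ≔ v ⟩) i
set-sep x y j off uv i with i Finₚ.≟ j
... | yes _  = uv
... | no i≢j = off i i≢j

record Hom {n} (E : Graph n) (N : ℕ) : Set where
  field
    fun  : Point N → Fin n
    ext  : ∀ {x y} → x ≗ y → fun x ≡ fun y
    pres : ∀ {x y} → (∀ i → x i ≢ y i) → T (E (fun x) (fun y))

-- For simple graphs: every edge lies in at most one triangle.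
DiamondFree : ∀ {n} → Graph n → Set
DiamondFree E = ∀ {p q x y} → T (E p q) → T (E p x) → T (E q x) → T (E p y) → T (E q y) → x ≡ y

module Kernel {n} {E : Graph n} (S : Simple E) (free : DiamondFree E) {N} (H : Hom E N) where
  open Simple S
  open Hom H renaming (fun to h)

  -- The image of u, w and t is a triangle; as h x ≡ h y it shares the edge of
  -- h u and h w with the triangle on h u, h w and h x.
  merge : ∀ {x y} → h x ≡ h y → ∀ t → (∀ i → (x i ≢ y i) ⊎ (t i ≡ x i)) → h t ≡ h x
  merge {x} {y} e t ok =
    free {h u} {h w} (pres λ i → proj₁ (proj₂ (proj₂ (B i)))) (pres λ i → proj₁ (proj₂ (proj₂ (proj₂ (B i)))) ∘ sym) (pres λ i → proj₂ (proj₂ (proj₂ (proj₂ (B i)))) ∘ sym)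
      (pres λ i → proj₁ (B i)) (subst (T ∘ E (h w)) (sym e) (pres λ i → proj₁ (proj₂ (B i))))
    where
    u w : Point N
    u i = proj₁ (between (x i) (y i) (t i) (ok i))
    w i = proj₁ (proj₂ (between (x i) (y i) (t i) (ok i)))
    B : ∀ i → u i ≢ x i × w i ≢ y i × u i ≢ w i × t i ≢ u i × t i ≢ w i
    B i = proj₂ (proj₂ (between (x i) (y i) (t i) (ok i)))

  Ignores : Fin N → Point N → Set
  Ignores j x = ∀ v → h (x ⟨ j ≔ v ⟩) ≡ h x

  ignores-from : ∀ {x y j} → h x ≡ h y → x j ≢ y j → Ignores j x
  ignores-from {x} {y} {j} e xj v = merge e (x ⟨ j ≔ v ⟩) λ i → case i Finₚ.≟ j of λ
    { (yes refl) → inj₁ xj ; (no i≢j) → inj₂ (set-off x j i i≢j) }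

  -- The points `q` with entries `v` and `q j` at `j` have the same image, because both images
  -- complete a triangle on one edge, that between the images of `P` and of `x` with entry `q j`.
  -- One of the four adjacencies is only visible with entry `v` in `x`; there it is used that `x`
  -- ignores `j`.
  ignores-step : ∀ {x q j} → (∀ i → i ≢ j → q i ≢ x i) → Ignores j x → Ignores j q
  ignores-step {x} {q} {j} off ig v with v Finₚ.≟ q j
  ... | yes e = ext (set-id q j e)
  ... | no v≢ = trans (free {h P} {h (x ⟨ j ≔ q j ⟩)}
      (pres (set-sep p x j (λ i _ → px i) (proj₂ pv)))
      (pres (set-sep p q j (λ i _ → pq i) (proj₁ pv)))
      (pres (set-sep x q j (λ i n → off i n ∘ sym) (v≢ ∘ sym)))
      (pres (set-sep p q j (λ i _ → pq i) (proj₂ pv)))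
      (subst (λ z → T (E z (h (q ⟨ j ≔ q j ⟩)))) (trans (ig v) (sym (ig (q j)))) (pres (set-sep x q j (λ i n → off i n ∘ sym) v≢))))
      (ext (set-id q j refl))
    where
    p P : Point N
    p i = proj₁ (avoid (x i) (q i))
    pv = proj₂ (avoid v (q j))
    P = p ⟨ j ≔ proj₁ (avoid v (q j)) ⟩
    px : ∀ i → p i ≢ x i
    px i = proj₁ (proj₂ (avoid (x i) (q i)))
    pq : ∀ i → p i ≢ q i
    pq i = proj₂ (proj₂ (avoid (x i) (q i)))

  -- Any two points of a power of the triangle have a common neighbour, so two steps lead from `x`
  -- to `z`.
  ignores-all : ∀ {x j} → Ignores j x → ∀ z → Ignores j z
  ignores-all {x} {j} ig z =
    ignores-step {q} {z} (λ i _ → proj₂ (proj₂ (avoid (x i) (z i))) ∘ sym)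
      (ignores-step {x} {q} (λ i _ → proj₁ (proj₂ (avoid (x i) (z i)))) ig)
    where
    q : Point N
    q i = proj₁ (avoid (x i) (z i))

  origin : Point N
  origin = const zero

  Depends : Fin N → Set
  Depends j = h origin ≢ h (origin ⟨ j ≔ suc zero ⟩)

  depends? : ∀ j → Dec (Depends j)
  depends? j = ¬? (h origin Finₚ.≟ h (origin ⟨ j ≔ suc zero ⟩))

  independent : ∀ {j} → ¬ Depends j → ∀ z → Ignores j z
  independent {j} ¬d = ignores-all (ignores-from {origin} {origin ⟨ j ≔ suc zero ⟩} (decidable-stable (_ Finₚ.≟ _) ¬d)
    (λ e → contradiction (trans e (set-same origin j)) λ ()))

  depends-inj : ∀ {j x y} → Depends j → h x ≡ h y → x j ≡ y j
  depends-inj {j} {x} {y} d e = decidable-stable (x j Finₚ.≟ y j)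
    λ n → d (sym (ignores-all (ignores-from {x} {y} e n) origin (suc zero)))

  -- With `depends-inj` this makes the kernel of `h` equality on the coordinates that `h` depends
  -- on. The entries of `y` are patched into `x` one at a time; the coordinates depended on are not
  -- changed by this.
  agree : ∀ {x y} → (∀ j → Depends j → x j ≡ y j) → h x ≡ h y
  agree {x} {y} same = trans (sym (go (allFin N))) (ext (λ i → patched (allFin N) i (∈ₚ.∈-allFin i)))
    where
    patch : List (Fin N) → Point N
    patch []       = x
    patch (j ∷ js) = patch js ⟨ j ≔ y j ⟩
    either : ∀ js i → patch js i ≡ x i ⊎ patch js i ≡ y i
    either []       i = inj₁ refl
    either (j ∷ js) i with i Finₚ.≟ j
    ... | yes refl = inj₂ refl
    ... | no _     = either js i
    patched : ∀ js i → i ∈ js → patch js i ≡ y i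
    patched (j ∷ js) i i∈ with i Finₚ.≟ j
    patched (j ∷ js) i i∈          | yes refl = refl
    patched (j ∷ js) i (Any.here e)    | no n = contradiction e n
    patched (j ∷ js) i (Any.there i∈)  | no _ = patched js i i∈
    go : ∀ js → h (patch js) ≡ h x
    go []       = refl
    go (j ∷ js) with depends? j
    ... | no ¬d = trans (independent ¬d (patch js) (y j)) (go js)
    ... | yes d = trans (ext (set-id (patch js) j (y≡ (either js j)))) (go js)
      where
      y≡ : patch js j ≡ x j ⊎ patch js j ≡ y j → y j ≡ patch js j
      y≡ (inj₁ e) = trans (sym (same j d)) (sym e)
      y≡ (inj₂ e) = sym e

record Embedding {n} (E : Graph n) (m : ℕ) : Set where
  field
    hom : Hom E m
    inj : ∀ {x y} → Hom.fun hom x ≡ Hom.fun hom y → x ≗ y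

module _ {n} {E : Graph n} where

  private
    Embeds : ∀ m → (Fin (3 ^ m) → Fin n) → Set
    Embeds m g = (∀ a b → (∀ i → finToFun {3} {m} a i ≢ finToFun b i) → T (E (g a) (g b))) × (∀ a b → g a ≡ g b → a ≡ b)

    embeds? : ∀ m g → Dec (Embeds m g)
    embeds? m g = (Finₚ.all? λ a → Finₚ.all? λ b → (Finₚ.all? λ i → ¬? (finToFun {3} {m} a i Finₚ.≟ finToFun b i)) →-dec T? (E (g a) (g b)))
            ×-dec (Finₚ.all? λ a → Finₚ.all? λ b → (g a Finₚ.≟ g b) →-dec (a Finₚ.≟ b))

    embeds-cong : ∀ m {f g} → f ≗ g → Embeds m f → Embeds m g
    embeds-cong m e (p , q) = (λ a b d → subst₂ (λ x y → T (E x y)) (e a) (e b) (p a b d)) ,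
                              (λ a b d → q a b (trans (e a) (trans d (sym (e b)))))

    table : ∀ {m} → Embedding E m → Fin (3 ^ m) → Fin n
    table em a = Hom.fun (Embedding.hom em) (finToFun a)

    table-embeds : ∀ {m} (em : Embedding E m) → Embeds m (table em)
    table-embeds {m} em = (λ a b → Hom.pres (Embedding.hom em)) , λ a b e →
      trans (sym (Finₚ.funToFin-finToFin {m} {3} a)) (trans (funToFin-cong (Embedding.inj em e)) (Finₚ.funToFin-finToFin {m} {3} b))

  embedding? : ∀ m → Dec (Embedding E m)
  embedding? m with Finₚ.any? (λ c → embeds? m (finToFun {n} {3 ^ m} c))
  ... | no ¬e = no λ em → ¬e (funToFin (table em) , embeds-cong m (λ a → sym (Finₚ.finToFun-funToFin (table em) a)) (table-embeds em))
  ... | yes (c , p , q) = yes record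
    { hom = record
      { fun  = λ x → finToFun c (funToFin x)
      ; ext  = λ e → cong (finToFun c) (funToFin-cong e)
      ; pres = λ {x} {y} d → p _ _ λ i e → d i (trans (sym (Finₚ.finToFun-funToFin x i)) (trans e (Finₚ.finToFun-funToFin y i)))
      }
    ; inj = λ {x} {y} e i → trans (sym (Finₚ.finToFun-funToFin x i)) (trans (cong (λ a → finToFun a i) (q _ _ e)) (Finₚ.finToFun-funToFin y i))
    }

  embedding-bound : ∀ {m} → Embedding E m → m < n
  embedding-bound {m} em = ℕₚ.≤-trans (grow m) (Finₚ.injective⇒≤ {f = table em} (λ {a} {b} → proj₂ (table-embeds em) a b))
    where
    grow : ∀ m → m < 3 ^ m
    grow zero    = s≤s z≤n
    grow (suc m) = ℕₚ.+-mono-≤ (ℕₚ.≤-trans (s≤s z≤n) (grow m)) (ℕₚ.≤-trans (grow m) (ℕₚ.m≤m+n _ _))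

  -- The search ends because a power with `m` factors has more than `m` points, all of them distinct
  -- vertices of `E`.
  largest : ∀ {m} → Embedding E m → ∃[ M ] (m ≤ M × Embedding E M × ¬ Embedding E (suc M))
  largest {m} em = go n m em (ℕₚ.m≤m+n n m)
    where
    go : ∀ fuel m → Embedding E m → n ≤ fuel + m → ∃[ M ] (m ≤ M × Embedding E M × ¬ Embedding E (suc M))
    go zero    m em l = contradiction (embedding-bound em) (ℕₚ.≤⇒≯ l)
    go (suc k) m em l with embedding? (suc m)
    ... | no ¬e  = m , ℕₚ.≤-refl , em , ¬e
    ... | yes em′ with go k (suc m) em′ (ℕₚ.≤-trans l (ℕₚ.≤-reflexive (sym (ℕₚ.+-suc k m))))
    ...   | M , m<M , r = M , ℕₚ.<⇒≤ m<M , r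

record Idempotent {n} (E : Graph n) {k} (f : Op n k) : Set where
  field
    preserves : Preserves E f
    idem      : ∀ {x} → T (support E x) → f (const x) ≡ x
  open Preserves preserves public

-- Let g embed the largest possible power m of the triangle. An idempotent f turns
-- it into a homomorphism from the power m * k that is injective on the diagonal,
-- so for every j ≤ m it depends on some coordinate (j , i); by maximality there
-- is only one such i.
module Selection {n} {E : Graph n} (S : Simple E) (free : DiamondFree E) {M : ℕ}
                 (em : Embedding E (suc M)) (max : ¬ Embedding E (suc (suc M))) where
  open Embedding em
  open Hom hom renaming (fun to g; ext to g-ext; pres to g-pres)

  m : ℕ
  m = suc M

  module _ {k} {f : Op n k} (I : Idempotent E f) where
    open Idempotent I

    F : Hom E (m * k)
    F = record
      { fun  = λ x → f (λ i → g (λ j → x (combine j i)))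
      ; ext  = λ e → ext (λ i → g-ext (λ j → e (combine j i)))
      ; pres = λ d → pres (λ i → g-pres (λ j → d (combine j i)))
      }

    module K = Kernel S free F

    diagonal : ∀ x → f (const (g x)) ≡ g x
    diagonal x = idem (∃ᵇ-in (g (λ j → proj₁ (avoid (x j) (x j)))) (g-pres (λ j e → proj₁ (proj₂ (avoid (x j) (x j))) (sym e))))

    some : ∀ j → ∃[ i ] K.Depends (combine j i)
    some j with Finₚ.any? (λ i → K.depends? (combine j i))
    ... | yes d = d
    ... | no ¬d = contradiction (trans (inj (trans (sym (diagonal (const zero))) (trans (K.agree {K.origin} {y} same) (trans (ext (λ i → g-ext (λ j′ → yc j′ i))) (diagonal (const zero ⟨ j ≔ suc zero ⟩)))) ) j) (set-same (const zero) j)) λ ()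
      where
      y : Point (m * k)
      y c = ((const zero) ⟨ j ≔ suc zero ⟩) (proj₁ (remQuot {m} k c))
      yc : ∀ j′ i → y (combine j′ i) ≡ (const zero ⟨ j ≔ suc zero ⟩) j′
      yc j′ i = cong ((const zero ⟨ j ≔ suc zero ⟩) ∘ proj₁) (Finₚ.remQuot-combine {m} {k} j′ i)
      same : ∀ c → K.Depends c → zero ≡ y c
      same c d with proj₁ (remQuot {m} k c) Finₚ.≟ j
      ... | yes e = contradiction (proj₂ (remQuot {m} k c) , subst K.Depends (trans (sym (Finₚ.combine-remQuot {m} k c)) (cong (λ z → combine z (proj₂ (remQuot {m} k c))) e)) d) ¬d
      ... | no _  = refl

    unique : ∀ {j i i′} → K.Depends (combine j i) → K.Depends (combine j i′) → i ≡ i′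
    unique {j} {i} {i′} d d′ = decidable-stable (i Finₚ.≟ i′) λ i≢i′ → max (bigger i≢i′)
      where
      -- The place `(j , i′)` reads a new coordinate `zero`, every other place of block `a` reads
      -- coordinate `suc a`. Block `j` keeps the place `i` that is depended on, so all `suc m`
      -- coordinates can be recovered from the image.
      ρ′ : Fin m × Fin k → Fin (suc m)
      ρ′ (a , b) = if ⌊ a Finₚ.≟ j ⌋ ∧ ⌊ b Finₚ.≟ i′ ⌋ then zero else suc a
      ρ : Fin (m * k) → Fin (suc m)
      ρ c = ρ′ (remQuot {m} k c)
      ρ-at : ∀ a b → ρ (combine a b) ≡ ρ′ (a , b)
      ρ-at a b = cong ρ′ (Finₚ.remQuot-combine {m} {k} a b)
      extra : ρ (combine j i′) ≡ zero
      extra rewrite ρ-at j i′ with j Finₚ.≟ j | i′ Finₚ.≟ i′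
      ... | yes _ | yes _ = refl
      ... | no n  | _     = contradiction refl n
      ... | yes _ | no n  = contradiction refl n
      bigger : i ≢ i′ → Embedding E (suc m)
      bigger i≢i′ = record
        { hom = record { fun = λ y → Hom.fun F (y ∘ ρ) ; ext = λ e → Hom.ext F (e ∘ ρ) ; pres = λ d → Hom.pres F (d ∘ ρ) }
        ; inj = λ {x} {y} e → λ { zero    → subst (λ z → x z ≡ y z) extra (K.depends-inj {x = x ∘ ρ} {y ∘ ρ} d′ e)
                                ; (suc a) → let b , db , eb = rep a in subst (λ z → x z ≡ y z) eb (K.depends-inj {x = x ∘ ρ} {y ∘ ρ} db e) }
        }
        where
        rep : ∀ a → ∃[ b ] (K.Depends (combine a b) × ρ (combine a b) ≡ suc a)
        rep a with a Finₚ.≟ j in eq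
        ... | yes refl = i , d , trans (ρ-at j i) (lemma (i Finₚ.≟ i′))
          where
          lemma : Dec (i ≡ i′) → ρ′ (j , i) ≡ suc j
          lemma _ with i Finₚ.≟ i′
          ... | yes e = contradiction e i≢i′
          ... | no _ rewrite Boolₚ.∧-zeroʳ ⌊ j Finₚ.≟ j ⌋ = refl
        ... | no _ = proj₁ (some a) , proj₂ (some a) , trans (ρ-at a (proj₁ (some a))) lemma
          where
          lemma : ρ′ (a , proj₁ (some a)) ≡ suc a
          lemma rewrite eq = refl

  select : Selects (Idempotent E)
  select = (λ f I → proj₁ (some I zero)) , minor
    where
    minor : ∀ {k l} (f : Op n k) (g : Op n l) (cf : Idempotent E f) (cg : Idempotent E g) (π : Fin k → Fin l) →
            (∀ xs → g xs ≡ f (xs ∘ π)) → proj₁ (some cg zero) ≡ π (proj₁ (some cf zero))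
    minor {k} {l} f g′ cf cg π e = unique cg {zero} (proj₂ (some cg zero)) dep
      where
      i = proj₁ (some cf zero)
      -- The point that differs from the origin only at `(zero , π i)`, pulled back along `π` to the
      -- places of `f`. Its entry at `(zero , i)` is the changed one, and there `f` notices the
      -- difference.
      y : Point (m * k)
      y c = (K.origin cg ⟨ combine {m} zero (π i) ≔ suc zero ⟩) (combine (proj₁ (remQuot {m} k c)) (π (proj₂ (remQuot {m} k c))))
      yc : ∀ a b → (K.origin cg ⟨ combine {m} zero (π i) ≔ suc zero ⟩) (combine a (π b)) ≡ y (combine a b)
      yc a b = cong (λ (a , b) → (K.origin cg ⟨ combine {m} zero (π i) ≔ suc zero ⟩) (combine a (π b))) (sym (Finₚ.remQuot-combine {m} {k} a b))
      dep : K.Depends cg (combine {m} zero (π i))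
      dep = λ eq → contradiction
        (trans (K.depends-inj cf {x = K.origin cf} {y} (proj₂ (some cf zero))
                 (trans (sym (e _)) (trans eq (trans (e _) (Idempotent.ext cf (λ b → g-ext (λ a → yc a b)))))))
               (trans (sym (yc zero i)) (set-same (K.origin cg) (combine {m} zero (π i))))) λ ()

iter-+ : {A : Set} (a b : ℕ) (f : A → A) (x : A) → iter (a + b) f x ≡ iter b f (iter a f x)
iter-+ zero    b f x = refl
iter-+ (suc a) b f x = iter-+ a b f (f x)

iter-cong : {A : Set} {f g : A → A} (a : ℕ) → f ≗ g → ∀ x → iter a f x ≡ iter a g x
iter-cong         zero    e x = refl
iter-cong {f = f} (suc a) e x = trans (cong (iter a f) (e x)) (iter-cong a e _)

triangle-embedding : ∀ {n} {E : Graph n} → Simple E → Triangle E → Embedding E 1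
triangle-embedding {n} {E} S (a , b , c , ab , bc , ac) = record
  { hom = record { fun = λ x → corner (x zero) ; ext = λ e → cong corner (e zero) ; pres = λ d → adjacent _ _ (d zero) }
  ; inj = λ { {x} {y} e zero → decidable-stable (x zero Finₚ.≟ y zero) λ n → irrefl (subst (T ∘ E (corner (x zero))) (sym e) (adjacent _ _ n)) }
  }
  where
  open Simple S
  corner : Fin 3 → Fin n
  corner zero             = a
  corner (suc zero)       = b
  corner (suc (suc zero)) = c
  adjacent : ∀ i j → i ≢ j → T (E (corner i) (corner j))
  adjacent zero zero n = contradiction refl n
  adjacent zero (suc zero) _ = ab
  adjacent zero (suc (suc zero)) _ = ac
  adjacent (suc zero) zero _ = symm ab
  adjacent (suc zero) (suc zero) n = contradiction refl n
  adjacent (suc zero) (suc (suc zero)) _ = bc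
  adjacent (suc (suc zero)) zero _ = symm ac
  adjacent (suc (suc zero)) (suc zero) _ = symm bc
  adjacent (suc (suc zero)) (suc (suc zero)) n = contradiction refl n

-- One round of an induction, first on the number of vertices that are not isolated, then on the
-- number of non-edges.
module Reduce {n} {E : Graph n} (S : Simple E) (tri : Triangle E)
  (smaller : ∀ (E′ : Graph n) → Simple E′ → Triangle E′ → count (support E′) < count (support E) → Selects (Preserves E′))
  (denser : ∀ (E′ : Graph n) → Simple E′ → Triangle E′ → (∀ x → T (support E′ x) → T (support E x)) →
            (∀ {x y} → T (E x y) → T (E′ x y)) → ∀ {x y} → T (E′ x y) → ¬ T (E x y) → Selects (Preserves E′)) where
  open Simple S

  Restrict : (Fin n → Bool) → Graph n
  Restrict P x y = E x y ∧ (P x ∧ P y)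

  module _ (P : Fin n → Bool) where
    restrict-in : ∀ {x y} → T (E x y) → T (P x) → T (P y) → T (Restrict P x y)
    restrict-in e p q = ∧-in e (∧-in p q)

    restrict-out : ∀ {x y} → T (Restrict P x y) → T (E x y) × T (P x) × T (P y)
    restrict-out {x} {y} r = map₂ (∧-out {P x} {P y}) (∧-out {E x y} r)

    restrict-simple : Simple (Restrict P)
    restrict-simple = record
      { symm   = λ r → let e , p , q = restrict-out r in restrict-in (symm e) q p
      ; irrefl = λ r → irrefl (proj₁ (restrict-out r))
      }

    restrict-triangle : ∀ {a b c} → T (E a b) → T (E b c) → T (E a c) → T (P a) → T (P b) → T (P c) → Triangle (Restrict P)
    restrict-triangle ab bc ac a b c = _ , _ , _ , restrict-in ab a b , restrict-in bc b c , restrict-in ac a c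

    restrict-< : ∀ {z} → T (support E z) → ¬ T (P z) → count (support (Restrict P)) < count (support E)
    restrict-< {z} s ¬p = count-< z (λ x r → let y , r′ = ∃ᵇ-out {P = Restrict P x} r in ∃ᵇ-in y (proj₁ (restrict-out r′))) s
      (λ r → ¬p (proj₁ (proj₂ (restrict-out (proj₂ (∃ᵇ-out {P = Restrict P z} r))))))

  Endo : (Fin n → Fin n) → Set
  Endo e = ∀ x y → T (E x y) → T (E (e x) (e y))

  Folds : (Fin n → Fin n) → Set
  Folds e = Endo e × ∃[ x ] ∃[ y ] (x ≢ y × T (support E x) × T (support E y) × e x ≡ e y)

  folds? : ∀ e → Dec (Folds e)
  folds? e = (Finₚ.all? λ x → Finₚ.all? λ y → T? (E x y) →-dec T? (E (e x) (e y))) ×-dec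
             (Finₚ.any? λ x → Finₚ.any? λ y → ¬? (x Finₚ.≟ y) ×-dec T? (support E x) ×-dec T? (support E y) ×-dec (e x Finₚ.≟ e y))

  -- Composition with `e` turns operations on `E` into operations on the subgraph induced by the
  -- image of `e`. As `e` identifies two vertices of the support, it also misses one.
  folded : ∀ e → Folds e → Selects (Preserves E)
  folded e (endo , x , y , x≢y , sx , sy , exy) =
    selects-map {D = Preserves (Restrict P)} (λ f xs → e (f xs)) pushed (λ f g π _ h xs → cong e (h xs))
      (smaller (Restrict P) (restrict-simple P)
        (restrict-triangle P (endo _ _ ab) (endo _ _ bc) (endo _ _ ac) (hits (∃ᵇ-in b ab)) (hits (∃ᵇ-in c bc)) (hits (∃ᵇ-in a (symm ac))))
        (restrict-< P z∈ z∉))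
    where
    a = proj₁ tri
    b = proj₁ (proj₂ tri)
    c = proj₁ (proj₂ (proj₂ tri))
    ab = proj₁ (proj₂ (proj₂ (proj₂ tri)))
    bc = proj₁ (proj₂ (proj₂ (proj₂ (proj₂ tri))))
    ac = proj₂ (proj₂ (proj₂ (proj₂ (proj₂ tri))))
    P : Fin n → Bool
    P x = ∃ᵇ (λ z → support E z ∧ ⌊ e z Finₚ.≟ x ⌋)
    hits : ∀ {z} → T (support E z) → T (P (e z))
    hits {z} s = ∃ᵇ-in z (∧-in s (fromWitness {a? = e z Finₚ.≟ e z} refl))
    -- Being the identity off the support, `e′` can only miss a vertex of the support.
    e′ : Fin n → Fin n
    e′ x = if support E x then e x else x
    e′-on : ∀ {x} → T (support E x) → e′ x ≡ e x
    e′-on {x} s with support E x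
    ... | true = refl
    missed = misses e′ x≢y (trans (e′-on sx) (trans exy (sym (e′-on sy))))
    z = proj₁ missed
    z∈ : T (support E z)
    z∈ with support E z in eq
    ... | true  = tt
    ... | false = proj₂ missed z (cong (λ b → if b then e z else z) eq)
    z∉ : ¬ T (P z)
    z∉ p with ∃ᵇ-out p
    ... | u , r = proj₂ missed u (trans (e′-on (proj₁ (∧-out r))) (toWitness {a? = e u Finₚ.≟ z} (proj₂ (∧-out r))))
    pushed : ∀ {k} (f : Op n k) → Preserves E f → Preserves (Restrict P) (λ xs → e (f xs))
    pushed f p = record
      { ext  = λ h → cong e (Preserves.ext p h)
      ; pres = λ h → let q = Preserves.pres p (λ i → proj₁ (restrict-out P (h i))) in
                     restrict-in P (endo _ _ q) (hits (∃ᵇ-in _ q)) (hits (∃ᵇ-in _ (symm q)))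
      }

  module Core (core : ∀ e → Endo e → ∀ {x y} → T (support E x) → T (support E y) → e x ≡ e y → x ≡ y) where

    -- Some power of an endomorphism inverts it on the support.
    undo : Fin (n ^ n) → Fin n → Fin n
    undo c with Finₚ.pigeonhole (ℕₚ.n<1+n (n ^ n)) (λ i → funToFin (iter (toℕ i) (finToFun {n} {n} c)))
    ... | i , j , _ = iter (pred (toℕ j ∸ toℕ i)) (finToFun c)

    iter-endo : ∀ {e} a → Endo e → Endo (iter a e)
    iter-endo zero    h x y = id
    iter-endo (suc a) h x y = iter-endo a h _ _ ∘ h x y

    undo-endo : ∀ c → Endo (finToFun c) → Endo (undo c)
    undo-endo c h with Finₚ.pigeonhole (ℕₚ.n<1+n (n ^ n)) (λ i → funToFin (iter (toℕ i) (finToFun {n} {n} c)))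
    ... | i , j , _ = iter-endo (pred (toℕ j ∸ toℕ i)) h

    endo-support : ∀ {e x} → Endo e → T (support E x) → T (support E (e x))
    endo-support {e} h s with ∃ᵇ-out s
    ... | y , xy = ∃ᵇ-in (e y) (h _ _ xy)

    -- Two different powers of the endomorphism coincide. The lower one cancels, since endomorphisms
    -- are injective on the support, and the quotient is the identity there.
    undo-inverse : ∀ c → Endo (finToFun c) → ∀ {x} → T (support E x) → undo c (finToFun c x) ≡ x
    undo-inverse c h {x} s with Finₚ.pigeonhole (ℕₚ.n<1+n (n ^ n)) (λ i → funToFin (iter (toℕ i) (finToFun {n} {n} c)))
    ... | i , j , i<j , eq with toℕ j ∸ toℕ i in d | ℕₚ.m∸n≢0⇒n<m {toℕ j} {toℕ i}
    ...   | zero  | _ = contradiction (ℕₚ.m∸n≡0⇒m≤n d) (ℕₚ.<⇒≱ i<j)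
    ...   | suc p | _ = core (iter (toℕ i) α) (iter-endo (toℕ i) h) (endo-support {e = iter (suc p) α} (iter-endo (suc p) h) s) s
      (trans (sym (iter-+ (suc p) (toℕ i) α x))
        (trans (cong (λ k → iter k α x) (trans (cong (_+ toℕ i) (sym d)) (ℕₚ.m∸n+n≡m (ℕₚ.<⇒≤ i<j))))
          (trans (sym (Finₚ.finToFun-funToFin (iter (toℕ j) α) x))
            (trans (cong (λ k → finToFun k x) (sym eq)) (Finₚ.finToFun-funToFin (iter (toℕ i) α) x)))))
      where
      α = finToFun {n} {n} c

    -- The correction depends on the table of the diagonal alone. Minors have the same diagonal, so
    -- an operation and its minors are corrected by the same map.
    idempotents : Selects (Idempotent E) → Selects (Preserves E)
    idempotents = selects-map (λ f xs → undo (diag f) (f xs)) make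
      (λ f g π p h xs → cong₂ undo (funToFin-cong (λ x → h (const x))) (h xs))
      where
      diag : ∀ {k} → Op n k → Fin (n ^ n)
      diag f = funToFin (λ x → f (const x))
      make : ∀ {k} (f : Op n k) → Preserves E f → Idempotent E (λ xs → undo (diag f) (f xs))
      make f p = record
        { preserves = record { ext = λ h → cong (undo (diag f)) (Preserves.ext p h)
                             ; pres = λ h → undo-endo (diag f) endo _ _ (Preserves.pres p h) }
        ; idem = λ {x} s → trans (cong (undo (diag f)) (sym (Finₚ.finToFun-funToFin (λ x → f (const x)) x))) (undo-inverse (diag f) endo s)
        }
        where
        endo : Endo (finToFun (diag f))
        endo x y xy = subst₂ (λ a b → T (E a b)) (sym (Finₚ.finToFun-funToFin (λ x → f (const x)) x)) (sym (Finₚ.finToFun-funToFin (λ x → f (const x)) y))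
                        (Preserves.pres p (const xy))

    -- The sets `P` in use are definable from edges and constants, and idempotent operations
    -- preserve such sets.
    restrictTo : ∀ (P : Fin n → Bool) → (∀ {k} {f : Op n k} → Idempotent E f → ∀ xs → (∀ i → T (P (xs i))) → T (P (f xs))) →
                 ∀ {a b c} → T (E a b) → T (E b c) → T (E a c) → T (P a) → T (P b) → T (P c) →
                 ∀ {z} → T (support E z) → ¬ T (P z) → Selects (Idempotent E)
    restrictTo P closed ab bc ac a b c z∈ z∉ =
      selects-⊆ {D = Preserves (Restrict P)} (λ f I → record
        { ext = Idempotent.ext I
        ; pres = λ h → restrict-in P (Idempotent.pres I (λ i → proj₁ (restrict-out P (h i))))
            (closed I _ (λ i → proj₁ (proj₂ (restrict-out P (h i))))) (closed I _ (λ i → proj₂ (proj₂ (restrict-out P (h i))))) })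
        (smaller (Restrict P) (restrict-simple P) (restrict-triangle P ab bc ac a b c) (restrict-< P z∈ z∉))

    -- Two vertices that complete the same edge to a triangle: opposite corners of a diamond, or the
    -- same vertex twice if it lies in a triangle.
    R : Graph n
    R x y = ∃ᵇ λ u → ∃ᵇ λ v → E u v ∧ ((E x u ∧ E x v) ∧ (E y u ∧ E y v))

    R-in : ∀ {x y u v} → T (E u v) → T (E x u) → T (E x v) → T (E y u) → T (E y v) → T (R x y)
    R-in {u = u} {v} uv xu xv yu yv = ∃ᵇ-in u (∃ᵇ-in v (∧-in uv (∧-in (∧-in xu xv) (∧-in yu yv))))

    R-out : ∀ {x y} → T (R x y) → ∃[ u ] ∃[ v ] (T (E u v) × T (E x u) × T (E x v) × T (E y u) × T (E y v))
    R-out r with ∃ᵇ-out r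
    ... | u , r′ with ∃ᵇ-out r′
    ... | v , r″ with ∧-out r″
    ... | uv , q with ∧-out q
    ... | xs , ys = u , v , uv , proj₁ (∧-out xs) , proj₂ (∧-out xs) , proj₁ (∧-out ys) , proj₂ (∧-out ys)

    R-sym : ∀ {x y} → T (R x y) → T (R y x)
    R-sym r with R-out r
    ... | u , v , uv , xu , xv , yu , yv = R-in uv yu yv xu xv

    R-support : ∀ {x y} → T (R x y) → T (support E x)
    R-support r with R-out r
    ... | u , v , uv , xu , _ = ∃ᵇ-in u xu

    R-pres : ∀ {k} {f : Op n k} → Preserves E f → ∀ {xs ys} → (∀ i → T (R (xs i) (ys i))) → T (R (f xs) (f ys))
    R-pres p h = R-in (pres (λ i → proj₁ (w i))) (pres (λ i → proj₁ (proj₂ (w i)))) (pres (λ i → proj₁ (proj₂ (proj₂ (w i)))))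
      (pres (λ i → proj₁ (proj₂ (proj₂ (proj₂ (w i)))))) (pres (λ i → proj₂ (proj₂ (proj₂ (proj₂ (w i))))))
      where
      open Preserves p
      w = λ i → proj₂ (proj₂ (R-out (h i)))

    S₂ : Fin n → Fin n → Bool
    S₂ a x = ∃ᵇ λ y → R a y ∧ E y x

    E₃ : Graph n
    E₃ x y = ∃ᵇ λ z → ∃ᵇ λ w → R x z ∧ (E z w ∧ R w y)

    E₃-in : ∀ {x y z w} → T (R x z) → T (E z w) → T (R w y) → T (E₃ x y)
    E₃-in {z = z} {w} a b c = ∃ᵇ-in z (∃ᵇ-in w (∧-in a (∧-in b c)))

    E₃-out : ∀ {x y} → T (E₃ x y) → ∃[ z ] ∃[ w ] (T (R x z) × T (E z w) × T (R w y))
    E₃-out r with ∃ᵇ-out r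
    ... | z , r′ with ∃ᵇ-out r′
    ... | w , r″ with ∧-out r″
    ... | a , q = z , w , a , ∧-out q

    E₃-pres : ∀ {k} {f : Op n k} → Preserves E f → Preserves E₃ f
    E₃-pres p = record { ext = Preserves.ext p ; pres = λ h → let w = λ i → proj₂ (proj₂ (E₃-out (h i))) in
      E₃-in (R-pres p (λ i → proj₁ (w i))) (Preserves.pres p (λ i → proj₁ (proj₂ (w i)))) (R-pres p (λ i → proj₂ (proj₂ (w i)))) }

    -- Every case but the last removes an obstacle: a vertex in no triangle; an edge in `R`, that
    -- is, a complete graph on four vertices, where the neighbourhood of `a` still has a triangle;
    -- an edge whose ends are also joined by two steps of `R`; a pair in `E₃` but not in `E`. After
    -- that, vertices related by `R` are twins, hence equal in a core, and `E` has no diamonds.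
    select-idempotent : Selects (Idempotent E)
    select-idempotent with Finₚ.any? (λ a → T? (support E a) ×-dec ¬? (T? (R a a)))
    ... | yes (a , a∈ , ¬r) = let x , y , z , xy , yz , xz = tri in
      restrictTo (λ x → R x x) (λ I xs h → R-pres (Idempotent.preserves I) h) xy yz xz
        (R-in yz xy xz xy xz) (R-in xz (symm xy) yz (symm xy) yz) (R-in xy (symm xz) (symm yz) (symm xz) (symm yz)) a∈ ¬r
    select-idempotent | no ¬A with Finₚ.any? (λ a → Finₚ.any? λ b → T? (E a b) ×-dec T? (R a b))
    ... | yes (a , b , ab , r) with R-out r
    ...   | u , v , uv , au , av , bu , bv =
      restrictTo (E a) (λ I xs h → subst (λ z → T (E z _)) (Idempotent.idem I (∃ᵇ-in b ab)) (Idempotent.pres I h)) uv (symm bv) (symm bu) au av ab (∃ᵇ-in b ab) irrefl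
    select-idempotent | no ¬A | no ¬B with Finₚ.any? (λ a → Finₚ.any? λ b → Finₚ.any? λ z → T? (E a b) ×-dec T? (R a z) ×-dec T? (R z b))
    ... | yes (a , b , z , ab , az , zb) with R-out zb
    ...   | u , v , uv , zu , zv , bu , bv =
      -- The triangle is `u`, `v`, `b`: the first two are reached through `z`, the last one directly
      -- from `a`. If `a` belonged to `S₂ a`, the previous case would have applied.
      restrictTo (S₂ a) closed uv (symm bv) (symm bu) (∃ᵇ-in z (∧-in az zu)) (∃ᵇ-in z (∧-in az zv)) (∃ᵇ-in a (∧-in (reflR (∃ᵇ-in b ab)) ab)) (∃ᵇ-in b ab)
        (λ s → let y , q = ∃ᵇ-out s in ¬B (a , y , symm (proj₂ (∧-out q)) , proj₁ (∧-out q)))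
      where
      reflR : ∀ {a} → T (support E a) → T (R a a)
      reflR {a} s = decidable-stable (T? (R a a)) λ ¬r → ¬A (a , s , ¬r)
      closed : ∀ {k} {f : Op n k} → Idempotent E f → ∀ xs → (∀ i → T (S₂ a (xs i))) → T (S₂ a (f xs))
      closed {f = f} I xs h = ∃ᵇ-in (f ys) (∧-in (subst (λ z → T (R z (f ys))) (Idempotent.idem I (∃ᵇ-in b ab)) (R-pres (Idempotent.preserves I) (λ i → proj₁ (∧-out (proj₂ (∃ᵇ-out (h i)))))))
                                                (Idempotent.pres I (λ i → proj₂ (∧-out (proj₂ (∃ᵇ-out (h i)))))))
        where
        ys = λ i → proj₁ (∃ᵇ-out (h i))
    select-idempotent | no ¬A | no ¬B | no ¬C with Finₚ.any? (λ x → Finₚ.any? λ y → T? (E₃ x y) ×-dec ¬? (T? (E x y)))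
    ... | yes (x , y , e₃ , ¬e) =
      -- A loop of `E₃` is an edge with ends joined by two steps of `R`, the case excluded just
      -- before. The new graph contains `E` because `R` is reflexive on the support.
      selects-⊆ {D = Preserves E₃} (λ f I → E₃-pres (Idempotent.preserves I))
        (denser E₃ (record { symm = λ r → let z , w , a , b , c = E₃-out r in E₃-in (R-sym c) (symm b) (R-sym a)
                           ; irrefl = λ r → let z , w , a , b , c = E₃-out r in ¬C (z , w , _ , b , R-sym a , R-sym c) })
          (let a , b , c , ab , bc , ac = tri in a , b , c , up ab , up bc , up ac)
          (λ x r → let y , r′ = ∃ᵇ-out {P = E₃ x} r in R-support (proj₁ (proj₂ (proj₂ (E₃-out r′))))) up e₃ ¬e)
      where
      reflR : ∀ {a} → T (support E a) → T (R a a)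
      reflR {a} s = decidable-stable (T? (R a a)) λ ¬r → ¬A (a , s , ¬r)
      up : ∀ {x y} → T (E x y) → T (E₃ x y)
      up xy = E₃-in (reflR (∃ᵇ-in _ xy)) xy (reflR (∃ᵇ-in _ (symm xy)))
    select-idempotent | no ¬A | no ¬B | no ¬C | no ¬D with largest (triangle-embedding S tri)
    ... | suc M , _ , em , max = Selection.select S free em max
      where
      reflR : ∀ {a} → T (support E a) → T (R a a)
      reflR {a} s = decidable-stable (T? (R a a)) λ ¬r → ¬A (a , s , ¬r)
      -- Diamond-related vertices are twins, so one can be folded onto the other.
      module Twins {x y} (r : T (R x y)) where
        e : Fin n → Fin n
        e z = if ⌊ z Finₚ.≟ y ⌋ then x else z
        half : ∀ w → T (E y w) → T (E x w)
        half w yw = decidable-stable (T? (E x w)) λ ¬xw → ¬D (x , w , E₃-in r yw (reflR (∃ᵇ-in y (symm yw))) , ¬xw)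
        endo : Endo e
        endo z w zw with z Finₚ.≟ y | w Finₚ.≟ y
        ... | yes refl | yes refl = ⊥-elim (irrefl zw)
        ... | yes refl | no _     = half w zw
        ... | no _     | yes refl = symm (half z (symm zw))
        ... | no _     | no _     = zw
        same : e x ≡ e y
        same with x Finₚ.≟ y | y Finₚ.≟ y
        ... | yes _ | yes _ = refl
        ... | no _  | yes _ = refl
        ... | _     | no n  = contradiction refl n
      free : DiamondFree E
      free pq px qx py qy = core (Twins.e r) (Twins.endo r) (R-support r) (R-support (R-sym r)) (Twins.same r)
        where
        r = R-in pq (symm px) (symm qx) (symm py) (symm qy)

  select : Selects (Preserves E)
  select with Finₚ.any? (λ c → folds? (finToFun {n} {n} c))
  ... | yes (c , h) = folded (finToFun c) h
  ... | no ¬f = Core.idempotents core (Core.select-idempotent core)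
    where
    core : ∀ e → Endo e → ∀ {x y} → T (support E x) → T (support E y) → e x ≡ e y → x ≡ y
    core e h {x} {y} sx sy exy = decidable-stable (x Finₚ.≟ y) λ n → ¬f (funToFin e ,
      (λ a b ab → subst₂ (λ a b → T (E a b)) (sym (table a)) (sym (table b)) (h a b ab)) ,
      x , y , n , sx , sy , trans (table x) (trans exy (sym (table y))))
      where
      table : finToFun (funToFin e) ≗ e
      table = Finₚ.finToFun-funToFin e

triangle-selects : ∀ {n} (E : Graph n) → Simple E → Triangle E → Selects (Preserves E)
triangle-selects {n} E S t = go _ _ E S t ℕₚ.≤-refl ℕₚ.≤-refl
  where
  go : ∀ s m (E : Graph n) → Simple E → Triangle E → count (support E) < s → nonedges E < m → Selects (Preserves E)
  go (suc s) (suc m) E S t (s≤s ls) (s≤s lm) = Reduce.select S t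
    (λ E′ S′ t′ l → go s (suc (nonedges E′)) E′ S′ t′ (ℕₚ.≤-trans l ls) ℕₚ.≤-refl)
    (λ E′ S′ t′ sup sub {x} {y} e ¬e → go (suc s) m E′ S′ t′ (s≤s (ℕₚ.≤-trans (count-≤ sup) ls))
      (ℕₚ.≤-trans (nonedges-< {E = E} {E′} (λ {x} {y} → sub {x} {y}) {x} {y} e ¬e) lm))

Colouring : ∀ {n} → Graph n → Set
Colouring {n} E = Σ[ c ∈ (Fin n → Bool) ] (∀ x y → T (E x y) → c x ≢ c y)

-- A graph without triangles that contains all its walks of length 3 is a disjoint
-- union of complete bipartite graphs; otherwise those walks give a denser graph.
non-bipartite-selects : ∀ {n} (E : Graph n) → Simple E → ¬ Colouring E → Selects (Preserves E)
non-bipartite-selects {n} E S ¬c = go _ E S ¬c ℕₚ.≤-refl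
  where
  W : Graph n → Graph n
  W E x y = ∃ᵇ λ z → ∃ᵇ λ w → E x z ∧ (E z w ∧ E w y)
  W-in : ∀ E {x y} z w → T (E x z) → T (E z w) → T (E w y) → T (W E x y)
  W-in E z w a b c = ∃ᵇ-in z (∃ᵇ-in w (∧-in a (∧-in b c)))
  W-out : ∀ E {x y} → T (W E x y) → ∃[ z ] ∃[ w ] (T (E x z) × T (E z w) × T (E w y))
  W-out E r with ∃ᵇ-out r
  ... | z , r′ with ∃ᵇ-out r′
  ... | w , r″ with ∧-out r″
  ... | a , q = z , w , a , ∧-out q

  -- By closure `N u`, reached by walks of length one or two, is the whole component of `u`, so
  -- adjacent vertices have the same least element `r` in it. The colour is adjacency to `r`: two
  -- adjacent neighbours of `r` would form a triangle, and closure makes one end of every edge a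
  -- neighbour of `r`.
  colour : ∀ E → Simple E → ¬ Triangle E → (∀ x y → T (W E x y) → T (E x y)) → Colouring E
  colour E S ¬t closed = (λ u → maybe (E u) (least (N u))) , proper
    where
    open Simple S
    maybe : (Fin n → Bool) → Maybe (Fin n) → Bool
    maybe P (just x) = P x
    maybe P nothing  = false
    N : Fin n → Fin n → Bool
    N u w = E u w ∨ ∃ᵇ (λ v → E u v ∧ E v w)
    N-near : ∀ {u w} → T (E u w) → T (N u w)
    N-near {u} {w} e with E u w
    ... | true = tt
    N-far : ∀ {u v w} → T (E u v) → T (E v w) → T (N u w)
    N-far {u} {v} {w} e f with E u w
    ... | true  = tt
    ... | false = ∃ᵇ-in v (∧-in e f)
    N-out : ∀ {u w} → T (N u w) → T (E u w) ⊎ (∃[ v ] (T (E u v) × T (E v w)))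
    N-out {u} {w} h with E u w
    ... | true  = inj₁ tt
    ... | false = inj₂ (map₂ ∧-out (∃ᵇ-out h))
    N-⊆ : ∀ {u v} w → T (E u v) → T (N u w) → T (N v w)
    N-⊆ w uv h with N-out h
    ... | inj₁ uw             = N-far (symm uv) uw
    ... | inj₂ (a , ua , aw) = N-near (closed _ _ (W-in E _ a (symm uv) ua aw))
    bool-≡ : ∀ {a b} → (T a → T b) → (T b → T a) → a ≡ b
    bool-≡ {true}  {true}  f g = refl
    bool-≡ {true}  {false} f g = ⊥-elim (f tt)
    bool-≡ {false} {true}  f g = ⊥-elim (g tt)
    bool-≡ {false} {false} f g = refl
    proper : ∀ u v → T (E u v) → maybe (E u) (least (N u)) ≢ maybe (E v) (least (N v))
    proper u v uv rewrite least-cong {P = N v} {N u} (λ w → bool-≡ (N-⊆ w (symm uv)) (N-⊆ w uv))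
      with least-just {P = N u} v (N-near uv)
    ... | r , e , h rewrite e = apart (E u r) (E v r) refl refl
      where
      apart : ∀ a b → E u r ≡ a → E v r ≡ b → a ≢ b
      apart true  true  ea eb _ = ¬t (u , v , r , uv , subst T (sym eb) tt , subst T (sym ea) tt)
      apart false false ea eb _ with N-out h
      ... | inj₁ p            = subst T ea p
      ... | inj₂ (a , ua , ar) = subst T eb (closed _ _ (W-in E u a (symm uv) ua ar))
      apart true  false _ _ ()
      apart false true  _ _ ()

  go : ∀ m (E : Graph n) → Simple E → ¬ Colouring E → nonedges E < m → Selects (Preserves E)
  go (suc m) E S ¬c (s≤s l)
    with Finₚ.any? (λ x → Finₚ.any? λ y → Finₚ.any? λ z → T? (E x y) ×-dec T? (E y z) ×-dec T? (E x z))
  ... | yes t = triangle-selects E S t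
  ... | no ¬t with Finₚ.any? (λ x → Finₚ.any? λ y → T? (W E x y) ×-dec ¬? (T? (E x y)))
  ...   | no ¬d = contradiction (colour E S ¬t λ x y w → decidable-stable (T? (E x y)) λ ¬e → ¬d (x , y , w , ¬e)) ¬c
  ...   | yes (x , y , w , ¬e) =
    selects-⊆ {D = Preserves (W E)} (λ f p → record { ext = Preserves.ext p ; pres = λ h → let q = λ i → W-out E (h i) in
        W-in E _ _ (Preserves.pres p λ i → proj₁ (proj₂ (proj₂ (q i)))) (Preserves.pres p λ i → proj₁ (proj₂ (proj₂ (proj₂ (q i))))) (Preserves.pres p λ i → proj₂ (proj₂ (proj₂ (proj₂ (q i))))) })
      (go m (W E) (record { symm = λ r → let z , w , a , b , c = W-out E r in W-in E w z (symm c) (symm b) (symm a)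
                          ; irrefl = λ r → let z , w , a , b , c = W-out E r in ¬t (_ , z , w , a , b , symm c) })
        (λ (c , p) → ¬c (c , λ x y e → p x y (up e)))
        (ℕₚ.≤-trans (nonedges-< {E = E} {W E} up {x} {y} w ¬e) l))
    where
    open Simple S
    up : ∀ {x y} → T (E x y) → T (W E x y)
    up {x} {y} e = W-in E y x e (symm e) e

-- Tilings of a grid as a homomorphism problem

record SignPreserves {n} (T′ : SignedGraph n) {k} (f : Op n k) : Set where
  field
    ext  : ∀ {xs ys} → xs ≗ ys → f xs ≡ f ys
    pres : ∀ s {xs ys} → (∀ i → Edge T′ s (xs i) (ys i)) → Edge T′ s (f xs) (f ys)

anyBelow : ℕ → (ℕ → Bool) → Bool
anyBelow zero    f = false
anyBelow (suc n) f = anyBelow n f ∨ f n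

anyBelow-in : ∀ {n f} i → i < n → T (f i) → T (anyBelow n f)
anyBelow-in {suc n} {f} i l h with i ℕₚ.≟ n
... | yes refl = Equivalence.from Boolₚ.T-∨ (inj₂ h)
... | no i≢n   = Equivalence.from Boolₚ.T-∨ (inj₁ (anyBelow-in i (ℕₚ.≤∧≢⇒< (ℕₚ.≤-pred l) i≢n) h))

anyBelow-out : ∀ {n f} → T (anyBelow n f) → ∃[ i ] (i < n × T (f i))
anyBelow-out {suc n} {f} h with Equivalence.to (Boolₚ.T-∨ {anyBelow n f} {f n}) h
... | inj₂ q = n , ℕₚ.≤-refl , q
... | inj₁ p = let i , l , q = anyBelow-out {n} p in i , ℕₚ.m≤n⇒m≤1+n l , q

bool-≡ : ∀ {a b} → (T a → T b) → (T b → T a) → a ≡ b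
bool-≡ {true}  {true}  f g = refl
bool-≡ {true}  {false} f g = ⊥-elim (f tt)
bool-≡ {false} {true}  f g = ⊥-elim (g tt)
bool-≡ {false} {false} f g = refl

module _ {A : Set} where
  split-ˡ : ∀ m {n} {f : Fin m → A} {g : Fin n → A} i → [ f , g ]′ (splitAt m (i ↑ˡ n)) ≡ f i
  split-ˡ m {n} {f} {g} i = cong [ f , g ]′ (Finₚ.splitAt-↑ˡ m i n)

  split-ʳ : ∀ m {n} {f : Fin m → A} {g : Fin n → A} j → [ f , g ]′ (splitAt m (m ↑ʳ j)) ≡ g j
  split-ʳ m {n} {f} {g} j = cong [ f , g ]′ (Finₚ.splitAt-↑ʳ m n j)

-- Row and column of the second cell of a clause, given the direction of the clause and its first
-- cell.
below after : Fin 2 → ℕ → ℕ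
below zero    t = t
below (suc _) t = suc t
after zero    p = suc p
after (suc _) p = p

-- A grid of cells with values in a domain of d′ + 2 elements; the constraint at a
-- cell and a direction forbids certain pairs of values of the cell and its
-- neighbour (to the right for direction 0, below for direction 1). Each
-- forbidden pair is a clause, and is represented by the power of the target
-- whose factors are the remaining pairs.
module Gadget {N : ℕ} (target : SignedGraph N) (d k : ℕ)
              (pair : Fin (suc k) → Fin d × Fin d) (unpair : Fin d → Fin d → Fin (suc k))
              (pair-unpair : ∀ x y → pair (unpair x y) ≡ (x , y)) (unpair-pair : ∀ e → uncurry unpair (pair e) ≡ e)
              (some : Fin d) (other : Fin d → Fin d) (other≢ : ∀ x → other x ≢ x) where

  pair-at : Fin (suc k) → Fin k → Fin d × Fin d
  pair-at e c = pair (punchIn e c)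

  left-at right-at : Fin (suc k) → Fin k → Fin d
  left-at e  = proj₁ ∘ pair-at e
  right-at e = proj₂ ∘ pair-at e

  index : ∀ e (x y : Fin d) → e ≢ unpair x y → Fin k
  index e x y n = punchOut n

  pair-index : ∀ e x y n → pair-at e (index e x y n) ≡ (x , y)
  pair-index e x y n = trans (cong pair (Finₚ.punchIn-punchOut n)) (pair-unpair x y)

  along-left : ∀ e x → ∃[ c ] (pair-at e c ≡ (x , other (proj₂ (pair e))))
  along-left e x = _ , pair-index e x (other (proj₂ (pair e)))
    λ eq → other≢ _ (sym (cong proj₂ (trans (cong pair eq) (pair-unpair x _))))

  along-right : ∀ e y → ∃[ c ] (pair-at e c ≡ (other (proj₁ (pair e)) , y))
  along-right e y = _ , pair-index e (other (proj₁ (pair e))) y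
    λ eq → other≢ _ (sym (cong proj₁ (trans (cong pair eq) (pair-unpair _ y))))

  base : Fin (suc k) → Fin k
  base e = proj₁ (along-left e some)

  -- Vertices are entries of the tables of operations: `var` has one tuple over the values of a
  -- cell, `own` one tuple over the pairs that a clause allows. Constant tuples belong to all cells
  -- and clauses at once, and `con` is their common copy.
  data Kind : Set where
    con : Fin N → Kind
    var : Fin (N ^ d) → Kind
    own : Fin 2 → Fin (suc k) → Fin (N ^ k) → Kind

  opaque
    kinds : ℕ
    kinds = N + (N ^ d + 2 * (suc k * N ^ k))

    ownKind : Fin (2 * (suc k * N ^ k)) → Kind
    ownKind = (λ (δ , l) → (λ (e , a) → own δ e a) (remQuot {suc k} (N ^ k) l)) ∘ remQuot {2} (suc k * N ^ k)

    kind : Fin kinds → Kind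
    kind i = [ con , (λ j → [ var , ownKind ]′ (splitAt (N ^ d) j)) ]′ (splitAt N i)

    unkind : Kind → Fin kinds
    unkind (con c)     = c ↑ˡ _
    unkind (var b)     = N ↑ʳ (b ↑ˡ _)
    unkind (own δ e a) = N ↑ʳ (N ^ d ↑ʳ combine δ (combine e a))

    kind-unkind : ∀ κ → kind (unkind κ) ≡ κ
    kind-unkind (con c)     = split-ˡ N c
    kind-unkind (var b)     = trans (split-ʳ N (b ↑ˡ _)) (split-ˡ (N ^ d) b)
    kind-unkind (own δ e a) = trans (split-ʳ N (N ^ d ↑ʳ combine δ (combine e a))) (trans (split-ʳ (N ^ d) (combine δ (combine e a)))
      (trans (cong (λ (δ , l) → (λ (e , a) → own δ e a) (remQuot {suc k} (N ^ k) l)) (Finₚ.remQuot-combine {2} {suc k * N ^ k} δ (combine e a)))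
             (cong (λ (e , a) → own δ e a) (Finₚ.remQuot-combine {suc k} {N ^ k} e a))))

  -- Position of a vertex relative to a clause: at the corner of the grid, at the
  -- first cell of the clause, at its second cell.
  record Place : Set where
    constructor place
    field
      corner first second : Bool

  -- The element of the power of the target that a vertex stands for.
  denotes : Fin 2 → Fin (suc k) → Place → Kind → Maybe (Fin k → Fin N)
  denotes δ e (place o h x) (con c)       = if o then just (const c) else nothing
  -- A tuple over the values of a cell is read as a tuple over pairs that depends on one entry only.
  -- This makes the operation of the cell a minor of the operation of the clause.
  denotes δ e (place o h x) (var b)       =
    if h then just (finToFun b ∘ left-at e) else (if x then just (finToFun b ∘ right-at e) else nothing)
  denotes δ e (place o h x) (own δ′ e′ a) =
    if h ∧ (⌊ δ Finₚ.≟ δ′ ⌋ ∧ ⌊ e Finₚ.≟ e′ ⌋) then just (finToFun a) else nothing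

  adjacent : Sign → Maybe (Fin k → Fin N) → Maybe (Fin k → Fin N) → Bool
  adjacent s (just a) (just b) = ⌊ Finₚ.all? (λ i → T? (edge target s (a i) (b i))) ⌋
  adjacent s _        _        = false

  adjacent-out : ∀ {s x y} → T (adjacent s x y) → ∃[ a ] ∃[ b ] (x ≡ just a × y ≡ just b × (∀ i → Edge target s (a i) (b i)))
  adjacent-out {s} {just a} {just b} h = a , b , refl , refl , toWitness {a? = Finₚ.all? (λ i → T? (edge target s (a i) (b i)))} h

  adjacent-in : ∀ {s a b} → (∀ i → Edge target s (a i) (b i)) → T (adjacent s (just a) (just b))
  adjacent-in {s} {a} {b} = fromWitness {a? = Finₚ.all? (λ i → T? (edge target s (a i) (b i)))}

  adjacent-sym : ∀ s x y → T (adjacent s x y) → T (adjacent s y x)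
  adjacent-sym s (just a) (just b) h = adjacent-in {s} {b} {a} λ i → subst T (edge-sym target s (a i) (b i))
    (toWitness {a? = Finₚ.all? (λ i → T? (edge target s (a i) (b i)))} h i)
  adjacent-sym s (just _) nothing ()
  adjacent-sym s nothing  _       ()

  placed : Fin 2 → ℕ → ℕ → ℕ → ℕ → Place
  placed δ t p t′ p′ = place ((t′ ≡ᵇ 0) ∧ (p′ ≡ᵇ 0)) ((t′ ≡ᵇ t) ∧ (p′ ≡ᵇ p)) ((t′ ≡ᵇ below δ t) ∧ (p′ ≡ᵇ after δ p))

  suc≢ᵇ : ∀ p → (suc p ≡ᵇ p) ≡ false
  suc≢ᵇ zero    = refl
  suc≢ᵇ (suc p) = suc≢ᵇ p

  apart : ∀ δ t p → ((below δ t ≡ᵇ t) ∧ (after δ p ≡ᵇ p)) ≡ false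
  apart zero    t p = trans (cong ((t ≡ᵇ t) ∧_) (suc≢ᵇ p)) (Boolₚ.∧-zeroʳ _)
  apart (suc _) t p = cong (_∧ (p ≡ᵇ p)) (suc≢ᵇ t)

  module Instance (bad : Fin 2 → ℕ → ℕ → Fin d → Fin d → Bool) (B : ℕ) where

    forbids : Fin 2 → ℕ → ℕ → Fin (suc k) → Bool
    forbids δ t p e = uncurry (bad δ t p) (pair e)

    joins : Sign → ℕ → ℕ → Kind → ℕ → ℕ → Kind → Fin 2 → Fin (suc k) → ℕ → ℕ → Bool
    joins s t₁ p₁ κ₁ t₂ p₂ κ₂ δ e t p =
      forbids δ t p e ∧ adjacent s (denotes δ e (placed δ t p t₁ p₁) κ₁) (denotes δ e (placed δ t p t₂ p₂) κ₂)

    joinedAt : Sign → ℕ → ℕ → Kind → ℕ → ℕ → Kind → ℕ → ℕ → Bool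
    joinedAt s t₁ p₁ κ₁ t₂ p₂ κ₂ t p = ∃ᵇ λ δ → ∃ᵇ λ e → joins s t₁ p₁ κ₁ t₂ p₂ κ₂ δ e t p

    joined : Sign → ℕ → ℕ → Kind → ℕ → ℕ → Kind → Bool
    joined s t₁ p₁ κ₁ t₂ p₂ κ₂ = anyBelow B λ t → anyBelow B λ p → joinedAt s t₁ p₁ κ₁ t₂ p₂ κ₂ t p

    joined-in : ∀ {s t₁ p₁ κ₁ t₂ p₂ κ₂} δ e t p → t < B → p < B → T (forbids δ t p e) →
                T (adjacent s (denotes δ e (placed δ t p t₁ p₁) κ₁) (denotes δ e (placed δ t p t₂ p₂) κ₂)) → T (joined s t₁ p₁ κ₁ t₂ p₂ κ₂)
    joined-in δ e t p t< p< f h = anyBelow-in t t< (anyBelow-in p p< (∃ᵇ-in δ (∃ᵇ-in e (∧-in f h))))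

    joined-out : ∀ {s t₁ p₁ κ₁ t₂ p₂ κ₂} → T (joined s t₁ p₁ κ₁ t₂ p₂ κ₂) → ∃[ δ ] ∃[ e ] ∃[ t ] ∃[ p ] (t < B × p < B × T (forbids δ t p e) ×
                 T (adjacent s (denotes δ e (placed δ t p t₁ p₁) κ₁) (denotes δ e (placed δ t p t₂ p₂) κ₂)))
    joined-out {s} {t₁} {p₁} {κ₁} {t₂} {p₂} {κ₂} h with anyBelow-out {B} h
    ... | t , t< , h₁ with anyBelow-out {B} h₁
    ... | p , p< , h₂ with ∃ᵇ-out {P = λ δ → ∃ᵇ λ e → joins s t₁ p₁ κ₁ t₂ p₂ κ₂ δ e t p} h₂
    ... | δ , h₃ with ∃ᵇ-out {P = λ e → joins s t₁ p₁ κ₁ t₂ p₂ κ₂ δ e t p} h₃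
    ... | e , h₄ = δ , e , t , p , t< , p< , ∧-out {forbids δ t p e} h₄

    joined-sym : ∀ {s t₁ p₁ κ₁ t₂ p₂ κ₂} → T (joined s t₁ p₁ κ₁ t₂ p₂ κ₂) → T (joined s t₂ p₂ κ₂ t₁ p₁ κ₁)
    joined-sym {s} {t₁} {p₁} {κ₁} {t₂} {p₂} {κ₂} h with joined-out {s} {t₁} {p₁} {κ₁} {t₂} {p₂} {κ₂} h
    ... | δ , e , t , p , t< , p< , f , a = joined-in {s} {t₂} {p₂} {κ₂} {t₁} {p₁} {κ₁} δ e t p t< p< f
      (adjacent-sym s (denotes δ e (placed δ t p t₁ p₁) κ₁) (denotes δ e (placed δ t p t₂ p₂) κ₂) a)

    Vertex : ℕ
    Vertex = B * B * kinds

    row col : Fin Vertex → ℕ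
    row u = toℕ (proj₁ (remQuot {B} B (proj₁ (remQuot {B * B} kinds u))))
    col u = toℕ (proj₂ (remQuot {B} B (proj₁ (remQuot {B * B} kinds u))))

    kindOf : Fin Vertex → Kind
    kindOf u = kind (proj₂ (remQuot {B * B} kinds u))

    graph : SignedGraph Vertex
    graph .edge s u v = joined s (row u) (col u) (kindOf u) (row v) (col v) (kindOf v)
    graph .edge-sym s u v = bool-≡ (joined-sym {s} {row u} {col u} {kindOf u} {row v} {col v} {kindOf v})
                                         (joined-sym {s} {row v} {col v} {kindOf v} {row u} {col u} {kindOf u})

    Tiling : (ℕ → ℕ → Fin d) → (Fin 2 → ℕ → ℕ → Set) → Set
    Tiling β Inside = ∀ δ t p → t < B → p < B → Inside δ t p → ¬ T (bad δ t p (β t p) (β (below δ t) (after δ p)))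

    ≡ᵇ-sound : ∀ {a b c e} → T ((a ≡ᵇ b) ∧ (c ≡ᵇ e)) → a ≡ b × c ≡ e
    ≡ᵇ-sound {a} {b} {c} {e} h = let p , q = ∧-out {a ≡ᵇ b} h in ℕₚ.≡ᵇ⇒≡ a b p , ℕₚ.≡ᵇ⇒≡ c e q

    ≡ᵇ-complete : ∀ {a b c e} → a ≡ b → c ≡ e → ((a ≡ᵇ b) ∧ (c ≡ᵇ e)) ≡ true
    ≡ᵇ-complete {a} {b} {c} {e} p q = Equivalence.to Boolₚ.T-≡ (∧-in (ℕₚ.≡⇒≡ᵇ a b p) (ℕₚ.≡⇒≡ᵇ c e q))

    module Complete (β : ℕ → ℕ → Fin d) (sat : Tiling β (λ _ _ _ → ⊤)) where

      -- The homomorphism is evaluation at one factor, the one that belongs to the values of the two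
      -- cells. The default `base e` arises only when these values are the forbidden pair, which the
      -- tiling excludes for clauses in force.
      chosen : Fin 2 → Fin (suc k) → ℕ → ℕ → Fin k
      chosen δ e t p with e Finₚ.≟ unpair (β t p) (β (below δ t) (after δ p))
      ... | yes _ = base e
      ... | no n  = index e _ _ n

      chosen-pair : ∀ δ e t p → t < B → p < B → T (forbids δ t p e) → pair-at e (chosen δ e t p) ≡ (β t p , β (below δ t) (after δ p))
      chosen-pair δ e t p t< p< f with e Finₚ.≟ unpair (β t p) (β (below δ t) (after δ p))
      ... | yes refl = contradiction (subst (λ z → T (uncurry (bad δ t p) z)) (pair-unpair _ _) f) (sat δ t p t< p< tt)
      ... | no n     = pair-index e _ _ n

      value : ℕ → ℕ → Kind → Fin N
      value t p (con c)     = c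
      value t p (var b)     = finToFun b (β t p)
      value t p (own δ e a) = finToFun a (chosen δ e t p)

      value-denotes : ∀ δ e t p t′ p′ κ a → t < B → p < B → T (forbids δ t p e) →
                      denotes δ e (placed δ t p t′ p′) κ ≡ just a → a (chosen δ e t p) ≡ value t′ p′ κ
      value-denotes δ e t p t′ p′ (con c) a t< p< f eq with (t′ ≡ᵇ 0) ∧ (p′ ≡ᵇ 0)
      value-denotes δ e t p t′ p′ (con c) a t< p< f refl | true = refl
      value-denotes δ e t p t′ p′ (con c) a t< p< f ()   | false
      value-denotes δ e t p t′ p′ (var b) a t< p< f eq with (t′ ≡ᵇ t) ∧ (p′ ≡ᵇ p) in h
      ... | true with ≡ᵇ-sound {t′} {t} {p′} {p} (Equivalence.from Boolₚ.T-≡ h) | eq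
      ...   | refl , refl | refl = cong (finToFun b ∘ proj₁) (chosen-pair δ e t p t< p< f)
      value-denotes δ e t p t′ p′ (var b) a t< p< f eq | false with (t′ ≡ᵇ below δ t) ∧ (p′ ≡ᵇ after δ p) in h′
      ... | true with ≡ᵇ-sound {t′} {below δ t} {p′} {after δ p} (Equivalence.from Boolₚ.T-≡ h′) | eq
      ...   | refl , refl | refl = cong (finToFun b ∘ proj₂) (chosen-pair δ e t p t< p< f)
      value-denotes δ e t p t′ p′ (var b) a t< p< f () | false | false
      value-denotes δ e t p t′ p′ (own δ′ e′ c) a t< p< f eq with (t′ ≡ᵇ t) ∧ (p′ ≡ᵇ p) in h | δ Finₚ.≟ δ′ | e Finₚ.≟ e′
      ... | true | yes refl | yes refl with ≡ᵇ-sound {t′} {t} {p′} {p} (Equivalence.from Boolₚ.T-≡ h) | eq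
      ...   | refl , refl | refl = refl

      hom : Fin Vertex → Fin N
      hom u = value (row u) (col u) (kindOf u)

      isHom : IsECHom graph target hom
      isHom s u v h with joined-out {s} {row u} {col u} {kindOf u} {row v} {col v} {kindOf v} h
      ... | δ , e , t , p , t< , p< , f , ad with adjacent-out {s} {denotes δ e (placed δ t p (row u) (col u)) (kindOf u)} ad
      ... | a , b , ea , eb , ab = subst₂ (λ x y → Edge target s x y)
        (value-denotes δ e t p _ _ (kindOf u) a t< p< f ea) (value-denotes δ e t p _ _ (kindOf v) b t< p< f eb) (ab (chosen δ e t p))

    Inside : Fin 2 → ℕ → ℕ → Set
    Inside δ t p = below δ t < B × after δ p < B

    module Sound (select : Selects (SignPreserves target)) (φ : Fin Vertex → Fin N) (isHom : IsECHom graph target φ) where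

      ξ = proj₁ select

      at : (t p : ℕ) → t < B → p < B → Kind → Fin Vertex
      at t p t< p< κ = combine (combine (fromℕ< t<) (fromℕ< p<)) (unkind κ)

      at-edge : ∀ {s δ e t p t₁ p₁ κ₁ t₂ p₂ κ₂} {a b : Fin k → Fin N} (l₁ : t₁ < B) (m₁ : p₁ < B) (l₂ : t₂ < B) (m₂ : p₂ < B) →
                t < B → p < B → T (forbids δ t p e) →
                denotes δ e (placed δ t p t₁ p₁) κ₁ ≡ just a → denotes δ e (placed δ t p t₂ p₂) κ₂ ≡ just b →
                (∀ i → Edge target s (a i) (b i)) → Edge target s (φ (at t₁ p₁ l₁ m₁ κ₁)) (φ (at t₂ p₂ l₂ m₂ κ₂))
      at-edge {s} {δ} {e} {t} {p} {t₁} {p₁} {κ₁} {t₂} {p₂} {κ₂} l₁ m₁ l₂ m₂ t< p< f ea eb ab =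
        isHom s _ _ (subst T (sym same) (joined-in {s} {t₁} {p₁} {κ₁} {t₂} {p₂} {κ₂} δ e t p t< p< f
          (subst₂ (λ x y → T (adjacent s x y)) (sym ea) (sym eb) (adjacent-in {s} ab))))
        where
        coords : ∀ {t p κ} (l : t < B) (m : p < B) →
                 _≡_ {A = ℕ × ℕ × Kind} (row (at t p l m κ) , col (at t p l m κ) , kindOf (at t p l m κ)) (t , p , κ)
        coords {t} {p} {κ} l m =
          trans (cong (λ (q , κ) → toℕ (proj₁ (remQuot {B} B q)) , toℕ (proj₂ (remQuot {B} B q)) , kind κ)
                      (Finₚ.remQuot-combine {B * B} {kinds} (combine (fromℕ< l) (fromℕ< m)) (unkind κ)))
            (trans (cong (λ (a , b) → toℕ a , toℕ b , kind (unkind κ)) (Finₚ.remQuot-combine {B} {B} (fromℕ< l) (fromℕ< m)))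
              (cong₂ _,_ (Finₚ.toℕ-fromℕ< l) (cong₂ _,_ (Finₚ.toℕ-fromℕ< m) (kind-unkind κ))))
        same : edge graph s (at t₁ p₁ l₁ m₁ κ₁) (at t₂ p₂ l₂ m₂ κ₂) ≡ joined s t₁ p₁ κ₁ t₂ p₂ κ₂
        same = cong₂ (λ (t₁ , p₁ , κ₁) (t₂ , p₂ , κ₂) → joined s t₁ p₁ κ₁ t₂ p₂ κ₂) (coords {κ = κ₁} l₁ m₁) (coords {κ = κ₂} l₂ m₂)

      module _ (B> : 0 < B) where

        -- All constant tuples are represented by the vertices in the corner.
        cellOp : ∀ {t p} → t < B → p < B → Fin (N ^ d) → Fin N
        cellOp l m c with Finₚ.all? (λ i → finToFun {N} {d} c i Finₚ.≟ finToFun c some)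
        ... | yes _ = φ (at 0 0 B> B> (con (finToFun {N} {d} c some)))
        ... | no _  = φ (at _ _ l m (var c))

        codePreserves? : ∀ {l} s (f : Fin (N ^ l) → Fin N) →
          Dec (∀ b c → (∀ i → Edge target s (finToFun {N} {l} b i) (finToFun c i)) → Edge target s (f b) (f c))
        codePreserves? {l} s f = Finₚ.all? λ b → Finₚ.all? λ c →
          (Finₚ.all? λ i → T? (edge target s (finToFun {N} {l} b i) (finToFun c i))) →-dec T? (edge target s (f b) (f c))

        coded : ∀ {l} {f : Fin (N ^ l) → Fin N} →
          (∀ s b c → (∀ i → Edge target s (finToFun {N} {l} b i) (finToFun c i)) → Edge target s (f b) (f c)) →
          SignPreserves target (f ∘ funToFin)
        coded {l} {f} h = record
          { ext = λ e → cong f (funToFin-cong e)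
          ; pres = λ s {xs} {ys} e → h s _ _ λ i → subst₂ (λ x y → Edge target s x y)
              (sym (Finₚ.finToFun-funToFin xs i)) (sym (Finₚ.finToFun-funToFin ys i)) (e i) }

        uncoded : ∀ {l} {f : Fin (N ^ l) → Fin N} → SignPreserves target (f ∘ funToFin) →
          (∀ s b c → (∀ i → Edge target s (finToFun {N} {l} b i) (finToFun c i)) → Edge target s (f b) (f c))
        uncoded {l} {f} h s b c e = subst₂ (λ x y → Edge target s (f x) (f y)) (Finₚ.funToFin-finToFin {l} {N} b) (Finₚ.funToFin-finToFin {l} {N} c)
          (SignPreserves.pres h s e)

        -- A cell in no clause in force may carry a map that preserves nothing, and no place is
        -- selected for it. Hence the tests and the default `some`.
        β : ℕ → ℕ → Fin d
        β t p with t ℕₚ.<? B | p ℕₚ.<? B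
        ... | no _  | _    = some
        ... | yes _ | no _ = some
        ... | yes l | yes m with codePreserves? {d} Sign.+ (cellOp l m) | codePreserves? {d} Sign.- (cellOp l m)
        ...   | yes h₊ | yes h₋ = ξ (cellOp l m ∘ funToFin) (coded λ { Sign.+ → h₊ ; Sign.- → h₋ })
        ...   | _      | _      = some

        β-spec : ∀ {t p} (l : t < B) (m : p < B) (h : SignPreserves target (cellOp l m ∘ funToFin)) → β t p ≡ ξ (cellOp l m ∘ funToFin) h
        β-spec {t} {p} l m h with t ℕₚ.<? B | p ℕₚ.<? B
        ... | no n  | _    = contradiction l n
        ... | yes _ | no n = contradiction m n
        ... | yes l′ | yes m′ with ℕₚ.<-irrelevant l l′ | ℕₚ.<-irrelevant m m′
        ... | refl | refl with codePreserves? {d} Sign.+ (cellOp l m) | codePreserves? {d} Sign.- (cellOp l m)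
        ...   | yes h₊ | yes h₋ = proj₂ select _ _ h _ id (λ _ → refl)
        ...   | no n   | _      = contradiction (uncoded {d} h Sign.+) n
        ...   | yes _  | no n   = contradiction (uncoded {d} h Sign.-) n

        module _ δ t p e (t< : t < B) (p< : p < B) (l : below δ t < B) (m : after δ p < B) (active : T (forbids δ t p e)) where

          through-left through-right : (Fin k → Fin N) → Fin d → Fin N
          through-left  a x = a (proj₁ (along-left e x))
          through-right a y = a (proj₁ (along-right e y))

          -- Several vertices may denote the same tuple, and nothing forces `φ` to agree on them.
          -- Adjacency depends on the tuples only, so any choice of representatives gives an
          -- operation that preserves the signs.
          data Represents (a : Fin k → Fin N) : Fin N → Set where
            represented : ∀ {t′ p′ κ a′} (l′ : t′ < B) (m′ : p′ < B) → denotes δ e (placed δ t p t′ p′) κ ≡ just a′ → a′ ≗ a →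
                          Represents a (φ (at t′ p′ l′ m′ κ))

          -- The representatives are chosen to match `cellOp`: constants are read in the corner,
          -- tuples that depend on one entry in the cell of that entry. Only thus are the operations
          -- of both cells minors of this one.
          clauseOp : Fin (N ^ k) → Fin N
          clauseOp c with Finₚ.all? (λ i → finToFun {N} {k} c i Finₚ.≟ finToFun c (base e))
          ... | yes _ = φ (at 0 0 B> B> (con (finToFun {N} {k} c (base e))))
          ... | no _ with Finₚ.all? (λ i → through-left (finToFun {N} {k} c) (left-at e i) Finₚ.≟ finToFun c i)
          ...   | yes _ = φ (at t p t< p< (var (funToFin (through-left (finToFun {N} {k} c)))))
          ...   | no _ with Finₚ.all? (λ i → through-right (finToFun {N} {k} c) (right-at e i) Finₚ.≟ finToFun c i)
          ...     | yes _ = φ (at (below δ t) (after δ p) l m (var (funToFin (through-right (finToFun {N} {k} c)))))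
          ...     | no _  = φ (at t p t< p< (own δ e c))

          denotes-con : ∀ c → denotes δ e (placed δ t p 0 0) (con c) ≡ just (const c)
          denotes-con c = refl

          denotes-left : ∀ b → denotes δ e (placed δ t p t p) (var b) ≡ just (finToFun b ∘ left-at e)
          denotes-left b rewrite ≡ᵇ-complete {t} {t} {p} {p} refl refl = refl

          denotes-right : ∀ b → denotes δ e (placed δ t p (below δ t) (after δ p)) (var b) ≡ just (finToFun b ∘ right-at e)
          denotes-right b rewrite apart δ t p | ≡ᵇ-complete {below δ t} {below δ t} {after δ p} {after δ p} refl refl = refl

          denotes-own : ∀ a → denotes δ e (placed δ t p t p) (own δ e a) ≡ just (finToFun a)
          denotes-own a rewrite ≡ᵇ-complete {t} {t} {p} {p} refl refl with δ Finₚ.≟ δ | e Finₚ.≟ e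
          ... | yes _ | yes _ = refl
          ... | no n  | _     = contradiction refl n
          ... | yes _ | no n  = contradiction refl n

          clauseOp-represents : ∀ c → Represents (finToFun {N} {k} c) (clauseOp c)
          clauseOp-represents c with Finₚ.all? (λ i → finToFun {N} {k} c i Finₚ.≟ finToFun c (base e))
          ... | yes h = represented B> B> (denotes-con _) (λ i → sym (h i))
          ... | no _ with Finₚ.all? (λ i → through-left (finToFun {N} {k} c) (left-at e i) Finₚ.≟ finToFun c i)
          ...   | yes h = represented t< p< (denotes-left _) λ i → trans (Finₚ.finToFun-funToFin (through-left (finToFun {N} {k} c)) (left-at e i)) (h i)
          ...   | no _ with Finₚ.all? (λ i → through-right (finToFun {N} {k} c) (right-at e i) Finₚ.≟ finToFun c i)
          ...     | yes h = represented l m (denotes-right _) λ i → trans (Finₚ.finToFun-funToFin (through-right (finToFun {N} {k} c)) (right-at e i)) (h i)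
          ...     | no _  = represented t< p< (denotes-own c) λ _ → refl

          represents-edge : ∀ {s a b x y} → Represents a x → Represents b y → (∀ i → Edge target s (a i) (b i)) → Edge target s x y
          represents-edge {s} (represented {κ = κ₁} l₁ m₁ ea aa) (represented {κ = κ₂} l₂ m₂ eb bb) ab =
            at-edge {κ₁ = κ₁} {κ₂ = κ₂} l₁ m₁ l₂ m₂ t< p< active ea eb λ i → subst₂ (λ x y → Edge target s x y) (sym (aa i)) (sym (bb i)) (ab i)

          clause-preserves : SignPreserves target (clauseOp ∘ funToFin)
          clause-preserves = coded {k} λ s b c → represents-edge (clauseOp-represents b) (clauseOp-represents c)

          left-along : ∀ x → left-at e (proj₁ (along-left e x)) ≡ x
          left-along x = cong proj₁ (proj₂ (along-left e x))

          right-along : ∀ y → right-at e (proj₁ (along-right e y)) ≡ y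
          right-along y = cong proj₂ (proj₂ (along-right e y))

          module _ (b : Fin d → Fin N) where
            private
              L = funToFin (b ∘ left-at e)
              R = funToFin (b ∘ right-at e)
              eL : finToFun L ≗ b ∘ left-at e
              eL = Finₚ.finToFun-funToFin (b ∘ left-at e)
              eR : finToFun R ≗ b ∘ right-at e
              eR = Finₚ.finToFun-funToFin (b ∘ right-at e)
              eb : finToFun (funToFin b) ≗ b
              eb = Finₚ.finToFun-funToFin b

            minor-left : cellOp t< p< (funToFin b) ≡ clauseOp L
            minor-left with Finₚ.all? (λ i → finToFun {N} {d} (funToFin b) i Finₚ.≟ finToFun (funToFin b) some)
                          | Finₚ.all? (λ i → finToFun {N} {k} L i Finₚ.≟ finToFun L (base e))
            ... | yes c | yes _ = cong (φ ∘ at 0 0 B> B> ∘ con)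
              (trans (sym (c (left-at e (base e)))) (trans (eb _) (sym (eL (base e)))))
            ... | yes c | no n = contradiction (λ i → trans (eL i) (trans (trans (sym (eb _)) (trans (c _) (trans (sym (c _)) (eb _)))) (sym (eL (base e))))) n
            ... | no n  | yes c = contradiction (λ x → trans (spread x) (trans (trans (c _) (sym (c _))) (sym (spread some)))) n
              where
              spread : ∀ x → finToFun (funToFin b) x ≡ finToFun L (proj₁ (along-left e x))
              spread x = trans (eb x) (trans (cong b (sym (left-along x))) (sym (eL _)))
            ... | no _  | no _ with Finₚ.all? (λ i → through-left (finToFun {N} {k} L) (left-at e i) Finₚ.≟ finToFun L i)
            ...   | yes _ = cong (φ ∘ at t p t< p< ∘ var) (funToFin-cong λ x → sym (trans (eL _) (cong b (left-along x))))
            ...   | no n  = contradiction (λ i → trans (eL _) (trans (cong b (left-along _)) (sym (eL i)))) n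

            minor-right : cellOp l m (funToFin b) ≡ clauseOp R
            minor-right with Finₚ.all? (λ i → finToFun {N} {d} (funToFin b) i Finₚ.≟ finToFun (funToFin b) some)
                           | Finₚ.all? (λ i → finToFun {N} {k} R i Finₚ.≟ finToFun R (base e))
            ... | yes c | yes _ = cong (φ ∘ at 0 0 B> B> ∘ con)
              (trans (sym (c (right-at e (base e)))) (trans (eb _) (sym (eR (base e)))))
            ... | yes c | no n = contradiction (λ i → trans (eR i) (trans (trans (sym (eb _)) (trans (c _) (trans (sym (c _)) (eb _)))) (sym (eR (base e))))) n
            ... | no n  | yes c = contradiction (λ x → trans (spread x) (trans (trans (c _) (sym (c _))) (sym (spread some)))) n
              where
              spread : ∀ x → finToFun (funToFin b) x ≡ finToFun R (proj₁ (along-right e x))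
              spread x = trans (eb x) (trans (cong b (sym (right-along x))) (sym (eR _)))
            ... | no n  | no n′ with Finₚ.all? (λ i → through-left (finToFun {N} {k} R) (left-at e i) Finₚ.≟ finToFun R i)
            -- The pairs other than e form a connected bipartite graph, so a function of
            -- the left entry that is also one of the right entry is constant.
            ...   | yes c = contradiction (λ i → trans (eR i) (trans (const-b (right-at e i) (right-at e (base e))) (sym (eR (base e))))) n′
              where
              const-b : ∀ x y → b x ≡ b y
              const-b x y = trans (via x) (sym (via y))
                where
                via : ∀ z → b z ≡ finToFun R (proj₁ (along-left e (other (proj₁ (pair e)))))
                via z = trans (cong b (sym (right-along z))) (trans (sym (eR _))
                  (trans (sym (c (proj₁ (along-right e z)))) (cong (finToFun R ∘ proj₁ ∘ along-left e) (cong proj₁ (proj₂ (along-right e z))))))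
            ...   | no _ with Finₚ.all? (λ i → through-right (finToFun {N} {k} R) (right-at e i) Finₚ.≟ finToFun R i)
            ...     | yes _ = cong (φ ∘ at (below δ t) (after δ p) l m ∘ var) (funToFin-cong λ x → sym (trans (eR _) (cong b (right-along x))))
            ...     | no n″ = contradiction (λ i → trans (eR _) (trans (cong b (right-along _)) (sym (eR i)))) n″

          preserves-minor : ∀ {f : Fin (N ^ d) → Fin N} {π : Fin k → Fin d} → (∀ b → f (funToFin b) ≡ clauseOp (funToFin (b ∘ π))) →
                            SignPreserves target (f ∘ funToFin)
          preserves-minor {f} {π} h = record
            { ext = λ e → cong f (funToFin-cong e)
            ; pres = λ s {xs} {ys} e → subst₂ (λ x y → Edge target s x y) (sym (h xs)) (sym (h ys)) (SignPreserves.pres clause-preserves s (λ i → e (π i))) }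

          -- The place selected for the clause is one of the pairs other than `e`. Its entries are
          -- the places selected for the two minors, that is, the values of the cells.
          satisfied : unpair (β t p) (β (below δ t) (after δ p)) ≢ e
          satisfied eq = Finₚ.punchInᵢ≢i e (ξ _ clause-preserves) (trans (sym (unpair-pair _))
            (trans (cong₂ unpair (sym (trans (β-spec t< p< pl) (proj₂ select _ _ clause-preserves pl (left-at e) minor-left)))
                                  (sym (trans (β-spec l m pr) (proj₂ select _ _ clause-preserves pr (right-at e) minor-right)))) eq))
            where
            pl = preserves-minor {cellOp t< p<} {left-at e} minor-left
            pr = preserves-minor {cellOp l m} {right-at e} minor-right

        tiling : Tiling β Inside
        tiling δ t p t< p< (l , m) h = satisfied δ t p (unpair (β t p) (β (below δ t) (after δ p))) t< p< l m
          (subst (λ z → T (uncurry (bad δ t p) z)) (sym (pair-unpair _ _)) h) refl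

-- Tableaux of Turing machines

-- Tokens describe what the input tape may hold: a prescribed bit, any bit or
-- blank, or blank.
data Tok : Set where
  fix  : Bool → Tok
  free : Tok
  end  : Tok

tokAt : List Tok → ℕ → Tok
tokAt []       _       = end
tokAt (k ∷ ks) zero    = k
tokAt (k ∷ ks) (suc n) = tokAt ks n

tokens : Word → ℕ → List Tok
tokens v P = map fix v ++ replicate P free

module _ {g : ℕ} where

  infix 4 _≟ₛ_
  _≟ₛ_ : (a b : Symbol g) → Dec (a ≡ b)
  blank  ≟ₛ blank  = yes refl
  blank  ≟ₛ bit _  = no λ ()
  blank  ≟ₛ mark _ = no λ ()
  bit _  ≟ₛ blank  = no λ ()
  bit a  ≟ₛ bit b  = map′ (cong bit) (λ { refl → refl }) (a Boolₚ.≟ b)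
  bit _  ≟ₛ mark _ = no λ ()
  mark _ ≟ₛ blank  = no λ ()
  mark _ ≟ₛ bit _  = no λ ()
  mark a ≟ₛ mark b = map′ (cong mark) (λ { refl → refl }) (a Finₚ.≟ b)

  fits : Tok → Symbol g → Bool
  fits (fix b) s       = ⌊ s ≟ₛ bit b ⌋
  fits free    blank   = true
  fits free    (bit _) = true
  fits end     blank   = true
  fits _       _       = false

  cellAt-bits : ∀ P v u → length u ≤ P → ∀ n → T (fits (tokAt (tokens v P) n) (cellAt (map bit (v ++ u)) n))
  cellAt-bits P (b ∷ v) u l zero    = fromWitness {a? = bit b ≟ₛ bit b} refl
  cellAt-bits P (b ∷ v) u l (suc n) = cellAt-bits P v u l n
  cellAt-bits zero    [] []      l       n       = tt
  cellAt-bits (suc P) [] []      l       zero    = tt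
  cellAt-bits (suc P) [] []      l       (suc n) = cellAt-bits P [] [] z≤n n
  cellAt-bits (suc P) [] (_ ∷ u) l       zero    = tt
  cellAt-bits (suc P) [] (_ ∷ u) (s≤s l) (suc n) = cellAt-bits P [] u l n

  cellAt-blank : ∀ (v : Word) n → cellAt {g} (map bit v) n ≡ blank → cellAt {g} (map bit v) (suc n) ≡ blank
  cellAt-blank []          n       e = refl
  cellAt-blank (b ∷ [])    (suc n) e = refl
  cellAt-blank (b ∷ c ∷ v) (suc n) e = cellAt-blank (c ∷ v) n e

  -- A `free` cell may be blank; as no bit follows a blank, the nonblank ones form a word.
  extract : ∀ P v K (s : ℕ → Symbol g) → (∀ n → n < K → T (fits (tokAt (tokens v P) n) (s n))) →
            (∀ n → suc n < K → s n ≡ blank → s (suc n) ≡ blank) →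
            ∃[ u ] (length u ≤ P × (∀ n → n < K → s n ≡ cellAt (map bit (v ++ u)) n))
  extract P v zero s f m = [] , z≤n , λ _ ()
  extract P (b ∷ v) (suc K) s f m with extract P v K (s ∘ suc) (λ n l → f (suc n) (s≤s l)) (λ n l → m (suc n) (s≤s l))
  ... | u , l , h = u , l , λ { zero _ → toWitness {a? = s zero ≟ₛ bit b} (f zero (s≤s z≤n)) ; (suc n) (s≤s l) → h n l }
  extract zero [] (suc K) s f m = [] , z≤n , λ n l → ended (s n) (f n l)
    where
    ended : ∀ x → T (fits end x) → x ≡ blank
    ended blank _ = refl
  extract (suc P) [] (suc K) s f m with s zero in eq
  ... | blank = [] , z≤n , blanks
    where
    blanks : ∀ n → n < suc K → s n ≡ blank
    blanks zero    _ = eq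
    blanks (suc n) l = m n l (blanks n (ℕₚ.<⇒≤ l))
  ... | bit b with extract P [] K (s ∘ suc) (λ n l → f (suc n) (s≤s l)) (λ n l → m (suc n) (s≤s l))
  ...   | u , l , h = b ∷ u , s≤s l , λ { zero _ → eq ; (suc n) (s≤s l) → h n l }
  extract (suc P) [] (suc K) s f m | mark _ = ⊥-elim (subst (T ∘ fits free) eq (f zero (s≤s z≤n)))

pattern hd = zero
pattern lp = suc zero
pattern lc = suc (suc zero)
pattern ln = suc (suc (suc zero))
pattern rp = suc (suc (suc (suc zero)))
pattern rc = suc (suc (suc (suc (suc zero))))
pattern rn = suc (suc (suc (suc (suc (suc zero)))))

vec-ext : ∀ {A : Set} {n} (xs ys : Vec A n) → (∀ i → lookup xs i ≡ lookup ys i) → xs ≡ ys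
vec-ext []       []       e = refl
vec-ext (x ∷ xs) (y ∷ ys) e = cong₂ _∷_ (e zero) (vec-ext xs ys (e ∘ suc))

leftChoice rightChoice : {A : Set} → Move → A → A → A → A
leftChoice stay    cur nxt prev = cur
leftChoice goLeft  cur nxt prev = nxt
leftChoice goRight cur nxt prev = prev
rightChoice stay    cur nxt prev = cur
rightChoice goRight cur nxt prev = nxt
rightChoice goLeft  cur nxt prev = prev

headChoice : {A : Set} → Move → A → A → A → A
headChoice stay    a l r = a
headChoice goLeft  a l r = l
headChoice goRight a l r = r

cong₃ : {A B C D : Set} (f : A → B → C → D) {a a′ : A} {b b′ : B} {c c′ : C} → a ≡ a′ → b ≡ b′ → c ≡ c′ → f a b c ≡ f a′ b′ c′
cong₃ f refl refl refl = refl

-- Row t of the tableau describes the configuration at time t, with every tape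
-- aligned at its head: column p holds the cells at distance p + 1 to the left and
-- to the right of the head (lc, rc), copies of their neighbours, and the state
-- and the scanned symbols (hd), which are the same in the whole row.
module Tableau (M : TM) (d : ℕ)
               (stateOf : Fin d → Fin (TM.states M))
               (symOf : Fin d → Fin 7 → Fin (suc (TM.work M)) → Symbol (TM.marks M))
               (mk : Fin (TM.states M) → (Fin 7 → Fin (suc (TM.work M)) → Symbol (TM.marks M)) → Fin d)
               (stateOf-mk : ∀ q f → stateOf (mk q f) ≡ q) (symOf-mk : ∀ q f j i → symOf (mk q f) j i ≡ f j i) where
  open TM M

  W : ℕ
  W = suc work

  Sy : Set
  Sy = Symbol marks

  -- A move brings one half-tape closer to the head by a cell and pushes the other one away. The
  -- written symbol becomes the nearest cell of the half that is pushed away, which is why the first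
  -- column is special.
  newLeft newRight : Bool → Move → Sy → Fin d → Fin W → Sy
  newLeft  first m a x i = leftChoice  m (symOf x lc i) (symOf x ln i) (if first then a else symOf x lp i)
  newRight first m a x i = rightChoice m (symOf x rc i) (symOf x rn i) (if first then a else symOf x rp i)

  newHead : Move → Sy → Fin d → Fin W → Sy
  newHead m a x i = headChoice m a (symOf x lc i) (symOf x rc i)

  Initially : Tok → Tok → Fin d → Set
  Initially k₀ k x = stateOf x ≡ TM.start M × T (fits k₀ (symOf x hd zero)) × T (fits k (symOf x rc zero)) ×
    (symOf x rc zero ≡ blank → symOf x rn zero ≡ blank) × symOf x lc zero ≡ blank ×
    (∀ (i : Fin work) → symOf x hd (suc i) ≡ blank × symOf x lc (suc i) ≡ blank × symOf x rc (suc i) ≡ blank)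

  Beside : Bool → Tok → Tok → Fin d → Fin d → Set
  Beside z k₀ k x y = stateOf x ≡ stateOf y ×
    (∀ i → symOf x hd i ≡ symOf y hd i × symOf x ln i ≡ symOf y lc i × symOf x lc i ≡ symOf y lp i ×
           symOf x rn i ≡ symOf y rc i × symOf x rc i ≡ symOf y rp i) ×
    (T z → Initially k₀ k x)

  notBit : Sy → Bool
  notBit (bit _) = false
  notBit _       = true

  heads : Fin d → Vec Sy W
  heads x = Vec.tabulate (symOf x hd)

  -- A halting row has to be accepting, which is checked next to the head, and leaves the row below
  -- it unconstrained.
  Next : Bool → Fin d → Fin d → Maybe (Fin states × Vec (Sy × Move) W) → Set
  Next first x y nothing          = T first → symOf x hd zero ≡ bit true × T (notBit (symOf x rc zero))
  Next first x y (just (q , acts)) = stateOf y ≡ q × (∀ i → let a , m = lookup acts i in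
    symOf y lc i ≡ newLeft first m a x i × symOf y rc i ≡ newRight first m a x i × (T first → symOf y hd i ≡ newHead m a x i))

  Above : Bool → Fin d → Fin d → Set
  Above first x y = Next first x y (δ (stateOf x) (heads x))

  beside? : ∀ z k₀ k x y → Dec (Beside z k₀ k x y)
  beside? z k₀ k x y = (stateOf x Finₚ.≟ stateOf y) ×-dec
    (Finₚ.all? λ i → (symOf x hd i ≟ₛ symOf y hd i) ×-dec (symOf x ln i ≟ₛ symOf y lc i) ×-dec (symOf x lc i ≟ₛ symOf y lp i) ×-dec
                     (symOf x rn i ≟ₛ symOf y rc i) ×-dec (symOf x rc i ≟ₛ symOf y rp i)) ×-dec
    (T? z →-dec ((stateOf x Finₚ.≟ TM.start M) ×-dec T? (fits k₀ (symOf x hd zero)) ×-dec T? (fits k (symOf x rc zero)) ×-dec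
      ((symOf x rc zero ≟ₛ blank) →-dec (symOf x rn zero ≟ₛ blank)) ×-dec (symOf x lc zero ≟ₛ blank) ×-dec
      (Finₚ.all? λ i → (symOf x hd (suc i) ≟ₛ blank) ×-dec (symOf x lc (suc i) ≟ₛ blank) ×-dec (symOf x rc (suc i) ≟ₛ blank))))

  next? : ∀ first x y r → Dec (Next first x y r)
  next? first x y nothing = T? first →-dec ((symOf x hd zero ≟ₛ bit true) ×-dec T? (notBit (symOf x rc zero)))
  next? first x y (just (q , acts)) = (stateOf y Finₚ.≟ q) ×-dec (Finₚ.all? λ i →
    (symOf y lc i ≟ₛ newLeft first (proj₂ (lookup acts i)) (proj₁ (lookup acts i)) x i) ×-dec
    (symOf y rc i ≟ₛ newRight first (proj₂ (lookup acts i)) (proj₁ (lookup acts i)) x i) ×-dec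
    (T? first →-dec (symOf y hd i ≟ₛ newHead (proj₂ (lookup acts i)) (proj₁ (lookup acts i)) x i)))

  badAt : Fin 2 → Bool → Bool → Tok → Tok → Fin d → Fin d → Bool
  badAt zero    z first k₀ k x y = not ⌊ beside? z k₀ k x y ⌋
  badAt (suc _) z first k₀ k x y = not ⌊ next? first x y (δ (stateOf x) (heads x)) ⌋

  bad : List Tok → Fin 2 → ℕ → ℕ → Fin d → Fin d → Bool
  bad ks dir t p = badAt dir (t ≡ᵇ 0) (p ≡ᵇ 0) (tokAt ks 0) (tokAt ks (suc p))

  not-in : ∀ {A : Set} (a? : Dec A) → A → ¬ T (not ⌊ a? ⌋)
  not-in (yes _) _ ()
  not-in (no ¬a) a _ = ¬a a

  not-out : ∀ {A : Set} (a? : Dec A) → ¬ T (not ⌊ a? ⌋) → A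
  not-out (yes a) _ = a
  not-out (no _)  h = ⊥-elim (h tt)

  C : Set
  C = Config M

  tapeAt : C → Fin W → Tape marks
  tapeAt c i = lookup (tapes c) i

  headsOf : C → Vec Sy W
  headsOf c = Vec.map head (tapes c)

  step-nothing : ∀ c → δ (state c) (headsOf c) ≡ nothing → step M c ≡ nothing
  step-nothing c e rewrite e = refl

  step-nothing⁻¹ : ∀ c → step M c ≡ nothing → δ (state c) (headsOf c) ≡ nothing
  step-nothing⁻¹ c e with δ (state c) (headsOf c)
  ... | nothing = refl
  step-nothing⁻¹ c () | just _

  step-just : ∀ c {q acts} → δ (state c) (headsOf c) ≡ just (q , acts) →
              ∃[ c′ ] (step M c ≡ just c′ × state c′ ≡ q ×
                       (∀ i → tapeAt c′ i ≡ move (proj₂ (lookup acts i)) (write (proj₁ (lookup acts i)) (tapeAt c i))))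
  step-just c {q} {acts} e rewrite e = _ , refl , refl , λ i → Vecₚ.lookup-zipWith (λ (a , d) t → move d (write a t)) i acts (tapes c)

  Follows : C → C → Set
  Follows c c′ = ∃[ q ] ∃[ acts ] (δ (state c) (headsOf c) ≡ just (q , acts) × state c′ ≡ q ×
    (∀ i → tapeAt c′ i ≡ move (proj₂ (lookup acts i)) (write (proj₁ (lookup acts i)) (tapeAt c i))))

  stepped : ∀ c {c′} → step M c ≡ just c′ → Follows c c′
  stepped c {c′} s = go (δ (state c) (headsOf c)) refl
    where
    go : ∀ r → δ (state c) (headsOf c) ≡ r → Follows c c′
    go nothing           e = contradiction (trans (sym (step-nothing c e)) s) λ ()
    go (just (q , acts)) e with step-just c e
    ... | c″ , s″ , q≡ , moved with trans (sym s″) s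
    ... | refl = q , acts , e , q≡ , moved

  -- A halted configuration is repeated, so that a run fills a grid of any height.
  advance : C → C
  advance c = Maybe.maybe′ id c (step M c)

  conf : C → ℕ → C
  conf c zero    = c
  conf c (suc n) = advance (conf c n)

  conf-shift : ∀ c n → conf c (suc n) ≡ conf (advance c) n
  conf-shift c zero    = refl
  conf-shift c (suc n) = cong advance (conf-shift c n)

  conf-stuck : ∀ c n → step M c ≡ nothing → conf c n ≡ c
  conf-stuck c zero    e = refl
  conf-stuck c (suc n) e rewrite conf-stuck c n e | e = refl

  halts-unique : ∀ {t c d} → HaltsIn M t c d → ∀ n → step M (conf c n) ≡ nothing → conf c n ≡ d
  halts-unique {c = c} (halted e) n _ = conf-stuck c n e
  halts-unique (next e h) zero    s with trans (sym e) s
  ... | ()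
  halts-unique {c = c} (next {c′ = c′} e h) (suc n) s = trans shifted (halts-unique h n (trans (cong (step M) (sym shifted)) s))
    where
    shifted : conf c (suc n) ≡ conf c′ n
    shifted = trans (conf-shift c n) (cong (λ r → conf (Maybe.maybe′ id c r) n) e)

  Accepts : C → Set
  Accepts c = head (tapeAt c zero) ≡ bit true × T (notBit (cellAt (right (tapeAt c zero)) 0))

  accepts-out : ∀ c → Accepts c → output M c ≡ true ∷ []
  accepts-out (config _ (tape _ _ []            ∷ _)) (refl , _) = refl
  accepts-out (config _ (tape _ _ (blank ∷ _)   ∷ _)) (refl , _) = refl
  accepts-out (config _ (tape _ _ (mark _ ∷ _)  ∷ _)) (refl , _) = refl

  accepts-in : ∀ c → output M c ≡ true ∷ [] → Accepts c
  accepts-in (config _ (tape _ (bit _) []           ∷ _)) refl = refl , tt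
  accepts-in (config _ (tape _ (bit _) (blank ∷ _)  ∷ _)) refl = refl , tt
  accepts-in (config _ (tape _ (bit _) (mark _ ∷ _) ∷ _)) refl = refl , tt

  preceding : List Sy → ℕ → Sy → Sy
  preceding l zero    a = a
  preceding l (suc p) a = cellAt l p

  tracks : C → ℕ → Fin 7 → Fin W → Sy
  tracks c p hd i = head (tapeAt c i)
  tracks c p lp i = preceding (left (tapeAt c i)) p blank
  tracks c p lc i = cellAt (left (tapeAt c i)) p
  tracks c p ln i = cellAt (left (tapeAt c i)) (suc p)
  tracks c p rp i = preceding (right (tapeAt c i)) p blank
  tracks c p rc i = cellAt (right (tapeAt c i)) p
  tracks c p rn i = cellAt (right (tapeAt c i)) (suc p)

  module _ (a : Sy) (t : Tape marks) where
    left-move : ∀ m p → cellAt (left (move m (write a t))) p ≡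
                leftChoice m (cellAt (left t) p) (cellAt (left t) (suc p)) (preceding (left t) p a)
    left-move stay    p = refl
    left-move goLeft  p with left t
    ... | []    = refl
    ... | _ ∷ _ = refl
    left-move goRight p with right t
    left-move goRight zero    | []    = refl
    left-move goRight (suc p) | []    = refl
    left-move goRight zero    | _ ∷ _ = refl
    left-move goRight (suc p) | _ ∷ _ = refl

    right-move : ∀ m p → cellAt (right (move m (write a t))) p ≡
                 rightChoice m (cellAt (right t) p) (cellAt (right t) (suc p)) (preceding (right t) p a)
    right-move stay    p = refl
    right-move goRight p with right t
    ... | []    = refl
    ... | _ ∷ _ = refl
    right-move goLeft  p with left t
    right-move goLeft  zero    | []    = refl
    right-move goLeft  (suc p) | []    = refl
    right-move goLeft  zero    | _ ∷ _ = refl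
    right-move goLeft  (suc p) | _ ∷ _ = refl

    head-move : ∀ m → head (move m (write a t)) ≡ headChoice m a (cellAt (left t) 0) (cellAt (right t) 0)
    head-move stay    = refl
    head-move goLeft  with left t
    ... | []    = refl
    ... | _ ∷ _ = refl
    head-move goRight with right t
    ... | []    = refl
    ... | _ ∷ _ = refl

  preceding-if : ∀ l p a → preceding l p a ≡ (if p ≡ᵇ 0 then a else preceding l p blank)
  preceding-if l zero    a = refl
  preceding-if l (suc p) a = refl

  work-tape : ∀ x i → tapeAt (initial M x) (suc i) ≡ blankTape
  work-tape x i = Vecₚ.lookup-replicate i blankTape

  module _ (b : Bool) (v : Word) (P : ℕ) where

    private
      ks : List Tok
      ks = tokens (b ∷ v) P

    module _ (u : Word) (u≤ : length u ≤ P)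
             (accepting : ∀ n → step M (conf (initial M (b ∷ v ++ u)) n) ≡ nothing → Accepts (conf (initial M (b ∷ v ++ u)) n)) where

      cs : ℕ → C
      cs = conf (initial M (b ∷ v ++ u))

      tile : ℕ → ℕ → Fin d
      tile t p = mk (state (cs t)) (tracks (cs t) p)

      tile-sym : ∀ t p j i → symOf (tile t p) j i ≡ tracks (cs t) p j i
      tile-sym t p = symOf-mk (state (cs t)) (tracks (cs t) p)

      tile-state : ∀ t p → stateOf (tile t p) ≡ state (cs t)
      tile-state t p = stateOf-mk (state (cs t)) (tracks (cs t) p)

      tile-heads : ∀ t p → heads (tile t p) ≡ headsOf (cs t)
      tile-heads t p = vec-ext _ _ λ i → trans (Vecₚ.lookup∘tabulate (symOf (tile t p) hd) i)
        (trans (tile-sym t p hd i) (sym (Vecₚ.lookup-map i head (tapes (cs t)))))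

      via : ∀ t p j i t′ p′ j′ i′ → tracks (cs t) p j i ≡ tracks (cs t′) p′ j′ i′ → symOf (tile t p) j i ≡ symOf (tile t′ p′) j′ i′
      via t p j i t′ p′ j′ i′ e = trans (tile-sym t p j i) (trans e (sym (tile-sym t′ p′ j′ i′)))

      initially : ∀ p → Initially (tokAt ks 0) (tokAt ks (suc p)) (tile 0 p)
      initially p = tile-state 0 p ,
        subst (T ∘ fits (tokAt ks 0)) (sym (tile-sym 0 p hd zero)) (cellAt-bits P (b ∷ v) u u≤ 0) ,
        subst (T ∘ fits (tokAt ks (suc p))) (sym (tile-sym 0 p rc zero)) (cellAt-bits P (b ∷ v) u u≤ (suc p)) ,
        (λ e → trans (tile-sym 0 p rn zero) (cellAt-blank (v ++ u) p (trans (sym (tile-sym 0 p rc zero)) e))) ,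
        tile-sym 0 p lc zero ,
        λ i → trans (tile-sym 0 p hd (suc i)) (cong head (work-tape (b ∷ v ++ u) i)) ,
              trans (tile-sym 0 p lc (suc i)) (cong (λ t → cellAt (left t) p) (work-tape (b ∷ v ++ u) i)) ,
              trans (tile-sym 0 p rc (suc i)) (cong (λ t → cellAt (right t) p) (work-tape (b ∷ v ++ u) i))

      beside : ∀ t p → Beside (t ≡ᵇ 0) (tokAt ks 0) (tokAt ks (suc p)) (tile t p) (tile t (suc p))
      beside t p = trans (tile-state t p) (sym (tile-state t (suc p))) ,
        (λ i → via t p hd i t (suc p) hd i refl , via t p ln i t (suc p) lc i refl , via t p lc i t (suc p) lp i refl ,
               via t p rn i t (suc p) rc i refl , via t p rc i t (suc p) rp i refl) , first t
        where
        first : ∀ t → T (t ≡ᵇ 0) → Initially (tokAt ks 0) (tokAt ks (suc p)) (tile t p)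
        first zero _ = initially p

      above : ∀ t p → Above (p ≡ᵇ 0) (tile t p) (tile (suc t) p)
      above t p = subst (Next (p ≡ᵇ 0) (tile t p) (tile (suc t) p)) (sym (cong₂ δ (tile-state t p) (tile-heads t p)))
        (go p (δ (state (cs t)) (headsOf (cs t))) refl)
        where
        go : ∀ p r → δ (state (cs t)) (headsOf (cs t)) ≡ r → Next (p ≡ᵇ 0) (tile t p) (tile (suc t) p) r
        go (suc _) nothing e ()
        go zero    nothing e first = let h , n = accepting t (step-nothing (cs t) e) in
          trans (tile-sym t 0 hd zero) h , subst (T ∘ notBit) (sym (tile-sym t 0 rc zero)) n
        go p (just (q , acts)) e with step-just (cs t) e
        ... | c′ , s , q≡ , moved = trans (tile-state (suc t) p) (trans (cong state next≡) q≡) , λ i →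
          let a = proj₁ (lookup acts i) ; m = proj₂ (lookup acts i) ; τ = tapeAt (cs t) i
              tape≡ = trans (cong (λ c → tapeAt c i) next≡) (moved i) in
          trans (tile-sym (suc t) p lc i) (trans (cong (λ z → cellAt (left z) p) tape≡) (trans (left-move a τ m p)
            (cong₃ (leftChoice m) (sym (tile-sym t p lc i)) (sym (tile-sym t p ln i))
              (trans (preceding-if (left τ) p a) (cong (λ z → if p ≡ᵇ 0 then a else z) (sym (tile-sym t p lp i))))))) ,
          trans (tile-sym (suc t) p rc i) (trans (cong (λ z → cellAt (right z) p) tape≡) (trans (right-move a τ m p)
            (cong₃ (rightChoice m) (sym (tile-sym t p rc i)) (sym (tile-sym t p rn i))
              (trans (preceding-if (right τ) p a) (cong (λ z → if p ≡ᵇ 0 then a else z) (sym (tile-sym t p rp i))))))) ,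
          head≡ i p tape≡
          where
          next≡ : cs (suc t) ≡ c′
          next≡ = cong (Maybe.maybe′ id (cs t)) s
          head≡ : ∀ i p → tapeAt (cs (suc t)) i ≡ move (proj₂ (lookup acts i)) (write (proj₁ (lookup acts i)) (tapeAt (cs t) i)) →
                  T (p ≡ᵇ 0) → symOf (tile (suc t) p) hd i ≡ newHead (proj₂ (lookup acts i)) (proj₁ (lookup acts i)) (tile t p) i
          head≡ i zero tape≡ _ = trans (tile-sym (suc t) 0 hd i) (trans (cong head tape≡) (trans (head-move _ (tapeAt (cs t) i) (proj₂ (lookup acts i)))
            (cong₂ (headChoice (proj₂ (lookup acts i)) (proj₁ (lookup acts i))) (sym (tile-sym t 0 lc i)) (sym (tile-sym t 0 rc i)))))

      tile-ok : ∀ dir t p → ¬ T (bad ks dir t p (tile t p) (tile (below dir t) (after dir p)))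
      tile-ok zero    t p = not-in (beside? (t ≡ᵇ 0) (tokAt ks 0) (tokAt ks (suc p)) (tile t p) (tile t (suc p))) (beside t p)
      tile-ok (suc _) t p = not-in (next? (p ≡ᵇ 0) (tile t p) (tile (suc t) p) (δ (stateOf (tile t p)) (heads (tile t p)))) (above t p)

    module _ (B : ℕ) (β : ℕ → ℕ → Fin d)
             (ok : ∀ dir t p → t < B → p < B → below dir t < B × after dir p < B → ¬ T (bad ks dir t p (β t p) (β (below dir t) (after dir p)))) where

      hor : ∀ t p → t < B → suc p < B → Beside (t ≡ᵇ 0) (tokAt ks 0) (tokAt ks (suc p)) (β t p) (β t (suc p))
      hor t p t< p< = not-out (beside? (t ≡ᵇ 0) (tokAt ks 0) (tokAt ks (suc p)) (β t p) (β t (suc p))) (ok zero t p t< (ℕₚ.<⇒≤ p<) (t< , p<))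

      ver : ∀ t p → suc t < B → p < B → Above (p ≡ᵇ 0) (β t p) (β (suc t) p)
      ver t p t< p< = not-out (next? (p ≡ᵇ 0) (β t p) (β (suc t) p) (δ (stateOf (β t p)) (heads (β t p)))) (ok (suc zero) t p (ℕₚ.<⇒≤ t<) p< (t< , p<))

      record Row (p : ℕ) (c : C) (x : Fin d) : Set where
        field
          state≡ : stateOf x ≡ state c
          head≡  : ∀ i → symOf x hd i ≡ head (tapeAt c i)
          left≡  : ∀ i → symOf x lc i ≡ cellAt (left (tapeAt c i)) p
          right≡ : ∀ i → symOf x rc i ≡ cellAt (right (tapeAt c i)) p
      open Row

      -- The contents of a column come from the next column in the row above, so one column less is
      -- under control after each step. What is known of the grid is a triangle.
      Rows : ℕ → C → Set
      Rows t c = ∀ p → p + suc t < B → Row p c (β t p)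

      row-heads : ∀ {p c x} → Row p c x → heads x ≡ headsOf c
      row-heads {c = c} {x} r = vec-ext _ _ λ i → trans (Vecₚ.lookup∘tabulate (symOf x hd) i) (trans (head≡ r i) (sym (Vecₚ.lookup-map i head (tapes c))))

      inside : ∀ {p t} → p + suc (suc t) < B → (suc p + suc t < B) × (p + suc t < B) × (suc t < B) × (suc p < B)
      inside {p} {t} l =
        subst (_< B) (ℕₚ.+-suc p (suc t)) l ,
        ℕₚ.<-trans (ℕₚ.+-monoʳ-< p ℕₚ.≤-refl) l ,
        ℕₚ.<-trans ℕₚ.≤-refl (ℕₚ.≤-<-trans (ℕₚ.m≤n+m (suc (suc t)) p) l) ,
        ℕₚ.≤-<-trans (ℕₚ.≤-trans (ℕₚ.m≤m+n (suc p) (suc t)) (ℕₚ.≤-reflexive (sym (ℕₚ.+-suc p (suc t))))) l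

      scanned : ∀ t p → t < B → p < B → ∀ i → symOf (β t p) hd i ≡ symOf (β t 0) hd i
      scanned t zero    t< p< i = refl
      scanned t (suc p) t< p< i = trans (sym (proj₁ (proj₁ (proj₂ (hor t p t< p<)) i))) (scanned t p t< (ℕₚ.<⇒≤ p<) i)

      rows-step : ∀ {t c c′} → step M c ≡ just c′ → Rows t c → Rows (suc t) c′
      rows-step {t} {c} {c′} s rows p l with stepped c s
      ... | q , acts , e , q≡ , moved″ = record
        { state≡ = trans (proj₁ (at p (proj₁ (proj₂ (inside l))) (suc-p<))) (sym q≡)
        -- The scanned symbols are prescribed in the first column and copied along the row.
        ; head≡  = λ i → trans (scanned (suc t) p suc-t< (ℕₚ.<⇒≤ suc-p<) i)
            (trans (proj₂ (proj₂ (proj₂ (at 0 (ℕₚ.≤-<-trans (ℕₚ.m≤n+m (suc t) p) (proj₁ (proj₂ (inside l)))) (ℕₚ.≤-<-trans (s≤s z≤n) suc-p<)) i)) tt)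
              (trans (cong₂ (headChoice (m i) (a i)) (left≡ r₀ i) (right≡ r₀ i)) (sym (trans (cong head (moved″ i)) (head-move (a i) (tapeAt c i) (m i))))))
        ; left≡  = λ i → trans (proj₁ (proj₂ (at p (proj₁ (proj₂ (inside l))) suc-p<) i))
            (trans (cong₃ (leftChoice (m i)) (left≡ r i) (trans (proj₁ (proj₂ (windows p t< suc-p< i))) (left≡ r₊ i)) (previous-left p (proj₁ (proj₂ (inside l))) i))
              (sym (trans (cong (λ z → cellAt (left z) p) (moved″ i)) (left-move (a i) (tapeAt c i) (m i) p))))
        ; right≡ = λ i → trans (proj₁ (proj₂ (proj₂ (at p (proj₁ (proj₂ (inside l))) suc-p<) i)))
            (trans (cong₃ (rightChoice (m i)) (right≡ r i) (trans (proj₁ (proj₂ (proj₂ (proj₂ (windows p t< suc-p< i))))) (right≡ r₊ i)) (previous-right p (proj₁ (proj₂ (inside l))) i))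
              (sym (trans (cong (λ z → cellAt (right z) p) (moved″ i)) (right-move (a i) (tapeAt c i) (m i) p))))
        }
        where
        a : Fin W → Sy
        a i = proj₁ (lookup acts i)
        m : Fin W → Move
        m i = proj₂ (lookup acts i)
        suc-p< = proj₂ (proj₂ (proj₂ (inside l)))
        suc-t< = proj₁ (proj₂ (proj₂ (inside l)))
        t< = ℕₚ.<⇒≤ suc-t<
        r  = rows p (proj₁ (proj₂ (inside l)))
        r₊ = rows (suc p) (proj₁ (inside l))
        r₀ = rows 0 (ℕₚ.≤-<-trans (ℕₚ.m≤n+m (suc t) p) (proj₁ (proj₂ (inside l))))
        windows : ∀ p → t < B → suc p < B → ∀ i → _
        windows p t< p< = proj₁ (proj₂ (hor t p t< p<))
        at : ∀ p → p + suc t < B → suc p < B → Next (p ≡ᵇ 0) (β t p) (β (suc t) p) (just (q , acts))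
        at p l p< = subst (Next (p ≡ᵇ 0) (β t p) (β (suc t) p)) (trans (cong₂ δ (state≡ (rows p l)) (row-heads (rows p l))) e) (ver t p suc-t< (ℕₚ.<⇒≤ p<))
        previous-left : ∀ p → p + suc t < B → ∀ i → (if p ≡ᵇ 0 then a i else symOf (β t p) lp i) ≡ preceding (left (tapeAt c i)) p (a i)
        previous-left zero    l i = refl
        previous-left (suc p) l i = trans (sym (proj₁ (proj₂ (proj₂ (windows p t< (ℕₚ.≤-<-trans (ℕₚ.m≤m+n (suc p) (suc t)) l) i))))) (left≡ (rows p (ℕₚ.<⇒≤ l)) i)
        previous-right : ∀ p → p + suc t < B → ∀ i → (if p ≡ᵇ 0 then a i else symOf (β t p) rp i) ≡ preceding (right (tapeAt c i)) p (a i)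
        previous-right zero    l i = refl
        previous-right (suc p) l i = trans (sym (proj₂ (proj₂ (proj₂ (proj₂ (windows p t< (ℕₚ.≤-<-trans (ℕₚ.m≤m+n (suc p) (suc t)) l) i)))))) (right≡ (rows p (ℕₚ.<⇒≤ l)) i)

      rows-accept : ∀ {n c d t} → HaltsIn M n c d → Rows t c → suc (t + n) < B → Accepts d
      rows-accept {c = c} {t = t} (halted s) rows l =
        let r = rows 0 t<
            h , n = subst (Next true (β t 0) (β (suc t) 0)) (trans (cong₂ δ (state≡ r) (row-heads r)) (step-nothing⁻¹ c s)) (ver t 0 t< (ℕₚ.≤-<-trans z≤n t<)) tt
        in trans (sym (head≡ r zero)) h , subst (T ∘ notBit) (right≡ r zero) n
        where
        t< : suc t < B
        t< = subst (λ z → suc z < B) (ℕₚ.+-identityʳ t) l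
      rows-accept {n = suc n} {t = t} (next s h) rows l = rows-accept h (rows-step s rows) (subst (λ z → suc z < B) (ℕₚ.+-suc t n) l)

      -- The first row spells out an input, with `u` in the free cells. The machine being
      -- deterministic, the further rows can only be its run on that input.
      guess : 1 < B → ∃[ u ] (length u ≤ P × (∀ {n e} → suc n < B → HaltsIn M n (initial M (b ∷ v ++ u)) e → Accepts e))
      guess 1<B = u , u≤ , λ l h → rows-accept h rows₀ l
        where
        firstRow : ∀ p → suc p < B → Initially (tokAt ks 0) (tokAt ks (suc p)) (β 0 p)
        firstRow p l = proj₂ (proj₂ (hor 0 p (ℕₚ.≤-<-trans z≤n l) l)) tt
        s : ℕ → Sy
        s zero    = symOf (β 0 0) hd zero
        s (suc p) = symOf (β 0 p) rc zero
        s-fits : ∀ n → n < B → T (fits (tokAt ks n) (s n))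
        s-fits zero    l = proj₁ (proj₂ (firstRow 0 1<B))
        s-fits (suc p) l = proj₁ (proj₂ (proj₂ (firstRow p l)))
        s-blank : ∀ n → suc n < B → s n ≡ blank → s (suc n) ≡ blank
        s-blank zero    l e with subst (T ∘ fits (fix b)) e (proj₁ (proj₂ (firstRow 0 1<B)))
        ... | ()
        s-blank (suc p) l e = trans (sym (proj₁ (proj₂ (proj₂ (proj₂ (proj₁ (proj₂ (hor 0 p (ℕₚ.≤-<-trans z≤n l) (ℕₚ.<⇒≤ l))) zero))))))
          (proj₁ (proj₂ (proj₂ (proj₂ (firstRow p (ℕₚ.<⇒≤ l))))) e)
        found = extract P (b ∷ v) B s s-fits s-blank
        u  = proj₁ found
        u≤ = proj₁ (proj₂ found)
        rows₀ : Rows 0 (initial M (b ∷ v ++ u))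
        rows₀ p l with firstRow p (subst (_< B) (ℕₚ.+-comm p 1) l)
        ... | q , k₀ , k , _ , l₀ , others = record
          { state≡ = q
          ; head≡  = λ { zero → toWitness {a? = symOf (β 0 p) hd zero ≟ₛ bit b} k₀ ; (suc i) → trans (proj₁ (others i)) (sym (cong head (work-tape (b ∷ v ++ u) i))) }
          ; left≡  = λ { zero → l₀ ; (suc i) → trans (proj₁ (proj₂ (others i))) (sym (cong (λ t → cellAt (left t) p) (work-tape (b ∷ v ++ u) i))) }
          ; right≡ = λ { zero → proj₂ (proj₂ found) (suc p) (subst (_< B) (ℕₚ.+-comm p 1) l)
                       ; (suc i) → trans (proj₂ (proj₂ (others i))) (sym (cong (λ t → cellAt (right t) p) (work-tape (b ∷ v ++ u) i))) }
          }

-- Reasoning about register programs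

-- Polynomial expressions in the input length, as numbers of repetitions
data PE : Set where
  K    : ℕ → PE
  N    : PE
  _⊕_  : PE → PE → PE
  _⊗_  : PE → PE → PE

⟦_⟧ : PE → ℕ → ℕ
⟦ K c ⟧   n = c
⟦ N ⟧     n = n
⟦ p ⊕ q ⟧ n = ⟦ p ⟧ n + ⟦ q ⟧ n
⟦ p ⊗ q ⟧ n = ⟦ p ⟧ n * ⟦ q ⟧ n

powE : PE → ℕ → PE
powE e zero    = K 1
powE e (suc k) = e ⊗ powE e k

boundE : ℕ → ℕ → PE → PE
boundE c k e = (K c ⊗ powE e k) ⊕ K c

⟦boundE⟧ : ∀ c k e n → ⟦ boundE c k e ⟧ n ≡ polyBound c k (⟦ e ⟧ n)
⟦boundE⟧ c k e n = cong (λ z → c * z + c) (pow k)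
  where
  pow : ∀ k → ⟦ powE e k ⟧ n ≡ ⟦ e ⟧ n ^ k
  pow zero    = refl
  pow (suc k) = cong (⟦ e ⟧ n *_) (pow k)

times : ∀ {r} → ℕ → Cmd r → Cmd r
times zero    c = skip
times (suc k) c = c ▸ times k c

rep : ∀ {r} → PE → Cmd r → Cmd r
rep (K k)   c = times k c
rep N       c = loop c
rep (p ⊕ q) c = rep p c ▸ rep q c
rep (p ⊗ q) c = rep p (rep q c)

seqs : ∀ {r} → List (Cmd r) → Cmd r
seqs []       = skip
seqs (c ∷ cs) = c ▸ seqs cs

iter-* : {A : Set} (a b : ℕ) (f : A → A) (x : A) → iter (a * b) f x ≡ iter a (iter b f) x
iter-* zero    b f x = refl
iter-* (suc a) b f x = trans (iter-+ b (a * b) f x) (iter-* a b f (iter b f x))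

iter-last : {A : Set} (m : ℕ) (f : A → A) (x : A) → iter (suc m) f x ≡ f (iter m f x)
iter-last zero    f x = refl
iter-last (suc m) f x = iter-last m f (f x)

acc! : {A : Set} → (ℕ → A → A) → ℕ → A → A
acc! step zero    a = a
acc! step (suc m) a = step m (acc! step m a)

record Runs {r} (w : Word) (c : Cmd r) (σ τ : State r) : Set where
  constructor runs
  field
    run≡ : run w c σ ≡ τ
open Runs public

module _ {r : ℕ} {w : Word} where

  private
    n : ℕ
    n = length w

  infixr 5 _⟫_
  _⟫_ : ∀ {c d : Cmd r} {σ τ υ} → Runs w c σ τ → Runs w d τ υ → Runs w (c ▸ d) σ υ
  _⟫_ {d = d} (runs e) (runs f) = runs (trans (cong (run w d) e) f)

  to : ∀ {c : Cmd r} {σ τ υ} → Runs w c σ τ → τ ≡ υ → Runs w c σ υ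
  to (runs e) f = runs (trans e f)

  rep-run : ∀ e (c : Cmd r) σ → run w (rep e c) σ ≡ iter (⟦ e ⟧ n) (run w c) σ
  rep-run (K zero)    c σ = refl
  rep-run (K (suc k)) c σ = rep-run (K k) c (run w c σ)
  rep-run N       c σ = refl
  rep-run (p ⊕ q) c σ = trans (cong (run w (rep q c)) (rep-run p c σ))
    (trans (rep-run q c _) (sym (iter-+ (⟦ p ⟧ n) (⟦ q ⟧ n) (run w c) σ)))
  rep-run (p ⊗ q) c σ = trans (rep-run p (rep q c) σ)
    (trans (iter-cong (⟦ p ⟧ n) (rep-run q c) σ) (sym (iter-* (⟦ p ⟧ n) (⟦ q ⟧ n) (run w c) σ)))

  rep-runs : ∀ e {c : Cmd r} {σ τ} → iter (⟦ e ⟧ n) (run w c) σ ≡ τ → Runs w (rep e c) σ τ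
  rep-runs e {c} {σ} h = runs (trans (rep-run e c σ) h)

  -- The family S lists the states at the start of the rounds of a loop: the first
  -- index is the loop variable, the second the data that the loop accumulates.
  module _ {A : Set} (S : ℕ → A → State r) where

    iter-acc : ∀ {F step} m a → (∀ i a → i < m → F (S i a) ≡ S (suc i) (step i a)) → iter m F (S 0 a) ≡ S m (acc! step m a)
    iter-acc         zero    a h = refl
    iter-acc {F} (suc m) a h = trans (iter-last m F (S 0 a))
      (trans (cong F (iter-acc m a (λ i a l → h i a (ℕₚ.m≤n⇒m≤1+n l)))) (h m _ ℕₚ.≤-refl))

    for-run : ∀ e {body nxt rst : Cmd r} step a → (∀ i a → i < ⟦ e ⟧ n → Runs w body (S i a) (S i (step i a))) →
              (∀ i a → Runs w nxt (S i a) (S (suc i) a)) → (∀ i a → Runs w rst (S i a) (S 0 a)) →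
              Runs w (rep e (body ▸ nxt) ▸ rst) (S 0 a) (S 0 (acc! step (⟦ e ⟧ n) a))
    for-run e step a b x z =
      rep-runs e (iter-acc (⟦ e ⟧ n) a (λ i a l → run≡ (b i a l ⟫ x i (step i a)))) ⟫ z _ _

    -- x and y are the registers of the loop variable and the bound.
    upto-run : ∀ {body : Cmd r} {x y} step Y a → Y ≤ n → (∀ i a → lookup (regs (S i a)) x ≡ i) → (∀ i a → lookup (regs (S i a)) y ≡ Y) →
               (∀ i a → i < Y → Runs w body (S i a) (S i (step i a))) →
               (∀ i a → Runs w (inc x) (S i a) (S (suc i) a)) → (∀ i a → Runs w (zer x) (S i a) (S 0 a)) →
               Runs w (loop (ifeq x y skip (body ▸ inc x)) ▸ zer x) (S 0 a) (S 0 (acc! step Y a))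
    upto-run {body} {x} {y} step Y a Y≤n lx ly b nx zx = runs all ⟫ zx _ _
      where
      F : State r → State r
      F = run w (ifeq x y skip (body ▸ inc x))
      moves : ∀ i a → i < Y → F (S i a) ≡ S (suc i) (step i a)
      moves i a l rewrite lx i a | ly i a | dec-false (T? (i ≡ᵇ Y)) (ℕₚ.<⇒≢ l ∘ ℕₚ.≡ᵇ⇒≡ i Y) =
        run≡ (b i a l ⟫ nx i (step i a))
      rests : ∀ a → F (S Y a) ≡ S Y a
      rests a rewrite lx Y a | ly Y a | dec-true (T? (Y ≡ᵇ Y)) (ℕₚ.≡⇒≡ᵇ Y Y refl) = refl
      -- A loop always runs `length w` times; once the bound is reached, the remaining rounds change
      -- nothing.
      idle : ∀ m a → iter m F (S Y a) ≡ S Y a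
      idle zero    a = refl
      idle (suc m) a = trans (cong (iter m F) (rests a)) (idle m a)
      all : iter n F (S 0 a) ≡ S Y (acc! step Y a)
      all = trans (cong (λ z → iter z F (S 0 a)) (sym (ℕₚ.m+[n∸m]≡n Y≤n)))
        (trans (iter-+ Y (n ∸ Y) F (S 0 a)) (trans (cong (iter (n ∸ Y) F) (iter-acc Y a moves)) (idle (n ∸ Y) _)))

data Test (r : ℕ) : Set where
  eqT : Fin r → Fin r → Test r
  inT : Fin r → Bool → Test r

eval : ∀ {r} → Word → State r → Test r → Bool
eval w σ (eqT i j) = lookup (regs σ) i ≡ᵇ lookup (regs σ) j
eval w σ (inT i b) = hit w (lookup (regs σ) i) b

branchOn : ∀ {r} → Test r → Cmd r → Cmd r → Cmd r
branchOn (eqT i j) = ifeq i j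
branchOn (inT i b) = ifin i b

branch-run : ∀ {r} w (t : Test r) c d σ → run w (branchOn t c d) σ ≡ (if eval w σ t then run w c σ else run w d σ)
branch-run w (eqT i j) c d σ = refl
branch-run w (inT i b) c d σ = refl

-- Opaque, as a decision tree unfolds to exponential size.
opaque
  decide : ∀ {r k} → Vec (Test r) k → (Vec Bool k → Cmd r) → Cmd r
  decide []       g = g []
  decide (t ∷ ts) g = branchOn t (decide ts (λ bs → g (true ∷ bs))) (decide ts (λ bs → g (false ∷ bs)))

  decide-run : ∀ {r k} w (ts : Vec (Test r) k) g σ → run w (decide ts g) σ ≡ run w (g (Vec.map (eval w σ) ts)) σ
  decide-run w []       g σ = refl
  decide-run w (t ∷ ts) g σ rewrite branch-run w t (decide ts (λ bs → g (true ∷ bs))) (decide ts (λ bs → g (false ∷ bs))) σ with eval w σ t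
  ... | true  = decide-run w ts (λ bs → g (true ∷ bs)) σ
  ... | false = decide-run w ts (λ bs → g (false ∷ bs)) σ

decide-runs : ∀ {r k w} (ts : Vec (Test r) k) g σ {τ} → Runs w (g (Vec.map (eval w σ) ts)) σ τ → Runs w (decide ts g) σ τ
decide-runs {w = w} ts g σ (runs e) = runs (trans (decide-run w ts g σ) e)

-- Concatenations over finite ranges

catF : ∀ {A : Set} n → (Fin n → List A) → List A
catF zero    g = []
catF (suc n) g = g zero ++ catF n (g ∘ suc)

up : ∀ {A : Set} → ℕ → (ℕ → List A) → List A
up m g = catF m (g ∘ toℕ)

module _ {A : Set} where

  catF-cong : ∀ n {f g : Fin n → List A} → f ≗ g → catF n f ≡ catF n g
  catF-cong zero    e = refl
  catF-cong (suc n) e = cong₂ _++_ (e zero) (catF-cong n (e ∘ suc))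

  catF-+ : ∀ a b (g : Fin (a + b) → List A) → catF (a + b) g ≡ catF a (λ i → g (i ↑ˡ b)) ++ catF b (λ j → g (a ↑ʳ j))
  catF-+ zero    b g = refl
  catF-+ (suc a) b g = trans (cong (g zero ++_) (catF-+ a b (g ∘ suc))) (sym (Listₚ.++-assoc (g zero) _ _))

  catF-* : ∀ a b (g : Fin (a * b) → List A) → catF (a * b) g ≡ catF a (λ i → catF b (λ j → g (combine i j)))
  catF-* zero    b g = refl
  catF-* (suc a) b g = trans (catF-+ b (a * b) g) (cong (catF b (λ j → g (j ↑ˡ (a * b))) ++_) (catF-* a b (λ j → g (b ↑ʳ j))))

  up-suc : ∀ m (g : ℕ → List A) → up (suc m) g ≡ up m g ++ g m
  up-suc zero    g = Listₚ.++-identityʳ (g 0)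
  up-suc (suc m) g = trans (cong (g 0 ++_) (up-suc m (g ∘ suc))) (sym (Listₚ.++-assoc (g 0) _ _))

  acc-++ : ∀ m (g : ℕ → List A) o → acc! (λ i o → o ++ g i) m o ≡ o ++ up m g
  acc-++ zero    g o = sym (Listₚ.++-identityʳ o)
  acc-++ (suc m) g o = trans (cong (_++ g m) (acc-++ m g o)) (trans (Listₚ.++-assoc o (up m g) (g m)) (cong (o ++_) (sym (up-suc m g))))

  map-allFin : ∀ {B : Set} n (h : Fin n → B) (g : B → A) → map g (List.tabulate h) ≡ catF n (λ i → [ g (h i) ])
  map-allFin zero    h g = refl
  map-allFin (suc n) h g = cong (g (h zero) ∷_) (map-allFin n (h ∘ suc) g)

  map-product : ∀ {B C : Set} n (h : Fin n → B) (ys : List C) (g : B × C → A) →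
                map g (cartesianProduct (List.tabulate h) ys) ≡ catF n (λ i → map (λ y → g (h i , y)) ys)
  map-product zero    h ys g = refl
  map-product (suc n) h ys g = trans (Listₚ.map-++ g (map (h zero ,_) ys) _)
    (cong₂ _++_ (sym (Listₚ.map-∘ ys)) (map-product n (h ∘ suc) ys g))

acc-∨ : ∀ m (g : ℕ → Bool) f → acc! (λ i f → f ∨ g i) m f ≡ f ∨ anyBelow m g
acc-∨ zero    g f = sym (Boolₚ.∨-identityʳ f)
acc-∨ (suc m) g f = trans (cong (_∨ g m) (acc-∨ m g f)) (Boolₚ.∨-assoc f (anyBelow m g) (g m))

∃ᵇ-cong : ∀ {n} {P Q : Fin n → Bool} → P ≗ Q → ∃ᵇ P ≡ ∃ᵇ Q
∃ᵇ-cong e = bool-≡ (λ h → let x , p = ∃ᵇ-out h in ∃ᵇ-in x (subst T (e x) p)) (λ h → let x , p = ∃ᵇ-out h in ∃ᵇ-in x (subst T (sym (e x)) p))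

matrixBits : ∀ {V} → (Fin V → Fin V → Bool) → Word
matrixBits {V} h = catF V λ u → catF V λ v → [ h u v ]

encode-bits : ∀ {V} (G : SignedGraph V) → encode G ≡ replicate V true ++ false ∷ matrixBits (edge G Sign.+) ++ matrixBits (edge G Sign.-)
encode-bits {V} G = cong₂ (λ a b → replicate V true ++ false ∷ a ++ b) (bits Sign.+) (bits Sign.-)
  where
  bits : ∀ s → map (λ (x , y) → edge G s x y) (cartesianProduct (allFin V) (allFin V)) ≡ matrixBits (edge G s)
  bits s = trans (map-product V id (allFin V) (λ (x , y) → edge G s x y)) (catF-cong V λ u → map-allFin V id (edge G s u))

hit-here : ∀ (pre : Word) b u → hit (pre ++ b ∷ u) (length pre) true ≡ b
hit-here []        b u = refl
hit-here (_ ∷ pre) b u = hit-here pre b u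

-- A register program cannot index a list of tokens. It lets them pass, counts them and keeps the
-- one with number `k`.
scanStep : ℕ → ℕ × Tok → Tok → ℕ × Tok
scanStep k (a , τ) κ = suc a , (if a ≡ᵇ k then κ else τ)

doubled : Word → List Tok
doubled []      = []
doubled (b ∷ w) = fix b ∷ fix b ∷ doubled w

tokens-doubled : ∀ w P → tokens (pair w []) P ≡ doubled w ++ fix false ∷ fix true ∷ replicate P free
tokens-doubled []      P = refl
tokens-doubled (b ∷ w) P = cong (λ z → fix b ∷ fix b ∷ z) (tokens-doubled w P)

foldl-++ : ∀ {A B : Set} (f : A → B → A) a xs ys → foldl f a (xs ++ ys) ≡ foldl f (foldl f a xs) ys
foldl-++ f a []       ys = refl
foldl-++ f a (x ∷ xs) ys = foldl-++ f (f a x) xs ys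

scan-late : ∀ ks k a τ → k < a → proj₂ (foldl (scanStep k) (a , τ) ks) ≡ τ
scan-late []       k a τ l = refl
scan-late (κ ∷ ks) k a τ l = trans (scan-late ks k (suc a) _ (ℕₚ.m≤n⇒m≤1+n l))
  (cong (λ b → if b then κ else τ) (dec-false (T? (a ≡ᵇ k)) (λ h → ℕₚ.<⇒≢ l (sym (ℕₚ.≡ᵇ⇒≡ a k h)))))

scan-tokAt : ∀ ks k a → proj₂ (foldl (scanStep (k + a)) (a , end) ks) ≡ tokAt ks k
scan-tokAt []       k       a = refl
scan-tokAt (κ ∷ ks) zero    a = trans (scan-late ks a (suc a) _ ℕₚ.≤-refl)
  (cong (λ b → if b then κ else end) (dec-true (T? (a ≡ᵇ a)) (ℕₚ.≡⇒≡ᵇ a a refl)))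
scan-tokAt (κ ∷ ks) (suc k) a =
  trans (cong₂ (λ j τ → proj₂ (foldl (scanStep j) (suc a , τ) ks)) (sym (ℕₚ.+-suc k a))
          (cong (λ b → if b then κ else end) (dec-false (T? (a ≡ᵇ suc k + a)) (λ h → ℕₚ.m≢1+n+m a (ℕₚ.≡ᵇ⇒≡ a (suc k + a) h)))))
        (scan-tokAt ks k (suc a))

seqs-run : ∀ {r w} (S : Word → State r) m {c : Fin m → Cmd r} {g : Fin m → Word} o →
           (∀ κ o → Runs w (c κ) (S o) (S (o ++ g κ))) → Runs w (seqs (List.tabulate c)) (S o) (S (o ++ catF m g))
seqs-run S zero    o h = runs (cong S (sym (Listₚ.++-identityʳ o)))
seqs-run S (suc m) {c} {g} o h = to (h zero o ⟫ seqs-run S m (o ++ g zero) (h ∘ suc)) (cong S (Listₚ.++-assoc o (g zero) _))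

-- The program that writes down the graph of a tableau instance
module Reduction {N′ : ℕ} (target : SignedGraph N′) (d k : ℕ)
                 (pairing : Fin (suc k) → Fin d × Fin d) (unpair : Fin d → Fin d → Fin (suc k))
                 (pair-unpair : ∀ x y → pairing (unpair x y) ≡ (x , y)) (unpair-pair : ∀ e → uncurry unpair (pairing e) ≡ e)
                 (some : Fin d) (other : Fin d → Fin d) (other≢ : ∀ x → other x ≢ x)
                 (badAt : Fin 2 → Bool → Bool → Tok → Tok → Fin d → Fin d → Bool) (Pe Be : PE) where

  module Γ = Gadget target d k pairing unpair pair-unpair unpair-pair some other other≢
  open Γ using (Kind; kinds; kind; place; Place; placed; adjacent; denotes)

  badOf : List Tok → Fin 2 → ℕ → ℕ → Fin d → Fin d → Bool
  badOf ks δ t p = badAt δ (t ≡ᵇ 0) (p ≡ᵇ 0) (tokAt ks 0) (tokAt ks (suc p))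

  module _ (w : Word) where
    toks : List Tok
    toks = tokens (pair w []) (⟦ Pe ⟧ (length w))

    module I = Γ.Instance (badOf toks) (⟦ Be ⟧ (length w))

  flag : Bool → ℕ
  flag true  = 1
  flag false = 0

  isT isF isFree : Tok → Bool
  isT (fix true)  = true
  isT _           = false
  isF (fix false) = true
  isF _           = false
  isFree free     = true
  isFree _        = false

  zero′ : Fin 15
  zero′ = zero

  rt₁ rq₁ rt₂ rq₂ rt rq rf ra ri rt⁺ rq⁺ rT rF rU : Fin 15
  rt₁ = suc zero
  rq₁ = suc rt₁′ where rt₁′ = suc zero
  rt₂ = suc (suc (suc zero))
  rq₂ = suc (suc (suc (suc zero)))
  rt  = suc (suc (suc (suc (suc zero))))
  rq  = suc (suc (suc (suc (suc (suc zero)))))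
  rf  = suc (suc (suc (suc (suc (suc (suc zero))))))
  ra  = suc (suc (suc (suc (suc (suc (suc (suc zero)))))))
  ri  = suc (suc (suc (suc (suc (suc (suc (suc (suc zero))))))))
  rt⁺ = suc (suc (suc (suc (suc (suc (suc (suc (suc (suc zero)))))))))
  rq⁺ = suc (suc (suc (suc (suc (suc (suc (suc (suc (suc (suc zero))))))))))
  rT  = suc (suc (suc (suc (suc (suc (suc (suc (suc (suc (suc (suc zero)))))))))))
  rF  = suc (suc (suc (suc (suc (suc (suc (suc (suc (suc (suc (suc (suc zero))))))))))))
  rU  = suc (suc (suc (suc (suc (suc (suc (suc (suc (suc (suc (suc (suc (suc zero)))))))))))))

  -- Registers can only be compared for equality, so `suc t` and `suc p` are kept next to `t` and
  -- `p`. Three flags code a token; `end` is the one that sets none.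
  Q : (t₁ p₁ t₂ p₂ t p : ℕ) → Bool → (a i : ℕ) → Tok → Word → State 15
  Q t₁ p₁ t₂ p₂ t p f a i τ o = mkState
    (0 ∷ t₁ ∷ p₁ ∷ t₂ ∷ p₂ ∷ t ∷ p ∷ flag f ∷ a ∷ i ∷ suc t ∷ suc p ∷ flag (isT τ) ∷ flag (isF τ) ∷ flag (isFree τ) ∷ []) (const false) o

  forP : Cmd 15 → Cmd 15 → Cmd 15 → Cmd 15
  forP body nxt rst = rep Be (body ▸ nxt) ▸ rst

  setTok : Tok → Cmd 15
  setTok (fix true)  = zer rT ▸ inc rT ▸ zer rF ▸ zer rU
  setTok (fix false) = zer rT ▸ zer rF ▸ inc rF ▸ zer rU
  setTok free        = zer rT ▸ zer rF ▸ zer rU ▸ inc rU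
  setTok end         = zer rT ▸ zer rF ▸ zer rU

  seeTok : Tok → Cmd 15
  seeTok κ = ifeq ra rq⁺ (setTok κ) skip ▸ inc ra

  -- The tokens are generated on the fly: each input bit twice, the separator of the pair, then the
  -- free cells.
  scanToks : Cmd 15
  scanToks = loop (ifin ri true (seeTok (fix true) ▸ seeTok (fix true)) (seeTok (fix false) ▸ seeTok (fix false)) ▸ inc ri) ▸
             seeTok (fix false) ▸ seeTok (fix true) ▸ rep Pe (seeTok free)

  tests : Vec (Test 15) 18
  tests = eqT rt₁ zero′ ∷ eqT rq₁ zero′ ∷ eqT rt₁ rt ∷ eqT rq₁ rq ∷ eqT rt₁ rt⁺ ∷ eqT rq₁ rq⁺ ∷
          eqT rt₂ zero′ ∷ eqT rq₂ zero′ ∷ eqT rt₂ rt ∷ eqT rq₂ rq ∷ eqT rt₂ rt⁺ ∷ eqT rq₂ rq⁺ ∷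
          eqT rt zero′ ∷ eqT rq zero′ ∷ inT zero′ true ∷ eqT rT zero′ ∷ eqT rF zero′ ∷ eqT rU zero′ ∷ []

  placeB : Fin 2 → (o₁ o₂ h₁ h₂ n₁ n₂ : Bool) → Place
  placeB zero    o₁ o₂ h₁ h₂ n₁ n₂ = place (o₁ ∧ o₂) (h₁ ∧ h₂) (h₁ ∧ n₂)
  placeB (suc _) o₁ o₂ h₁ h₂ n₁ n₂ = place (o₁ ∧ o₂) (h₁ ∧ h₂) (n₁ ∧ h₂)

  tokB : Bool → Bool → Bool → Tok
  tokB false _     _     = fix true
  tokB true  false _     = fix false
  tokB true  true  false = free
  tokB true  true  true  = end

  -- Whether some clause at a cell joins two vertices depends on the positions and the input only
  -- through eighteen tests, so it is a finite table over their outcomes.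
  joinsB : Sign → Kind → Kind → Vec Bool 18 → Bool
  joinsB s κ₁ κ₂ (a ∷ b ∷ c ∷ e ∷ f ∷ g ∷ a′ ∷ b′ ∷ c′ ∷ e′ ∷ f′ ∷ g′ ∷ z ∷ y ∷ τ₀ ∷ x₁ ∷ x₂ ∷ x₃ ∷ []) =
    ∃ᵇ λ δ → ∃ᵇ λ ε → uncurry (badAt δ z y (fix τ₀) (tokB x₁ x₂ x₃)) (pairing ε) ∧
      adjacent s (denotes δ ε (placeB δ a b c e f g) κ₁) (denotes δ ε (placeB δ a′ b′ c′ e′ f′ g′) κ₂)

  raise : Cmd 15
  raise = zer rf ▸ inc rf

  visit : Sign → Kind → Kind → Cmd 15
  visit s κ₁ κ₂ = scanToks ▸ decide tests (λ bs → if joinsB s κ₁ κ₂ bs then raise else skip) ▸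
    zer ra ▸ zer ri ▸ zer rT ▸ zer rF ▸ zer rU

  entry : Sign → Kind → Kind → Cmd 15
  entry s κ₁ κ₂ = forP (forP (visit s κ₁ κ₂) (inc rq ▸ inc rq⁺) (zer rq ▸ zer rq⁺ ▸ inc rq⁺)) (inc rt ▸ inc rt⁺) (zer rt ▸ zer rt⁺ ▸ inc rt⁺) ▸
    ifeq rf zero′ (emit false) (emit true) ▸ zer rf

  rows-of : Sign → Kind → Cmd 15
  rows-of s κ₁ = forP (forP (seqs (List.tabulate (λ κ₂ → entry s κ₁ (kind κ₂)))) (inc rq₂) (zer rq₂)) (inc rt₂) (zer rt₂)

  matrixP : Sign → Cmd 15
  matrixP s = forP (forP (seqs (List.tabulate (λ κ₁ → rows-of s (kind κ₁)))) (inc rq₁) (zer rq₁)) (inc rt₁) (zer rt₁)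

  program : Cmd 15
  program = inc rt⁺ ▸ inc rq⁺ ▸ rep ((Be ⊗ Be) ⊗ K kinds) (emit true) ▸ emit false ▸ matrixP Sign.+ ▸ matrixP Sign.-

  module _ (w : Word) where
    private
      n B P : ℕ
      n = length w
      B = ⟦ Be ⟧ n
      P = ⟦ Pe ⟧ n

    module _ (t₁ p₁ t₂ p₂ t p : ℕ) (f : Bool) (o : Word) where
      private
        R : ℕ → ℕ × Tok → State 15
        R i (a , τ) = Q t₁ p₁ t₂ p₂ t p f a i τ o

        setTok-run : ∀ κ a i τ → Runs w (setTok κ) (R i (a , τ)) (R i (a , κ))
        setTok-run (fix true)  a i τ = runs refl
        setTok-run (fix false) a i τ = runs refl
        setTok-run free        a i τ = runs refl
        setTok-run end         a i τ = runs refl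

        σ! : ℕ × Tok → Tok → ℕ × Tok
        σ! = scanStep (suc p)

        seeTok-run : ∀ κ i x → Runs w (seeTok κ) (R i x) (R i (σ! x κ))
        seeTok-run κ i (a , τ) with a ≡ᵇ suc p in h
        ... | true  = runs (trans (cong (λ b → run w (inc ra) (if b then run w (setTok κ) (R i (a , τ)) else R i (a , τ))) h) (cong (run w (inc ra)) (run≡ (setTok-run κ a i τ))))
        ... | false = runs (cong (λ b → run w (inc ra) (if b then run w (setTok κ) (R i (a , τ)) else R i (a , τ))) h)

        twice : ∀ b i x → Runs w (seeTok (fix b) ▸ seeTok (fix b)) (R i x) (R i (foldl σ! x (fix b ∷ fix b ∷ [])))
        twice b i x = seeTok-run (fix b) i x ⟫ seeTok-run (fix b) i (σ! x (fix b))

        readBit : Cmd 15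
        readBit = ifin ri true (seeTok (fix true) ▸ seeTok (fix true)) (seeTok (fix false) ▸ seeTok (fix false)) ▸ inc ri

        round : ∀ b i x → hit w i true ≡ b → run w readBit (R i x) ≡ R (suc i) (foldl σ! x (fix b ∷ fix b ∷ []))
        round true  i x h = trans (cong (λ b → run w (inc ri) (if b then run w (seeTok (fix true) ▸ seeTok (fix true)) (R i x) else run w (seeTok (fix false) ▸ seeTok (fix false)) (R i x))) h)
          (cong (run w (inc ri)) (run≡ (twice true i x)))
        round false i x h = trans (cong (λ b → run w (inc ri) (if b then run w (seeTok (fix true) ▸ seeTok (fix true)) (R i x) else run w (seeTok (fix false) ▸ seeTok (fix false)) (R i x))) h)
          (cong (run w (inc ri)) (run≡ (twice false i x)))

        input : ∀ pre u i x → pre ++ u ≡ w → length pre ≡ i → iter (length u) (run w readBit) (R i x) ≡ R (i + length u) (foldl σ! x (doubled u))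
        input pre []      i x e l = cong (λ j → R j x) (sym (ℕₚ.+-identityʳ i))
        input pre (b ∷ u) i x e l = trans (cong (iter (length u) (run w readBit)) (round b i x (trans (cong₂ (λ v j → hit v j true) (sym e) (sym l)) (hit-here pre b u))))
          (trans (input (pre ++ [ b ]) u (suc i) (foldl σ! x (fix b ∷ fix b ∷ [])) (trans (Listₚ.++-assoc pre [ b ] u) e) (trans (Listₚ.length-++ pre) (trans (ℕₚ.+-comm (length pre) 1) (cong suc l))))
            (cong (λ j → R j (foldl σ! x (doubled (b ∷ u)))) (sym (ℕₚ.+-suc i (length u)))))

        frees : ∀ m i x → iter m (run w (seeTok free)) (R i x) ≡ R i (foldl σ! x (replicate m free))
        frees zero    i x = refl
        frees (suc m) i x = trans (cong (iter m (run w (seeTok free))) (run≡ (seeTok-run free i x))) (frees m i (σ! x free))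

      scanned-toks : ∃[ a ] Runs w scanToks (R 0 (0 , end)) (R n (a , tokAt (toks w) (suc p)))
      scanned-toks = proj₁ (foldl σ! x₂ (replicate P free)) ,
        to (runs (input [] w 0 (0 , end) refl refl) ⟫ seeTok-run (fix false) n x₀ ⟫ seeTok-run (fix true) n x₁ ⟫ rep-runs Pe (frees P n x₂))
          (cong (λ τ → R n (proj₁ (foldl σ! x₂ (replicate P free)) , τ)) found)
        where
        ks = doubled w ++ fix false ∷ fix true ∷ replicate P free
        x₀ = foldl σ! (0 , end) (doubled w)
        x₁ = σ! x₀ (fix false)
        x₂ = σ! x₁ (fix true)
        found : proj₂ (foldl σ! x₂ (replicate P free)) ≡ tokAt (toks w) (suc p)
        found = trans (cong proj₂ (sym (foldl-++ σ! (0 , end) (doubled w) _)))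
          (trans (cong (λ j → proj₂ (foldl (scanStep j) (0 , end) ks)) (sym (ℕₚ.+-identityʳ (suc p))))
            (trans (scan-tokAt ks (suc p) 0) (cong (λ z → tokAt z (suc p)) (sym (tokens-doubled w P)))))

    tok-zero : fix (hit w 0 true) ≡ tokAt (toks w) 0
    tok-zero = go w
      where
      go : ∀ w → fix (hit w 0 true) ≡ tokAt (toks w) 0
      go []      = refl
      go (_ ∷ _) = refl

    tokB-code : ∀ τ → tokB (flag (isT τ) ≡ᵇ 0) (flag (isF τ) ≡ᵇ 0) (flag (isFree τ) ≡ᵇ 0) ≡ τ
    tokB-code (fix true)  = refl
    tokB-code (fix false) = refl
    tokB-code free        = refl
    tokB-code end         = refl

    placeB-placed : ∀ δ t p t′ p′ → placeB δ (t′ ≡ᵇ 0) (p′ ≡ᵇ 0) (t′ ≡ᵇ t) (p′ ≡ᵇ p) (t′ ≡ᵇ suc t) (p′ ≡ᵇ suc p) ≡ placed δ t p t′ p′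
    placeB-placed zero    t p t′ p′ = refl
    placeB-placed (suc _) t p t′ p′ = refl

    joinsB-joined : ∀ s κ₁ κ₂ t₁ p₁ t₂ p₂ t p f a i o →
      joinsB s κ₁ κ₂ (Vec.map (eval w (Q t₁ p₁ t₂ p₂ t p f a i (tokAt (toks w) (suc p)) o)) tests) ≡ I.joinedAt w s t₁ p₁ κ₁ t₂ p₂ κ₂ t p
    joinsB-joined s κ₁ κ₂ t₁ p₁ t₂ p₂ t p f a i o = ∃ᵇ-cong λ δ → ∃ᵇ-cong λ ε →
      cong₂ _∧_ (cong₂ (λ x y → uncurry (badAt δ (t ≡ᵇ 0) (p ≡ᵇ 0) x y) (pairing ε)) tok-zero (tokB-code _))
        (cong₂ (λ x y → adjacent s (denotes δ ε x κ₁) (denotes δ ε y κ₂)) (placeB-placed δ t p t₁ p₁) (placeB-placed δ t p t₂ p₂))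

    visit-run : ∀ s κ₁ κ₂ t₁ p₁ t₂ p₂ t p f o → Runs w (visit s κ₁ κ₂) (Q t₁ p₁ t₂ p₂ t p f 0 0 end o)
                (Q t₁ p₁ t₂ p₂ t p (f ∨ I.joinedAt w s t₁ p₁ κ₁ t₂ p₂ κ₂ t p) 0 0 end o)
    visit-run s κ₁ κ₂ t₁ p₁ t₂ p₂ t p f o = proj₂ (scanned-toks t₁ p₁ t₂ p₂ t p f o) ⟫
      decide-runs tests _ (Q t₁ p₁ t₂ p₂ t p f a n τ o) (subst (λ b → Runs w (if b then raise else skip) (Q t₁ p₁ t₂ p₂ t p f a n τ o) (Q t₁ p₁ t₂ p₂ t p (f ∨ J) a n τ o))
        (sym (joinsB-joined s κ₁ κ₂ t₁ p₁ t₂ p₂ t p f a n o)) (raised J f)) ⟫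
      runs refl
      where
      J : Bool
      J = I.joinedAt w s t₁ p₁ κ₁ t₂ p₂ κ₂ t p
      τ : Tok
      τ = tokAt (toks w) (suc p)
      a : ℕ
      a = proj₁ (scanned-toks t₁ p₁ t₂ p₂ t p f o)
      raised : ∀ b f → Runs w (if b then raise else skip) (Q t₁ p₁ t₂ p₂ t p f a n τ o) (Q t₁ p₁ t₂ p₂ t p (f ∨ b) a n τ o)
      raised true  true  = runs refl
      raised true  false = runs refl
      raised false true  = runs refl
      raised false false = runs refl

    entry-run : ∀ s κ₁ κ₂ t₁ p₁ t₂ p₂ o → Runs w (entry s κ₁ κ₂) (Q t₁ p₁ t₂ p₂ 0 0 false 0 0 end o)
                (Q t₁ p₁ t₂ p₂ 0 0 false 0 0 end (o ++ [ I.joined w s t₁ p₁ κ₁ t₂ p₂ κ₂ ]))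
    entry-run s κ₁ κ₂ t₁ p₁ t₂ p₂ o =
      to (for-run (λ t f → Q t₁ p₁ t₂ p₂ t 0 f 0 0 end o) Be (λ t f → f ∨ anyBelow B (J t)) false
        (λ t f _ → to (for-run (λ p f → Q t₁ p₁ t₂ p₂ t p f 0 0 end o) Be (λ p f → f ∨ J t p) f (λ p f _ → visit-run s κ₁ κ₂ t₁ p₁ t₂ p₂ t p f o) (λ _ _ → runs refl) (λ _ _ → runs refl))
                     (cong (λ f → Q t₁ p₁ t₂ p₂ t 0 f 0 0 end o) (acc-∨ B (J t) f)))
        (λ _ _ → runs refl) (λ _ _ → runs refl))
        (cong (λ f → Q t₁ p₁ t₂ p₂ 0 0 f 0 0 end o) (acc-∨ B (λ t → anyBelow B (J t)) false)) ⟫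
      write-flag (I.joined w s t₁ p₁ κ₁ t₂ p₂ κ₂)
      where
      J : ℕ → ℕ → Bool
      J = I.joinedAt w s t₁ p₁ κ₁ t₂ p₂ κ₂
      write-flag : ∀ f → Runs w (ifeq rf zero′ (emit false) (emit true) ▸ zer rf) (Q t₁ p₁ t₂ p₂ 0 0 f 0 0 end o) (Q t₁ p₁ t₂ p₂ 0 0 false 0 0 end (o ++ [ f ]))
      write-flag true  = runs refl
      write-flag false = runs refl

    Z : ℕ → ℕ → ℕ → ℕ → Word → State 15
    Z t₁ p₁ t₂ p₂ o = Q t₁ p₁ t₂ p₂ 0 0 false 0 0 end o

    for-out : ∀ (S : ℕ → Word → State 15) {body nxt rst} (g : ℕ → Word) o → (∀ i o → Runs w body (S i o) (S i (o ++ g i))) →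
              (∀ i o → Runs w nxt (S i o) (S (suc i) o)) → (∀ i o → Runs w rst (S i o) (S 0 o)) →
              Runs w (forP body nxt rst) (S 0 o) (S 0 (o ++ up B g))
    for-out S g o b x z = to (for-run S Be (λ i o → o ++ g i) o (λ i o _ → b i o) x z) (cong (S 0) (acc-++ B g o))

    rowBits : Sign → ℕ → ℕ → Kind → Word
    rowBits s t₁ p₁ κ₁ = up B λ t₂ → up B λ p₂ → catF kinds λ κ₂ → [ I.joined w s t₁ p₁ κ₁ t₂ p₂ (kind κ₂) ]

    rows-run : ∀ s κ₁ t₁ p₁ o → Runs w (rows-of s κ₁) (Z t₁ p₁ 0 0 o) (Z t₁ p₁ 0 0 (o ++ rowBits s t₁ p₁ κ₁))
    rows-run s κ₁ t₁ p₁ o = for-out (λ t₂ → Z t₁ p₁ t₂ 0) _ o (λ t₂ o → for-out (λ p₂ → Z t₁ p₁ t₂ p₂) _ o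
      (λ p₂ o → seqs-run (Z t₁ p₁ t₂ p₂) kinds o (λ κ₂ o → entry-run s κ₁ (kind κ₂) t₁ p₁ t₂ p₂ o)) (λ _ _ → runs refl) (λ _ _ → runs refl)) (λ _ _ → runs refl) (λ _ _ → runs refl)

    gridBits : Sign → Word
    gridBits s = up B λ t₁ → up B λ p₁ → catF kinds λ κ₁ → rowBits s t₁ p₁ (kind κ₁)

    matrix-run : ∀ s o → Runs w (matrixP s) (Z 0 0 0 0 o) (Z 0 0 0 0 (o ++ gridBits s))
    matrix-run s o = for-out (λ t₁ → Z t₁ 0 0 0) _ o (λ t₁ o → for-out (λ p₁ → Z t₁ p₁ 0 0) _ o
      (λ p₁ o → seqs-run (Z t₁ p₁ 0 0) kinds o (λ κ₁ o → rows-run s (kind κ₁) t₁ p₁ o)) (λ _ _ → runs refl) (λ _ _ → runs refl)) (λ _ _ → runs refl) (λ _ _ → runs refl)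

    coords : ∀ (g : ℕ → ℕ → Kind → Word) →
             catF (I.Vertex w) (λ u → g (I.row w u) (I.col w u) (I.kindOf w u)) ≡ up B λ t → up B λ p → catF kinds λ κ → g t p (kind κ)
    coords g = trans (catF-* (B * B) kinds _) (trans (catF-* B B _) (catF-cong B λ t → catF-cong B λ p → catF-cong kinds λ κ →
      trans (cong (λ (q , κ) → g (toℕ (proj₁ (remQuot {B} B q))) (toℕ (proj₂ (remQuot {B} B q))) (kind κ)) (Finₚ.remQuot-combine {B * B} {kinds} (combine t p) κ))
            (cong (λ (a , b) → g (toℕ a) (toℕ b) (kind κ)) (Finₚ.remQuot-combine {B} {B} t p))))

    grid-matrix : ∀ s → gridBits s ≡ matrixBits (edge (I.graph w) s)
    grid-matrix s = sym (trans (catF-cong (I.Vertex w) λ u → coords (λ t p κ → [ I.joined w s (I.row w u) (I.col w u) (I.kindOf w u) t p κ ]))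
      (coords (rowBits s)))

    ones-run : ∀ m o → iter m (run w (emit true)) (Z 0 0 0 0 o) ≡ Z 0 0 0 0 (o ++ replicate m true)
    ones-run zero    o = cong (Z 0 0 0 0) (sym (Listₚ.++-identityʳ o))
    ones-run (suc m) o = trans (ones-run m (o ++ [ true ])) (cong (Z 0 0 0 0) (Listₚ.++-assoc o [ true ] _))

    program-runs : Runs w program start (Z 0 0 0 0 ((((replicate (I.Vertex w) true) ++ [ false ]) ++ gridBits Sign.+) ++ gridBits Sign.-))
    program-runs = runs refl ⟫ runs refl ⟫ rep-runs ((Be ⊗ Be) ⊗ K kinds) (ones-run (I.Vertex w) []) ⟫ runs refl ⟫ matrix-run Sign.+ _ ⟫ matrix-run Sign.- _

    program-run : out (run w program start) ≡ encode (I.graph w)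
    program-run = trans (cong out (run≡ program-runs))
      (trans (cong₂ (λ a b → ((replicate (I.Vertex w) true ++ [ false ]) ++ a) ++ b) (grid-matrix Sign.+) (grid-matrix Sign.-))
        (trans (Listₚ.++-assoc (replicate (I.Vertex w) true ++ [ false ]) _ _) (trans (Listₚ.++-assoc (replicate (I.Vertex w) true) [ false ] _)
          (sym (encode-bits (I.graph w))))))

  reduction-polyTime : PolyTime (λ w → encode (I.graph w))
  reduction-polyTime = program-polyTime program program-run

-- Tiles as numbers

module Coding (M : TM) where
  open TM M

  opaque
    symbols : ℕ
    symbols = 3 + marks

    symCode : Symbol marks → Fin symbols
    symCode blank       = zero
    symCode (bit false) = suc zero
    symCode (bit true)  = suc (suc zero)
    symCode (mark i)    = suc (suc (suc i))

    symDecode : Fin symbols → Symbol marks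
    symDecode zero                = blank
    symDecode (suc zero)          = bit false
    symDecode (suc (suc zero))    = bit true
    symDecode (suc (suc (suc i))) = mark i

    symDecode-code : ∀ a → symDecode (symCode a) ≡ a
    symDecode-code blank       = refl
    symDecode-code (bit false) = refl
    symDecode-code (bit true)  = refl
    symDecode-code (mark i)    = refl

    slots : ℕ
    slots = 7 * suc work

    slot : Fin 7 → Fin (suc work) → Fin slots
    slot = combine

    unslot : Fin slots → Fin 7 × Fin (suc work)
    unslot = remQuot (suc work)

    unslot-slot : ∀ j i → unslot (slot j i) ≡ (j , i)
    unslot-slot = Finₚ.remQuot-combine

  opaque
    variants : ℕ
    variants = states * symbols ^ slots

    variant : Fin states → Fin (symbols ^ slots) → Fin variants
    variant = combine

    unvariant : Fin variants → Fin states × Fin (symbols ^ slots)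
    unvariant = remQuot (symbols ^ slots)

    unvariant-variant : ∀ q c → unvariant (variant q c) ≡ (q , c)
    unvariant-variant = Finₚ.remQuot-combine

  opaque
    -- The factor 2 gives every tile a twin, so that `other` exists: the gadget requires at least
    -- two values.
    tiles : ℕ
    tiles = 2 * variants

    tile : Fin 2 → Fin variants → Fin tiles
    tile = combine

    untile : Fin tiles → Fin 2 × Fin variants
    untile = remQuot variants

    untile-tile : ∀ c v → untile (tile c v) ≡ (c , v)
    untile-tile = Finₚ.remQuot-combine

  opaque
    contents : Fin tiles → Fin states × Fin (symbols ^ slots)
    contents x = unvariant (proj₂ (untile x))

    stateOf : Fin tiles → Fin states
    stateOf x = proj₁ (contents x)

    symOf : Fin tiles → Fin 7 → Fin (suc work) → Symbol marks
    symOf x j i = symDecode (finToFun (proj₂ (contents x)) (slot j i))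

    table : (Fin 7 → Fin (suc work) → Symbol marks) → Fin slots → Fin symbols
    table f l = symCode (uncurry f (unslot l))

    mk : Fin states → (Fin 7 → Fin (suc work) → Symbol marks) → Fin tiles
    mk q f = tile zero (variant q (funToFin (table f)))

    contents-mk : ∀ q f → contents (mk q f) ≡ (q , funToFin (table f))
    contents-mk q f = trans (cong (unvariant ∘ proj₂) (untile-tile zero _)) (unvariant-variant q _)

    stateOf-mk : ∀ q f → stateOf (mk q f) ≡ q
    stateOf-mk q f = cong proj₁ (contents-mk q f)

    symOf-mk : ∀ q f j i → symOf (mk q f) j i ≡ f j i
    symOf-mk q f j i = trans (cong (λ z → symDecode (finToFun (proj₂ z) (slot j i))) (contents-mk q f))
      (trans (cong symDecode (Finₚ.finToFun-funToFin (table f) (slot j i)))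
        (trans (symDecode-code _) (cong (uncurry f) (unslot-slot j i))))

    flip₂ : Fin 2 → Fin 2
    flip₂ zero    = suc zero
    flip₂ (suc _) = zero

    flip₂≢ : ∀ y → flip₂ y ≢ y
    flip₂≢ zero    ()
    flip₂≢ (suc _) ()

    other : Fin tiles → Fin tiles
    other x = tile (flip₂ (proj₁ (untile x))) (proj₂ (untile x))

    other≢ : ∀ x → other x ≢ x
    other≢ x e = flip₂≢ _ (trans (sym (cong proj₁ (untile-tile (flip₂ (proj₁ (untile x))) (proj₂ (untile x))))) (cong (proj₁ ∘ untile) e))

    some : Fin tiles
    some = mk (TM.start M) (λ _ _ → blank)

    tiles² : suc (pred (tiles * tiles)) ≡ tiles * tiles
    tiles² = positive (tiles * tiles) (combine some some)
      where
      positive : ∀ n → Fin n → suc (pred n) ≡ n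
      positive (suc n) _ = refl

    pairing : Fin (suc (pred (tiles * tiles))) → Fin tiles × Fin tiles
    pairing e = remQuot {tiles} tiles (Fin.cast tiles² e)

    unpair : Fin tiles → Fin tiles → Fin (suc (pred (tiles * tiles)))
    unpair x y = Fin.cast (sym tiles²) (combine x y)

    pair-unpair : ∀ x y → pairing (unpair x y) ≡ (x , y)
    pair-unpair x y = trans (cong (remQuot {tiles} tiles) (Finₚ.cast-involutive tiles² (sym tiles²) (combine x y))) (Finₚ.remQuot-combine x y)

    unpair-pair : ∀ e → uncurry unpair (pairing e) ≡ e
    unpair-pair e = trans (cong (Fin.cast (sym tiles²)) (Finₚ.combine-remQuot {tiles} tiles (Fin.cast tiles² e))) (Finₚ.cast-involutive (sym tiles²) tiles² e)

-- Injectivity of the encoding, and the hardness of homomorphism problems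

catF-length : ∀ {n} {f g : Fin n → Word} → (∀ i → length (f i) ≡ length (g i)) → length (catF n f) ≡ length (catF n g)
catF-length {zero}  h = refl
catF-length {suc n} {f} {g} h = trans (Listₚ.length-++ (f zero)) (trans (cong₂ _+_ (h zero) (catF-length {n} (h ∘ suc))) (sym (Listₚ.length-++ (g zero))))

++-split : ∀ {A : Set} (xs ys : List A) {us vs} → length xs ≡ length ys → xs ++ us ≡ ys ++ vs → xs ≡ ys × us ≡ vs
++-split []       []       l e = refl , e
++-split (x ∷ xs) (y ∷ ys) l e = let p , q = Listₚ.∷-injective e ; r , s = ++-split xs ys (ℕₚ.suc-injective l) q in cong₂ _∷_ p r , s

catF-injective : ∀ {n} {f g : Fin n → Word} → (∀ i → length (f i) ≡ length (g i)) → catF n f ≡ catF n g → f ≗ g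
catF-injective {suc n} {f} {g} h e i with ++-split (f zero) (g zero) (h zero) e
catF-injective {suc n} h e zero    | p , q = p
catF-injective {suc n} h e (suc i) | p , q = catF-injective {n} (h ∘ suc) q i

matrixBits-injective : ∀ {V} {f g : Fin V → Fin V → Bool} → matrixBits f ≡ matrixBits g → ∀ x y → f x y ≡ g x y
matrixBits-injective {V} e x y = proj₁ (Listₚ.∷-injective (catF-injective {V} (λ _ → refl) (catF-injective {V} (λ i → catF-length {V} λ _ → refl) e x) y))

encode-order : ∀ {V V′} (G : SignedGraph V) (G′ : SignedGraph V′) → encode G ≡ encode G′ → V ≡ V′
encode-order {V} {V′} G G′ e = go V V′ e
  where
  go : ∀ m n {us vs : Word} → replicate m true ++ false ∷ us ≡ replicate n true ++ false ∷ vs → m ≡ n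
  go zero    zero    e = refl
  go (suc m) (suc n) e = cong suc (go m n (Listₚ.∷-injectiveʳ e))
  go zero    (suc n) ()
  go (suc m) zero    ()

encode-edges : ∀ {V} (G G′ : SignedGraph V) → encode G ≡ encode G′ → ∀ s x y → edge G s x y ≡ edge G′ s x y
encode-edges {V} G G′ e = λ { Sign.+ → matrixBits-injective (proj₁ halves) ; Sign.- → matrixBits-injective (proj₂ halves) }
  where
  bodies = Listₚ.∷-injectiveʳ (proj₂ (++-split (replicate V true) (replicate V true) refl (trans (sym (encode-bits G)) (trans e (encode-bits G′)))))
  halves = ++-split (matrixBits (edge G Sign.+)) (matrixBits (edge G′ Sign.+)) (catF-length {V} λ i → catF-length {V} λ _ → refl) bodies

ecHom : ∀ {N′} → SignedGraph N′ → Language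
ecHom T′ w = ∃[ n ] Σ[ G ∈ SignedGraph n ] (w ≡ encode G × ∃[ φ ] IsECHom G T′ φ)

ecHom-encode : ∀ {N′} {T′ : SignedGraph N′} {n} {G : SignedGraph n} → ecHom T′ (encode G) → ∃[ φ ] IsECHom G T′ φ
ecHom-encode {G = G} (n , G′ , e , φ , h) with encode-order G G′ e
... | refl = φ , λ s x y xy → h s x y (subst T (encode-edges G G′ e s x y) xy)

polyBound-mono : ∀ c k {m n} → m ≤ n → polyBound c k m ≤ polyBound c k n
polyBound-mono c k l = ℕₚ.+-monoˡ-≤ c (ℕₚ.*-monoʳ-≤ c (ℕₚ.^-monoˡ-≤ k l))

pair-++ : ∀ w u → pair w u ≡ pair w [] ++ u
pair-++ []      u = refl
pair-++ (b ∷ w) u = cong (λ z → b ∷ b ∷ z) (pair-++ w u)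

pair-length : ∀ w → length (pair w []) ≡ 2 * length w + 2
pair-length []      = refl
pair-length (b ∷ w) = trans (cong (2 +_) (pair-length w)) (cong (_+ 2) (sym (ℕₚ.*-suc 2 (length w))))

-- The tableau presupposes a bit under the head at the start, that is, a nonempty input.
pair-cons : ∀ w → ∃[ b ] ∃[ v ] (pair w [] ≡ b ∷ v)
pair-cons []      = false , true ∷ [] , refl
pair-cons (b ∷ w) = b , b ∷ pair w [] , refl

hardness : ∀ {N′} (T′ : SignedGraph N′) → Selects (SignPreserves T′) → ∀ L → InNP L → L ≤ₚ ecHom T′
hardness T′ select L (V , (f , (M , c , k , halts) , V⇔) , c₀ , k₀ , L⇔) =
  (λ w → encode (R.I.graph w)) , R.reduction-polyTime , λ w → mk⇔ (complete w) (sound w)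
  where
  module Co = Coding M
  module Ta = Tableau M Co.tiles Co.stateOf Co.symOf Co.mk Co.stateOf-mk Co.symOf-mk
  Pe Be : PE
  Pe = boundE c₀ k₀ N
  -- The input of the verifier consists of `pair w []`, of length `2 * n + 2`, and a certificate
  -- bounded by `Pe`. The grid has to exceed the running time because each step loses a column; the
  -- surplus gives the strict inequality of `run-length`.
  Be = boundE c k (((K 2 ⊗ N) ⊕ K 2) ⊕ Pe) ⊕ K 3
  module R = Reduction T′ Co.tiles (pred (Co.tiles * Co.tiles)) Co.pairing Co.unpair Co.pair-unpair Co.unpair-pair Co.some Co.other Co.other≢ Ta.badAt Pe Be

  P B : Word → ℕ
  P w = ⟦ Pe ⟧ (length w)
  B w = ⟦ Be ⟧ (length w)

  P≡ : ∀ w → P w ≡ polyBound c₀ k₀ (length w)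
  P≡ w = ⟦boundE⟧ c₀ k₀ N (length w)

  run-length : ∀ w u → length u ≤ P w → suc (polyBound c k (length (pair w u))) < B w
  run-length w u l = subst₂ _<_ refl (trans (ℕₚ.+-comm 3 _) (cong (_+ 3) (sym (⟦boundE⟧ c k (((K 2 ⊗ N) ⊕ K 2) ⊕ Pe) (length w)))))
    (s≤s (ℕₚ.≤-trans (s≤s (polyBound-mono c k len)) (ℕₚ.n≤1+n _)))
    where
    len : length (pair w u) ≤ 2 * length w + 2 + P w
    len = ℕₚ.≤-trans (ℕₚ.≤-reflexive (trans (cong length (pair-++ w u)) (trans (Listₚ.length-++ (pair w [])) (cong (_+ length u) (pair-length w)))))
            (ℕₚ.+-monoʳ-≤ (2 * length w + 2) l)

  complete : ∀ w → L w → ecHom T′ (encode (R.I.graph w))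
  complete w Lw with Equivalence.to (L⇔ w) Lw | pair-cons w
  ... | u , u≤ , Vu | b , v , e = _ , R.I.graph w , refl , Complete.hom , Complete.isHom
    where
    x≡ : pair w u ≡ b ∷ v ++ u
    x≡ = trans (pair-++ w u) (cong (_++ u) e)
    accepting : ∀ n → step M (Ta.conf (initial M (b ∷ v ++ u)) n) ≡ nothing → Ta.Accepts (Ta.conf (initial M (b ∷ v ++ u)) n)
    accepting n s with halts (b ∷ v ++ u)
    ... | t , d , _ , h , o = subst Ta.Accepts (sym (Ta.halts-unique h n s))
      (Ta.accepts-in d (trans o (cong [_] (Equivalence.to Boolₚ.T-≡ (subst (T ∘ f) x≡ (Equivalence.to (V⇔ (pair w u)) Vu))))))
    u≤P : length u ≤ P w
    u≤P = subst (length u ≤_) (sym (P≡ w)) u≤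
    module Complete = R.I.Complete w (Ta.tile b v (P w) u u≤P accepting)
      (λ δ t p _ _ _ → subst (λ z → ¬ T (Ta.bad (tokens z (P w)) δ t p (Ta.tile b v (P w) u u≤P accepting t p) (Ta.tile b v (P w) u u≤P accepting (below δ t) (after δ p))))
        (sym e) (Ta.tile-ok b v (P w) u u≤P accepting δ t p))

  module Decoded (w : Word) (φ : Fin (R.I.Vertex w) → Fin _) (hom : IsECHom (R.I.graph w) T′ φ) (b : Bool) (v : Word) (e : pair w [] ≡ b ∷ v) where
    1<B : 1 < B w
    1<B = ℕₚ.≤-<-trans (s≤s z≤n) (run-length w [] z≤n)

    0<B : 0 < B w
    0<B = ℕₚ.<⇒≤ 1<B

    β : ℕ → ℕ → Fin Co.tiles
    β = R.I.Sound.β w select φ hom 0<B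

    tiled : ∀ δ t p → t < B w → p < B w → below δ t < B w × after δ p < B w → ¬ T (Ta.bad (tokens (b ∷ v) (P w)) δ t p (β t p) (β (below δ t) (after δ p)))
    tiled δ t p t< p< i = subst (λ z → ¬ T (Ta.bad (tokens z (P w)) δ t p (β t p) (β (below δ t) (after δ p)))) e
      (R.I.Sound.tiling w select φ hom 0<B δ t p t< p< i)

    found : ∃[ u ] (length u ≤ P w × (∀ {n c} → suc n < B w → HaltsIn M n (initial M (b ∷ v ++ u)) c → Ta.Accepts c))
    found = Ta.guess b v (P w) (B w) β tiled 1<B

    u : Word
    u = proj₁ found

    u≤ : length u ≤ P w
    u≤ = proj₁ (proj₂ found)

    x≡ : pair w u ≡ b ∷ v ++ u
    x≡ = trans (pair-++ w u) (cong (_++ u) e)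

    accepted : T (f (pair w u))
    accepted = let t , d , t≤ , run , o = halts (pair w u) in
      subst T (sym (Listₚ.∷-injectiveˡ (trans (sym o) (Ta.accepts-out d
        (proj₂ (proj₂ found) (ℕₚ.≤-<-trans (s≤s t≤) (run-length w u u≤)) (subst (λ x → HaltsIn M t (initial M x) d) x≡ run)))))) tt

  sound : ∀ w → ecHom T′ (encode (R.I.graph w)) → L w
  sound w h = Equivalence.from (L⇔ w) (D.u , subst (length D.u ≤_) (P≡ w) D.u≤ , Equivalence.from (V⇔ (pair w D.u)) D.accepted)
    where
    decoded = ecHom-encode {T′ = T′} {G = R.I.graph w} h
    module D = Decoded w (proj₁ decoded) (proj₂ decoded) (proj₁ (pair-cons w)) (proj₁ (proj₂ (pair-cons w))) (proj₂ (proj₂ (pair-cons w)))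

-- Switching, labellings and the signed double cover

all± : ∀ {P : Sign → Set} → (∀ s → Dec (P s)) → Dec (∀ s → P s)
all± P? = map′ (λ (p , m) → λ { Sign.+ → p ; Sign.- → m }) (λ h → h Sign.+ , h Sign.-) (P? Sign.+ ×-dec P? Sign.-)

infixl 7 _·_
_·_ : Sign → Sign → Sign
_·_ = Sign._*_

·-pairs : ∀ a b c d → (a · b) · (c · d) ≡ (a · c) · (b · d)
·-pairs = toWitness {a? = all± λ a → all± λ b → all± λ c → all± λ d → (a · b) · (c · d) Signₚ.≟ (a · c) · (b · d)} tt

·-undo : ∀ s a b → (s · (a · b)) · (a · b) ≡ s
·-undo = toWitness {a? = all± λ s → all± λ a → all± λ b → (s · (a · b)) · (a · b) Signₚ.≟ s} tt

flipAt : ∀ {n} → Fin n → Fin n → Sign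
flipAt v x = if ⌊ x Finₚ.≟ v ⌋ then Sign.- else Sign.+

-- A sequence of switchings acts through the parity with which each vertex occurs, as a labelling by
-- signs. At a loop the label appears squared, so loops keep their sign.
switched : ∀ {n} → List (Fin n) → Fin n → Sign
switched []       x = Sign.+
switched (v ∷ vs) x = flipAt v x · switched vs x

switch-edge : ∀ {n} (G : SignedGraph n) v s x y → edge (switch G v) s x y ≡ edge G (s · (flipAt v x · flipAt v y)) x y
switch-edge G v s x y = cong (λ z → edge G z x y) lemma
  where
  lemma : (if nonLoopAt v x y then opposite s else s) ≡ s · (flipAt v x · flipAt v y)
  lemma with x Finₚ.≟ y | x Finₚ.≟ v | y Finₚ.≟ v
  ... | yes refl | yes _ | yes _ = sym (Signₚ.*-identityʳ s)
  ... | yes refl | no _  | no _  = sym (Signₚ.*-identityʳ s)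
  ... | yes refl | yes e | no n  = contradiction e n
  ... | yes refl | no n  | yes e = contradiction e n
  ... | no n | yes e | yes f = contradiction (trans e (sym f)) n
  ... | no _ | yes _ | no _  = Signₚ.*-comm Sign.- s
  ... | no _ | no _  | yes _ = Signₚ.*-comm Sign.- s
  ... | no _ | no _  | no _  = sym (Signₚ.*-identityʳ s)

switches-edge : ∀ {n} (G : SignedGraph n) vs s x y → edge (foldl switch G vs) s x y ≡ edge G (s · (switched vs x · switched vs y)) x y
switches-edge G []       s x y = cong (λ z → edge G z x y) (sym (Signₚ.*-identityʳ s))
switches-edge G (v ∷ vs) s x y = trans (switches-edge (switch G v) vs s x y) (trans (switch-edge G v _ x y)
  (cong (λ z → edge G z x y) (regroup s (switched vs x) (switched vs y) (flipAt v x) (flipAt v y))))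
  where
  regroup : ∀ s p q a b → (s · (p · q)) · (a · b) ≡ s · ((a · p) · (b · q))
  regroup = toWitness {a? = all± λ s → all± λ p → all± λ q → all± λ a → all± λ b → (s · (p · q)) · (a · b) Signₚ.≟ s · ((a · p) · (b · q))} tt

switched-++ : ∀ {n} (us vs : List (Fin n)) x → switched (us ++ vs) x ≡ switched us x · switched vs x
switched-++ []       vs x = refl
switched-++ (u ∷ us) vs x = trans (cong (flipAt u x ·_) (switched-++ us vs x)) (sym (Signₚ.*-assoc (flipAt u x) (switched us x) (switched vs x)))

module _ {n : ℕ} (σ : Fin n → Sign) where

  pick : Fin n → List (Fin n)
  pick v with σ v
  ... | Sign.+ = []
  ... | Sign.- = [ v ]

  pick-same : ∀ v → switched (pick v) v ≡ σ v
  pick-same v with σ v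
  ... | Sign.+ = refl
  ... | Sign.- with v Finₚ.≟ v
  ...   | yes _ = refl
  ...   | no c  = contradiction refl c

  pick-other : ∀ v x → x ≢ v → switched (pick v) x ≡ Sign.+
  pick-other v x x≢v with σ v
  ... | Sign.+ = refl
  ... | Sign.- with x Finₚ.≟ v
  ...   | yes e = contradiction e x≢v
  ...   | no _  = refl

  picks : List (Fin n)
  picks = catF n pick

  picks-switched : ∀ x → switched picks x ≡ σ x
  picks-switched = on n id id
    where
    off : ∀ m (g : Fin m → Fin n) x → (∀ j → x ≢ g j) → switched (catF m (pick ∘ g)) x ≡ Sign.+
    off zero    g x h = refl
    off (suc m) g x h = trans (switched-++ (pick (g zero)) _ x) (cong₂ _·_ (pick-other (g zero) x (h zero)) (off m (g ∘ suc) x (h ∘ suc)))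
    on : ∀ m (g : Fin m → Fin n) → (∀ {i j} → g i ≡ g j → i ≡ j) → ∀ j → switched (catF m (pick ∘ g)) (g j) ≡ σ (g j)
    on (suc m) g inj zero = trans (switched-++ (pick (g zero)) _ (g zero))
      (trans (cong₂ _·_ (pick-same (g zero)) (off m (g ∘ suc) (g zero) λ j e → Finₚ.0≢1+n (inj e))) (Signₚ.*-identityʳ _))
    on (suc m) g inj (suc j) = trans (switched-++ (pick (g zero)) _ (g (suc j)))
      (cong₂ _·_ (pick-other (g zero) (g (suc j)) (λ e → Finₚ.0≢1+n (sym (inj e)))) (on m (g ∘ suc) (Finₚ.suc-injective ∘ inj) j))

module _ {n m : ℕ} (G : SignedGraph n) (H : SignedGraph m) where

  -- Switchings of `H` are pulled back along `φ` and merge with those of `G`, so one labelling of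
  -- `G` accounts for both.
  Lifts : (Fin n → Fin m) → (Fin n → Sign) → Set
  Lifts φ σ = ∀ s x y → Edge G s x y → Edge H (s · (σ x · σ y)) (φ x) (φ y)

  sHom⇒lift : ∀ {φ} → IsSHom G H φ → ∃[ σ ] Lifts φ σ
  sHom⇒lift {φ} (G′ , H′ , (us , eG) , (vs , eH) , hom) = (λ x → switched us x · switched vs (φ x)) , λ s x y xy →
    let s′ = s · (switched us x · switched us y)
        inG′ = subst T (trans (cong (λ z → edge G z x y) (sym (·-undo s (switched us x) (switched us y)))) (trans (sym (switches-edge G us s′ x y)) (eG s′ x y))) xy
        inH = subst T (trans (sym (eH s′ (φ x) (φ y))) (switches-edge H vs s′ (φ x) (φ y))) (hom s′ x y inG′)
    in subst (λ z → Edge H z (φ x) (φ y)) (regroup s (switched us x) (switched us y) (switched vs (φ x)) (switched vs (φ y))) inH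
    where
    regroup : ∀ s p q a b → (s · (p · q)) · (a · b) ≡ s · ((p · a) · (q · b))
    regroup = toWitness {a? = all± λ s → all± λ p → all± λ q → all± λ a → all± λ b → (s · (p · q)) · (a · b) Signₚ.≟ s · ((p · a) · (q · b))} tt

  lift⇒sHom : ∀ {φ σ} → Lifts φ σ → IsSHom G H φ
  lift⇒sHom {φ} {σ} h = foldl switch G (picks σ) , H , (picks σ , λ _ _ _ → refl) , ([] , λ _ _ _ → refl) , λ s x y xy →
    subst (λ z → Edge H z (φ x) (φ y)) (·-undo s (σ x) (σ y))
      (h (s · (σ x · σ y)) x y (subst T (trans (switches-edge G (picks σ) s x y)
        (cong (λ z → edge G (s · z) x y) (cong₂ _·_ (picks-switched σ x) (picks-switched σ y)))) xy))

cover-sign : Fin 2 → Sign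
cover-sign zero    = Sign.+
cover-sign (suc _) = Sign.-

cover-index : Sign → Fin 2
cover-index Sign.+ = zero
cover-index Sign.- = suc zero

cover-sign-index : ∀ s → cover-sign (cover-index s) ≡ s
cover-sign-index Sign.+ = refl
cover-sign-index Sign.- = refl

module _ {m : ℕ} where
 opaque
  base : Fin (m * 2) → Fin m
  base u = proj₁ (remQuot {m} 2 u)

  sheet : Fin (m * 2) → Sign
  sheet u = cover-sign (proj₂ (remQuot {m} 2 u))

  over : Fin m → Sign → Fin (m * 2)
  over v a = combine v (cover-index a)

  base-over : ∀ v a → base (over v a) ≡ v
  base-over v a = cong proj₁ (Finₚ.remQuot-combine v (cover-index a))

  sheet-over : ∀ v a → sheet (over v a) ≡ a
  sheet-over v a = trans (cong (cover-sign ∘ proj₂) (Finₚ.remQuot-combine v (cover-index a))) (cover-sign-index a)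

module _ {m : ℕ} (H : SignedGraph m) where

  -- A vertex records the image of a vertex together with its label; a labelled map to `H` thereby
  -- becomes a plain sign-preserving map to the cover.
  cover : SignedGraph (m * 2)
  cover .edge s u v = edge H (s · (sheet {m} u · sheet {m} v)) (base {m} u) (base {m} v)
  cover .edge-sym s u v = trans (cong (λ z → edge H (s · z) (base {m} u) (base {m} v)) (Signₚ.*-comm (sheet {m} u) (sheet {m} v))) (edge-sym H _ _ _)

  cover-over : ∀ s v a w b → edge cover s (over v a) (over w b) ≡ edge H (s · (a · b)) v w
  cover-over s v a w b rewrite base-over v a | base-over w b | sheet-over v a | sheet-over w b = refl

  sHom⇔cover : ∀ {n} (G : SignedGraph n) → SHom G H ⇔ (∃[ ψ ] IsECHom G cover ψ)
  sHom⇔cover G = mk⇔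
    (λ (φ , h) → let σ , l = sHom⇒lift G H h in (λ x → over (φ x) (σ x)) , λ s x y xy → subst T (sym (cover-over s (φ x) (σ x) (φ y) (σ y))) (l s x y xy))
    (λ (ψ , h) → base {m} ∘ ψ , lift⇒sHom G H {base {m} ∘ ψ} {sheet {m} ∘ ψ} h)

LHom : ∀ {n m} → SignedGraph n → SignedGraph m → Set
LHom G H = ∃[ φ ] ∃[ σ ] Lifts G H φ σ

sHom⇔lHom : ∀ {n m} (G : SignedGraph n) (H : SignedGraph m) → SHom G H ⇔ LHom G H
sHom⇔lHom G H = mk⇔ (λ (φ , h) → φ , sHom⇒lift G H h) (λ (φ , σ , l) → φ , lift⇒sHom G H {φ} {σ} l)

-- The identity gives balanced signed graphs, `opposite` antibalanced ones, the constant negative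
-- sign bipartite ones, and the constant positive sign imposes nothing.
Balanced : ∀ {n} → (Sign → Sign) → SignedGraph n → Set
Balanced {n} h G = Σ[ σ ∈ (Fin n → Sign) ] (∀ s x y → Edge G s x y → σ x · σ y ≡ h s)

-- Says that `h` commutes with multiplication by a sign, which is what absorbing the labels `a` and
-- `b` takes. Constant functions fail, and bipartiteness is pulled back without labels instead.
Twisted : (Sign → Sign) → Set
Twisted h = ∀ s a b c d → c · d ≡ h (s · (a · b)) → (c · a) · (d · b) ≡ h s

balanced-pull : ∀ {h} → Twisted h → ∀ {n m} (G : SignedGraph n) (H : SignedGraph m) → LHom G H → Balanced h H → Balanced h G
balanced-pull t G H (φ , σ , l) (τ , b) = (λ x → τ (φ x) · σ x) , λ s x y xy → t s (σ x) (σ y) (τ (φ x)) (τ (φ y)) (b _ _ _ (l s x y xy))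

bipartite-pull : ∀ {n m} (G : SignedGraph n) (H : SignedGraph m) → LHom G H → Balanced (const Sign.-) H → Balanced (const Sign.-) G
bipartite-pull G H (φ , σ , l) (τ , b) = τ ∘ φ , λ s x y xy → b _ _ _ (l s x y xy)

twisted-id : Twisted id
twisted-id = toWitness {a? = all± λ s → all± λ a → all± λ b → all± λ c → all± λ d → (c · d Signₚ.≟ s · (a · b)) →-dec ((c · a) · (d · b) Signₚ.≟ s)} tt

twisted-opposite : Twisted opposite
twisted-opposite = toWitness {a? = all± λ s → all± λ a → all± λ b → all± λ c → all± λ d → (c · d Signₚ.≟ opposite (s · (a · b))) →-dec ((c · a) · (d · b) Signₚ.≟ opposite s)} tt

-- The three graphs on the cover whose 2-colourability decides the complexity:
-- positive edges, negative edges, and negative walks of length 2.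

data Relation : Set where
  positive negative walk₂ : Relation

graphOf : ∀ {N′} → SignedGraph N′ → Relation → Graph N′
graphOf C′ positive = edge C′ Sign.+
graphOf C′ negative = edge C′ Sign.-
graphOf C′ walk₂ x y = ∃ᵇ λ z → edge C′ Sign.+ x z ∧ edge C′ Sign.- z y

walk₂-out : ∀ {N′} {C′ : SignedGraph N′} {x y} → T (graphOf C′ walk₂ x y) → ∃[ z ] (Edge C′ Sign.+ x z × Edge C′ Sign.- z y)
walk₂-out h = let z , r = ∃ᵇ-out h in z , ∧-out r

graphOf-hom : ∀ {N₁ N₂} {C₁ : SignedGraph N₁} {C₂ : SignedGraph N₂} {ψ} → IsECHom C₁ C₂ ψ → ∀ R {x y} → T (graphOf C₁ R x y) → T (graphOf C₂ R (ψ x) (ψ y))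
graphOf-hom h positive = h Sign.+ _ _
graphOf-hom h negative = h Sign.- _ _
graphOf-hom {C₁ = C₁} h walk₂ r = let z , p , q = walk₂-out {C′ = C₁} r in ∃ᵇ-in _ (∧-in (h Sign.+ _ _ p) (h Sign.- _ _ q))

graphOf-preserves : ∀ {N′} {C′ : SignedGraph N′} R {k} {f : Op N′ k} → SignPreserves C′ f → Preserves (graphOf C′ R) f
graphOf-preserves positive p = record { ext = SignPreserves.ext p ; pres = SignPreserves.pres p Sign.+ }
graphOf-preserves negative p = record { ext = SignPreserves.ext p ; pres = SignPreserves.pres p Sign.- }
graphOf-preserves {C′ = C′} walk₂ p = record { ext = SignPreserves.ext p ; pres = λ h → let w = λ i → walk₂-out {C′ = C′} (h i) in
  ∃ᵇ-in _ (∧-in (SignPreserves.pres p Sign.+ (λ i → proj₁ (proj₂ (w i)))) (SignPreserves.pres p Sign.- (λ i → proj₂ (proj₂ (w i))))) }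

Hard : ∀ {m} → SignedGraph m → Set
Hard H = ∃[ R ] (Simple (graphOf (cover H) R) × ¬ Colouring (graphOf (cover H) R))

hard-selects : ∀ {m} (H : SignedGraph m) → Hard H → Selects (SignPreserves (cover H))
hard-selects H (R , S , ¬c) = selects-⊆ (λ f → graphOf-preserves R) (non-bipartite-selects _ S ¬c)

edge-flip : ∀ {n} (G : SignedGraph n) {s x y} → Edge G s x y → Edge G s y x
edge-flip G {s} {x} {y} = subst T (edge-sym G s x y)

module _ {m : ℕ} (H : SignedGraph m) where

  -- A walk of two edges read backwards has its signs in the wrong order. Passing through the other
  -- vertex over the same base changes both signs and restores the order.
  graphOf-sym : ∀ R {x y} → T (graphOf (cover H) R x y) → T (graphOf (cover H) R y x)
  graphOf-sym positive {x} {y} = edge-flip (cover H) {Sign.+} {x} {y}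
  graphOf-sym negative {x} {y} = edge-flip (cover H) {Sign.-} {x} {y}
  graphOf-sym walk₂ {x} {y} r with walk₂-out {C′ = cover H} r
  ... | z , p , q = ∃ᵇ-in z′ (∧-in (turn Sign.- Sign.+ {y} refl (edge-flip (cover H) {Sign.-} {z} {y} q))
                                   (edge-flip (cover H) {Sign.-} {x} {z′} (turn Sign.+ Sign.- {x} refl p)))
    where
    z′ = over (base {m} z) (opposite (sheet {m} z))
    signs : ∀ s t a b → t ≡ opposite s → t · (a · opposite b) ≡ s · (a · b)
    signs = toWitness {a? = all± λ s → all± λ t → all± λ a → all± λ b → (t Signₚ.≟ opposite s) →-dec (t · (a · opposite b) Signₚ.≟ s · (a · b))} tt
    turn : ∀ s t {x} → t ≡ opposite s → Edge (cover H) s x z → Edge (cover H) t x z′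
    turn s t {x} e h rewrite base-over (base {m} z) (opposite (sheet {m} z)) | sheet-over (base {m} z) (opposite (sheet {m} z)) =
      subst (λ z₁ → Edge H z₁ (base {m} x) (base {m} z)) (sym (signs s t (sheet {m} x) (sheet {m} z) e)) h

  module _ (r : Sign) (c : Colouring (edge (cover H) r)) where
    private
      χ : Bool → Sign
      χ true  = Sign.+
      χ false = Sign.-
      differ : ∀ a b → a ≢ b → χ a · χ b ≡ Sign.-
      differ true  true  n = contradiction refl n
      differ true  false n = refl
      differ false true  n = refl
      differ false false n = contradiction refl n

    colour-at : Fin m → Sign → Sign
    colour-at v a = χ (proj₁ c (over v a))

    -- An edge of sign `s` lifts to edges of sign `r`: the label `a` at one end goes with
    -- `r · (s · a)` at the other.
    colour-edge : ∀ {s v w} a → Edge H s v w → colour-at v a · colour-at w (r · (s · a)) ≡ Sign.-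
    colour-edge {s} {v} {w} a e = differ _ _ (proj₂ c _ _ (subst T (trans (cong (λ z → edge H z v w) (sym (signs r s a))) (sym (cover-over H r v a w (r · (s · a))))) e))
      where
      signs : ∀ r s a → r · (a · (r · (s · a))) ≡ s
      signs = toWitness {a? = all± λ r → all± λ s → all± λ a → r · (a · (r · (s · a))) Signₚ.≟ s} tt

    -- Positive if both vertices over `v` have the same colour, negative otherwise. Along an edge of
    -- `H` both colours change, so by connectedness all fibres are of one type.
    fibre : Fin m → Sign
    fibre v = colour-at v Sign.+ · colour-at v Sign.-

    fibre-edge : ∀ {s v w} → Edge H s v w → fibre v ≡ fibre w
    fibre-edge {s} {v} {w} e =
      signs (colour-at v Sign.+) (colour-at v Sign.-) (colour-at w) (r · (s · Sign.+)) (r · (s · Sign.-)) (twin r s) (colour-edge Sign.+ e) (colour-edge Sign.- e)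
      where
      twin : ∀ r s → r · (s · Sign.-) ≡ opposite (r · (s · Sign.+))
      twin = toWitness {a? = all± λ r → all± λ s → r · (s · Sign.-) Signₚ.≟ opposite (r · (s · Sign.+))} tt
      same : ∀ a b p q → a · p ≡ Sign.- → b · q ≡ Sign.- → a · b ≡ p · q
      same = toWitness {a? = all± λ a → all± λ b → all± λ p → all± λ q → (a · p Signₚ.≟ Sign.-) →-dec ((b · q Signₚ.≟ Sign.-) →-dec (a · b Signₚ.≟ p · q))} tt
      signs : ∀ a b (f : Sign → Sign) z z′ → z′ ≡ opposite z → a · f z ≡ Sign.- → b · f z′ ≡ Sign.- → a · b ≡ f Sign.+ · f Sign.-
      signs a b f Sign.+ .Sign.- refl e e′ = same a b (f Sign.+) (f Sign.-) e e′
      signs a b f Sign.- .Sign.+ refl e e′ = trans (same a b (f Sign.-) (f Sign.+) e e′) (Signₚ.*-comm (f Sign.-) (f Sign.+))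

    fibre-const : Connected H → ∀ v w → fibre v ≡ fibre w
    fibre-const conn v w = go (conn v w)
      where
      go : ∀ {v w} → Star (Adjacent H) v w → fibre v ≡ fibre w
      go ε            = refl
      go ((_ , e) ◅ p) = trans (fibre-edge e) (go p)

    -- Constant fibres colour H itself; alternating fibres make it balanced.
    flat : (∀ v → fibre v ≡ Sign.+) → Balanced (const Sign.-) H
    flat h = (λ v → colour-at v Sign.+) , λ s v w e → signs (colour-at v Sign.+) (colour-at w) (r · (s · Sign.+)) (h w) (colour-edge Sign.+ e)
      where
      signs : ∀ a (f : Sign → Sign) z → f Sign.+ · f Sign.- ≡ Sign.+ → a · f z ≡ Sign.- → a · f Sign.+ ≡ Sign.-
      signs a f Sign.+ h e = e
      signs a f Sign.- h e = trans (cong (a ·_) (eq (f Sign.+) (f Sign.-) h)) e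
        where
        eq : ∀ p q → p · q ≡ Sign.+ → p ≡ q
        eq = toWitness {a? = all± λ p → all± λ q → (p · q Signₚ.≟ Sign.+) →-dec (p Signₚ.≟ q)} tt

    steep : (∀ v → fibre v ≡ Sign.-) → Balanced (λ s → opposite (r · s)) H
    steep h = (λ v → colour-at v Sign.+) , λ s v w e → signs (colour-at v Sign.+) (colour-at w) r s (h w) (colour-edge Sign.+ e)
      where
      alternate : ∀ (f : Sign → Sign) z → f Sign.+ · f Sign.- ≡ Sign.- → f z ≡ z · f Sign.+
      alternate f Sign.+ h = refl
      alternate f Sign.- h = eq (f Sign.+) (f Sign.-) h
        where
        eq : ∀ p q → p · q ≡ Sign.- → q ≡ opposite p
        eq = toWitness {a? = all± λ p → all± λ q → (p · q Signₚ.≟ Sign.-) →-dec (q Signₚ.≟ opposite p)} tt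
      signs : ∀ a (f : Sign → Sign) r s → f Sign.+ · f Sign.- ≡ Sign.- → a · f (r · (s · Sign.+)) ≡ Sign.- → a · f Sign.+ ≡ opposite (r · s)
      signs a f r s h e = eq a (f Sign.+) r s (trans (cong (a ·_) (sym (alternate f (r · (s · Sign.+)) h))) e)
        where
        eq : ∀ a p r s → a · ((r · (s · Sign.+)) · p) ≡ Sign.- → a · p ≡ opposite (r · s)
        eq = toWitness {a? = all± λ a → all± λ p → all± λ r → all± λ s → (a · ((r · (s · Sign.+)) · p) Signₚ.≟ Sign.-) →-dec (a · p Signₚ.≟ opposite (r · s))} tt

alternates : ∀ (f : Sign → Sign) → f Sign.+ · f Sign.- ≡ Sign.- → ∀ z → f z ≡ z · f Sign.+
alternates f h Sign.+ = refl
alternates f h Sign.- = eq (f Sign.+) (f Sign.-) h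
  where
  eq : ∀ p q → p · q ≡ Sign.- → q ≡ opposite p
  eq = toWitness {a? = all± λ p → all± λ q → (p · q Signₚ.≟ Sign.-) →-dec (q Signₚ.≟ opposite p)} tt

module WalkColouring {m : ℕ} (H : SignedGraph m) (c : Colouring (graphOf (cover H) walk₂)) where
  private
    χ : Bool → Sign
    χ true  = Sign.+
    χ false = Sign.-
    differ : ∀ a b → a ≢ b → χ a · χ b ≡ Sign.-
    differ true  true  n = contradiction refl n
    differ true  false n = refl
    differ false true  n = refl
    differ false false n = contradiction refl n

  sign-at : Fin m → Sign → Sign
  sign-at v a = χ (proj₁ c (over v a))

  walk-signs : ∀ {s₁ s₂ v z w} a → Edge H s₁ v z → Edge H s₂ z w → sign-at v a · sign-at w (opposite (s₁ · s₂) · a) ≡ Sign.-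
  walk-signs {s₁} {s₂} {v} {z} {w} a e₁ e₂ = differ _ _ (proj₂ c _ _ (∃ᵇ-in (over z (a · s₁)) (∧-in
    (subst T (trans (cong (λ q → edge H q v z) (sym (first a s₁))) (sym (cover-over H Sign.+ v a z (a · s₁)))) e₁)
    (subst T (trans (cong (λ q → edge H q z w) (sym (second a s₁ s₂))) (sym (cover-over H Sign.- z (a · s₁) w (opposite (s₁ · s₂) · a)))) e₂))))
    where
    first : ∀ a s → Sign.+ · (a · (a · s)) ≡ s
    first = toWitness {a? = all± λ a → all± λ s → Sign.+ · (a · (a · s)) Signₚ.≟ s} tt
    second : ∀ a s t → Sign.- · ((a · s) · (opposite (s · t) · a)) ≡ t
    second = toWitness {a? = all± λ a → all± λ s → all± λ t → Sign.- · ((a · s) · (opposite (s · t) · a)) Signₚ.≟ t} tt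

  potential : Fin m → Sign
  potential v = sign-at v Sign.+

  -- Going along an edge and back joins the two vertices over its end, so their colours differ. The
  -- colours are therefore determined by those at the positive label, and a walk of two edges
  -- multiplies these by its signs.
  potential-walk : ∀ {s₁ s₂ v z w} → Edge H s₁ v z → Edge H s₂ z w → potential v · potential w ≡ s₁ · s₂
  potential-walk {s₁} {s₂} {v} {z} {w} e₁ e₂ = eq (potential v) (potential w) (s₁ · s₂)
    (trans (cong (potential v ·_) (sym (alternates (sign-at w) (eq′ s₂ (sign-at w) (walk-signs Sign.+ (edge-flip H e₂) e₂)) (opposite (s₁ · s₂) · Sign.+)))) (walk-signs Sign.+ e₁ e₂))
    where
    eq : ∀ p q t → p · ((opposite t · Sign.+) · q) ≡ Sign.- → p · q ≡ t
    eq = toWitness {a? = all± λ p → all± λ q → all± λ t → (p · ((opposite t · Sign.+) · q) Signₚ.≟ Sign.-) →-dec (p · q Signₚ.≟ t)} tt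
    eq′ : ∀ s (f : Sign → Sign) → f Sign.+ · f (opposite (s · s) · Sign.+) ≡ Sign.- → f Sign.+ · f Sign.- ≡ Sign.-
    eq′ Sign.+ f h = h
    eq′ Sign.- f h = h

Edgeless : ∀ {n} → SignedGraph n → Set
Edgeless G = ∀ s x y → ¬ Edge G s x y

-- The connected graphs with a core of at most two edges, by that core
data Easy {m} (H : SignedGraph m) : Set where
  no-vertices : m ≡ 0 → Easy H
  no-edges    : Fin m → Edgeless H → Easy H
  one-loop    : ∀ r z → Edge H r z z → Balanced (r ·_) H → Easy H
  both-loops  : ∀ z → (∀ r → Edge H r z z) → Easy H
  one-edge    : ∀ s z z′ → Edge H s z z′ → Balanced id H → Balanced (const Sign.-) H → Easy H
  digon       : ∀ z z′ → (∀ s → Edge H s z z′) → Balanced (const Sign.-) H → Easy H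

-- One shape for all the easy targets, so that a single algorithm serves them all.
record Condition : Set where
  constructor condition
  field
    vertexless edgeless : Bool
    sign₁ sign₂ : Sign → Sign

Satisfies : ∀ {n} → Condition → SignedGraph n → Set
Satisfies {n} (condition v e h₁ h₂) G = (T v → n ≡ 0) × (T e → Edgeless G) × Balanced h₁ G × Balanced h₂ G

trivial : ∀ {n} (G : SignedGraph n) → Balanced (const Sign.+) G
trivial G = const Sign.+ , λ _ _ _ _ → refl

conditionOf : ∀ {m} {H : SignedGraph m} → Easy H → Condition
conditionOf (no-vertices _)          = condition true  false (const Sign.+) (const Sign.+)
conditionOf (no-edges _ _)           = condition false true  (const Sign.+) (const Sign.+)
conditionOf (one-loop r _ _ _)       = condition false false (r ·_) (const Sign.+)
conditionOf (both-loops _ _)         = condition false false (const Sign.+) (const Sign.+)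
conditionOf (one-edge _ _ _ _ _ _)   = condition false false id (const Sign.-)
conditionOf (digon _ _ _ _)          = condition false false (const Sign.+) (const Sign.-)

twisted-· : ∀ r → Twisted (r ·_)
twisted-· Sign.+ = twisted-id
twisted-· Sign.- = twisted-opposite

signs-apart : ∀ {a b} → a · b ≡ Sign.- → (a ≡ Sign.+ × b ≡ Sign.-) ⊎ (a ≡ Sign.- × b ≡ Sign.+)
signs-apart {Sign.+} {Sign.-} _ = inj₁ (refl , refl)
signs-apart {Sign.-} {Sign.+} _ = inj₂ (refl , refl)

choose : {A : Set} → Sign → A → A → A
choose Sign.+ x y = x
choose Sign.- x y = y

module _ {m : ℕ} {H : SignedGraph m} where

  necessary : (e : Easy H) → ∀ {n} (G : SignedGraph n) → LHom G H → Satisfies (conditionOf e) G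
  necessary (no-vertices refl) {zero}  G l = (λ _ → refl) , (λ ()) , trivial G , trivial G
  necessary (no-vertices refl) {suc n} G (φ , _) with φ zero
  ... | ()
  necessary (no-edges z ¬e) G (φ , σ , l) = (λ ()) , (λ _ s x y e → ¬e _ _ _ (l s x y e)) , trivial G , trivial G
  necessary (one-loop r z e b) G l = (λ ()) , (λ ()) , balanced-pull (twisted-· r) G H l b , trivial G
  necessary (both-loops z e) G l = (λ ()) , (λ ()) , trivial G , trivial G
  necessary (one-edge s z z′ e b k) G l = (λ ()) , (λ ()) , balanced-pull twisted-id G H l b , bipartite-pull G H l k
  necessary (digon z z′ e k) G l = (λ ()) , (λ ()) , trivial G , bipartite-pull G H l k

  sufficient : (e : Easy H) → ∀ {n} {G : SignedGraph n} → Satisfies (conditionOf e) G → LHom G H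
  sufficient (no-vertices refl) (v , _) with v tt
  ... | refl = id , const Sign.+ , λ _ ()
  sufficient (no-edges z ¬e) (_ , e , _) = const z , const Sign.+ , λ s x y xy → ⊥-elim (e tt s x y xy)
  sufficient (one-loop r z e b) (_ , _ , (σ , h) , _) = const z , σ , λ s x y xy →
    subst (λ q → Edge H q z z) (trans (signs r s) (cong (s ·_) (sym (h s x y xy)))) e
    where
    signs : ∀ r s → r ≡ s · (r · s)
    signs = toWitness {a? = all± λ r → all± λ s → r Signₚ.≟ s · (r · s)} tt
  sufficient (both-loops z e) _ = const z , const Sign.+ , λ s x y _ → e _
  -- The two sides of the bipartition go to the ends of the edge. Balance makes all edges positive
  -- under `τ`, and the factor `s₀` on one side gives them the sign of the edge.
  sufficient (one-edge s₀ z z′ e b k) {G = G} (_ , _ , (τ , h) , (κ , g)) = (λ x → choose (κ x) z z′) , (λ x → τ x · choose (κ x) Sign.+ s₀) , lifts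
    where
    signs : ∀ s p q t → p · q ≡ s → s · ((p · Sign.+) · (q · t)) ≡ t
    signs = toWitness {a? = all± λ s → all± λ p → all± λ q → all± λ t → (p · q Signₚ.≟ s) →-dec (s · ((p · Sign.+) · (q · t)) Signₚ.≟ t)} tt
    signs′ : ∀ s p q t → p · q ≡ s → s · ((p · t) · (q · Sign.+)) ≡ t
    signs′ = toWitness {a? = all± λ s → all± λ p → all± λ q → all± λ t → (p · q Signₚ.≟ s) →-dec (s · ((p · t) · (q · Sign.+)) Signₚ.≟ t)} tt
    lifts : Lifts G H (λ x → choose (κ x) z z′) (λ x → τ x · choose (κ x) Sign.+ s₀)
    lifts s x y xy with signs-apart {κ x} {κ y} (g s x y xy)
    ... | inj₁ (p , q) rewrite p | q = subst (λ t → Edge H t z z′) (sym (signs s (τ x) (τ y) s₀ (h s x y xy))) e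
    ... | inj₂ (p , q) rewrite p | q = subst (λ t → Edge H t z′ z) (sym (signs′ s (τ x) (τ y) s₀ (h s x y xy))) (edge-flip H e)
  sufficient (digon z z′ e k) {G = G} (_ , _ , _ , (κ , g)) = (λ x → choose (κ x) z z′) , const Sign.+ , lifts
    where
    lifts : Lifts G H (λ x → choose (κ x) z z′) (const Sign.+)
    lifts s x y xy with signs-apart {κ x} {κ y} (g s x y xy)
    ... | inj₁ (p , q) rewrite p | q = e _
    ... | inj₂ (p , q) rewrite p | q = edge-flip H (e _)

  -- Easiness is invariant under homomorphic equivalence: edges that exist in `H` are carried along
  -- `ρ`, and conditions on all edges are pulled back along `ι`.
  easy-transfer : ∀ {m′} (C : SignedGraph m′) → LHom C H → LHom H C → Easy H → Easy C
  easy-transfer {zero}  C ι ρ _ = no-vertices refl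
  easy-transfer {suc _} C (φ , _) ρ (no-vertices refl) with φ zero
  ... | ()
  easy-transfer C (φ , σ , l) (ψ , _) (no-edges z ¬e) = no-edges (ψ z) (λ s x y e → ¬e _ _ _ (l s x y e))
  easy-transfer C ι (ψ , τ , k) (one-loop r z e b) =
    one-loop r (ψ z) (subst (λ q → Edge C q _ _) (trans (cong (r ·_) (Signₚ.s*s≡+ (τ z))) (Signₚ.*-identityʳ r)) (k r z z e)) (balanced-pull (twisted-· r) C H ι b)
  easy-transfer C ι (ψ , τ , k) (both-loops z e) =
    both-loops (ψ z) λ r → subst (λ q → Edge C q _ _) (trans (cong (r ·_) (Signₚ.s*s≡+ (τ z))) (Signₚ.*-identityʳ r)) (k r z z (e r))
  easy-transfer C ι (ψ , τ , k) (one-edge s z z′ e b c) = one-edge _ (ψ z) (ψ z′) (k s z z′ e) (balanced-pull twisted-id C H ι b) (bipartite-pull C H ι c)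
  easy-transfer C ι (ψ , τ , k) (digon z z′ e c) =
    digon (ψ z) (ψ z′) (λ s → subst (λ q → Edge C q _ _) (·-undo s (τ z) (τ z′)) (k _ z z′ (e (s · (τ z · τ z′))))) (bipartite-pull C H ι c)

lHom-refl : ∀ {m} (H : SignedGraph m) → LHom H H
lHom-refl H = id , const Sign.+ , λ s x y e → subst (λ q → Edge H q x y) (sym (Signₚ.*-identityʳ s)) e

-- Cores of easy graphs

filterᵇ-length-mono : ∀ {A : Set} (p q : A → Bool) xs → (∀ x → T (p x) → T (q x)) → length (filterᵇ p xs) ≤ length (filterᵇ q xs)
filterᵇ-length-mono p q []       h = z≤n
filterᵇ-length-mono p q (x ∷ xs) h with p x | q x | h x
... | true  | true  | _  = s≤s (filterᵇ-length-mono p q xs h)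
... | true  | false | hx = ⊥-elim (hx tt)
... | false | true  | _  = ℕₚ.m≤n⇒m≤1+n (filterᵇ-length-mono p q xs h)
... | false | false | _  = filterᵇ-length-mono p q xs h

automorphism-injective : ∀ {m} (C : SignedGraph m) → IsSCore C → (l : LHom C C) → ∀ {x y} → proj₁ l x ≡ proj₁ l y → x ≡ y
automorphism-injective C core (φ , σ , l) {x} {y} e with core φ (lift⇒sHom C C {φ} {σ} l)
... | _ , ψ , (_ , inv) , _ = trans (sym (inv refl)) (trans (cong ψ e) (inv refl))

candidates : ∀ {m} → SignedGraph m → Sign × Fin m × Fin m → Bool
candidates C (s , x , y) = ⌊ x Finₚ.≤? y ⌋ ∧ edge C s x y

places : ∀ m → List (Sign × Fin m × Fin m)
places m = cartesianProduct (Sign.+ ∷ Sign.- ∷ []) (cartesianProduct (allFin m) (allFin m))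

one-vertex : ∀ {m} (C : SignedGraph m) → (∀ (x y : Fin m) → x ≡ y) → numEdges C ≤ 2
one-vertex {zero}        C _ = z≤n
one-vertex {suc zero}    C _ = filterᵇ-length-mono (candidates C) (const true) (places 1) (λ _ _ → tt)
one-vertex {suc (suc _)} C h with h zero (suc zero)
... | ()

two-vertices : ∀ {m} (C : SignedGraph m) → (∀ s x → ¬ Edge C s x x) → (∀ (x y z : Fin m) → x ≡ y ⊎ y ≡ z ⊎ x ≡ z) → numEdges C ≤ 2
two-vertices {zero}          C _ _ = z≤n
two-vertices {suc zero}      C _ _ = filterᵇ-length-mono (candidates C) (const true) (places 1) (λ _ _ → tt)
two-vertices {suc (suc zero)} C h _ =
  filterᵇ-length-mono (candidates C) (λ (_ , x , y) → ⌊ x Finₚ.≤? y ⌋ ∧ not ⌊ x Finₚ.≟ y ⌋) (places 2)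
    (λ (s , x , y) c → let l , e = ∧-out {⌊ x Finₚ.≤? y ⌋} c in ∧-in l (distinct s x y e (x Finₚ.≟ y)))
  where
  distinct : ∀ s x y → Edge C s x y → (d : Dec (x ≡ y)) → T (not ⌊ d ⌋)
  distinct s x y e (yes refl) = h s x e
  distinct s x y e (no _)     = tt
two-vertices {suc (suc (suc _))} C _ h with h zero (suc zero) (suc (suc zero))
... | inj₁ ()
... | inj₂ (inj₁ ())
... | inj₂ (inj₂ ())

bipartite-loopless : ∀ {m} (C : SignedGraph m) → Balanced (const Sign.-) C → ∀ s x → ¬ Edge C s x x
bipartite-loopless C (κ , g) s x e with trans (sym (Signₚ.s*s≡+ (κ x))) (g s x x e)
... | ()

three-collide : ∀ {m} {z z′ : Fin m} (κ : Fin m → Sign) → (∀ {x y} → choose (κ x) z z′ ≡ choose (κ y) z z′ → x ≡ y) → ∀ x y w → x ≡ y ⊎ y ≡ w ⊎ x ≡ w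
three-collide {z = z} {z′} κ inj x y w = go (κ x) (κ y) (κ w) refl refl refl
  where
  same : ∀ {t x y} → κ x ≡ t → κ y ≡ t → x ≡ y
  same p q = inj (cong (λ t → choose t z z′) (trans p (sym q)))
  go : ∀ a b c → κ x ≡ a → κ y ≡ b → κ w ≡ c → x ≡ y ⊎ y ≡ w ⊎ x ≡ w
  go Sign.+ Sign.+ _      p q r = inj₁ (same p q)
  go Sign.- Sign.- _      p q r = inj₁ (same p q)
  go Sign.+ Sign.- Sign.+ p q r = inj₂ (inj₂ (same p r))
  go Sign.+ Sign.- Sign.- p q r = inj₂ (inj₁ (same q r))
  go Sign.- Sign.+ Sign.- p q r = inj₂ (inj₂ (same p r))
  go Sign.- Sign.+ Sign.+ p q r = inj₂ (inj₁ (same q r))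

-- In the nonempty cases easiness provides an s-homomorphism of `C` to itself with at most two
-- vertices in its image. In a core it is injective, which bounds the number of vertices. Two
-- vertices arise only from bipartite cases, which have no loops.
easy-core : ∀ {m} (C : SignedGraph m) → IsSCore C → Easy C → numEdges C ≤ 2
easy-core C core e = small e (automorphism-injective C core (sufficient e {G = C} (necessary e C (lHom-refl C))))
  where
  small : (e : Easy C) → (∀ {x y} → proj₁ (sufficient e {G = C} (necessary e C (lHom-refl C))) x ≡ proj₁ (sufficient e {G = C} (necessary e C (lHom-refl C))) y → x ≡ y) →
          numEdges C ≤ 2
  small (no-vertices refl)        inj = z≤n
  small (no-edges z ¬e)           inj = one-vertex C λ x y → inj refl
  small (one-loop r z _ b)        inj = one-vertex C λ x y → inj refl
  small (both-loops z _)          inj = one-vertex C λ x y → inj refl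
  small (one-edge s z z′ _ b k)   inj = two-vertices C (bipartite-loopless C k) (three-collide {z = z} {z′} (proj₁ k) inj)
  small (digon z z′ _ k)          inj = two-vertices C (bipartite-loopless C k) (three-collide {z = z} {z′} (proj₁ k) inj)

-- The dichotomy for connected graphs

module _ {N′ : ℕ} (E : Graph N′) where
  private
    toBool : Fin 2 → Bool
    toBool zero    = false
    toBool (suc _) = true
    fromBool : Bool → Fin 2
    fromBool false = zero
    fromBool true  = suc zero
    to-from : ∀ b → toBool (fromBool b) ≡ b
    to-from false = refl
    to-from true  = refl

  colouring? : Dec (Colouring E)
  colouring? with Finₚ.any? (λ k → Finₚ.all? λ x → Finₚ.all? λ y → T? (E x y) →-dec ¬? (toBool (finToFun {2} {N′} k x) Boolₚ.≟ toBool (finToFun k y)))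
  ... | yes (k , h) = yes ((λ x → toBool (finToFun k x)) , h)
  ... | no ¬h = no λ (c , h) → ¬h (funToFin (fromBool ∘ c) , λ x y e → h x y e ∘ λ eq → trans (sym (same c x)) (trans eq (same c y)))
    where
    same : ∀ (c : Fin N′ → Bool) x → toBool (finToFun (funToFin (fromBool ∘ c)) x) ≡ c x
    same c x = trans (cong toBool (Finₚ.finToFun-funToFin (fromBool ∘ c) x)) (to-from (c x))

-- Rules out loops of `walk₂`; the case `x ≡ z` of two loops at one vertex is included.
Unpaired : ∀ {m} → SignedGraph m → Set
Unpaired H = ∀ x z → Edge H Sign.+ x z → Edge H Sign.- x z → ⊥

balanced-cong : ∀ {h k : Sign → Sign} {m} (H : SignedGraph m) → h ≗ k → Balanced h H → Balanced k H
balanced-cong H e (σ , b) = σ , λ s x y xy → trans (b s x y xy) (e s)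

module _ {m : ℕ} (H : SignedGraph m) where

  loop-below : ∀ r {u} → Edge (cover H) r u u → Edge H r (base {m} u) (base {m} u)
  loop-below r {u} = subst (λ q → Edge H q (base {m} u) (base {m} u)) (trans (cong (r ·_) (Signₚ.s*s≡+ (sheet {m} u))) (Signₚ.*-identityʳ r))

  signed : Sign → Relation
  signed Sign.+ = positive
  signed Sign.- = negative

  signed-simple : ∀ r → ¬ HasLoop r H → Simple (graphOf (cover H) (signed r))
  signed-simple Sign.+ n = record { symm = λ {x} {y} → graphOf-sym H positive {x} {y} ; irrefl = λ {x} e → n (base {m} x , loop-below Sign.+ e) }
  signed-simple Sign.- n = record { symm = λ {x} {y} → graphOf-sym H negative {x} {y} ; irrefl = λ {x} e → n (base {m} x , loop-below Sign.- e) }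

  walk₂-simple : Unpaired H → Simple (graphOf (cover H) walk₂)
  walk₂-simple u = record { symm = λ {x} {y} → graphOf-sym H walk₂ {x} {y} ; irrefl = λ {x} r → let z , p , q = walk₂-out {C′ = cover H} r in
    both (base {m} x) (base {m} z) (Sign.+ · (sheet {m} x · sheet {m} z)) p (subst (λ t → Edge H t (base {m} x) (base {m} z)) (signs (sheet {m} x) (sheet {m} z)) (edge-flip H q)) }
    where
    signs : ∀ a g → Sign.- · (g · a) ≡ opposite (Sign.+ · (a · g))
    signs = toWitness {a? = all± λ a → all± λ g → Sign.- · (g · a) Signₚ.≟ opposite (Sign.+ · (a · g))} tt
    both : ∀ x z s → Edge H s x z → Edge H (opposite s) x z → ⊥
    both x z Sign.+ p q = u x z p q
    both x z Sign.- p q = u x z q p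

  neighbour : Connected H → ∀ {s x y} → Edge H s x y → ∀ v → ∃[ t ] ∃[ u ] Edge H t v u
  neighbour conn {s} {x} {y} e v = go (conn v x)
    where
    go : ∀ {v} → Star (Adjacent H) v x → ∃[ t ] ∃[ u ] Edge H t v u
    go ε             = s , y , e
    go ((t , f) ◅ _) = t , _ , f

  -- The loop joins the two vertices over `z` in the graph of the other sign. A colouring of that
  -- graph alternates on this fibre, hence on all fibres.
  loop-case : Connected H → ∀ ℓ z → Edge H ℓ z z → ¬ HasLoop (opposite ℓ) H → Easy H ⊎ Hard H
  loop-case conn ℓ z e n with colouring? (graphOf (cover H) (signed (opposite ℓ)))
  ... | no ¬c = inj₂ (signed (opposite ℓ) , signed-simple (opposite ℓ) n , ¬c)
  ... | yes c = inj₁ (one-loop ℓ z e (balanced-cong H (signs ℓ) (steep H (opposite ℓ) c′ λ v → trans (fibre-const H (opposite ℓ) c′ conn v z) at-z)))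
    where
    c′ : Colouring (edge (cover H) (opposite ℓ))
    c′ = as-edges ℓ c
      where
      as-edges : ∀ ℓ → Colouring (graphOf (cover H) (signed (opposite ℓ))) → Colouring (edge (cover H) (opposite ℓ))
      as-edges Sign.+ c = c
      as-edges Sign.- c = c
    signs : ∀ ℓ s → opposite (opposite ℓ · s) ≡ ℓ · s
    signs = toWitness {a? = all± λ ℓ → all± λ s → opposite (opposite ℓ · s) Signₚ.≟ ℓ · s} tt
    at-z : fibre H (opposite ℓ) c′ z ≡ Sign.-
    at-z = trans (cong (λ q → colour-at H (opposite ℓ) c′ z Sign.+ · colour-at H (opposite ℓ) c′ z q) (sym (twist ℓ))) (colour-edge H (opposite ℓ) c′ Sign.+ e)
      where
      twist : ∀ ℓ → opposite ℓ · (ℓ · Sign.+) ≡ Sign.-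
      twist Sign.+ = refl
      twist Sign.- = refl

  -- The positive loop at `x` extends each edge there to a walk of two edges, so `potential` follows
  -- the signs of single edges at `x`. This property spreads along walks to `y`, where the negative
  -- loop contradicts it.
  two-loops-absurd : Connected H → Colouring (graphOf (cover H) walk₂) → ∀ {x y} → Edge H Sign.+ x x → Edge H Sign.- y y → ⊥
  two-loops-absurd conn c {x} {y} ex ey = clash (potential y) (spread (conn x y) (λ e → walks ex e) ey)
    where
    open WalkColouring H c
    Follows′ : Fin m → Set
    Follows′ v = ∀ {s z} → Edge H s v z → potential v · potential z ≡ s
    walks : ∀ {s v z w t} → Edge H s v z → Edge H t z w → potential v · potential w ≡ s · t
    walks = potential-walk
    pass : ∀ {v z t} → Edge H t v z → Follows′ v → Follows′ z
    pass {v} {z} {t} e f {s} {w} e′ = signs (potential v) (potential z) (potential w) t s (f e) (walks e e′)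
      where
      signs : ∀ p q r t s → p · q ≡ t → p · r ≡ t · s → q · r ≡ s
      signs = toWitness {a? = all± λ p → all± λ q → all± λ r → all± λ t → all± λ s → (p · q Signₚ.≟ t) →-dec ((p · r Signₚ.≟ t · s) →-dec (q · r Signₚ.≟ s))} tt
    spread : ∀ {v w} → Star (Adjacent H) v w → Follows′ v → Follows′ w
    spread ε            f = f
    spread ((_ , e) ◅ p) f = spread p (pass e f)
    clash : ∀ p → p · p ≡ Sign.- → ⊥
    clash Sign.+ ()
    clash Sign.- ()

  -- If the colourings for both signs alternate, `H` is both balanced and antibalanced, and the
  -- product of the two labellings is a 2-colouring.
  bipartite-of : Connected H → Fin m → Colouring (edge (cover H) Sign.+) → Colouring (edge (cover H) Sign.-) → Balanced (const Sign.-) H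
  bipartite-of conn v₀ c d with fibre H Sign.+ c v₀ in ec | fibre H Sign.- d v₀ in ed
  ... | Sign.+ | _ = flat H Sign.+ c λ v → trans (fibre-const H Sign.+ c conn v v₀) ec
  ... | Sign.- | Sign.+ = flat H Sign.- d λ v → trans (fibre-const H Sign.- d conn v v₀) ed
  ... | Sign.- | Sign.- =
    let σ , f = steep H Sign.+ c λ v → trans (fibre-const H Sign.+ c conn v v₀) ec
        τ , g = steep H Sign.- d λ v → trans (fibre-const H Sign.- d conn v v₀) ed
    in (λ v → σ v · τ v) , λ s x y e → trans (·-pairs (σ x) (τ x) (σ y) (τ y)) (trans (cong₂ _·_ (f s x y e) (g s x y e)) (signs s))
    where
    signs : ∀ s → opposite (Sign.+ · s) · opposite (Sign.- · s) ≡ Sign.-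
    signs = toWitness {a? = all± λ s → opposite (Sign.+ · s) · opposite (Sign.- · s) Signₚ.≟ Sign.-} tt

  -- The potential relates vertices on the same side of the bipartition only. On the other side the
  -- label is taken over from some neighbour, and walks of two edges show that it fits all the other
  -- neighbours.
  balanced-of : (∀ v → ∃[ t ] ∃[ u ] Edge H t v u) → Balanced (const Sign.-) H → Colouring (graphOf (cover H) walk₂) → Balanced id H
  balanced-of nb (κ , g) c = σ , λ s x y e → verify s x y e (κ x) (κ y) refl refl (g s x y e)
    where
    open WalkColouring H c
    σ : Fin m → Sign
    σ v = choose (κ v) (potential v) (proj₁ (nb v) · potential (proj₁ (proj₂ (nb v))))
    signs : ∀ p q s t → p · q ≡ s · t → p · (t · q) ≡ s
    signs = toWitness {a? = all± λ p → all± λ q → all± λ s → all± λ t → (p · q Signₚ.≟ s · t) →-dec (p · (t · q) Signₚ.≟ s)} tt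
    verify : ∀ s x y → Edge H s x y → ∀ a b → κ x ≡ a → κ y ≡ b → κ x · κ y ≡ Sign.- → σ x · σ y ≡ s
    verify s x y e Sign.+ Sign.- p q _ rewrite p | q =
      signs (potential x) (potential (proj₁ (proj₂ (nb y)))) s (proj₁ (nb y)) (potential-walk e (proj₂ (proj₂ (nb y))))
    verify s x y e Sign.- Sign.+ p q _ rewrite p | q = trans (Signₚ.*-comm (proj₁ (nb x) · potential (proj₁ (proj₂ (nb x)))) (potential y))
      (signs (potential y) (potential (proj₁ (proj₂ (nb x)))) s (proj₁ (nb x)) (potential-walk (edge-flip H e) (proj₂ (proj₂ (nb x)))))
    verify s x y e Sign.+ Sign.+ p q r = contradiction (trans (sym (cong₂ _·_ p q)) r) λ ()
    verify s x y e Sign.- Sign.- p q r = contradiction (trans (sym (cong₂ _·_ p q)) r) λ ()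

  loopless-case : Connected H → ∀ {s x y} → Edge H s x y → (∀ r → ¬ HasLoop r H) → Easy H ⊎ Hard H
  loopless-case conn {s} {x} {y} e n with colouring? (edge (cover H) Sign.+) | colouring? (edge (cover H) Sign.-)
  ... | no ¬c | _     = inj₂ (positive , signed-simple Sign.+ (n Sign.+) , ¬c)
  ... | yes _ | no ¬d = inj₂ (negative , signed-simple Sign.- (n Sign.-) , ¬d)
  ... | yes c | yes d with Finₚ.any? (λ x → Finₚ.any? λ z → T? (edge H Sign.+ x z) ×-dec T? (edge H Sign.- x z))
  ...   | yes (x′ , z , p , q) = inj₁ (digon x′ z (λ { Sign.+ → p ; Sign.- → q }) (bipartite-of conn x c d))
  ...   | no ¬p with colouring? (graphOf (cover H) walk₂)
  ...     | no ¬k = inj₂ (walk₂ , walk₂-simple (λ x z p q → ¬p (x , z , p , q)) , ¬k)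
  ...     | yes k = inj₁ (one-edge s x y e (balanced-of (neighbour conn e) (bipartite-of conn x c d) k) (bipartite-of conn x c d))

hasLoop? : ∀ {m} (H : SignedGraph m) s → Dec (HasLoop s H)
hasLoop? H s = Finₚ.any? λ x → T? (edge H s x x)

dichotomy : ∀ {m} (H : SignedGraph m) → Connected H → ¬ (HasNegativeDigon H × HasLoop Sign.+ H × HasLoop Sign.- H) → Easy H ⊎ Hard H
dichotomy {zero}  H conn _ = inj₁ (no-vertices refl)
dichotomy {suc _} H conn ¬3 with Finₚ.any? (λ x → Finₚ.any? λ y → T? (edge H Sign.+ x y) ⊎-dec T? (edge H Sign.- x y))
... | no ¬e = inj₁ (no-edges zero λ { Sign.+ x y e → ¬e (x , y , inj₁ e) ; Sign.- x y e → ¬e (x , y , inj₂ e) })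
... | yes (x , y , xy) with hasLoop? H Sign.+ | hasLoop? H Sign.-
...   | yes (z , e) | no n        = loop-case H conn Sign.+ z e n
...   | no n        | yes (z , e) = loop-case H conn Sign.- z e n
...   | no n₊       | no n₋       = [ (λ e → loopless-case H conn {Sign.+} e n) , (λ e → loopless-case H conn {Sign.-} e n) ]′ xy
  where
  n : ∀ r → ¬ HasLoop r H
  n Sign.+ = n₊
  n Sign.- = n₋
...   | yes (a , ea) | yes (b , eb) with Finₚ.any? (λ x → T? (edge H Sign.+ x x) ×-dec T? (edge H Sign.- x x))
...     | yes (z , p , q) = inj₁ (both-loops z λ { Sign.+ → p ; Sign.- → q })
...     | no ¬b with colouring? (graphOf (cover H) walk₂)
...       | no ¬k = inj₂ (walk₂ , walk₂-simple H unpaired , ¬k)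
  where
  -- Here the excluded triple enters: in the presence of loops of both signs there is no negative
  -- digon.
  unpaired : Unpaired H
  unpaired x z p q with x Finₚ.≟ z
  ... | yes refl = ¬b (x , p , q)
  ... | no x≢z   = ¬3 ((x , z , x≢z , p , q) , (a , ea) , (b , eb))
...       | yes k = ⊥-elim (two-loops-absurd H conn k ea eb)

-- Graphs with at most two edges are not hard

χ : Bool → Sign
χ true  = Sign.+
χ false = Sign.-

bool-of : Sign → Bool
bool-of Sign.+ = true
bool-of Sign.- = false

bool-of-apart : ∀ {a b} → a · b ≡ Sign.- → bool-of a ≢ bool-of b
bool-of-apart {Sign.+} {Sign.+} () _
bool-of-apart {Sign.+} {Sign.-} _ ()
bool-of-apart {Sign.-} {Sign.+} _ ()
bool-of-apart {Sign.-} {Sign.-} () _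

module _ {m : ℕ} (C : SignedGraph m) where

  -- The converses of `flat` and `steep`: labellings of `C` give back colourings of the cover,
  -- constant or alternating on the fibres.
  colour-flat : ∀ r → Balanced (const Sign.-) C → Colouring (edge (cover C) r)
  colour-flat r (κ , g) = (λ u → bool-of (κ (base {m} u))) , λ u v e → bool-of-apart (g _ _ _ e)

  colour-steep : ∀ r → Balanced (λ s → opposite (r · s)) C → Colouring (edge (cover C) r)
  colour-steep r (τ , g) = (λ u → bool-of (sheet {m} u · τ (base {m} u))) , λ u v e →
    bool-of-apart (signs r (sheet {m} u) (sheet {m} v) (τ (base {m} u)) (τ (base {m} v)) (g _ _ _ e))
    where
    signs : ∀ r a b p q → p · q ≡ opposite (r · (r · (a · b))) → (a · p) · (b · q) ≡ Sign.-
    signs = toWitness {a? = all± λ r → all± λ a → all± λ b → all± λ p → all± λ q → (p · q Signₚ.≟ opposite (r · (r · (a · b)))) →-dec ((a · p) · (b · q) Signₚ.≟ Sign.-)} tt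

  colour-walk₂ : (τ : Fin m → Sign) → (∀ {s t x z y} → Edge C s x z → Edge C t z y → τ x · τ y ≡ s · t) → Colouring (graphOf (cover C) walk₂)
  colour-walk₂ τ g = (λ u → bool-of (sheet {m} u · τ (base {m} u))) , λ u v r → let z , p , q = walk₂-out {C′ = cover C} r in
    bool-of-apart (signs (sheet {m} u) (sheet {m} z) (sheet {m} v) (τ (base {m} u)) (τ (base {m} v)) (g p q))
    where
    signs : ∀ a c b p q → p · q ≡ (Sign.+ · (a · c)) · (Sign.- · (c · b)) → (a · p) · (b · q) ≡ Sign.-
    signs = toWitness {a? = all± λ a → all± λ c → all± λ b → all± λ p → all± λ q →
      (p · q Signₚ.≟ (Sign.+ · (a · c)) · (Sign.- · (c · b))) →-dec ((a · p) · (b · q) Signₚ.≟ Sign.-)} tt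

  colour-walk₂-balanced : ∀ r → Balanced (r ·_) C → Colouring (graphOf (cover C) walk₂)
  colour-walk₂-balanced r (τ , g) = colour-walk₂ τ λ {s} {t} {x} {z} {y} e f → signs r s t (τ x) (τ z) (τ y) (g s x z e) (g t z y f)
    where
    signs : ∀ r s t p q u → p · q ≡ r · s → q · u ≡ r · t → p · u ≡ s · t
    signs = toWitness {a? = all± λ r → all± λ s → all± λ t → all± λ p → all± λ q → all± λ u →
      (p · q Signₚ.≟ r · s) →-dec ((q · u Signₚ.≟ r · t) →-dec (p · u Signₚ.≟ s · t))} tt

module _ {m : ℕ} where

  single : Fin m → Sign → Fin m → Sign
  single a g v = if ⌊ v Finₚ.≟ a ⌋ then g else Sign.+

  single-edge : ∀ x y g → (x ≡ y → g ≡ Sign.+) → single x g x · single x g y ≡ g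
  single-edge x y g h with x Finₚ.≟ x | y Finₚ.≟ x
  ... | no n  | _        = contradiction refl n
  ... | yes _ | no _     = Signₚ.*-identityʳ g
  ... | yes _ | yes refl = trans (Signₚ.s*s≡+ g) (sym (h refl))

  override : Fin m → Sign → (Fin m → Sign) → Fin m → Sign
  override a g σ v = if ⌊ v Finₚ.≟ a ⌋ then g else σ v

  override-same : ∀ a g σ → override a g σ a ≡ g
  override-same a g σ with a Finₚ.≟ a
  ... | yes _ = refl
  ... | no n  = contradiction refl n

  override-off : ∀ a g σ v → v ≢ a → override a g σ v ≡ σ v
  override-off a g σ v n with v Finₚ.≟ a
  ... | yes e = contradiction e n
  ... | no _  = refl

  SameEnds : Fin m → Fin m → Fin m → Fin m → Set
  SameEnds x₁ y₁ x₂ y₂ = (x₁ ≡ x₂ × y₁ ≡ y₂) ⊎ (x₁ ≡ y₂ × y₁ ≡ x₂)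

  -- If the first pair is neither a loop nor equal to the second pair, one of its ends lies off the
  -- second pair, and its label can be adjusted last.
  two-products : ∀ x₁ y₁ g₁ x₂ y₂ g₂ → (x₁ ≡ y₁ → g₁ ≡ Sign.+) → (x₂ ≡ y₂ → g₂ ≡ Sign.+) → (SameEnds x₁ y₁ x₂ y₂ → g₁ ≡ g₂) →
                 Σ[ σ ∈ (Fin m → Sign) ] (σ x₁ · σ y₁ ≡ g₁ × σ x₂ · σ y₂ ≡ g₂)
  two-products x₁ y₁ g₁ x₂ y₂ g₂ h₁ h₂ h = go
    where
    σ₂ = single x₂ g₂
    second : σ₂ x₂ · σ₂ y₂ ≡ g₂
    second = single-edge x₂ y₂ g₂ h₂
    at : ∀ a b → a ≢ b → a ≢ x₂ → a ≢ y₂ → let σ = override a (g₁ · σ₂ b) σ₂ in σ a · σ b ≡ g₁ × σ x₂ · σ y₂ ≡ g₂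
    at a b a≢b ax ay =
      trans (cong₂ _·_ (override-same a _ σ₂) (override-off a _ σ₂ b (a≢b ∘ sym))) (trans (Signₚ.*-assoc g₁ (σ₂ b) (σ₂ b)) (trans (cong (g₁ ·_) (Signₚ.s*s≡+ (σ₂ b))) (Signₚ.*-identityʳ g₁))) ,
      trans (cong₂ _·_ (override-off a _ σ₂ x₂ (ax ∘ sym)) (override-off a _ σ₂ y₂ (ay ∘ sym))) second
    go : Σ[ σ ∈ (Fin m → Sign) ] (σ x₁ · σ y₁ ≡ g₁ × σ x₂ · σ y₂ ≡ g₂)
    go with x₁ Finₚ.≟ y₁
    ... | yes refl = σ₂ , trans (Signₚ.s*s≡+ (σ₂ x₁)) (sym (h₁ refl)) , second
    ... | no n with x₁ Finₚ.≟ x₂ | x₁ Finₚ.≟ y₂ | y₁ Finₚ.≟ x₂ | y₁ Finₚ.≟ y₂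
    ...   | no p  | no q  | _     | _     = override x₁ (g₁ · σ₂ y₁) σ₂ , at x₁ y₁ n p q
    ...   | _     | _     | no p  | no q  = override y₁ (g₁ · σ₂ x₁) σ₂ ,
            map₁ (trans (Signₚ.*-comm (override y₁ (g₁ · σ₂ x₁) σ₂ x₁) (override y₁ (g₁ · σ₂ x₁) σ₂ y₁))) (at y₁ x₁ (n ∘ sym) p q)
    ...   | yes p | _     | yes q | _     = contradiction (trans p (sym q)) n
    ...   | _     | yes p | _     | yes q = contradiction (trans p (sym q)) n
    ...   | yes refl | _  | no _  | yes refl = σ₂ , trans second (sym (h (inj₁ (refl , refl)))) , second
    ...   | no _  | yes refl | yes refl | no _ = σ₂ , trans (Signₚ.*-comm (σ₂ x₁) (σ₂ y₁)) (trans second (sym (h (inj₂ (refl , refl))))) , second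

-- The two edges may coincide, which covers graphs with a single edge.
record TwoEdges {m} (C : SignedGraph m) : Set where
  field
    s₁ s₂       : Sign
    x₁ y₁ x₂ y₂ : Fin m
    e₁          : Edge C s₁ x₁ y₁
    e₂          : Edge C s₂ x₂ y₂
    only        : ∀ {s x y} → Edge C s x y → (s ≡ s₁ × SameEnds x y x₁ y₁) ⊎ (s ≡ s₂ × SameEnds x y x₂ y₂)

few-edges : ∀ {m} (C : SignedGraph m) → numEdges C ≤ 2 → Edgeless C ⊎ TwoEdges C
few-edges {m} C l = go (edges C) refl l
  where
  listed : ∀ {s x y} → Edge C s x y → toℕ x ≤ toℕ y → (s , x , y) ∈ edges C
  listed {s} {x} {y} e x≤y = ∈ₚ.∈-filter⁺ (T? ∘ candidates C)
    (∈ₚ.∈-cartesianProduct⁺ (sign-listed s) (∈ₚ.∈-cartesianProduct⁺ (∈ₚ.∈-allFin x) (∈ₚ.∈-allFin y)))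
    (∧-in (fromWitness {a? = x Finₚ.≤? y} x≤y) e)
    where
    sign-listed : ∀ s → s ∈ (Sign.+ ∷ Sign.- ∷ [])
    sign-listed Sign.+ = Any.here refl
    sign-listed Sign.- = Any.there (Any.here refl)
  covered : ∀ {s x y} → Edge C s x y → ∃[ a ] ∃[ b ] ((s , a , b) ∈ edges C × SameEnds x y a b)
  covered {s} {x} {y} e with ℕₚ.≤-total (toℕ x) (toℕ y)
  ... | inj₁ l = x , y , listed e l , inj₁ (refl , refl)
  ... | inj₂ l = y , x , listed (edge-flip C e) l , inj₂ (refl , refl)
  isEdge : ∀ {s x y} → (s , x , y) ∈ edges C → Edge C s x y
  isEdge {s} {x} {y} i = proj₂ (∧-out {⌊ x Finₚ.≤? y ⌋} (proj₂ (∈ₚ.∈-filter⁻ (T? ∘ candidates C) {xs = places m} i)))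
  go : ∀ es → es ≡ edges C → length es ≤ 2 → Edgeless C ⊎ TwoEdges C
  go [] eq _ = inj₁ λ s x y e → let a , b , i , _ = covered e in absurd (subst ((s , a , b) ∈_) (sym eq) i)
    where
    absurd : ∀ {z : Sign × Fin m × Fin m} → z ∈ [] → ⊥
    absurd ()
  go ((s₁ , x₁ , y₁) ∷ []) eq _ = inj₂ record
    { e₁ = isEdge (subst ((s₁ , x₁ , y₁) ∈_) eq (Any.here refl)) ; e₂ = isEdge (subst ((s₁ , x₁ , y₁) ∈_) eq (Any.here refl))
    ; only = λ e → let a , b , i , h = covered e in pick₁ h (subst ((_ , a , b) ∈_) (sym eq) i) }
    where
    pick₁ : ∀ {s x y a b} → SameEnds x y a b → (s , a , b) ∈ ((s₁ , x₁ , y₁) ∷ []) → (s ≡ s₁ × SameEnds x y x₁ y₁) ⊎ (s ≡ s₁ × SameEnds x y x₁ y₁)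
    pick₁ h (Any.here refl) = inj₁ (refl , h)
  go ((s₁ , x₁ , y₁) ∷ (s₂ , x₂ , y₂) ∷ []) eq _ = inj₂ record
    { e₁ = isEdge (subst ((s₁ , x₁ , y₁) ∈_) eq (Any.here refl)) ; e₂ = isEdge (subst ((s₂ , x₂ , y₂) ∈_) eq (Any.there (Any.here refl)))
    ; only = λ e → let a , b , i , h = covered e in pick₂ h (subst ((_ , a , b) ∈_) (sym eq) i) }
    where
    pick₂ : ∀ {s x y a b} → SameEnds x y a b → (s , a , b) ∈ ((s₁ , x₁ , y₁) ∷ (s₂ , x₂ , y₂) ∷ []) → (s ≡ s₁ × SameEnds x y x₁ y₁) ⊎ (s ≡ s₂ × SameEnds x y x₂ y₂)
    pick₂ h (Any.here refl)             = inj₁ (refl , h)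
    pick₂ h (Any.there (Any.here refl)) = inj₂ (refl , h)
  go (_ ∷ _ ∷ _ ∷ _) eq (s≤s (s≤s ()))

module _ {m : ℕ} (C : SignedGraph m) (D : TwoEdges C) where
  open TwoEdges D

  balanced-two : ∀ h → (x₁ ≡ y₁ → h s₁ ≡ Sign.+) → (x₂ ≡ y₂ → h s₂ ≡ Sign.+) → (SameEnds x₁ y₁ x₂ y₂ → h s₁ ≡ h s₂) → Balanced h C
  balanced-two h l₁ l₂ e with two-products x₁ y₁ (h s₁) x₂ y₂ (h s₂) l₁ l₂ e
  ... | σ , p , q = σ , λ s x y xy → case only xy of λ { (inj₁ (refl , k)) → ends p k ; (inj₂ (refl , k)) → ends q k }
    where
    ends : ∀ {x y a b g} → σ a · σ b ≡ g → SameEnds x y a b → σ x · σ y ≡ g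
    ends {a = a} {b} p (inj₁ (refl , refl)) = p
    ends {a = a} {b} p (inj₂ (refl , refl)) = trans (Signₚ.*-comm (σ b) (σ a)) p

  loop₁ : x₁ ≡ y₁ → Edge C s₁ x₁ x₁
  loop₁ e = subst (Edge C s₁ x₁) (sym e) e₁

  loop₂ : x₂ ≡ y₂ → Edge C s₂ x₂ x₂
  loop₂ e = subst (Edge C s₂ x₂) (sym e) e₂

  -- Two edges that are not loops form a bipartite graph. Otherwise there is a loop, its sign is not
  -- `r`, and the colouring that alternates on fibres works.
  sign-colouring : ∀ r → ¬ HasLoop r C → Colouring (edge (cover C) r)
  sign-colouring r n with x₁ Finₚ.≟ y₁ | x₂ Finₚ.≟ y₂
  ... | no a | no b = colour-flat C r (balanced-two (const Sign.-) (λ e → contradiction e a) (λ e → contradiction e b) (λ _ → refl))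
  ... | yes a | b = colour-steep C r (balanced-two (λ s → opposite (r · s)) (λ e → loop-sign r s₁ λ z → n (x₁ , subst (λ q → Edge C q x₁ x₁) z (loop₁ e)))
        (λ e → loop-sign r s₂ λ z → n (x₂ , subst (λ q → Edge C q x₂ x₂) z (loop₂ e)))
        (λ { (inj₁ (p , q)) → both-loops′ (trans (sym p) (trans a q)) ; (inj₂ (p , q)) → both-loops′ (trans (sym q) (trans (sym a) p)) }))
    where
    loop-sign : ∀ r s → s ≢ r → opposite (r · s) ≡ Sign.+
    loop-sign = toWitness {a? = all± λ r → all± λ s → ¬? (s Signₚ.≟ r) →-dec (opposite (r · s) Signₚ.≟ Sign.+)} tt
    both-loops′ : x₂ ≡ y₂ → opposite (r · s₁) ≡ opposite (r · s₂)
    both-loops′ b = trans (loop-sign r s₁ λ z → n (x₁ , subst (λ q → Edge C q x₁ x₁) z (loop₁ a)))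
                     (sym (loop-sign r s₂ λ z → n (x₂ , subst (λ q → Edge C q x₂ x₂) z (loop₂ b))))
  ... | no a | yes b = colour-steep C r (balanced-two (λ s → opposite (r · s)) (λ e → contradiction e a)
        (λ e → loop-sign r s₂ λ z → n (x₂ , subst (λ q → Edge C q x₂ x₂) z (loop₂ e)))
        (λ { (inj₁ (p , q)) → contradiction (trans p (trans b (sym q))) a ; (inj₂ (p , q)) → contradiction (trans p (trans (sym b) (sym q))) a }))
    where
    loop-sign : ∀ r s → s ≢ r → opposite (r · s) ≡ Sign.+
    loop-sign = toWitness {a? = all± λ r → all± λ s → ¬? (s Signₚ.≟ r) →-dec (opposite (r · s) Signₚ.≟ Sign.+)} tt

  unpaired-same : Unpaired C → SameEnds x₁ y₁ x₂ y₂ → s₁ ≡ s₂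
  unpaired-same u k = go s₁ s₂ e₁ (moved k)
    where
    moved : SameEnds x₁ y₁ x₂ y₂ → Edge C s₂ x₁ y₁
    moved (inj₁ (p , q)) = subst₂ (Edge C s₂) (sym p) (sym q) e₂
    moved (inj₂ (p , q)) = subst₂ (Edge C s₂) (sym p) (sym q) (edge-flip C e₂)
    go : ∀ s t → Edge C s x₁ y₁ → Edge C t x₁ y₁ → s ≡ t
    go Sign.+ Sign.+ _ _ = refl
    go Sign.- Sign.- _ _ = refl
    go Sign.+ Sign.- p q = ⊥-elim (u _ _ p q)
    go Sign.- Sign.+ p q = ⊥-elim (u _ _ q p)

  walk₂-colouring : Unpaired C → Colouring (graphOf (cover C) walk₂)
  walk₂-colouring u with x₁ Finₚ.≟ y₁ | x₂ Finₚ.≟ y₂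
  ... | no a | no b = colour-walk₂-balanced C Sign.+ (balanced-two id (λ e → contradiction e a) (λ e → contradiction e b) (unpaired-same u))
  ... | yes a | no b = colour-walk₂-balanced C s₁ (balanced-two (s₁ ·_) (λ _ → Signₚ.s*s≡+ s₁) (λ e → contradiction e b) (cong (s₁ ·_) ∘ unpaired-same u))
  ... | no a | yes b = colour-walk₂-balanced C s₂ (balanced-two (s₂ ·_) (λ e → contradiction e a) (λ _ → Signₚ.s*s≡+ s₂) (cong (s₂ ·_) ∘ unpaired-same u))
  ... | yes refl | yes refl with s₁ Signₚ.≟ s₂
  ...   | yes e = colour-walk₂-balanced C s₁ (balanced-two (s₁ ·_) (λ _ → Signₚ.s*s≡+ s₁) (λ _ → trans (cong (s₁ ·_) (sym e)) (Signₚ.s*s≡+ s₁)) (cong (s₁ ·_) ∘ unpaired-same u))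
  -- Loops of opposite signs are at different vertices here, so no walk uses both and all walks of
  -- two edges are positive.
  ...   | no n  = colour-walk₂ C (const Sign.+) λ p q → loops (only p) (only q)
    where
    loops : ∀ {s t x z y} → (s ≡ s₁ × SameEnds x z x₁ x₁) ⊎ (s ≡ s₂ × SameEnds x z x₂ x₂) → (t ≡ s₁ × SameEnds z y x₁ x₁) ⊎ (t ≡ s₂ × SameEnds z y x₂ x₂) → Sign.+ ≡ s · t
    loops (inj₁ (refl , _)) (inj₁ (refl , _)) = sym (Signₚ.s*s≡+ s₁)
    loops (inj₂ (refl , _)) (inj₂ (refl , _)) = sym (Signₚ.s*s≡+ s₂)
    loops (inj₁ (_ , k)) (inj₂ (_ , l)) = contradiction (unpaired-same u (inj₁ (meet k l , meet k l))) n
      where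
      meet : ∀ {x z y} → SameEnds x z x₁ x₁ → SameEnds z y x₂ x₂ → x₁ ≡ x₂
      meet (inj₁ (_ , p)) (inj₁ (q , _)) = trans (sym p) q
      meet (inj₁ (_ , p)) (inj₂ (q , _)) = trans (sym p) q
      meet (inj₂ (_ , p)) (inj₁ (q , _)) = trans (sym p) q
      meet (inj₂ (_ , p)) (inj₂ (q , _)) = trans (sym p) q
    loops (inj₂ (_ , k)) (inj₁ (_ , l)) = contradiction (unpaired-same u (inj₁ (sym (meet k l) , sym (meet k l)))) n
      where
      meet : ∀ {x z y} → SameEnds x z x₂ x₂ → SameEnds z y x₁ x₁ → x₂ ≡ x₁
      meet (inj₁ (_ , p)) (inj₁ (q , _)) = trans (sym p) q
      meet (inj₁ (_ , p)) (inj₂ (q , _)) = trans (sym p) q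
      meet (inj₂ (_ , p)) (inj₁ (q , _)) = trans (sym p) q
      meet (inj₂ (_ , p)) (inj₂ (q , _)) = trans (sym p) q

cover-loop : ∀ {m} (C : SignedGraph m) r → HasLoop r C → ∃[ u ] Edge (cover C) r u u
cover-loop C r (x , e) = over x Sign.+ , subst T (trans (cong (λ q → edge C q x x) (sym (Signₚ.*-identityʳ r))) (sym (cover-over C r x Sign.+ x Sign.+))) e

few-edges-easy : ∀ {m} (C : SignedGraph m) → numEdges C ≤ 2 → ¬ Hard C
few-edges-easy {m} C l (R , S , ¬c) with few-edges C l
... | inj₁ none = ¬c (colour R)
  where
  colour : ∀ R → Colouring (graphOf (cover C) R)
  colour positive = const true , λ u v e _ → none _ _ _ e
  colour negative = const true , λ u v e _ → none _ _ _ e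
  colour walk₂    = const true , λ u v r _ → let z , p , _ = walk₂-out {C′ = cover C} r in none _ _ _ p
... | inj₂ D = ¬c (colour R S)
  where
  colour : ∀ R → Simple (graphOf (cover C) R) → Colouring (graphOf (cover C) R)
  colour positive S = sign-colouring C D Sign.+ λ h → Simple.irrefl S (proj₂ (cover-loop C Sign.+ h))
  colour negative S = sign-colouring C D Sign.- λ h → Simple.irrefl S (proj₂ (cover-loop C Sign.- h))
  colour walk₂    S = walk₂-colouring C D λ x z p q → Simple.irrefl S {over x Sign.+} (∃ᵇ-in (over z Sign.+) (∧-in
    (subst T (sym (cover-over C Sign.+ x Sign.+ z Sign.+)) p) (subst T (sym (cover-over C Sign.- z Sign.+ x Sign.+)) (edge-flip C q))))

cover-hom : ∀ {n m} (G : SignedGraph n) (H : SignedGraph m) → LHom G H → ∃[ ψ ] IsECHom (cover G) (cover H) ψ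
cover-hom {n} {m} G H (φ , σ , l) = (λ u → over (φ (base {n} u)) (sheet {n} u · σ (base {n} u))) , λ s u v e →
  subst T (sym (cover-over H s _ (sheet {n} u · σ (base {n} u)) _ (sheet {n} v · σ (base {n} v))))
    (subst (λ q → Edge H q _ _) (signs s (sheet {n} u) (sheet {n} v) (σ (base {n} u)) (σ (base {n} v))) (l _ _ _ e))
  where
  signs : ∀ s a b p q → (s · (a · b)) · (p · q) ≡ s · ((a · p) · (b · q))
  signs = toWitness {a? = all± λ s → all± λ a → all± λ b → all± λ p → all± λ q → (s · (a · b)) · (p · q) Signₚ.≟ s · ((a · p) · (b · q))} tt

-- Loops would be carried along `ι` to `H`, and 2-colourings are pulled back along `ρ` to `H`.
hard-transfer : ∀ {m m′} (H : SignedGraph m) (C : SignedGraph m′) → LHom C H → LHom H C → Hard H → Hard C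
hard-transfer H C ι ρ (R , S , ¬c) = R ,
  record { symm = λ {x} {y} → graphOf-sym C R {x} {y} ; irrefl = λ e → Simple.irrefl S (graphOf-hom {C₁ = cover C} {cover H} (proj₂ (cover-hom C H ι)) R e) } ,
  λ (c , h) → ¬c (c ∘ proj₁ (cover-hom H C ρ) , λ x y e → h _ _ (graphOf-hom {C₁ = cover H} {cover C} (proj₂ (cover-hom H C ρ)) R e))

-- Words that encode graphs

hit-++ : ∀ (pre v : Word) j b → hit (pre ++ v) (length pre + j) b ≡ hit v j b
hit-++ []        v j b = refl
hit-++ (_ ∷ pre) v j b = hit-++ pre v j b

hit-catF : ∀ {k} (g : Fin k → Bool) i → hit (catF k (λ i → [ g i ])) (toℕ i) true ≡ g i
hit-catF g zero    = refl
hit-catF g (suc i) = hit-catF (g ∘ suc) i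

catF-hit : ∀ k (v : Word) → length v ≡ k → v ≡ catF k (λ i → [ hit v (toℕ i) true ])
catF-hit zero    []      e = refl
catF-hit (suc k) (b ∷ v) e = cong (b ∷_) (catF-hit k v (ℕₚ.suc-injective e))

catF-length₁ : ∀ k (g : Fin k → Bool) → length (catF k (λ i → [ g i ])) ≡ k
catF-length₁ zero    g = refl
catF-length₁ (suc k) g = cong suc (catF-length₁ k (g ∘ suc))

lead : Word → ℕ
lead (true ∷ w) = suc (lead w)
lead _          = 0

lead-≤ : ∀ w → lead w ≤ length w
lead-≤ []          = z≤n
lead-≤ (true ∷ w)  = s≤s (lead-≤ w)
lead-≤ (false ∷ w) = z≤n

lead-split : ∀ w → lead w < length w → ∃[ M ] (w ≡ replicate (lead w) true ++ false ∷ M)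
lead-split (true ∷ w)  (s≤s l) = let M , e = lead-split w l in M , cong (true ∷_) e
lead-split (false ∷ w) l       = w , refl

lead-hit : ∀ w i → i < lead w → hit w i true ≡ true
lead-hit (true ∷ w) zero    l       = refl
lead-hit (true ∷ w) (suc i) (s≤s l) = lead-hit w i l

lead-end : ∀ w → hit w (lead w) true ≡ false
lead-end []          = refl
lead-end (true ∷ w)  = lead-end w
lead-end (false ∷ w) = refl

offset : Sign → ℕ → ℕ
offset Sign.+ n = 0
offset Sign.- n = n * n

-- Position of a matrix entry in an encoding: behind `n` ones and the zero that ends them, and
-- behind a whole matrix in the case of negative edges.
idx : ℕ → Sign → ℕ → ℕ → ℕ
idx n s a b = n + suc (offset s n + (n * a + b))

bitsOf : ∀ n → (Sign → Fin n → Fin n → Bool) → Word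
bitsOf n f = replicate n true ++ false ∷ matrixBits (f Sign.+) ++ matrixBits (f Sign.-)

matrix-flat : ∀ {n} (f : Fin n → Fin n → Bool) → matrixBits f ≡ catF (n * n) (λ i → [ uncurry f (remQuot {n} n i) ])
matrix-flat {n} f = sym (trans (catF-* n n _) (catF-cong n λ a → catF-cong n λ b → cong (λ p → [ uncurry f p ]) (Finₚ.remQuot-combine {n} a b)))

matrix-length : ∀ {n} (f : Fin n → Fin n → Bool) → length (matrixBits f) ≡ n * n
matrix-length {n} f = trans (cong length (matrix-flat f)) (catF-length₁ (n * n) _)

matrix-hit : ∀ {n} (f : Fin n → Fin n → Bool) a b → hit (matrixBits f) (n * toℕ a + toℕ b) true ≡ f a b
matrix-hit {n} f a b = trans (cong₂ (λ v j → hit v j true) (matrix-flat f) (sym (Finₚ.toℕ-combine a b)))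
  (trans (hit-catF (λ i → uncurry f (remQuot {n} n i)) (combine a b)) (cong (uncurry f) (Finₚ.remQuot-combine {n} a b)))

replicate-length : ∀ n → length (replicate n true) ≡ n
replicate-length zero    = refl
replicate-length (suc n) = cong suc (replicate-length n)

module _ {n : ℕ} (f : Sign → Fin n → Fin n → Bool) where
  bits-length : length (bitsOf n f) ≡ n + suc (n * n + n * n)
  bits-length = trans (Listₚ.length-++ (replicate n true)) (cong₂ _+_ (replicate-length n) (cong suc
    (trans (Listₚ.length-++ (matrixBits (f Sign.+))) (cong₂ _+_ (matrix-length (f Sign.+)) (matrix-length (f Sign.-))))))

  bits-lead : lead (bitsOf n f) ≡ n
  bits-lead = go n
    where
    go : ∀ k {v} → lead (replicate k true ++ false ∷ v) ≡ k
    go zero    = refl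
    go (suc k) = cong suc (go k)

  bits-hit : ∀ s a b → hit (bitsOf n f) (idx n s (toℕ a) (toℕ b)) true ≡ f s a b
  bits-hit s a b = trans (cong (λ k → hit (bitsOf n f) (k + suc (offset s n + (n * toℕ a + toℕ b))) true) (sym (replicate-length n)))
    (trans (hit-++ (replicate n true) _ _ true) (body s))
    where
    body : ∀ s → hit (matrixBits (f Sign.+) ++ matrixBits (f Sign.-)) (offset s n + (n * toℕ a + toℕ b)) true ≡ f s a b
    body Sign.+ = trans (first (matrixBits (f Sign.+)) (n * toℕ a + toℕ b) (subst (n * toℕ a + toℕ b <_) (sym (matrix-length (f Sign.+)))
                    (subst (_< n * n) (Finₚ.toℕ-combine a b) (Finₚ.toℕ<n (combine a b))))) (matrix-hit (f Sign.+) a b)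
      where
      first : ∀ (v : Word) {u} j → j < length v → hit (v ++ u) j true ≡ hit v j true
      first (x ∷ v) zero    l       = refl
      first (x ∷ v) (suc j) (s≤s l) = first v j l
    body Sign.- = trans (cong (λ k → hit (matrixBits (f Sign.+) ++ matrixBits (f Sign.-)) (k + (n * toℕ a + toℕ b)) true) (sym (matrix-length (f Sign.+))))
      (trans (hit-++ (matrixBits (f Sign.+)) _ _ true) (matrix-hit (f Sign.-) a b))

entryOf : (w : Word) → Sign → ℕ → ℕ → Bool
entryOf w s a b = hit w (idx (lead w) s a b) true

-- Once the length fits the number of leading ones, a word is the code of two matrices, and only
-- their symmetry is left to check.
word-bits : ∀ w → length w ≡ lead w + suc (lead w * lead w + lead w * lead w) → w ≡ bitsOf (lead w) (λ s a b → entryOf w s (toℕ a) (toℕ b))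
word-bits w e with lead-split w (subst (lead w <_) (sym e) (ℕₚ.m<m+n (lead w) (s≤s z≤n)))
... | M , w≡ = trans w≡ (cong (λ v → replicate n true ++ false ∷ v) (trans (catF-hit (n * n + n * n) M M-length)
    (trans (catF-+ (n * n) (n * n) _) (cong₂ _++_ (part Sign.+ (_↑ˡ (n * n)) λ k → Finₚ.toℕ-↑ˡ k (n * n)) (part Sign.- (n * n ↑ʳ_) λ k → Finₚ.toℕ-↑ʳ (n * n) k)))))
  where
  n : ℕ
  n = lead w
  M-length : length M ≡ n * n + n * n
  M-length = ℕₚ.suc-injective (ℕₚ.+-cancelˡ-≡ n _ _ (trans (sym (trans (cong length w≡) (trans (Listₚ.length-++ (replicate n true)) (cong (_+ suc (length M)) (replicate-length n))))) e))
  into : ∀ j → hit M j true ≡ hit w (n + suc j) true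
  into j = sym (trans (cong₂ (λ v k → hit v (k + suc j) true) w≡ (sym (replicate-length n))) (hit-++ (replicate n true) (false ∷ M) (suc j) true))
  part : ∀ s (g : Fin (n * n) → Fin (n * n + n * n)) → (∀ k → toℕ (g k) ≡ offset s n + toℕ k) →
         catF (n * n) (λ k → [ hit M (toℕ (g k)) true ]) ≡ matrixBits {n} (λ a b → entryOf w s (toℕ a) (toℕ b))
  part s g h = trans (catF-* n n _) (catF-cong n λ a → catF-cong n λ b → cong [_] (trans (into _)
    (cong (λ k → hit w (n + suc k) true) (trans (h (combine a b)) (cong (offset s n +_) (Finₚ.toℕ-combine a b))))))

Symmetric : Word → Set
Symmetric w = ∀ s (a b : Fin (lead w)) → entryOf w s (toℕ a) (toℕ b) ≡ entryOf w s (toℕ b) (toℕ a)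

decodedGraph : (w : Word) → Symmetric w → SignedGraph (lead w)
decodedGraph w h = record { edge = λ s a b → entryOf w s (toℕ a) (toℕ b) ; edge-sym = h }

FullLength : Word → Set
FullLength w = length w ≡ lead w + suc (lead w * lead w + lead w * lead w)

decoded-encode : ∀ w (h : Symmetric w) → FullLength w → w ≡ encode (decodedGraph w h)
decoded-encode w h l = trans (word-bits w l) (sym (encode-bits (decodedGraph w h)))

module _ {n : ℕ} (G : SignedGraph n) where
  encode-lead : lead (encode G) ≡ n
  encode-lead = trans (cong lead (encode-bits G)) (bits-lead (edge G))

  encode-full : FullLength (encode G)
  encode-full = trans (cong length (encode-bits G)) (trans (bits-length (edge G)) (cong (λ k → k + suc (k * k + k * k)) (sym encode-lead)))

  encode-entry : ∀ s a b → entryOf (encode G) s (toℕ a) (toℕ b) ≡ edge G s a b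
  encode-entry s a b = trans (cong₂ (λ v k → hit v (idx k s (toℕ a) (toℕ b)) true) (encode-bits G) encode-lead) (bits-hit (edge G) s a b)

-- Arithmetic by loops over registers

uptoR : ∀ {r} → Fin r → Fin r → Cmd r → Cmd r
uptoR i x body = loop (ifeq i x skip (body ▸ inc i)) ▸ zer i

module _ {r : ℕ} {w : Word} where

  -- All that the arithmetic has to know of the registers of a program: a target register and two
  -- loop registers, with the other registers fixed.
  record Frame (rᵢ rⱼ t : Fin r) (S : ℕ → ℕ → ℕ → State r) : Set where
    field
      incᵢ  : ∀ i j v → Runs w (inc rᵢ) (S i j v) (S (suc i) j v)
      zerᵢ  : ∀ i j v → Runs w (zer rᵢ) (S i j v) (S 0 j v)
      lookᵢ : ∀ i j v → lookup (regs (S i j v)) rᵢ ≡ i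
      incⱼ  : ∀ i j v → Runs w (inc rⱼ) (S i j v) (S i (suc j) v)
      zerⱼ  : ∀ i j v → Runs w (zer rⱼ) (S i j v) (S i 0 v)
      lookⱼ : ∀ i j v → lookup (regs (S i j v)) rⱼ ≡ j
      incₜ  : ∀ i j v → Runs w (inc t) (S i j v) (S i j (suc v))

  module Arith {rᵢ rⱼ t : Fin r} {S : ℕ → ℕ → ℕ → State r} (F : Frame rᵢ rⱼ t S) where
    open Frame F

    Holds : Fin r → ℕ → Set
    Holds x X = ∀ i j v → lookup (regs (S i j v)) x ≡ X

    bump : ∀ m i j v → Runs w (times m (inc t)) (S i j v) (S i j (v + m))
    bump zero    i j v = runs (cong (S i j) (sym (ℕₚ.+-identityʳ v)))
    bump (suc m) i j v = to (incₜ i j v ⟫ bump m i j (suc v)) (cong (S i j) (sym (ℕₚ.+-suc v m)))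

    acc-add : ∀ m Y v → acc! (λ _ v → v + m) Y v ≡ v + Y * m
    acc-add m zero    v = sym (ℕₚ.+-identityʳ v)
    acc-add m (suc Y) v = trans (cong (_+ m) (acc-add m Y v)) (trans (ℕₚ.+-assoc v (Y * m) m) (cong (v +_) (ℕₚ.+-comm (Y * m) m)))

    addReg : ℕ → Fin r → Cmd r
    addReg m x = uptoR rᵢ x (times m (inc t))

    addReg-run : ∀ m {x X} v → Holds x X → X ≤ length w → Runs w (addReg m x) (S 0 0 v) (S 0 0 (v + X * m))
    addReg-run m {x} {X} v h l = to (upto-run (λ i v → S i 0 v) (λ _ v → v + m) X v l (λ i v → lookᵢ i 0 v) (λ i v → h i 0 v)
      (λ i v _ → bump m i 0 v) (λ i v → incᵢ i 0 v) (λ i v → zerᵢ i 0 v)) (cong (S 0 0) (acc-add m X v))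

    addProd : ℕ → Fin r → Fin r → Cmd r
    addProd m x y = uptoR rᵢ x (uptoR rⱼ y (times m (inc t)))

    addProd-run : ∀ m {x X y Y} v → Holds x X → X ≤ length w → Holds y Y → Y ≤ length w →
                  Runs w (addProd m x y) (S 0 0 v) (S 0 0 (v + X * (Y * m)))
    addProd-run m {x} {X} {y} {Y} v h l k l′ = to (upto-run (λ i v → S i 0 v) (λ _ v → v + Y * m) X v l (λ i v → lookᵢ i 0 v) (λ i v → h i 0 v)
      (λ i v _ → to (upto-run (λ j v → S i j v) (λ _ v → v + m) Y v l′ (λ j v → lookⱼ i j v) (λ j v → k i j v)
        (λ j v _ → bump m i j v) (λ j v → incⱼ i j v) (λ j v → zerⱼ i j v)) (cong (S i 0) (acc-add m Y v)))
      (λ i v → incᵢ i 0 v) (λ i v → zerᵢ i 0 v)) (cong (S 0 0) (acc-add (Y * m) X v))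

-- A decision is an output of exactly one bit, so the program must not write anything before it.
mute : ∀ {r} → Cmd r → Cmd r
mute (c ▸ d)        = mute c ▸ mute d
mute (emit b)       = skip
mute (ifeq i j c d) = ifeq i j (mute c) (mute d)
mute (ifin i b c d) = ifin i b (mute c) (mute d)
mute (ifmk i c d)   = ifmk i (mute c) (mute d)
mute (loop c)       = loop (mute c)
mute c              = c

module _ {r : ℕ} (w : Word) where

  silent : State r → Word → State r
  silent (mkState ρ μ _) o = mkState ρ μ o

  mute-run : ∀ (c : Cmd r) σ o → run w (mute c) (silent σ o) ≡ silent (run w c σ) o
  mute-iter : ∀ (c : Cmd r) m σ o → iter m (run w (mute c)) (silent σ o) ≡ silent (iter m (run w c) σ) o
  mute-if : ∀ (c d : Cmd r) b σ o → (if b then run w (mute c) (silent σ o) else run w (mute d) (silent σ o)) ≡ silent (if b then run w c σ else run w d σ) o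
  mute-run skip           σ o = refl
  mute-run (c ▸ d)        σ o = trans (cong (run w (mute d)) (mute-run c σ o)) (mute-run d (run w c σ) o)
  mute-run (inc j)        σ o = refl
  mute-run (zer j)        σ o = refl
  mute-run (mark j)       σ o = refl
  mute-run (emit b)       σ o = refl
  mute-run (ifeq i j c d) σ o = mute-if c d _ σ o
  mute-run (ifin i b c d) σ o = mute-if c d _ σ o
  mute-run (ifmk i c d)   σ o = mute-if c d _ σ o
  mute-run (loop c)       σ o = mute-iter c (length w) σ o
  mute-iter c zero    σ o = refl
  mute-iter c (suc m) σ o = trans (cong (iter m (run w (mute c))) (mute-run c σ o)) (mute-iter c m (run w c σ) o)
  mute-if c d true  σ o = mute-run c σ o
  mute-if c d false σ o = mute-run d σ o

-- A program decides by the register rf: its value is 0 exactly on acceptance.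
module _ {r : ℕ} (c : Cmd r) (rf r0 : Fin r) where

  verdict : Word → Bool
  verdict w = lookup (regs (run w c start)) rf ≡ᵇ lookup (regs (run w c start)) r0

  verdict-polyTime : PolyTime ([_] ∘ verdict)
  verdict-polyTime = program-polyTime (mute c ▸ ifeq rf r0 (emit true) (emit false)) λ w →
    trans (cong (λ σ → out (run w (ifeq rf r0 (emit true) (emit false)) σ)) (mute-run w c start [])) (final (run w c start))
    where
    final : ∀ σ → out (if lookup (regs σ) rf ≡ᵇ lookup (regs σ) r0 then mkState (regs σ) (marked σ) (true ∷ []) else mkState (regs σ) (marked σ) (false ∷ [])) ≡
                  [ lookup (regs σ) rf ≡ᵇ lookup (regs σ) r0 ]
    final σ with lookup (regs σ) rf ≡ᵇ lookup (regs σ) r0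
    ... | true  = refl
    ... | false = refl

flagged : Bool → ℕ
flagged true  = 1
flagged false = 0

-- n: number of vertices; L: length of the word; z, q: positions; a, b, c: vertices
R : (n L z a b : ℕ) → Bool → (i j c q : ℕ) → (ℕ → Bool) → State 11
R n L z a b f i j c q μ = mkState (0 ∷ n ∷ L ∷ z ∷ a ∷ b ∷ flagged f ∷ i ∷ j ∷ c ∷ q ∷ []) μ []

r0 rN rL rz ra rb rf ri rj rc′ rq : Fin 11
r0  = zero
rN  = suc zero
rL  = suc (suc zero)
rz  = suc (suc (suc zero))
ra  = suc (suc (suc (suc zero)))
rb  = suc (suc (suc (suc (suc zero))))
rf  = suc (suc (suc (suc (suc (suc zero)))))
ri  = suc (suc (suc (suc (suc (suc (suc zero))))))
rj  = suc (suc (suc (suc (suc (suc (suc (suc zero)))))))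
rc′ = suc (suc (suc (suc (suc (suc (suc (suc (suc zero))))))))
rq  = suc (suc (suc (suc (suc (suc (suc (suc (suc (suc zero)))))))))

setbad : Cmd 11
setbad = zer rf ▸ inc rf

-- The code below reads graph words in which symbol i is stored at m * i.
module Reader (m : ℕ) where

  offsetP : Fin 11 → Sign → Cmd 11
  offsetP t Sign.+ = skip
  offsetP t Sign.- = uptoR ri rN (uptoR rj rN (times m (inc t)))

  seek : Fin 11 → Sign → Fin 11 → Fin 11 → Cmd 11
  seek t s X Y = uptoR ri rN (times m (inc t)) ▸ times m (inc t) ▸ offsetP t s ▸
    uptoR ri rN (uptoR rj X (times m (inc t))) ▸ uptoR ri Y (times m (inc t))

  mirror : Sign → Cmd 11
  mirror s = seek rz s ra rb ▸ seek rq s rb ra ▸ ifin rz true (ifin rq true skip setbad) (ifin rq true setbad skip) ▸ zer rz ▸ zer rq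

  lengthCheck : Cmd 11
  lengthCheck = uptoR ri rN (times 1 (inc rq)) ▸ inc rq ▸ uptoR ri rN (uptoR rj rN (times 2 (inc rq))) ▸ ifeq rL rq skip setbad ▸ zer rq

  wellformed : Cmd 11
  wellformed = lengthCheck ▸ uptoR ra rN (uptoR rb rN (mirror Sign.+)) ▸ uptoR ra rN (uptoR rb rN (mirror Sign.-))

  leadPhase : Cmd 11
  leadPhase = loop (ifin rz true (inc rN ▸ times m (inc rz)) skip) ▸ zer rz

  module On (x : Word) where

    frameZ : ∀ {n L a b f c q μ} → Frame {w = x} ri rj rz (λ i j v → R n L v a b f i j c q μ)
    frameZ = record { incᵢ = λ _ _ _ → runs refl ; zerᵢ = λ _ _ _ → runs refl ; lookᵢ = λ _ _ _ → refl
                    ; incⱼ = λ _ _ _ → runs refl ; zerⱼ = λ _ _ _ → runs refl ; lookⱼ = λ _ _ _ → refl ; incₜ = λ _ _ _ → runs refl }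

    frameQ : ∀ {n L z a b f c μ} → Frame {w = x} ri rj rq (λ i j v → R n L z a b f i j c v μ)
    frameQ = record { incᵢ = λ _ _ _ → runs refl ; zerᵢ = λ _ _ _ → runs refl ; lookᵢ = λ _ _ _ → refl
                    ; incⱼ = λ _ _ _ → runs refl ; zerⱼ = λ _ _ _ → runs refl ; lookⱼ = λ _ _ _ → refl ; incₜ = λ _ _ _ → runs refl }

    module _ {t : Fin 11} {S : ℕ → ℕ → ℕ → State 11} (F : Frame {w = x} ri rj t S) {n : ℕ} (hN : ∀ i j v → lookup (regs (S i j v)) rN ≡ n) (lN : n ≤ length x) where
      open Arith F

      seek-run : ∀ s {X Y A B} → (∀ i j v → lookup (regs (S i j v)) X ≡ A) → A ≤ length x → (∀ i j v → lookup (regs (S i j v)) Y ≡ B) → B ≤ length x →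
                 Runs x (seek t s X Y) (S 0 0 0) (S 0 0 (m * idx n s A B))
      seek-run s {A = A} {B} hX lX hY lY = to
        (addReg-run m 0 hN lN ⟫ bump m 0 0 _ ⟫ offset-run s _ ⟫ addProd-run m _ hN lN hX lX ⟫ addReg-run m _ hY lY)
        (cong (S 0 0) (total (offset s n)))
        where
        offset-run : ∀ s v → Runs x (offsetP t s) (S 0 0 v) (S 0 0 (v + m * offset s n))
        offset-run Sign.+ v = runs (cong (S 0 0) (trans (sym (ℕₚ.+-identityʳ v)) (cong (v +_) (sym (ℕₚ.*-zeroʳ m)))))
        offset-run Sign.- v = to (addProd-run m v hN lN hN lN) (cong (λ z → S 0 0 (v + z)) (trans (sym (ℕₚ.*-assoc n n m)) (ℕₚ.*-comm (n * n) m)))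
        total : ∀ o → n * m + m + m * o + n * (A * m) + B * m ≡ m * (n + suc (o + (n * A + B)))
        total o = solve 5 (λ n m o A B → n :* m :+ m :+ m :* o :+ n :* (A :* m) :+ B :* m := m :* (n :+ ((:con 1) :+ (o :+ (n :* A :+ B))))) refl n m o A B

    module _ {n : ℕ} (n≤ : n ≤ length x) where

      raw : Sign → ℕ → ℕ → Bool
      raw s a b = hit x (m * idx n s a b) true

      private
        below≤ : ∀ {a} → a < n → a ≤ length x
        below≤ l = ℕₚ.≤-trans (ℕₚ.<⇒≤ l) n≤

      forA : ∀ {L f body μ} (g : ℕ → Bool) → (∀ a f → a < n → Runs x body (R n L 0 a 0 f 0 0 0 0 μ) (R n L 0 a 0 (f ∨ g a) 0 0 0 0 μ)) →
             Runs x (uptoR ra rN body) (R n L 0 0 0 f 0 0 0 0 μ) (R n L 0 0 0 (f ∨ anyBelow n g) 0 0 0 0 μ)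
      forA {L} {f} {μ = μ} g h = to (upto-run (λ a f → R n L 0 a 0 f 0 0 0 0 μ) (λ a f → f ∨ g a) n f n≤ (λ _ _ → refl) (λ _ _ → refl) (λ a f l → h a f l) (λ _ _ → runs refl) (λ _ _ → runs refl))
        (cong (λ f → R n L 0 0 0 f 0 0 0 0 μ) (acc-∨ n g f))

      forAB : ∀ {L f body μ} (g : ℕ → ℕ → Bool) → (∀ a b f → a < n → b < n → Runs x body (R n L 0 a b f 0 0 0 0 μ) (R n L 0 a b (f ∨ g a b) 0 0 0 0 μ)) →
              Runs x (uptoR ra rN (uptoR rb rN body)) (R n L 0 0 0 f 0 0 0 0 μ) (R n L 0 0 0 (f ∨ anyBelow n (λ a → anyBelow n (g a))) 0 0 0 0 μ)
      forAB {L} {μ = μ} g h = forA (λ a → anyBelow n (g a)) λ a f la →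
        to (upto-run (λ b f → R n L 0 a b f 0 0 0 0 μ) (λ b f → f ∨ g a b) n f n≤ (λ _ _ → refl) (λ _ _ → refl) (λ b f l → h a b f la l) (λ _ _ → runs refl) (λ _ _ → runs refl))
          (cong (λ f → R n L 0 a 0 f 0 0 0 0 μ) (acc-∨ n (g a) f))

      seekZ-run : ∀ s {L a b f c q μ} → a < n → b < n → Runs x (seek rz s ra rb) (R n L 0 a b f 0 0 c q μ) (R n L (m * idx n s a b) a b f 0 0 c q μ)
      seekZ-run s la lb = seek-run frameZ (λ _ _ _ → refl) n≤ s (λ _ _ _ → refl) (below≤ la) (λ _ _ _ → refl) (below≤ lb)

      asymmetry : Sign → Bool
      asymmetry s = anyBelow n λ a → anyBelow n λ b → raw s a b xor raw s b a

      mirror-run : ∀ s {L a b f μ} → a < n → b < n → Runs x (mirror s) (R n L 0 a b f 0 0 0 0 μ) (R n L 0 a b (f ∨ (raw s a b xor raw s b a)) 0 0 0 0 μ)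
      mirror-run s {L} {a} {b} {f} {μ} la lb = seekZ-run s la lb ⟫
        seek-run frameQ (λ _ _ _ → refl) n≤ s (λ _ _ _ → refl) (below≤ lb) (λ _ _ _ → refl) (below≤ la) ⟫
        runs (compare (raw s a b) (raw s b a) refl refl f)
        where
        Z = m * idx n s a b
        Y = m * idx n s b a
        compare : ∀ u v → hit x Z true ≡ u → hit x Y true ≡ v → ∀ f →
          run x (ifin rz true (ifin rq true skip setbad) (ifin rq true setbad skip) ▸ zer rz ▸ zer rq) (R n L Z a b f 0 0 0 Y μ) ≡ R n L 0 a b (f ∨ (u xor v)) 0 0 0 0 μ
        compare true  true  e e′ f rewrite e | e′ = cong (λ f → R n L 0 a b f 0 0 0 0 μ) (sym (Boolₚ.∨-identityʳ f))
        compare true  false e e′ f rewrite e | e′ = cong (λ f → R n L 0 a b f 0 0 0 0 μ) (sym (Boolₚ.∨-zeroʳ f))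
        compare false true  e e′ f rewrite e | e′ = cong (λ f → R n L 0 a b f 0 0 0 0 μ) (sym (Boolₚ.∨-zeroʳ f))
        compare false false e e′ f rewrite e | e′ = cong (λ f → R n L 0 a b f 0 0 0 0 μ) (sym (Boolₚ.∨-identityʳ f))

      lengthCheck-run : ∀ {L f μ} → Runs x lengthCheck (R n L 0 0 0 f 0 0 0 0 μ) (R n L 0 0 0 (f ∨ not (L ≡ᵇ n + suc (n * n + n * n))) 0 0 0 0 μ)
      lengthCheck-run {L} {f} {μ} = Arith.addReg-run (frameQ {n} {L} {0} {0} {0} {f} {0} {μ}) 1 0 (λ _ _ _ → refl) n≤ ⟫ runs refl ⟫
        Arith.addProd-run (frameQ {n} {L} {0} {0} {0} {f} {0} {μ}) 2 (suc (n * 1)) (λ _ _ _ → refl) n≤ (λ _ _ _ → refl) n≤ ⟫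
        runs (trans (cong (λ v → run x (ifeq rL rq skip setbad ▸ zer rq) (R n L 0 0 0 f 0 0 0 v μ)) total) (compare _ f (L ≡ᵇ n + suc (n * n + n * n)) refl))
        where
        total : suc (n * 1) + n * (n * 2) ≡ n + suc (n * n + n * n)
        total = solve 1 (λ n → ((:con 1) :+ n :* (:con 1)) :+ n :* (n :* (:con 2)) := n :+ ((:con 1) :+ (n :* n :+ n :* n))) refl n
        compare : ∀ v f u → (L ≡ᵇ v) ≡ u → run x (ifeq rL rq skip setbad ▸ zer rq) (R n L 0 0 0 f 0 0 0 v μ) ≡ R n L 0 0 0 (f ∨ not u) 0 0 0 0 μ
        compare v f true  e rewrite e = cong (λ f → R n L 0 0 0 f 0 0 0 0 μ) (sym (Boolₚ.∨-identityʳ f))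
        compare v f false e rewrite e = cong (λ f → R n L 0 0 0 f 0 0 0 0 μ) (sym (Boolₚ.∨-zeroʳ f))

      malformed : ℕ → Bool
      malformed L = (not (L ≡ᵇ n + suc (n * n + n * n)) ∨ asymmetry Sign.+) ∨ asymmetry Sign.-

      wellformed-run : ∀ {L μ} → Runs x wellformed (R n L 0 0 0 false 0 0 0 0 μ) (R n L 0 0 0 (malformed L) 0 0 0 0 μ)
      wellformed-run = lengthCheck-run ⟫ forAB (λ a b → raw Sign.+ a b xor raw Sign.+ b a) (λ a b f la lb → mirror-run Sign.+ la lb) ⟫
        forAB (λ a b → raw Sign.- a b xor raw Sign.- b a) (λ a b f la lb → mirror-run Sign.- la lb)

    leadPhase-run : ∀ {L μ} ℓ → ℓ ≤ length x → (∀ i → i < ℓ → hit x (i * m) true ≡ true) → hit x (ℓ * m) true ≡ false →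
                    Runs x leadPhase (R 0 L 0 0 0 false 0 0 0 0 μ) (R ℓ L 0 0 0 false 0 0 0 0 μ)
    leadPhase-run {L} {μ} ℓ l h e = runs (trans (cong (λ k → run x (zer rz) (iter k F (R 0 L 0 0 0 false 0 0 0 0 μ))) (sym (ℕₚ.m+[n∸m]≡n l)))
      (cong (run x (zer rz)) (trans (iter-+ ℓ (length x ∸ ℓ) F _) (trans (cong (iter (length x ∸ ℓ) F) (moves ℓ ℕₚ.≤-refl)) (idle (length x ∸ ℓ))))))
      where
      F : State 11 → State 11
      F = run x (ifin rz true (inc rN ▸ times m (inc rz)) skip)
      S : ℕ → State 11
      S i = R i L (i * m) 0 0 false 0 0 0 0 μ
      forward : ∀ i → hit x (i * m) true ≡ true → F (S i) ≡ S (suc i)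
      forward i h rewrite h = trans (run≡ (Arith.bump (frameZ {suc i} {L} {0} {0} {false} {0} {0} {μ}) m 0 0 (i * m))) (cong (λ v → R (suc i) L v 0 0 false 0 0 0 0 μ) (ℕₚ.+-comm (i * m) m))
      moves : ∀ i → i ≤ ℓ → iter i F (S 0) ≡ S i
      moves zero    _ = refl
      moves (suc i) l = trans (iter-last i F (S 0)) (trans (cong F (moves i (ℕₚ.<⇒≤ l))) (forward i (h i l)))
      rests : F (S ℓ) ≡ S ℓ
      rests rewrite e = refl
      idle : ∀ k → iter k F (S ℓ) ≡ S ℓ
      idle zero    = refl
      idle (suc k) = trans (cong (iter k F) rests) (idle k)

-- Recognising the words that encode graphs

module _ {w : Word} where
  encoding-full : ∀ {n} {G : SignedGraph n} → w ≡ encode G → FullLength w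
  encoding-full {G = G} refl = encode-full G

  encoding-symmetric : ∀ {n} {G : SignedGraph n} → w ≡ encode G → Symmetric w
  encoding-symmetric {n} {G} refl s a b = trans (sym (at a b)) (trans (encode-entry G s (into a) (into b))
    (trans (edge-sym G s (into a) (into b)) (trans (sym (encode-entry G s (into b) (into a))) (at b a))))
    where
    into : Fin (lead w) → Fin n
    into = Fin.cast (encode-lead G)
    at : ∀ a b → entryOf w s (toℕ (into a)) (toℕ (into b)) ≡ entryOf w s (toℕ a) (toℕ b)
    at a b = cong₂ (entryOf w s) (Finₚ.toℕ-cast (encode-lead G) a) (Finₚ.toℕ-cast (encode-lead G) b)

idx-< : ∀ n s {a b} → a < n → b < n → idx n s a b < n + suc (n * n + n * n)
idx-< n s {a} {b} la lb = ℕₚ.+-monoʳ-< n (s≤s (ℕₚ.+-mono-≤-< (off s) cell))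
  where
  off : ∀ s → offset s n ≤ n * n
  off Sign.+ = z≤n
  off Sign.- = ℕₚ.≤-refl
  cell : n * a + b < n * n
  cell = ℕₚ.<-≤-trans (ℕₚ.+-monoʳ-< (n * a) lb)
    (ℕₚ.≤-trans (ℕₚ.≤-reflexive (trans (ℕₚ.+-comm (n * a) n) (sym (ℕₚ.*-suc n a)))) (ℕₚ.*-monoʳ-≤ n la))

T-not : ∀ {a} → ¬ T a → T (not a)
T-not {true}  h = h tt
T-not {false} h = tt

xor-equal : ∀ {a b} → a ≡ b → ¬ T (a xor b)
xor-equal {true}  refl ()
xor-equal {false} refl ()

equal-xor : ∀ a b → ¬ T (a xor b) → a ≡ b
equal-xor true  true  h = refl
equal-xor true  false h = ⊥-elim (h tt)
equal-xor false true  h = ⊥-elim (h tt)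
equal-xor false false h = refl

∨-no : ∀ {a b} → ¬ T (a ∨ b) → ¬ T a × ¬ T b
∨-no {true}  h = ⊥-elim (h tt)
∨-no {false} h = id , h

no-∨ : ∀ {a b} → ¬ T a → ¬ T b → ¬ T (a ∨ b)
no-∨ {true}  h k = h
no-∨ {false} h k = k

not-no : ∀ {a} → ¬ T (not a) → T a
not-no {true}  h = tt
not-no {false} h = ⊥-elim (h tt)

no-not : ∀ {a} → T a → ¬ T (not a)
no-not {true} _ ()

-- The step `m` is 2 for a word inside a pair, where bits are doubled, and 1 for the word itself.
-- Position `length w` is included, because the count of leading ones may stop only there.
module Parsing (m : ℕ) (w x : Word) (stored : ∀ i → i ≤ length w → hit x (i * m) true ≡ hit w i true) (w≤x : length w ≤ length x) where
  open Reader m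
  open On x

  n : ℕ
  n = lead w

  n≤ : n ≤ length x
  n≤ = ℕₚ.≤-trans (lead-≤ w) w≤x

  lead-found : ∀ {L μ} → Runs x leadPhase (R 0 L 0 0 0 false 0 0 0 0 μ) (R n L 0 0 0 false 0 0 0 0 μ)
  lead-found = leadPhase-run n n≤ (λ i l → trans (stored i (ℕₚ.≤-trans (ℕₚ.<⇒≤ l) (lead-≤ w))) (lead-hit w i l)) (trans (stored n (lead-≤ w)) (lead-end w))

  module _ (full : FullLength w) where

    raw-entry : ∀ s {a b} → a < n → b < n → raw n≤ s a b ≡ entryOf w s a b
    raw-entry s {a} {b} la lb = trans (cong (λ i → hit x i true) (ℕₚ.*-comm m (idx n s a b)))
      (stored _ (subst (idx n s a b ≤_) (sym full) (ℕₚ.<⇒≤ (idx-< n s la lb))))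

    asymmetry-no : Symmetric w → ∀ s → ¬ T (asymmetry n≤ s)
    asymmetry-no h s bad =
      let a , la , bad′ = anyBelow-out {n} bad
          b , lb , bad″ = anyBelow-out {n} bad′
          e = h s (fromℕ< la) (fromℕ< lb)
      in xor-equal (trans (raw-entry s la lb) (trans (subst₂ (λ a b → entryOf w s a b ≡ entryOf w s b a) (Finₚ.toℕ-fromℕ< la) (Finₚ.toℕ-fromℕ< lb) e) (sym (raw-entry s lb la)))) bad″

    no-asymmetry : (∀ s → ¬ T (asymmetry n≤ s)) → Symmetric w
    no-asymmetry h s a b = trans (sym (raw-entry s (Finₚ.toℕ<n a) (Finₚ.toℕ<n b))) (trans
      (equal-xor _ _ λ t → h s (anyBelow-in (toℕ a) (Finₚ.toℕ<n a) (anyBelow-in (toℕ b) (Finₚ.toℕ<n b) t)))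
      (raw-entry s (Finₚ.toℕ<n b) (Finₚ.toℕ<n a)))

  malformed-no : FullLength w → Symmetric w → ¬ T (malformed n≤ (length w))
  malformed-no full h = no-∨ (no-∨ (no-not (ℕₚ.≡⇒≡ᵇ _ _ full)) (asymmetry-no full h Sign.+)) (asymmetry-no full h Sign.-)

  no-malformed : ¬ T (malformed n≤ (length w)) → FullLength w × Symmetric w
  no-malformed h =
    let h₁ , minus = ∨-no h
        bad , plus = ∨-no h₁
        full = ℕₚ.≡ᵇ⇒≡ _ _ (not-no bad)
    in full , no-asymmetry full λ { Sign.+ → plus ; Sign.- → minus }

-- Membership in NP

pair-doubled : ∀ w u i → i ≤ length w → hit (pair w u) (i * 2) true ≡ hit w i true
pair-doubled []      u zero    l       = refl
pair-doubled (b ∷ w) u zero    l       = refl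
pair-doubled (b ∷ w) u (suc i) (s≤s l) = pair-doubled w u i l

pair-twice : ∀ w u i → i < length w → hit (pair w u) (suc (i * 2)) true ≡ hit (pair w u) (i * 2) true
pair-twice (b ∷ w) u zero    l       = refl
pair-twice (b ∷ w) u (suc i) (s≤s l) = pair-twice w u i l

pair-end : ∀ w u → hit (pair w u) (suc (length w * 2)) true ≡ true
pair-end []      u = refl
pair-end (b ∷ w) u = pair-end w u

pair-rest : ∀ w u j → hit (pair w u) (length w * 2 + 2 + j) true ≡ hit u j true
pair-rest []      u j = refl
pair-rest (b ∷ w) u j = pair-rest w u j

pair-≥ : ∀ w u → length w ≤ length (pair w u)
pair-≥ []      u = z≤n
pair-≥ (b ∷ w) u = s≤s (ℕₚ.m≤n⇒m≤1+n (pair-≥ w u))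

seqF : ∀ {r} k → (Fin k → Cmd r) → Cmd r
seqF zero    g = skip
seqF (suc k) g = g zero ▸ seqF k (g ∘ suc)

anyF : ∀ k → (Fin k → Bool) → Bool
anyF zero    P = false
anyF (suc k) P = P zero ∨ anyF k (P ∘ suc)

anyF-in : ∀ {k P} ℓ → T (P ℓ) → T (anyF k P)
anyF-in {suc k} zero    h = Equivalence.from Boolₚ.T-∨ (inj₁ h)
anyF-in {suc k} (suc ℓ) h = Equivalence.from Boolₚ.T-∨ (inj₂ (anyF-in ℓ h))

anyF-out : ∀ {k P} → T (anyF k P) → ∃[ ℓ ] T (P ℓ)
anyF-out {suc k} {P} h with Equivalence.to (Boolₚ.T-∨ {P zero}) h
... | inj₁ p = zero , p
... | inj₂ q = let ℓ , p = anyF-out {k} q in suc ℓ , p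

seqF-run : ∀ {r x} (S : Bool → State r) k {g} P f → (∀ ℓ f → Runs x (g ℓ) (S f) (S (f ∨ P ℓ))) → Runs x (seqF k g) (S f) (S (f ∨ anyF k P))
seqF-run S zero    P f h = runs (cong S (sym (Boolₚ.∨-identityʳ f)))
seqF-run S (suc k) P f h = to (h zero f ⟫ seqF-run S k (P ∘ suc) (f ∨ P zero) (h ∘ suc)) (cong S (Boolₚ.∨-assoc f (P zero) _))

-- A certificate lists, for each vertex, one bit per vertex of the target.
module Verifier {k : ℕ} (H : SignedGraph k) where
  open Reader 2

  -- Blocks 11 and 00 are passed and counted, the block 01 is never passed; so the count stops at
  -- the length of the first word.
  splitPhase : Cmd 11
  splitPhase = inc rj ▸ loop (ifin rz true advance (ifin rj true skip advance)) ▸ zer rz ▸ zer rj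
    where
    advance : Cmd 11
    advance = inc rL ▸ times 2 (inc rz) ▸ times 2 (inc rj)

  label : Fin 11 → Fin 11 → Fin k → Cmd 11
  label t X ℓ = uptoR ri rL (times 2 (inc t)) ▸ times 2 (inc t) ▸ uptoR ri X (times k (inc t)) ▸ times (toℕ ℓ) (inc t)

  labelled : Cmd 11
  labelled = seqF k (λ ℓ → label rz ra ℓ ▸ ifin rz true (zer rc′ ▸ inc rc′) skip ▸ zer rz) ▸ ifeq rc′ r0 setbad skip ▸ zer rc′

  -- A certificate may give several labels to a vertex. Every combination of labels is checked at
  -- every edge, so any choice among them is a homomorphism.
  respects : Sign → Fin k → Fin k → Cmd 11
  respects s ℓ ℓ′ = if edge H s ℓ ℓ′ then skip else
    (seek rz s ra rb ▸ label rq ra ℓ ▸ ifin rz true (ifin rq true (zer rq ▸ label rq rb ℓ′ ▸ ifin rq true setbad skip) skip) skip ▸ zer rz ▸ zer rq)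

  checkEdges : Cmd 11
  checkEdges = seqF 2 λ i → seqF k λ ℓ → seqF k λ ℓ′ → respects (cover-sign i) ℓ ℓ′

  program : Cmd 11
  program = splitPhase ▸ leadPhase ▸ wellformed ▸ uptoR ra rN labelled ▸ uptoR ra rN (uptoR rb rN checkEdges)

  module Correct (w u : Word) where

    x : Word
    x = pair w u

    open On x
    open Parsing 2 w x (pair-doubled w u) (pair-≥ w u)

    L : ℕ
    L = length w

    none : ℕ → Bool
    none _ = false

    split-run : Runs x splitPhase start (R 0 L 0 0 0 false 0 0 0 0 none)
    split-run = runs (trans (cong (λ k → run x (zer rz ▸ zer rj) (iter k F (S 0))) (sym (ℕₚ.m+[n∸m]≡n (pair-≥ w u))))
      (cong (run x (zer rz ▸ zer rj)) (trans (iter-+ L (length x ∸ L) F _) (trans (cong (iter (length x ∸ L) F) (moves L ℕₚ.≤-refl)) (idle (length x ∸ L))))))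
      where
      advance : Cmd 11
      advance = inc rL ▸ times 2 (inc rz) ▸ times 2 (inc rj)
      F : State 11 → State 11
      F = run x (ifin rz true advance (ifin rj true skip advance))
      S : ℕ → State 11
      S i = R 0 i (i * 2) 0 0 false 0 (suc (i * 2)) 0 0 none
      forward : ∀ i v → hit x (i * 2) true ≡ v → hit x (suc (i * 2)) true ≡ v → F (S i) ≡ S (suc i)
      forward i true  e e′ rewrite e = refl
      forward i false e e′ rewrite e | e′ = refl
      moves : ∀ i → i ≤ L → iter i F (S 0) ≡ S i
      moves zero    _ = refl
      moves (suc i) l = trans (iter-last i F (S 0)) (trans (cong F (moves i (ℕₚ.<⇒≤ l))) (forward i _ refl (pair-twice w u i l)))
      rests : hit x (L * 2) true ≡ false → hit x (suc (L * 2)) true ≡ true → F (S L) ≡ S L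
      rests e e′ rewrite e | e′ = refl
      beyond : ∀ w → hit w (length w) true ≡ false
      beyond []      = refl
      beyond (b ∷ w) = beyond w
      idle : ∀ k → iter k F (S L) ≡ S L
      idle zero    = refl
      idle (suc k) = trans (cong (iter k F) (rests (trans (pair-doubled w u L ℕₚ.≤-refl) (beyond w)) (pair-end w u))) (idle k)

    position : ℕ → Fin k → ℕ
    position a ℓ = L * 2 + 2 + a * k + toℕ ℓ

    lab : ℕ → Fin k → Bool
    lab a ℓ = hit x (position a ℓ) true

    module _ {t : Fin 11} {S : ℕ → ℕ → ℕ → State 11} (F : Frame {w = x} ri rj t S) (hL : ∀ i j v → lookup (regs (S i j v)) rL ≡ L) where
      label-run : ∀ {X A} ℓ → (∀ i j v → lookup (regs (S i j v)) X ≡ A) → A ≤ length x → Runs x (label t X ℓ) (S 0 0 0) (S 0 0 (position A ℓ))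
      label-run ℓ hX lX = Arith.addReg-run F 2 0 hL (pair-≥ w u) ⟫ Arith.bump F 2 0 0 _ ⟫ Arith.addReg-run F k _ hX lX ⟫ Arith.bump F (toℕ ℓ) 0 0 _

    below≤x : ∀ {a} → a < n → a ≤ length x
    below≤x l = ℕₚ.≤-trans (ℕₚ.<⇒≤ l) n≤

    labelled-run : ∀ a f → a < n → Runs x labelled (R n L 0 a 0 f 0 0 0 0 none) (R n L 0 a 0 (f ∨ not (anyF k (lab a))) 0 0 0 0 none)
    labelled-run a f l = seqF-run (λ g → R n L 0 a 0 f 0 0 (flagged g) 0 none) k (lab a) false
        (λ ℓ g → label-run frameZ (λ _ _ _ → refl) ℓ (λ _ _ _ → refl) (below≤x l) ⟫ runs (found ℓ g (lab a ℓ) refl)) ⟫ runs (finish (anyF k (lab a)) f)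
      where
      found : ∀ ℓ g v → lab a ℓ ≡ v → run x (ifin rz true (zer rc′ ▸ inc rc′) skip ▸ zer rz) (R n L (position a ℓ) a 0 f 0 0 (flagged g) 0 none) ≡ R n L 0 a 0 f 0 0 (flagged (g ∨ v)) 0 none
      found ℓ g true  e rewrite e = cong (λ g → R n L 0 a 0 f 0 0 (flagged g) 0 none) (sym (Boolₚ.∨-zeroʳ g))
      found ℓ g false e rewrite e = cong (λ g → R n L 0 a 0 f 0 0 (flagged g) 0 none) (sym (Boolₚ.∨-identityʳ g))
      finish : ∀ g f → run x (ifeq rc′ r0 setbad skip ▸ zer rc′) (R n L 0 a 0 f 0 0 (flagged g) 0 none) ≡ R n L 0 a 0 (f ∨ not g) 0 0 0 0 none
      finish true  f = cong (λ f → R n L 0 a 0 f 0 0 0 0 none) (sym (Boolₚ.∨-identityʳ f))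
      finish false f = cong (λ f → R n L 0 a 0 f 0 0 0 0 none) (sym (Boolₚ.∨-zeroʳ f))

    violated : Sign → Fin k → Fin k → ℕ → ℕ → Bool
    violated s ℓ ℓ′ a b = not (edge H s ℓ ℓ′) ∧ (raw n≤ s a b ∧ (lab a ℓ ∧ lab b ℓ′))

    module _ {a b : ℕ} (la : a < n) (lb : b < n) where
      private
        Q : Bool → State 11
        Q f = R n L 0 a b f 0 0 0 0 none

      respects-run : ∀ s ℓ ℓ′ f → Runs x (respects s ℓ ℓ′) (Q f) (Q (f ∨ violated s ℓ ℓ′ a b))
      respects-run s ℓ ℓ′ f with edge H s ℓ ℓ′
      ... | true  = runs (cong Q (sym (Boolₚ.∨-identityʳ f)))
      ... | false = seekZ-run n≤ s la lb ⟫ label-run frameQ (λ _ _ _ → refl) ℓ (λ _ _ _ → refl) (below≤x la) ⟫ runs (outcome (raw n≤ s a b) (lab a ℓ) (lab b ℓ′) refl refl refl)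
        where
        Z : ℕ
        Z = 2 * idx n s a b
        inner : Cmd 11
        inner = zer rq ▸ label rq rb ℓ′ ▸ ifin rq true setbad skip
        second : run x (zer rq ▸ label rq rb ℓ′) (R n L Z a b f 0 0 0 (position a ℓ) none) ≡ R n L Z a b f 0 0 0 (position b ℓ′) none
        second = run≡ (label-run frameQ (λ _ _ _ → refl) ℓ′ (λ _ _ _ → refl) (below≤x lb))
        final : ∀ v → lab b ℓ′ ≡ v → run x (zer rz ▸ zer rq) (run x (ifin rq true setbad skip) (R n L Z a b f 0 0 0 (position b ℓ′) none)) ≡ Q (f ∨ v)
        final true  e rewrite e = cong Q (sym (Boolₚ.∨-zeroʳ f))
        final false e rewrite e = cong Q (sym (Boolₚ.∨-identityʳ f))
        outcome : ∀ u v v′ → raw n≤ s a b ≡ u → lab a ℓ ≡ v → lab b ℓ′ ≡ v′ →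
          run x (ifin rz true (ifin rq true inner skip) skip ▸ zer rz ▸ zer rq) (R n L Z a b f 0 0 0 (position a ℓ) none) ≡ Q (f ∨ (u ∧ (v ∧ v′)))
        outcome false v     v′ e e′ e″ rewrite e = cong Q (sym (Boolₚ.∨-identityʳ f))
        outcome true  false v′ e e′ e″ rewrite e | e′ = cong Q (sym (Boolₚ.∨-identityʳ f))
        outcome true  true  v′ e e′ e″ rewrite e | e′ = trans (cong (λ σ → run x (zer rz ▸ zer rq) (run x (ifin rq true setbad skip) σ)) second) (final v′ e″)

      checkEdges-run : ∀ f → Runs x checkEdges (Q f) (Q (f ∨ anyF 2 λ i → anyF k λ ℓ → anyF k λ ℓ′ → violated (cover-sign i) ℓ ℓ′ a b))
      checkEdges-run f = seqF-run Q 2 _ f λ i f → seqF-run Q k _ f λ ℓ f → seqF-run Q k _ f λ ℓ′ f → respects-run (cover-sign i) ℓ ℓ′ f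

    unlabelled unsound : Bool
    unlabelled = anyBelow n λ a → not (anyF k (lab a))
    unsound    = anyBelow n λ a → anyBelow n λ b → anyF 2 λ i → anyF k λ ℓ → anyF k λ ℓ′ → violated (cover-sign i) ℓ ℓ′ a b

    program-run : Runs x program start (R n L 0 0 0 ((malformed n≤ L ∨ unlabelled) ∨ unsound) 0 0 0 0 none)
    program-run = split-run ⟫ lead-found ⟫ wellformed-run n≤ ⟫ forA n≤ (λ a → not (anyF k (lab a))) labelled-run ⟫
      forAB n≤ (λ a b → anyF 2 λ i → anyF k λ ℓ → anyF k λ ℓ′ → violated (cover-sign i) ℓ ℓ′ a b) (λ a b f la lb → checkEdges-run la lb f)

    rejects : Bool
    rejects = (malformed n≤ L ∨ unlabelled) ∨ unsound

    verdict≡ : verdict program rf r0 x ≡ not rejects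
    verdict≡ = trans (cong (λ σ → lookup (regs σ) rf ≡ᵇ lookup (regs σ) r0) (run≡ program-run)) (unflag rejects)
      where
      unflag : ∀ f → (flagged f ≡ᵇ 0) ≡ not f
      unflag true  = refl
      unflag false = refl

    accepted⇒hom : ¬ T rejects → ecHom H w
    accepted⇒hom ok = n , decodedGraph w symm , decoded-encode w symm full , φ , hom
      where
      no₁ = ∨-no ok
      no₂ = ∨-no (proj₁ no₁)
      parsed = no-malformed (proj₁ no₂)
      full : FullLength w
      full = proj₁ parsed
      symm : Symmetric w
      symm = proj₂ parsed
      image : ∀ a → a < n → ∃[ ℓ ] T (lab a ℓ)
      image a l = anyF-out {k} (not-no λ h → proj₂ no₂ (anyBelow-in a l h))
      φ : Fin n → Fin k
      φ a = proj₁ (image (toℕ a) (Finₚ.toℕ<n a))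
      split : ∀ s → ∃[ i ] cover-sign i ≡ s
      split s = cover-index s , cover-sign-index s
      hom : IsECHom (decodedGraph w symm) H φ
      hom s a b ab with edge H s (φ a) (φ b) in eq | split s
      ... | true  | _        = tt
      ... | false | i , refl = proj₂ no₁ (anyBelow-in (toℕ a) (Finₚ.toℕ<n a) (anyBelow-in (toℕ b) (Finₚ.toℕ<n b)
        (anyF-in {2} {λ i → anyF k λ ℓ → anyF k λ ℓ′ → violated (cover-sign i) ℓ ℓ′ (toℕ a) (toℕ b)} i (anyF-in {k} {λ ℓ → anyF k λ ℓ′ → violated s ℓ ℓ′ (toℕ a) (toℕ b)} (φ a) (anyF-in {k} {λ ℓ′ → violated s (φ a) ℓ′ (toℕ a) (toℕ b)} (φ b) (∧-in (subst (T ∘ not) (sym eq) tt)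
          (∧-in (subst T (sym (raw-entry full s (Finₚ.toℕ<n a) (Finₚ.toℕ<n b))) ab)
            (∧-in (proj₂ (image (toℕ a) (Finₚ.toℕ<n a))) (proj₂ (image (toℕ b) (Finₚ.toℕ<n b)))))))))))

  certificate : ∀ {n} → (Fin n → Fin k) → Word
  certificate {n} φ = catF n λ a → catF k λ ℓ → [ ⌊ ℓ Finₚ.≟ φ a ⌋ ]

  module _ {n : ℕ} (φ : Fin n → Fin k) where
    certificate-flat : certificate φ ≡ catF (n * k) (λ i → [ uncurry (λ a ℓ → ⌊ ℓ Finₚ.≟ φ a ⌋) (remQuot {n} k i) ])
    certificate-flat = sym (trans (catF-* n k _) (catF-cong n λ a → catF-cong k λ ℓ → cong (λ p → [ uncurry (λ a ℓ → ⌊ ℓ Finₚ.≟ φ a ⌋) p ]) (Finₚ.remQuot-combine {n} a ℓ)))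

    certificate-length : length (certificate φ) ≡ n * k
    certificate-length = trans (cong length certificate-flat) (catF-length₁ (n * k) _)

    certificate-hit : ∀ a ℓ → hit (certificate φ) (toℕ a * k + toℕ ℓ) true ≡ ⌊ ℓ Finₚ.≟ φ a ⌋
    certificate-hit a ℓ = trans (cong₂ (λ v j → hit v j true) certificate-flat (trans (cong (_+ toℕ ℓ) (ℕₚ.*-comm (toℕ a) k)) (sym (Finₚ.toℕ-combine a ℓ))))
      (trans (hit-catF (λ i → uncurry (λ a ℓ → ⌊ ℓ Finₚ.≟ φ a ⌋) (remQuot {n} k i)) (combine a ℓ)) (cong (uncurry λ a ℓ → ⌊ ℓ Finₚ.≟ φ a ⌋) (Finₚ.remQuot-combine {n} a ℓ)))

  module _ (w : Word) (full : FullLength w) (symm : Symmetric w) (φ : Fin (lead w) → Fin k) (hom : IsECHom (decodedGraph w symm) H φ) where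
    open On (pair w (certificate φ))
    open Correct w (certificate φ)
    open Parsing 2 w (pair w (certificate φ)) (pair-doubled w (certificate φ)) (pair-≥ w (certificate φ)) hiding (n)

    lab-φ : ∀ {a} (l : a < lead w) ℓ → lab a ℓ ≡ ⌊ ℓ Finₚ.≟ φ (fromℕ< l) ⌋
    lab-φ {a} l ℓ = trans (cong (λ i → hit (pair w (certificate φ)) i true) (trans (ℕₚ.+-assoc (L * 2 + 2) (a * k) (toℕ ℓ)) (cong (λ a → L * 2 + 2 + (a * k + toℕ ℓ)) (sym (Finₚ.toℕ-fromℕ< l)))))
      (trans (pair-rest w (certificate φ) _) (certificate-hit φ (fromℕ< l) ℓ))

    hom⇒accepted : ¬ T rejects
    hom⇒accepted = no-∨ (no-∨ (malformed-no full symm) labels) sounds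
      where
      labels : ¬ T unlabelled
      labels bad = let a , l , h = anyBelow-out {lead w} bad in
        no-not (anyF-in {k} {lab a} (φ (fromℕ< l)) (subst T (sym (lab-φ l _)) (fromWitness {a? = φ (fromℕ< l) Finₚ.≟ φ (fromℕ< l)} refl))) h
      sounds : ¬ T unsound
      sounds bad =
        let a , la , h₁ = anyBelow-out {lead w} bad
            b , lb , h₂ = anyBelow-out {lead w} h₁
            i , h₃ = anyF-out {2} {λ i → anyF k λ ℓ → anyF k λ ℓ′ → violated (cover-sign i) ℓ ℓ′ a b} h₂
            s = cover-sign i
            ℓ , h₄ = anyF-out {k} {λ ℓ → anyF k λ ℓ′ → violated s ℓ ℓ′ a b} h₃
            ℓ′ , h₅ = anyF-out {k} {λ ℓ′ → violated s ℓ ℓ′ a b} h₄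
            miss , h₆ = ∧-out {not (edge H s ℓ ℓ′)} h₅
            ab , h₇ = ∧-out {raw n≤ s a b} h₆
            at , at′ = ∧-out {lab a ℓ} h₇
            e = toWitness {a? = ℓ Finₚ.≟ φ (fromℕ< la)} (subst T (lab-φ la ℓ) at)
            e′ = toWitness {a? = ℓ′ Finₚ.≟ φ (fromℕ< lb)} (subst T (lab-φ lb ℓ′) at′)
        in no-not (subst₂ (Edge H s) (sym e) (sym e′) (hom s (fromℕ< la) (fromℕ< lb)
             (subst₂ (λ a b → T (entryOf w s a b)) (sym (Finₚ.toℕ-fromℕ< la)) (sym (Finₚ.toℕ-fromℕ< lb)) (subst T (raw-entry full s la lb) ab)))) miss

  ecHom-NP : InNP (ecHom H)
  ecHom-NP = T ∘ verdict program rf r0 , (verdict program rf r0 , verdict-polyTime program rf r0 , λ w → mk⇔ id id) , k , 1 , λ w → mk⇔ (certify w) (λ (u , _ , h) →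
      Correct.accepted⇒hom w u λ bad → no-not bad (subst T (Correct.verdict≡ w u) h))
    where
    certify : ∀ w → ecHom H w → ∃[ u ] (length u ≤ polyBound k 1 (length w) × T (verdict program rf r0 (pair w u)))
    certify w (n , G , e , φ₀ , hom₀) = certificate φ , short , subst T (sym (Correct.verdict≡ w (certificate φ))) (T-not (hom⇒accepted w full symm φ hom))
      where
      full : FullLength w
      full = encoding-full {w} {G = G} e
      symm : Symmetric w
      symm = encoding-symmetric {w} {G = G} e
      found : ∃[ φ ] IsECHom (decodedGraph w symm) H φ
      found = ecHom-encode {T′ = H} {G = decodedGraph w symm} (n , G , trans (sym (decoded-encode w symm full)) e , φ₀ , hom₀)
      φ : Fin (lead w) → Fin k
      φ = proj₁ found
      hom : IsECHom (decodedGraph w symm) H φ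
      hom = proj₂ found
      short : length (certificate φ) ≤ polyBound k 1 (length w)
      short = ℕₚ.≤-trans (ℕₚ.≤-reflexive (trans (certificate-length φ) (ℕₚ.*-comm (lead w) k)))
        (ℕₚ.≤-trans (ℕₚ.*-monoʳ-≤ k (ℕₚ.≤-trans (lead-≤ w) (ℕₚ.≤-reflexive (sym (ℕₚ.*-identityʳ (length w)))))) (ℕₚ.m≤m+n _ k))

-- Balance, decided by closing a set of signed walks

data Walk {n} (G : SignedGraph n) (h : Sign → Sign) (a : Fin n) : Fin n → Sign → Set where
  here : Walk G h a a Sign.+
  _▷_  : ∀ {b c g s} → Walk G h a b g → Edge G s b c → Walk G h a c (g · h s)

module _ {n : ℕ} {G : SignedGraph n} {h : Sign → Sign} where

  walk-++ : ∀ {a b c g g′} → Walk G h a b g → Walk G h b c g′ → Walk G h a c (g · g′)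
  walk-++ {g = g} p here = subst (Walk G h _ _) (sym (Signₚ.*-identityʳ g)) p
  walk-++ {g = g} p (_▷_ {g = g′} {s} q e) = subst (Walk G h _ _) (Signₚ.*-assoc g g′ (h s)) (walk-++ p q ▷ e)

  walk-back : ∀ {a b g} → Walk G h a b g → Walk G h b a g
  walk-back here = here
  walk-back (_▷_ {g = g} {s} p e) = subst (Walk G h _ _) (Signₚ.*-comm (h s) g) (walk-++ (here ▷ edge-flip G e) (walk-back p))

  balanced-walk : (b : Balanced h G) → ∀ {x y g} → Walk G h x y g → proj₁ b x · proj₁ b y ≡ g
  balanced-walk (σ , e) {x} here = Signₚ.s*s≡+ (σ x)
  balanced-walk (σ , e) {x} (_▷_ {b} {c} {g} {s} p xy) = trans (compose (σ x) (σ b) (σ c)) (cong₂ _·_ (balanced-walk (σ , e) p) (e s b c xy))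
    where
    compose : ∀ p q r → p · r ≡ (p · q) · (q · r)
    compose = toWitness {a? = all± λ p → all± λ q → all± λ r → p · r Signₚ.≟ (p · q) · (q · r)} tt

  walk-unique : (∀ r → ¬ Walk G h r r Sign.-) → ∀ {a b g g′} → Walk G h a b g → Walk G h a b g′ → g ≡ g′
  walk-unique none p q = same _ _ (walk-++ p (walk-back q))
    where
    same : ∀ g g′ {a} → Walk G h a a (g · g′) → g ≡ g′
    same Sign.+ Sign.+ p = refl
    same Sign.- Sign.- p = refl
    same Sign.+ Sign.- p = ⊥-elim (none _ p)
    same Sign.- Sign.+ p = ⊥-elim (none _ p)

  module _ (reach : Fin n → Fin n → Sign → Bool) (reach-in : ∀ {r a g} → Walk G h r a g → T (reach r a g)) (reach-out : ∀ {r a g} → T (reach r a g) → Walk G h r a g)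
           (none : ∀ r → ¬ Walk G h r r Sign.-) where
    private
      near : Fin n → Fin n → Bool
      near a r = reach r a Sign.+ ∨ reach r a Sign.-

      near-in : ∀ {r a} g → Walk G h r a g → T (near a r)
      near-in Sign.+ p = Equivalence.from Boolₚ.T-∨ (inj₁ (reach-in p))
      near-in Sign.- p = Equivalence.from Boolₚ.T-∨ (inj₂ (reach-in p))

      near-out : ∀ {r a} → T (near a r) → ∃[ g ] Walk G h r a g
      near-out {r} {a} t with Equivalence.to (Boolₚ.T-∨ {reach r a Sign.+}) t
      ... | inj₁ p = Sign.+ , reach-out p
      ... | inj₂ p = Sign.- , reach-out p

      rooted : ∀ a → ∃[ r ] (least (near a) ≡ just r × T (near a r))
      rooted a = least-just a (near-in Sign.+ here)

      root : Fin n → Fin n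
      root a = proj₁ (rooted a)

      rootWalk : ∀ a → ∃[ g ] Walk G h (root a) a g
      rootWalk a = near-out (proj₂ (proj₂ (rooted a)))

      extend : ∀ {s a b} → Edge G s a b → ∀ r → T (near a r) → T (near b r)
      extend e r t = let g , p = near-out t in near-in _ (p ▷ e)

      same-root : ∀ {s a b} → Edge G s a b → root a ≡ root b
      same-root {a = a} {b} e = just-injective (trans (sym (proj₁ (proj₂ (rooted a)))) (trans (least-cong λ r → bool-≡ (extend e r) (extend (edge-flip G e) r)) (proj₁ (proj₂ (rooted b)))))
        where
        just-injective : ∀ {x y : Fin n} → just x ≡ just y → x ≡ y
        just-injective refl = refl

    -- The least vertex connected to `a` is the root of its component, and `a` is labelled by a walk
    -- from there. Without negative closed walks the label does not depend on the walk.
    walks-balanced : Balanced h G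
    walks-balanced = (λ a → proj₁ (rootWalk a)) , λ s a b e →
      shift (proj₁ (rootWalk a)) (h s) (proj₁ (rootWalk b)) (walk-unique none (subst (λ r → Walk G h r b _) (same-root e) (proj₂ (rootWalk a) ▷ e)) (proj₂ (rootWalk b)))
      where
      shift : ∀ p t q → p · t ≡ q → p · q ≡ t
      shift = toWitness {a? = all± λ p → all± λ t → all± λ q → (p · t Signₚ.≟ q) →-dec (p · q Signₚ.≟ t)} tt

-- Programs that add marks according to rules: from p conclude j, where p may be absent

Given : (ℕ → Set) → Maybe ℕ → Set
Given P nothing  = ⊤
Given P (just i) = P i

Rule : Set₁
Rule = Maybe ℕ → ℕ → Set

Closed : Rule → (ℕ → Set) → Set
Closed Q P = ∀ {p j} → Q p j → Given P p → P j

-- A command may apply its rules in any order, also to marks that it has just set. Hence only two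
-- bounds: rules with premises marked at the start have fired, and no set closed under the rules is
-- left.
record Applies (Q : Rule) (F : (ℕ → Bool) → ℕ → Bool) : Set₁ where
  field
    keeps : ∀ μ {i} → T (μ i) → T (F μ i)
    fires : ∀ μ {p j} → Q p j → Given (T ∘ μ) p → T (F μ j)
    sound : ∀ P → Closed Q P → ∀ μ → (∀ i → T (μ i) → P i) → ∀ i → T (F μ i) → P i
open Applies

given-map : ∀ {P P′ : ℕ → Set} → (∀ {i} → P i → P′ i) → ∀ p → Given P p → Given P′ p
given-map f nothing  g = tt
given-map f (just i) g = f g

module _ {F : (ℕ → Bool) → ℕ → Bool} where
  applies-⇔ : ∀ {Q Q′ : Rule} → (∀ {p j} → Q p j → Q′ p j) → (∀ {p j} → Q′ p j → Q p j) → Applies Q F → Applies Q′ F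
  applies-⇔ f g a = record { keeps = keeps a ; fires = λ μ q → fires a μ (g q) ; sound = λ P c → sound a P (λ q → c (f q)) }

applies-none : Applies (λ _ _ → ⊥) id
applies-none = record { keeps = λ _ t → t ; fires = λ _ () ; sound = λ P c μ h → h }

applies-∘ : ∀ {Q Q′ F F′} → Applies Q F → Applies Q′ F′ → Applies (λ p j → Q p j ⊎ Q′ p j) (F′ ∘ F)
applies-∘ {F = F} a b = record
  { keeps = λ μ t → keeps b (F μ) (keeps a μ t)
  ; fires = λ { μ (inj₁ q) g → keeps b (F μ) (fires a μ q g) ; μ {p} (inj₂ q) g → fires b (F μ) q (given-map (keeps a μ) p g) }
  ; sound = λ P c μ h → sound b P (c ∘ inj₂) (F μ) (sound a P (c ∘ inj₁) μ h) }

applies-acc : ∀ m {Q : ℕ → Rule} {step} → (∀ i → i < m → Applies (Q i) (step i)) → Applies (λ p j → ∃[ i ] (i < m × Q i p j)) (acc! step m)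
applies-acc zero    a = applies-⇔ (λ ()) (λ { (_ , () , _) }) applies-none
applies-acc (suc m) {Q} a = applies-⇔ (λ { (inj₁ (i , l , q)) → i , ℕₚ.m≤n⇒m≤1+n l , q ; (inj₂ q) → m , ℕₚ.≤-refl , q })
  (λ (i , l , q) → split (i ℕₚ.≟ m) l q) (applies-∘ (applies-acc m {Q} λ i l → a i (ℕₚ.m≤n⇒m≤1+n l)) (a m ℕₚ.≤-refl))
  where
  split : ∀ {i p j} → Dec (i ≡ m) → i < suc m → Q i p j → (∃[ i ] (i < m × Q i p j)) ⊎ Q m p j
  split (yes refl) l q = inj₂ q
  split (no i≢m)   l q = inj₁ (_ , ℕₚ.≤∧≢⇒< (ℕₚ.≤-pred l) i≢m , q)

addMark : ℕ → (ℕ → Bool) → ℕ → Bool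
addMark j μ k = (k ≡ᵇ j) ∨ μ k

fire : Maybe ℕ → ℕ → (ℕ → Bool) → ℕ → Bool
fire nothing  j μ = addMark j μ
fire (just i) j μ = if μ i then addMark j μ else μ

applies-fire : ∀ p j → Applies (λ p′ j′ → p′ ≡ p × j′ ≡ j) (fire p j)
applies-fire nothing j = record
  { keeps = λ μ t → Equivalence.from Boolₚ.T-∨ (inj₂ t)
  ; fires = λ { μ (refl , refl) _ → Equivalence.from Boolₚ.T-∨ (inj₁ (ℕₚ.≡⇒≡ᵇ j j refl)) }
  ; sound = λ P c μ h i t → [ (λ e → subst P (sym (ℕₚ.≡ᵇ⇒≡ i j e)) (c (refl , refl) tt)) , h i ]′ (Equivalence.to (Boolₚ.T-∨ {i ≡ᵇ j}) t) }
applies-fire (just p) j = record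
  { keeps = λ μ {i} → keep μ i
  ; fires = λ { μ (refl , refl) g → hot μ g }
  ; sound = λ P c μ h → ok P c μ h }
  where
  keep : ∀ μ i → T (μ i) → T (fire (just p) j μ i)
  keep μ i t with μ p
  ... | true  = Equivalence.from Boolₚ.T-∨ (inj₂ t)
  ... | false = t
  hot : ∀ μ → T (μ p) → T (fire (just p) j μ j)
  hot μ g with μ p
  ... | true = Equivalence.from Boolₚ.T-∨ (inj₁ (ℕₚ.≡⇒≡ᵇ j j refl))
  ok : ∀ P → Closed (λ p′ j′ → p′ ≡ just p × j′ ≡ j) P → ∀ μ → (∀ i → T (μ i) → P i) → ∀ i → T (fire (just p) j μ i) → P i
  ok P c μ h i t with μ p in eq
  ... | false = h i t
  ... | true  = [ (λ e → subst P (sym (ℕₚ.≡ᵇ⇒≡ i j e)) (c (refl , refl) (h p (subst T (sym eq) tt)))) , h i ]′ (Equivalence.to (Boolₚ.T-∨ {i ≡ᵇ j}) t)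

count-bound : ∀ {n} (P : Fin n → Bool) → count P ≤ n
count-bound {zero}  P = z≤n
count-bound {suc n} P with P zero
... | true  = s≤s (count-bound (P ∘ suc))
... | false = ℕₚ.m≤n⇒m≤1+n (count-bound (P ∘ suc))

-- More rounds than there are positions to mark: some round adds no mark.
module Saturation {Q : Rule} {F : (ℕ → Bool) → ℕ → Bool} (a : Applies Q F) {B : ℕ} (bounded : ∀ {p j} → Q p j → j < B) (μ₀ : ℕ → Bool) where
  private
    M : ℕ → ℕ → Bool
    M k = iter k F μ₀

    next-mark : ∀ k {i} → T (M k i) → T (M (suc k) i)
    next-mark k {i} t = subst (λ μ → T (μ i)) (sym (iter-last k F μ₀)) (keeps a (M k) t)

    later : ∀ d {μ i} → T (μ i) → T (iter d F μ i)
    later zero    t = t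
    later (suc d) {μ} t = later d (keeps a μ t)

    sound-iter : ∀ d P → Closed Q P → ∀ μ → (∀ i → T (μ i) → P i) → ∀ i → T (iter d F μ i) → P i
    sound-iter zero    P c μ h = h
    sound-iter (suc d) P c μ h = sound-iter d P c (F μ) (sound a P c μ h)

    Stable : ℕ → Set
    Stable k = ∀ (j : Fin B) → T (M (suc k) (toℕ j)) → T (M k (toℕ j))

    stabilises : ∀ k → (∃[ i ] (i < k × Stable i)) ⊎ k ≤ count {B} (M k ∘ toℕ)
    stabilises zero    = inj₂ z≤n
    stabilises (suc k) with stabilises k | Finₚ.all? {B} (λ j → T? (M (suc k) (toℕ j)) →-dec T? (M k (toℕ j)))
    ... | inj₁ (i , l , s) | _     = inj₁ (i , ℕₚ.m≤n⇒m≤1+n l , s)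
    ... | inj₂ _           | yes s = inj₁ (k , ℕₚ.≤-refl , s)
    ... | inj₂ l           | no ¬s with Finₚ.¬∀⟶∃¬ B _ (λ j → T? (M (suc k) (toℕ j)) →-dec T? (M k (toℕ j))) ¬s
    ... | j , new = inj₂ (ℕₚ.≤-<-trans l (count-< j (λ i → next-mark k) (decidable-stable (T? _) λ h → new λ t → ⊥-elim (h t)) λ t → new λ _ → t))

  saturated : ∀ k → B < k → Closed Q (T ∘ M k)
  saturated k B<k {p} {j} q g with stabilises k
  ... | inj₂ l = ⊥-elim (ℕₚ.<⇒≱ B<k (ℕₚ.≤-trans l (count-bound {B} (M k ∘ toℕ))))
  -- The marks of a stable round are closed under the rules, so later rounds add nothing; the
  -- premise of the rule was marked in that round already.
  ... | inj₁ (i , i<k , stable) = up-to (closed q (given-map down p g))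
    where
    closed : Closed Q (T ∘ M i)
    closed {p} {j} q g = subst (T ∘ M i) (Finₚ.toℕ-fromℕ< (bounded q)) (stable (fromℕ< (bounded q))
      (subst₂ (λ μ j → T (μ j)) (sym (iter-last i F μ₀)) (sym (Finₚ.toℕ-fromℕ< (bounded q))) (fires a (M i) q g)))
    split : M k ≡ iter (k ∸ i) F (M i)
    split = trans (cong M (sym (ℕₚ.m+[n∸m]≡n (ℕₚ.<⇒≤ i<k)))) (iter-+ i (k ∸ i) F μ₀)
    up-to : ∀ {j} → T (M i j) → T (M k j)
    up-to {j} t = subst (λ μ → T (μ j)) (sym split) (later (k ∸ i) t)
    down : ∀ {j} → T (M k j) → T (M i j)
    down {j} t = sound-iter (k ∸ i) (T ∘ M i) closed (M i) (λ _ t → t) j (subst (λ μ → T (μ j)) split t)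

  within : ∀ k P → Closed Q P → (∀ i → T (μ₀ i) → P i) → ∀ i → T (M k i) → P i
  within k P c h = sound-iter k P c μ₀ h

record Realises {r} (x : Word) (S : (ℕ → Bool) → State r) (c : Cmd r) (Q : Rule) : Set₁ where
  constructor realises
  field
    effect  : (ℕ → Bool) → ℕ → Bool
    applies : Applies Q effect
    effects : ∀ μ → Runs x c (S μ) (S (effect μ))
open Realises

module _ {r : ℕ} {x : Word} where

  module _ {S : (ℕ → Bool) → State r} where
    realises-▸ : ∀ {c d : Cmd r} {Q Q′} → Realises x S c Q → Realises x S d Q′ → Realises x S (c ▸ d) (λ p j → Q p j ⊎ Q′ p j)
    realises-▸ (realises F a h) (realises F′ a′ h′) = realises (F′ ∘ F) (applies-∘ a a′) λ μ → h μ ⟫ h′ (F μ)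

    realises-⇔ : ∀ {c : Cmd r} {Q Q′} → (∀ {p j} → Q p j → Q′ p j) → (∀ {p j} → Q′ p j → Q p j) → Realises x S c Q → Realises x S c Q′
    realises-⇔ f g (realises F a h) = realises F (applies-⇔ f g a) h

    realises-none : ∀ {c : Cmd r} → (∀ μ → Runs x c (S μ) (S μ)) → Realises x S c (λ _ _ → ⊥)
    realises-none h = realises id applies-none h

    realises-seqF : ∀ k {c : Fin k → Cmd r} {Q : Fin k → Rule} → (∀ ℓ → Realises x S (c ℓ) (Q ℓ)) → Realises x S (seqF k c) (λ p j → ∃[ ℓ ] Q ℓ p j)
    realises-seqF zero    h = realises-⇔ (λ ()) (λ ()) (realises-none λ _ → runs refl)
    realises-seqF (suc k) h = realises-⇔ (λ { (inj₁ q) → zero , q ; (inj₂ (ℓ , q)) → suc ℓ , q }) (λ { (zero , q) → inj₁ q ; (suc ℓ , q) → inj₂ (ℓ , q) })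
      (realises-▸ (h zero) (realises-seqF k (h ∘ suc)))

  realises-upto : (S : ℕ → (ℕ → Bool) → State r) → ∀ {i y body Y} {Q : ℕ → Rule} → Y ≤ length x →
                  (∀ k μ → lookup (regs (S k μ)) i ≡ k) → (∀ k μ → lookup (regs (S k μ)) y ≡ Y) →
                  (∀ k μ → Runs x (inc i) (S k μ) (S (suc k) μ)) → (∀ k μ → Runs x (zer i) (S k μ) (S 0 μ)) →
                  (∀ k → k < Y → Realises x (S k) body (Q k)) → Realises x (S 0) (uptoR i y body) (λ p j → ∃[ k ] (k < Y × Q k p j))
  realises-upto S {i} {y} {body} {Y} {Q} Y≤ li ly nxt rst h = realises (acc! perform Y) (applies-acc Y {Q} λ k l → appl k l (k ℕₚ.<? Y)) λ μ →
    upto-run S perform Y μ Y≤ li ly (λ k μ l → effs k μ l (k ℕₚ.<? Y)) nxt rst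
    where
    stepOf : ∀ k → Dec (k < Y) → (ℕ → Bool) → ℕ → Bool
    stepOf k (yes l) = effect (h k l)
    stepOf k (no _)  = id
    perform : ℕ → (ℕ → Bool) → ℕ → Bool
    perform k = stepOf k (k ℕₚ.<? Y)
    appl : ∀ k → k < Y → (d : Dec (k < Y)) → Applies (Q k) (stepOf k d)
    appl k l (yes l′) = applies (h k l′)
    appl k l (no ¬l)  = contradiction l ¬l
    effs : ∀ k μ → k < Y → (d : Dec (k < Y)) → Runs x body (S k μ) (S k (stepOf k d μ))
    effs k μ l (yes l′) = effects (h k l′) μ
    effs k μ l (no ¬l)  = contradiction l ¬l

-- Mark pos n r a (tag κ g) stands for a walk from r to a whose label under
-- the sign function number κ is g.

pos : ℕ → ℕ → ℕ → ℕ → ℕ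
pos n r a c = n * (r * 4) + a * 4 + c

tag : Fin 2 → Sign → Fin 4
tag κ g = combine κ (cover-index g)

cellOf : ∀ {n} → Fin n → Fin n → Fin 4 → Fin ((n * n) * 4)
cellOf r a c = combine (combine r a) c

pos-cell : ∀ {n} (r a : Fin n) c → pos n (toℕ r) (toℕ a) (toℕ c) ≡ toℕ (cellOf r a c)
pos-cell {n} r a c = trans (solve 4 (λ n r a c → n :* (r :* :con 4) :+ a :* :con 4 :+ c := :con 4 :* (n :* r :+ a) :+ c) refl n (toℕ r) (toℕ a) (toℕ c))
  (sym (trans (Finₚ.toℕ-combine (combine r a) c) (cong (λ v → 4 * v + toℕ c) (Finₚ.toℕ-combine r a))))

tag-injective : ∀ {κ g κ′ g′} → tag κ g ≡ tag κ′ g′ → κ ≡ κ′ × g ≡ g′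
tag-injective {κ} {g} {κ′} {g′} e = let p , q = Finₚ.combine-injective κ (cover-index g) κ′ (cover-index g′) e in
  p , trans (sym (cover-sign-index g)) (trans (cong cover-sign q) (cover-sign-index g′))

pos-injective : ∀ {n} {r a r′ a′ : Fin n} {κ g κ′ g′} → pos n (toℕ r) (toℕ a) (toℕ (tag κ g)) ≡ pos n (toℕ r′) (toℕ a′) (toℕ (tag κ′ g′)) →
                r ≡ r′ × a ≡ a′ × κ ≡ κ′ × g ≡ g′
pos-injective {n} {r} {a} {r′} {a′} {κ} {g} {κ′} {g′} e =
  let p , q = Finₚ.combine-injective (combine r a) (tag κ g) (combine r′ a′) (tag κ′ g′) (Finₚ.toℕ-injective (trans (sym (pos-cell r a (tag κ g))) (trans e (pos-cell r′ a′ (tag κ′ g′)))))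
      p₁ , p₂ = Finₚ.combine-injective r a r′ a′ p
      q₁ , q₂ = tag-injective {κ} {g} {κ′} {g′} q
  in p₁ , p₂ , q₁ , q₂

-- Deciding the easy cases

module Decider (cond : Condition) where
  open Condition cond
  open Reader 1

  h : Fin 2 → Sign → Sign
  h zero    = sign₁
  h (suc _) = sign₂

  sgn : Fin 2 → Sign
  sgn = cover-sign

  cell : Fin 11 → Fin 11 → Fin 4 → Cmd 11
  cell X Y c = uptoR ri rN (uptoR rj X (times 4 (inc rq))) ▸ uptoR ri Y (times 4 (inc rq)) ▸ times (toℕ c) (inc rq)

  startAt : Fin 2 → Cmd 11
  startAt κ = cell rc′ rc′ (tag κ Sign.+) ▸ mark rq ▸ zer rq

  extendBy : Sign → Fin 2 → Fin 2 → Cmd 11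
  extendBy s κ γ = cell rc′ ra (tag κ (sgn γ)) ▸ ifmk rq (zer rq ▸ cell rc′ rb (tag κ (sgn γ · h κ s)) ▸ mark rq) skip ▸ zer rq

  along : Sign → Cmd 11
  along s = seek rz s ra rb ▸ ifin rz true (zer rz ▸ seqF 2 λ κ → seqF 2 λ γ → extendBy s κ γ) skip ▸ zer rz

  round : Cmd 11
  round = uptoR rc′ rN (seqF 2 startAt ▸ uptoR ra rN (uptoR rb rN (seqF 2 (along ∘ sgn))))

  -- One more than the number of positions: there are `4 * n * n` of them, and the length of the
  -- word stands in for `n`.
  rounds : PE
  rounds = ((N ⊗ N) ⊗ K 4) ⊕ K 1

  conflictAt : Fin 2 → Cmd 11
  conflictAt κ = cell ra ra (tag κ Sign.-) ▸ ifmk rq setbad skip ▸ zer rq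

  edgeAt : Sign → Cmd 11
  edgeAt s = seek rz s ra rb ▸ ifin rz true setbad skip ▸ zer rz

  noVertices noEdges : Bool → Cmd 11
  noVertices v = if v then ifeq rN r0 skip setbad else skip
  noEdges    e = if e then uptoR ra rN (uptoR rb rN (seqF 2 (edgeAt ∘ sgn))) else skip

  program : Cmd 11
  program = loop (inc rL) ▸ leadPhase ▸ wellformed ▸ noVertices vertexless ▸ noEdges edgeless ▸ rep rounds round ▸ uptoR ra rN (seqF 2 conflictAt)

  module Correct (w : Word) where
    open On w
    open Parsing 1 w w (λ i _ → cong (λ i → hit w i true) (ℕₚ.*-identityʳ i)) ℕₚ.≤-refl

    L : ℕ
    L = length w

    none : ℕ → Bool
    none _ = false

    length-run : Runs w (loop (inc rL)) start (R 0 L 0 0 0 false 0 0 0 0 none)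
    length-run = runs (trans (go L 0) (cong S (ℕₚ.+-identityʳ L)))
      where
      S : ℕ → State 11
      S v = R 0 v 0 0 0 false 0 0 0 0 none
      go : ∀ m v → iter m (run w (inc rL)) (S v) ≡ S (m + v)
      go zero    v = refl
      go (suc m) v = trans (go m (suc v)) (cong S (ℕₚ.+-suc m v))

    below≤w : ∀ {a} → a < n → a ≤ length w
    below≤w l = ℕₚ.≤-trans (ℕₚ.<⇒≤ l) n≤

    module _ {S : ℕ → ℕ → ℕ → State 11} (F : Frame {w = w} ri rj rq S) (hN : ∀ i j v → lookup (regs (S i j v)) rN ≡ n) where
      cell-run : ∀ {X Y A B} c → (∀ i j v → lookup (regs (S i j v)) X ≡ A) → A ≤ length w → (∀ i j v → lookup (regs (S i j v)) Y ≡ B) → B ≤ length w →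
                 Runs w (cell X Y c) (S 0 0 0) (S 0 0 (pos n A B (toℕ c)))
      cell-run c hX lX hY lY = Arith.addProd-run F 4 0 hN n≤ hX lX ⟫ Arith.addReg-run F 4 _ hY lY ⟫ Arith.bump F (toℕ c) 0 0 _

    at : ℕ → ℕ → Fin 2 → Sign → ℕ
    at r a κ g = pos n r a (toℕ (tag κ g))

    module _ (f : Bool) where
      private
        Q : ℕ → ℕ → ℕ → (ℕ → Bool) → State 11
        Q r a b μ = R n L 0 a b f 0 0 r 0 μ

      start-realises : ∀ {r} → r < n → ∀ κ → Realises w (Q r 0 0) (startAt κ) (λ p j → p ≡ nothing × j ≡ at r r κ Sign.+)
      start-realises lr κ = realises (fire nothing _) (applies-fire nothing _) λ μ →
        cell-run frameQ (λ _ _ _ → refl) (tag κ Sign.+) (λ _ _ _ → refl) (below≤w lr) (λ _ _ _ → refl) (below≤w lr) ⟫ runs refl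

      module _ {r a b : ℕ} (lr : r < n) (la : a < n) (lb : b < n) where

        extend-realises : ∀ s κ γ → Realises w (Q r a b) (extendBy s κ γ) (λ p j → p ≡ just (at r a κ (sgn γ)) × j ≡ at r b κ (sgn γ · h κ s))
        extend-realises s κ γ = realises (fire (just I) J) (applies-fire (just I) J) λ μ →
          cell-run frameQ (λ _ _ _ → refl) (tag κ (sgn γ)) (λ _ _ _ → refl) (below≤w lr) (λ _ _ _ → refl) (below≤w la) ⟫ runs (outcome μ (μ I) refl)
          where
          I J : ℕ
          I = at r a κ (sgn γ)
          J = at r b κ (sgn γ · h κ s)
          second : ∀ μ → run w (zer rq ▸ cell rc′ rb (tag κ (sgn γ · h κ s))) (R n L 0 a b f 0 0 r I μ) ≡ R n L 0 a b f 0 0 r J μ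
          second μ = run≡ (cell-run frameQ (λ _ _ _ → refl) (tag κ (sgn γ · h κ s)) (λ _ _ _ → refl) (below≤w lr) (λ _ _ _ → refl) (below≤w lb))
          outcome : ∀ μ v → μ I ≡ v → run w (ifmk rq (zer rq ▸ cell rc′ rb (tag κ (sgn γ · h κ s)) ▸ mark rq) skip ▸ zer rq) (R n L 0 a b f 0 0 r I μ) ≡ Q r a b (fire (just I) J μ)
          outcome μ true  e rewrite e = cong (λ σ → run w (zer rq) (run w (mark rq) σ)) (second μ)
          outcome μ false e rewrite e = refl

        Extension : Sign → Rule
        Extension s p j = ∃[ κ ] ∃[ γ ] (p ≡ just (at r a κ (sgn γ)) × j ≡ at r b κ (sgn γ · h κ s))

        guarded : ∀ s (c : Cmd 11) {E : Rule} → Realises w (Q r a b) c E →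
                  Realises w (Q r a b) (seek rz s ra rb ▸ ifin rz true (zer rz ▸ c) skip ▸ zer rz) (λ p j → T (raw n≤ s a b) × E p j)
        guarded s c {E} body = split (raw n≤ s a b) refl
          where
          Z : ℕ
          Z = 1 * idx n s a b
          gate : Cmd 11
          gate = ifin rz true (zer rz ▸ c) skip ▸ zer rz
          taken : ∀ {μ τ} → hit w Z true ≡ true → run w c (Q r a b μ) ≡ Q r a b τ → run w gate (R n L Z a b f 0 0 r 0 μ) ≡ Q r a b τ
          taken e e′ rewrite e = cong (run w (zer rz)) e′
          avoided : ∀ {μ} → hit w Z true ≡ false → run w gate (R n L Z a b f 0 0 r 0 μ) ≡ Q r a b μ
          avoided e rewrite e = refl
          split : ∀ v → raw n≤ s a b ≡ v → Realises w (Q r a b) (seek rz s ra rb ▸ gate) (λ p j → T v × E p j)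
          split true  e = realises (effect body) (applies-⇔ (tt ,_) proj₂ (applies body)) λ μ → seekZ-run n≤ s la lb ⟫ runs (taken e (run≡ (effects body μ)))
          split false e = realises id (applies-⇔ (λ ()) proj₁ applies-none) λ μ → seekZ-run n≤ s la lb ⟫ runs (avoided e)

        along-realises : ∀ s → Realises w (Q r a b) (along s) (λ p j → T (raw n≤ s a b) × Extension s p j)
        along-realises s = guarded s (seqF 2 λ κ → seqF 2 λ γ → extendBy s κ γ) (realises-seqF 2 λ κ → realises-seqF 2 λ γ → extend-realises s κ γ)

      -- The rules in the nesting in which the loops produce them; `Reason` restates them for the
      -- vertices of the graph.
      Reaches : Rule
      Reaches p j = ∃[ r ] (r < n × ((∃[ κ ] (p ≡ nothing × j ≡ at r r κ Sign.+)) ⊎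
        ∃[ a ] (a < n × ∃[ b ] (b < n × ∃[ i ] (T (raw n≤ (sgn i) a b) × ∃[ κ ] ∃[ γ ] (p ≡ just (at r a κ (sgn γ)) × j ≡ at r b κ (sgn γ · h κ (sgn i))))))))

      round-realises : Realises w (Q 0 0 0) round Reaches
      round-realises = realises-upto (λ r → Q r 0 0) n≤ (λ _ _ → refl) (λ _ _ → refl) (λ _ _ → runs refl) (λ _ _ → runs refl) λ r lr →
        realises-▸ (realises-seqF 2 (start-realises lr)) (realises-upto (λ a → Q r a 0) n≤ (λ _ _ → refl) (λ _ _ → refl) (λ _ _ → runs refl) (λ _ _ → runs refl) λ a la →
          realises-upto (λ b → Q r a b) n≤ (λ _ _ → refl) (λ _ _ → refl) (λ _ _ → runs refl) (λ _ _ → runs refl) λ b lb → realises-seqF 2 (λ i → along-realises lr la lb (sgn i)))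

      final : ℕ → Bool
      final = iter (⟦ rounds ⟧ L) (effect round-realises) none

      rounds-run : Runs w (rep rounds round) (Q 0 0 0 none) (Q 0 0 0 final)
      rounds-run = rep-runs rounds (go (⟦ rounds ⟧ L) none)
        where
        go : ∀ m μ → iter m (run w round) (Q 0 0 0 μ) ≡ Q 0 0 0 (iter m (effect round-realises) μ)
        go zero    μ = refl
        go (suc m) μ = trans (cong (iter m (run w round)) (run≡ (effects round-realises μ))) (go m (effect round-realises μ))

    conflict-run : ∀ {a μ} → a < n → ∀ κ f → Runs w (conflictAt κ) (R n L 0 a 0 f 0 0 0 0 μ) (R n L 0 a 0 (f ∨ μ (at a a κ Sign.-)) 0 0 0 0 μ)
    conflict-run {a} {μ} la κ f = cell-run frameQ (λ _ _ _ → refl) (tag κ Sign.-) (λ _ _ _ → refl) (below≤w la) (λ _ _ _ → refl) (below≤w la) ⟫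
      runs (outcome (μ (at a a κ Sign.-)) refl)
      where
      outcome : ∀ v → μ (at a a κ Sign.-) ≡ v → run w (ifmk rq setbad skip ▸ zer rq) (R n L 0 a 0 f 0 0 0 (at a a κ Sign.-) μ) ≡ R n L 0 a 0 (f ∨ v) 0 0 0 0 μ
      outcome true  e rewrite e = cong (λ f → R n L 0 a 0 f 0 0 0 0 μ) (sym (Boolₚ.∨-zeroʳ f))
      outcome false e rewrite e = cong (λ f → R n L 0 a 0 f 0 0 0 0 μ) (sym (Boolₚ.∨-identityʳ f))

    edge-run : ∀ {a b μ} → a < n → b < n → ∀ s f → Runs w (edgeAt s) (R n L 0 a b f 0 0 0 0 μ) (R n L 0 a b (f ∨ raw n≤ s a b) 0 0 0 0 μ)
    edge-run {a} {b} {μ} la lb s f = seekZ-run n≤ s la lb ⟫ runs (outcome (raw n≤ s a b) refl)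
      where
      outcome : ∀ v → raw n≤ s a b ≡ v → run w (ifin rz true setbad skip ▸ zer rz) (R n L (1 * idx n s a b) a b f 0 0 0 0 μ) ≡ R n L 0 a b (f ∨ v) 0 0 0 0 μ
      outcome true  e rewrite e = cong (λ f → R n L 0 a b f 0 0 0 0 μ) (sym (Boolₚ.∨-zeroʳ f))
      outcome false e rewrite e = cong (λ f → R n L 0 a b f 0 0 0 0 μ) (sym (Boolₚ.∨-identityʳ f))

    hasEdge : Bool
    hasEdge = anyBelow n λ a → anyBelow n λ b → anyF 2 λ i → raw n≤ (sgn i) a b

    noVertices-run : ∀ v {f μ} → Runs w (noVertices v) (R n L 0 0 0 f 0 0 0 0 μ) (R n L 0 0 0 (f ∨ (v ∧ not (n ≡ᵇ 0))) 0 0 0 0 μ)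
    noVertices-run false {f} {μ} = runs (cong (λ f → R n L 0 0 0 f 0 0 0 0 μ) (sym (Boolₚ.∨-identityʳ f)))
    noVertices-run true {f} {μ} = runs (outcome (n ≡ᵇ 0) refl)
      where
      outcome : ∀ v → (n ≡ᵇ 0) ≡ v → run w (ifeq rN r0 skip setbad) (R n L 0 0 0 f 0 0 0 0 μ) ≡ R n L 0 0 0 (f ∨ not v) 0 0 0 0 μ
      outcome true  e rewrite e = cong (λ f → R n L 0 0 0 f 0 0 0 0 μ) (sym (Boolₚ.∨-identityʳ f))
      outcome false e rewrite e = cong (λ f → R n L 0 0 0 f 0 0 0 0 μ) (sym (Boolₚ.∨-zeroʳ f))

    noEdges-run : ∀ e {f μ} → Runs w (noEdges e) (R n L 0 0 0 f 0 0 0 0 μ) (R n L 0 0 0 (f ∨ (e ∧ hasEdge)) 0 0 0 0 μ)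
    noEdges-run false {f} {μ} = runs (cong (λ f → R n L 0 0 0 f 0 0 0 0 μ) (sym (Boolₚ.∨-identityʳ f)))
    noEdges-run true {f} {μ} = forAB n≤ (λ a b → anyF 2 λ i → raw n≤ (sgn i) a b) λ a b f la lb → seqF-run (λ f → R n L 0 a b f 0 0 0 0 μ) 2 _ f λ i f → edge-run la lb (sgn i) f

    early : Bool
    early = (malformed n≤ L ∨ (vertexless ∧ not (n ≡ᵇ 0))) ∨ (edgeless ∧ hasEdge)

    marks : ℕ → Bool
    marks = final early

    conflict : Bool
    conflict = anyBelow n λ a → anyF 2 λ κ → marks (at a a κ Sign.-)

    program-run : Runs w program start (R n L 0 0 0 (early ∨ conflict) 0 0 0 0 marks)
    program-run = length-run ⟫ lead-found ⟫ wellformed-run n≤ ⟫ noVertices-run vertexless ⟫ noEdges-run edgeless ⟫ rounds-run early ⟫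
      forA n≤ (λ a → anyF 2 λ κ → marks (at a a κ Sign.-)) λ a f la → seqF-run (λ f → R n L 0 a 0 f 0 0 0 0 marks) 2 _ f (conflict-run la)

fin-below : ∀ {n a} → a < n → ∃[ x ] toℕ {n} x ≡ a
fin-below l = fromℕ< l , Finₚ.toℕ-fromℕ< l

cover-split : ∀ s → ∃[ i ] cover-sign i ≡ s
cover-split s = cover-index s , cover-sign-index s

module Decides (cond : Condition) (w : Word) (full : FullLength w) (symm : Symmetric w) where
  open Condition cond
  open Reader 1
  open On w
  open Parsing 1 w w (λ i _ → cong (λ i → hit w i true) (ℕₚ.*-identityʳ i)) ℕₚ.≤-refl
  open Decider cond
  open Correct w

  G : SignedGraph n
  G = decodedGraph w symm

  pt : Fin n → Fin n → Fin 2 → Sign → ℕ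
  pt r a κ g = at (toℕ r) (toℕ a) κ g

  raw-edge : ∀ s (a b : Fin n) → raw n≤ s (toℕ a) (toℕ b) ≡ edge G s a b
  raw-edge s a b = raw-entry full s (Finₚ.toℕ<n a) (Finₚ.toℕ<n b)

  data Reason : Rule where
    starting  : ∀ r κ → Reason nothing (pt r r κ Sign.+)
    extending : ∀ r {a b s} κ g → Edge G s a b → Reason (just (pt r a κ g)) (pt r b κ (g · h κ s))

  reason : ∀ {p j} → Reaches early p j → Reason p j
  reason (_ , lr , inj₁ (κ , refl , refl)) with fin-below lr
  ... | r , refl = starting r κ
  reason (_ , lr , inj₂ (_ , la , _ , lb , i , e , κ , γ , refl , refl)) with fin-below lr | fin-below la | fin-below lb
  ... | r , refl | a , refl | b , refl = extending r κ (sgn γ) (subst T (raw-edge (sgn i) a b) e)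

  unreason : ∀ {p j} → Reason p j → Reaches early p j
  unreason (starting r κ) = toℕ r , Finₚ.toℕ<n r , inj₁ (κ , refl , refl)
  unreason (extending r {a} {b} {s} κ g e) with cover-split s | cover-split g
  ... | i , refl | γ , refl = toℕ r , Finₚ.toℕ<n r , inj₂ (toℕ a , Finₚ.toℕ<n a , toℕ b , Finₚ.toℕ<n b , i , subst T (sym (raw-edge (sgn i) a b)) e , κ , γ , refl , refl)

  reason-bounded : ∀ {p j} → Reason p j → j < (n * n) * 4
  reason-bounded (starting r κ)          = subst (_< (n * n) * 4) (sym (pos-cell r r (tag κ Sign.+))) (Finₚ.toℕ<n (cellOf r r (tag κ Sign.+)))
  reason-bounded (extending r {b = b} {s} κ g e) = subst (_< (n * n) * 4) (sym (pos-cell r b (tag κ (g · h κ s)))) (Finₚ.toℕ<n (cellOf r b (tag κ (g · h κ s))))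

  module Sat = Saturation (applies-⇔ reason unreason (applies (round-realises early))) reason-bounded none

  enough : (n * n) * 4 < ⟦ rounds ⟧ L
  enough = subst ((n * n) * 4 <_) (ℕₚ.+-comm 1 (L * L * 4)) (s≤s (ℕₚ.*-monoˡ-≤ 4 (ℕₚ.*-mono-≤ n≤ n≤)))

  reach : Fin 2 → Fin n → Fin n → Sign → Bool
  reach κ r a g = marks (pt r a κ g)

  reach-in : ∀ κ {r a g} → Walk G (h κ) r a g → T (reach κ r a g)
  reach-in κ {r} here = Sat.saturated (⟦ rounds ⟧ L) enough (starting r κ) tt
  reach-in κ {r} (_▷_ {g = g} p e) = Sat.saturated (⟦ rounds ⟧ L) enough (extending r κ g e) (reach-in κ p)

  -- A claim about every reading of a position; as `pos` is injective, there is at most one reading.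
  Walks : ℕ → Set
  Walks p = ∀ r a κ g → p ≡ pt r a κ g → Walk G (h κ) r a g

  walk-at : ∀ {r r′ a a′ κ κ′ g g′} → r ≡ r′ × a ≡ a′ × κ ≡ κ′ × g ≡ g′ → Walk G (h κ) r a g → Walk G (h κ′) r′ a′ g′
  walk-at (refl , refl , refl , refl) p = p

  walks-closed : Closed Reason Walks
  walks-closed (starting r₀ κ₀) _ r a κ g e = walk-at (pos-injective {n} {r₀} {r₀} {r} {a} {κ₀} {Sign.+} {κ} {g} e) here
  walks-closed (extending r₀ {a₀} {b₀} {s} κ₀ g₀ xy) before r a κ g e =
    walk-at (pos-injective {n} {r₀} {b₀} {r} {a} {κ₀} {g₀ · h κ₀ s} {κ} {g} e) (before r₀ a₀ κ₀ g₀ refl ▷ xy)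

  reach-out : ∀ κ {r a g} → T (reach κ r a g) → Walk G (h κ) r a g
  reach-out κ {r} {a} {g} t = Sat.within (⟦ rounds ⟧ L) Walks walks-closed (λ _ ()) (pt r a κ g) t r a κ g refl

  -- Stated for any array of marks, so that the one computed is not unfolded.
  module Conflicts (M : ℕ → Bool) (in-M : ∀ κ r a g → Walk G (h κ) r a g → T (M (pt r a κ g))) (out-M : ∀ κ r a g → T (M (pt r a κ g)) → Walk G (h κ) r a g) where
    conflicts : Bool
    conflicts = anyBelow n λ a → anyF 2 λ κ → M (at a a κ Sign.-)

    conflicts-no : (∀ κ → Balanced (h κ) G) → ¬ T conflicts
    conflicts-no b bad =
      let a , la , bad′ = anyBelow-out {n} {λ a → anyF 2 λ κ → M (at a a κ Sign.-)} bad
          κ , t = anyF-out {2} {λ κ → M (at a a κ Sign.-)} bad′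
          r , e = fin-below la
          walk = out-M κ r r Sign.- (subst (λ a → T (M (at a a κ Sign.-))) (sym e) t)
      in absurd (proj₁ (b κ) r) (balanced-walk {h = h κ} (b κ) walk)
      where
      absurd : ∀ s → s · s ≢ Sign.-
      absurd s e with trans (sym (Signₚ.s*s≡+ s)) e
      ... | ()

    no-conflicts : ¬ T conflicts → ∀ κ → Balanced (h κ) G
    no-conflicts ok κ = walks-balanced (λ r a g → M (pt r a κ g)) (in-M κ _ _ _) (out-M κ _ _ _) λ r walk →
      ok (anyBelow-in {n} {λ a → anyF 2 λ κ → M (at a a κ Sign.-)} (toℕ r) (Finₚ.toℕ<n r)
        (anyF-in {2} {λ κ → M (at (toℕ r) (toℕ r) κ Sign.-)} κ (in-M κ r r Sign.- walk)))

  open Conflicts marks (λ κ r a g → reach-in κ {r} {a} {g}) (λ κ r a g → reach-out κ {r} {a} {g})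

  hasEdge-no : Edgeless G → ¬ T hasEdge
  hasEdge-no ¬e bad =
    let a , la , bad′ = anyBelow-out {n} bad
        b , lb , bad″ = anyBelow-out {n} bad′
        i , t = anyF-out {2} {λ i → raw n≤ (sgn i) a b} bad″
        x , ex = fin-below la
        y , ey = fin-below lb
    in ¬e (sgn i) x y (subst T (raw-edge (sgn i) x y) (subst₂ (λ a b → T (raw n≤ (sgn i) a b)) (sym ex) (sym ey) t))

  no-hasEdge : ¬ T hasEdge → Edgeless G
  no-hasEdge ok s a b e with cover-split s
  ... | i , refl = ok (anyBelow-in (toℕ a) (Finₚ.toℕ<n a) (anyBelow-in (toℕ b) (Finₚ.toℕ<n b)
    (anyF-in {2} {λ i → raw n≤ (sgn i) (toℕ a) (toℕ b)} i (subst T (sym (raw-edge (sgn i) a b)) e))))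

  private
    ∧-no : ∀ {a b} → (T a → ¬ T b) → ¬ T (a ∧ b)
    ∧-no h t = let p , q = ∧-out t in h p q

    no-∧ : ∀ {a b} → ¬ T (a ∧ b) → T a → ¬ T b
    no-∧ h p q = h (∧-in p q)

  satisfies⇒accepted : Satisfies cond G → ¬ T (early ∨ conflict)
  satisfies⇒accepted (v , e , b₁ , b₂) = no-∨ (no-∨ (no-∨ (malformed-no full symm) (∧-no {vertexless} λ t → no-not (ℕₚ.≡⇒≡ᵇ n 0 (v t)))) (∧-no {edgeless} λ t → hasEdge-no (e t)))
    (conflicts-no λ { zero → b₁ ; (suc _) → b₂ })

  accepted⇒satisfies : ¬ T (early ∨ conflict) → Satisfies cond G
  accepted⇒satisfies ok =
    let ok₁ , ok₂ = ∨-no {early} ok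
        ok₃ , ok₄ = ∨-no {malformed n≤ L ∨ (vertexless ∧ not (n ≡ᵇ 0))} ok₁
        ok₅ , ok₆ = ∨-no {malformed n≤ L} ok₃
    in (λ t → ℕₚ.≡ᵇ⇒≡ n 0 (not-no (no-∧ {vertexless} ok₆ t))) , (λ t → no-hasEdge (no-∧ {edgeless} ok₄ t)) , no-conflicts ok₂ zero , no-conflicts ok₂ (suc zero)

condition-P : ∀ cond {L : Language} → (∀ w → L w ⇔ (Σ[ symm ∈ Symmetric w ] (FullLength w × Satisfies cond (decodedGraph w symm)))) → InP L
condition-P cond {L} char = verdict program rf r0 , verdict-polyTime program rf r0 , λ w → mk⇔
  (λ Lw → let symm , full , s = Equivalence.to (char w) Lw in
    subst T (sym (outcome w)) (T-not (Decides.satisfies⇒accepted cond w full symm s)))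
  (λ t → let ok = λ bad → no-not bad (subst T (outcome w) t)
             full , symm = parsed w ok
         in Equivalence.from (char w) (symm , full , Decides.accepted⇒satisfies cond w full symm ok))
  where
  open Decider cond
  rejects : Word → Bool
  rejects w = Correct.early w ∨ Correct.conflict w
  outcome : ∀ w → verdict program rf r0 w ≡ not (rejects w)
  outcome w = trans (cong (λ σ → lookup (regs σ) rf ≡ᵇ lookup (regs σ) r0) (run≡ (Correct.program-run w))) (unflag (rejects w))
    where
    unflag : ∀ f → (flagged f ≡ᵇ 0) ≡ not f
    unflag true  = refl
    unflag false = refl
  parsed : ∀ w → ¬ T (rejects w) → FullLength w × Symmetric w
  parsed w ok = Parsing.no-malformed 1 w w (λ i _ → cong (λ i → hit w i true) (ℕₚ.*-identityʳ i)) ℕₚ.≤-refl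
    (proj₁ (∨-no (proj₁ (∨-no (proj₁ (∨-no ok))))))

-- Both sides of the classification

sHom⇔ecHom : ∀ {m} (H : SignedGraph m) w → s-Hom H w ⇔ ecHom (cover H) w
sHom⇔ecHom H w = mk⇔ (λ (n , G , e , f) → n , G , e , Equivalence.to (sHom⇔cover H G) f) (λ (n , G , e , f) → n , G , e , Equivalence.from (sHom⇔cover H G) f)

npComplete-⇔ : ∀ {L L′ : Language} → (∀ w → L w ⇔ L′ w) → NPComplete L′ → NPComplete L
npComplete-⇔ L⇔ ((V , p , c , k , e) , hard) =
  (V , p , c , k , λ w → mk⇔ (Equivalence.to (e w) ∘ Equivalence.to (L⇔ w)) (Equivalence.from (L⇔ w) ∘ Equivalence.from (e w))) ,
  λ L₀ np → let f , poly , r = hard L₀ np in f , poly , λ w → mk⇔ (Equivalence.from (L⇔ (f w)) ∘ Equivalence.to (r w)) (Equivalence.from (r w) ∘ Equivalence.to (L⇔ (f w)))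

easy-P : ∀ {m} (H : SignedGraph m) → Easy H → InP (s-Hom H)
easy-P H e = condition-P (conditionOf e) λ w → mk⇔ (parse w) λ (symm , full , s) → _ , decodedGraph w symm , decoded-encode w symm full ,
    Equivalence.from (sHom⇔lHom (decodedGraph w symm) H) (sufficient e {G = decodedGraph w symm} s)
  where
  parse : ∀ w → s-Hom H w → Σ[ symm ∈ Symmetric w ] (FullLength w × Satisfies (conditionOf e) (decodedGraph w symm))
  parse w (n , G , eq , f) = symm , full , necessary e D (Equivalence.to (sHom⇔lHom D H) (Equivalence.from (sHom⇔cover H D)
      (ecHom-encode {T′ = cover H} {G = D} (n , G , trans (sym (decoded-encode w symm full)) eq , Equivalence.to (sHom⇔cover H G) f))))
    where
    full : FullLength w
    full = encoding-full {w} {G = G} eq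
    symm : Symmetric w
    symm = encoding-symmetric {w} {G = G} eq
    D : SignedGraph (lead w)
    D = decodedGraph w symm

hard-NPComplete : ∀ {m} (H : SignedGraph m) → Hard H → NPComplete (s-Hom H)
hard-NPComplete H h = npComplete-⇔ (sHom⇔ecHom H) (Verifier.ecHom-NP (cover H) , hardness (cover H) (hard-selects H h))

theorem4p2 : ∀ {n : ℕ} (H : SignedGraph n) → Connected H →
    ¬ (HasNegativeDigon H × HasLoop Sign.+ H × HasLoop Sign.- H) →
    ∀ {m : ℕ} (C : SignedGraph m) → C IsSCoreOf H →
    (numEdges C ≤ 2 → InP (s-Hom H)) × (¬ (numEdges C ≤ 2) → NPComplete (s-Hom H))
theorem4p2 H connected ¬3 C ((ι , _ , ι-hom) , core , retract) =
    -- Inclusion and retraction make `H` and `C` equivalent, so the case that holds for `H` also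
    -- holds for `C`, where the number of edges tells which one it is.
    (λ few → [ easy-P H , (λ h → ⊥-elim (few-edges-easy C few (hard-transfer H C inclusion retraction h))) ]′ (dichotomy H connected ¬3)) ,
    (λ many → [ (λ e → ⊥-elim (many (easy-core C core (easy-transfer C inclusion retraction e)))) , hard-NPComplete H ]′ (dichotomy H connected ¬3))
  where
  inclusion : LHom C H
  inclusion = ι , const Sign.+ , λ s x y e → subst (λ s → Edge H s (ι x) (ι y)) (sym (Signₚ.*-identityʳ s)) (ι-hom s x y e)
  retraction : LHom H C
  retraction = Equivalence.to (sHom⇔lHom H C) retract
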